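{- Let $g\in\mathbb{F}_q[T]$ be monic with $\deg(g)\ge1$ and let $c\in\mathbb{F}_q[T]$ with $(c,g)=1$. Then, for all $u\in\mathbb{C}$ (as an identity of meromorphic functions of $u$), $$\mathcal{D}_2\Big(u;\frac cg\Big)=(qu^2)^{\deg(g)-1}\sum_{\lambda\in\mathbb{F}_q^\times}\mathcal{A}_\lambda(u)\,\mathcal{D}_2\Big(\frac{1}{qu};\frac{\lambda\overline{c}}{g}\Big),$$ where $\overline c$ is any inverse of $c$ modulo $g$ and $$\mathcal{A}_\lambda(u):=\sum_{\eta_1,\eta_2\in\{0,1\}}(-1)^{\eta_1+\eta_2}\frac{\mathrm{Kl}_2\big(\eta_1-1,(1-\eta_2)\lambda\big)}{q(1-qu)^{\eta_1+\eta_2}}=\frac{\mathrm{Kl}_2(-1,\lambda)}{q}+\frac{1+q-2qu}{q(1-qu)^2}.$$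
   Context: $q=p^\eta$ is a prime power; $e_q(y)=\exp(2\pi i\,\mathrm{Tr}_{\mathbb{F}_q/\mathbb{F}_p}(y)/p)$ for $y\in\mathbb{F}_q$; for $\alpha=\sum_{j\le N}\alpha_jT^j\in\mathbb{F}_q((1/T))$, $e(\alpha)=e_q(\alpha_{ -1})$. For $\alpha,\beta\in\mathbb{F}_q$, $\mathrm{Kl}_2(\alpha,\beta)=\sum_{\gamma\in\mathbb{F}_q^\times}e_q(\alpha\gamma+\beta\gamma^{ -1})$. Let $\mathcal{M}$ be the set of monic polynomials in $\mathbb{F}_q[T]$ and $d(f)$ the number of monic divisors of $f$. For $|u|<1/q$ the Estermann function is $$\mathcal{D}_2(u;c/g)=\sum_{f\in\mathcal{M}}d(f)\,e(cf/g)\,u^{\deg f},$$ extended by meromorphic continuation to all $u\in\mathbb{C}$. -}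

module Defs where

open import Level using (0ℓ)
open import Algebra.Bundles using (CommutativeRing; RawSemiring; Semiring)
open import Algebra.Structures using (IsCommutativeRing)
import Algebra.Definitions.RawSemiring as RawSemiringDefs
open import Data.Fin.Base using (Fin; toℕ)
import Data.Fin.Properties as Fin
open import Data.Integer.Base as ℤ using (ℤ; +_; -[1+_])
open import Data.List.Base as List using (List; []; _∷_)
open import Data.List.Relation.Unary.Any using (any?)
open import Data.Maybe.Base using (fromMaybe)
open import Data.Nat.Base as ℕ using (ℕ; zero; suc; _∸_; _!)
open import Data.Nat.ListAction using (sum)
open import Data.Product.Base using (_×_; _,_; ∃; ∃-syntax; proj₁; proj₂)
open import Data.Vec.Base as Vec using (Vec; []; _∷_)
open import Function.Base using (_∘_)
open import Function.Bundles using (_↔_; Inverse)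
open import Function.Properties.Inverse using (↔⇒↣)
open import Relation.Binary.Core using (Rel)
open import Relation.Binary.Definitions using (DecidableEquality)
open import Relation.Binary.Structures using (IsStrictTotalOrder)
open import Relation.Binary.PropositionalEquality
  using (_≡_; refl; sym; trans)
open import Relation.Nullary using (¬_; Dec; yes; no; ¬?)

-- The real numbers, up to isomorphism: an Archimedean ordered field in which
-- every Cauchy sequence converges.
record RealField : Set₁ where
  field
    commutativeRing : CommutativeRing 0ℓ 0ℓ

  open CommutativeRing commutativeRing public renaming (Carrier to ℝ)
  open RawSemiringDefs (Semiring.rawSemiring semiring) public
    using () renaming (_×_ to _·_)

  infix 4 _<_

  field
    _<_                : Rel ℝ 0ℓ
    isStrictTotalOrder : IsStrictTotalOrder _≈_ _<_
    0#≉1#              : ¬ 0# ≈ 1#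
    inverse            : ∀ x → ¬ x ≈ 0# → ∃[ y ] x * y ≈ 1#
    +-monoˡ-<          : ∀ {x y} z → x < y → x + z < y + z
    *-pos              : ∀ {x y} → 0# < x → 0# < y → 0# < x * y
    archimedean        : ∀ x → ∃[ n ] x < n · 1#

  open IsStrictTotalOrder isStrictTotalOrder public using (compare; _≟_)

  ∣_-_∣<_ : ℝ → ℝ → ℝ → Set
  ∣ x - y ∣< ε = x < y + ε × y < x + ε

  Cauchy : (ℕ → ℝ) → Set
  Cauchy s = ∀ ε → 0# < ε →
    ∃[ N ] ∀ m n → N ℕ.≤ m → N ℕ.≤ n → ∣ s m - s n ∣< ε

  Converges : (ℕ → ℝ) → ℝ → Set
  Converges s l = ∀ ε → 0# < ε → ∃[ N ] ∀ n → N ℕ.≤ n → ∣ s n - l ∣< ε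

  field
    complete : ∀ s → Cauchy s → ∃[ l ] Converges s l

module Complex (R : RealField) where

  private module ℝ = RealField R
  open ℝ public using (ℝ)

  record ℂ : Set where
    constructor _+i_
    field
      re im : ℝ
  open ℂ public

  infixl 6 _+_ _-_
  infixl 7 _*_
  infix  8 -_
  infix  9 _⁻¹
  infix  4 _≈_

  _≈_ : Rel ℂ 0ℓ
  z ≈ w = re z ℝ.≈ re w × im z ℝ.≈ im w

  _+_ _*_ _-_ : ℂ → ℂ → ℂ
  z + w = (re z ℝ.+ re w) +i (im z ℝ.+ im w)
  z * w = (re z ℝ.* re w ℝ.- im z ℝ.* im w) +i
          (re z ℝ.* im w ℝ.+ im z ℝ.* re w)
  z - w = (re z ℝ.- re w) +i (im z ℝ.- im w)

  -_ : ℂ → ℂ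
  - z = (ℝ.- re z) +i (ℝ.- im z)

  ofReal : ℝ → ℂ
  ofReal x = x +i ℝ.0#

  0ℂ 1ℂ 𝕚 : ℂ
  0ℂ = ofReal ℝ.0#
  1ℂ = ofReal ℝ.1#
  𝕚  = ℝ.0# +i ℝ.1#

  rawSemiring : RawSemiring 0ℓ 0ℓ
  rawSemiring = record
    { Carrier = ℂ ; _≈_ = _≈_ ; _+_ = _+_ ; _*_ = _*_ ; 0# = 0ℂ ; 1# = 1ℂ }

  open RawSemiringDefs rawSemiring public using (_^_) renaming (_×_ to _·_)

  ofℕ : ℕ → ℂ
  ofℕ n = n · 1ℂ

  normSq : ℂ → ℝ
  normSq z = re z ℝ.* re z ℝ.+ im z ℝ.* im z

  -- Total inverse, with 0 ⁻¹ = 0.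
  _⁻¹ : ℂ → ℂ
  z ⁻¹ with normSq z ℝ.≟ ℝ.0#
  ... | yes _ = 0ℂ
  ... | no ≉0 = let r = proj₁ (ℝ.inverse (normSq z) ≉0) in
                (re z ℝ.* r) +i (ℝ.- (im z ℝ.* r))

  -- |z| < r, stated through |z|² to avoid square roots.
  ∣_∣<_ : ℂ → ℝ → Set
  ∣ z ∣< r = ℝ.0# ℝ.< r × normSq z ℝ.< r ℝ.* r

  ∑ : {A : Set} → List A → (A → ℂ) → ℂ
  ∑ xs f = List.foldr (λ x s → f x + s) 0ℂ xs

  partialSum : (ℕ → ℂ) → ℕ → ℂ
  partialSum a zero    = 0ℂ
  partialSum a (suc n) = partialSum a n + a n

  HasSum : (ℕ → ℂ) → ℂ → Set
  HasSum a s = ∀ ε → ℝ.0# ℝ.< ε →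
    ∃[ N ] ∀ n → N ℕ.≤ n → ∣ partialSum a n - s ∣< ε

  IsExp : (ℂ → ℂ) → Set
  IsExp exp = ∀ z → HasSum (λ n → z ^ n * ofℕ (n !) ⁻¹) (exp z)

  -- π is the least positive zero of sin x = Im exp(ix).
  IsPi : (ℂ → ℂ) → ℝ → Set
  IsPi exp π = ℝ.0# ℝ.< π × sin π ℝ.≈ ℝ.0# ×
               (∀ x → ℝ.0# ℝ.< x → x ℝ.< π → ¬ sin x ℝ.≈ ℝ.0#)
    where
    sin : ℝ → ℝ
    sin x = im (exp (𝕚 * ofReal x))

  DifferentiableAt : (ℂ → ℂ) → ℂ → Set
  DifferentiableAt h z = ∃[ l ] ∀ ε → ℝ.0# ℝ.< ε →
    ∃[ δ ] ℝ.0# ℝ.< δ × (∀ w → ¬ w ≈ z → ∣ w - z ∣< δ →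
      ∣ (h w - h z) * (w - z) ⁻¹ - l ∣< ε)

  -- Near z, f is (w - z)⁻ⁿ times a holomorphic function; the value of f at z
  -- itself is immaterial.
  MeromorphicAt : (ℂ → ℂ) → ℂ → Set
  MeromorphicAt f z = ∃[ n ] ∃[ r ] ∃[ h ] ℝ.0# ℝ.< r ×
    (∀ w → ∣ w - z ∣< r → DifferentiableAt h w) ×
    (∀ w → ¬ w ≈ z → ∣ w - z ∣< r → (w - z) ^ n * f w ≈ h w)

  Meromorphic : (ℂ → ℂ) → Set
  Meromorphic f = (∀ {z w} → z ≈ w → f z ≈ f w) × (∀ z → MeromorphicAt f z)

  -- Equality of meromorphic functions: agreement outside a closed discrete
  -- set, so that values assigned at poles play no role.
  infix 4 _≈ᵐ_
  _≈ᵐ_ : (ℂ → ℂ) → (ℂ → ℂ) → Set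
  f ≈ᵐ h = ∀ z → ∃[ r ] ℝ.0# ℝ.< r ×
    (∀ w → ¬ w ≈ z → ∣ w - z ∣< r → f w ≈ h w)

record FiniteField (q : ℕ) : Set₁ where
  infixl 6 _+_
  infixl 7 _*_
  infix  8 -_
  infix  9 _⁻¹
  field
    Carrier           : Set
    _+_ _*_           : Carrier → Carrier → Carrier
    -_                : Carrier → Carrier
    0# 1#             : Carrier
    isCommutativeRing : IsCommutativeRing _≡_ _+_ _*_ -_ 0# 1#
    0≢1               : ¬ 0# ≡ 1#
    -- The value at 0# is unconstrained and never used.
    _⁻¹               : Carrier → Carrier
    *-inverse         : ∀ x → ¬ x ≡ 0# → x * x ⁻¹ ≡ 1#
    enumeration       : Carrier ↔ Fin q

  commutativeRing : CommutativeRing 0ℓ 0ℓ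
  commutativeRing = record { isCommutativeRing = isCommutativeRing }

  open RawSemiringDefs
    (Semiring.rawSemiring (CommutativeRing.semiring commutativeRing)) public
    using (_^_) renaming (_×_ to _·_)

  infix 4 _≟_
  _≟_ : DecidableEquality Carrier
  _≟_ = Fin.inj⇒≟ (↔⇒↣ enumeration)

  elements : List Carrier
  elements = List.map (Inverse.from enumeration) (List.allFin q)

  units : List Carrier
  units = List.filter (λ x → ¬? (x ≟ 0#)) elements

module Polynomials {q : ℕ} (F : FiniteField q) where

  private module F = FiniteField F
  open F using (0#; 1#) renaming (Carrier to 𝔽)

  -- Coefficient lists, constant term first; trailing zeros are allowed.
  Poly : Set
  Poly = List 𝔽

  coeff : Poly → ℕ → 𝔽
  coeff []      k       = 0#
  coeff (a ∷ f) zero    = a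
  coeff (a ∷ f) (suc k) = coeff f k

  infix  4 _≈ₚ_ _≟ₚ_
  infixl 6 _+ₚ_ _-ₚ_
  infixl 7 _*ₚ_ _∙ₚ_

  _≈ₚ_ : Rel Poly 0ℓ
  f ≈ₚ g = ∀ k → coeff f k ≡ coeff g k

  _+ₚ_ : Poly → Poly → Poly
  []      +ₚ g       = g
  (a ∷ f) +ₚ []      = a ∷ f
  (a ∷ f) +ₚ (b ∷ g) = (a F.+ b) ∷ (f +ₚ g)

  _∙ₚ_ : 𝔽 → Poly → Poly
  a ∙ₚ f = List.map (a F.*_) f

  _-ₚ_ : Poly → Poly → Poly
  f -ₚ g = f +ₚ List.map F.-_ g

  _*ₚ_ : Poly → Poly → Poly
  []      *ₚ g = []
  (a ∷ f) *ₚ g = (a ∙ₚ g) +ₚ (0# ∷ (f *ₚ g))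

  1ₚ : Poly
  1ₚ = 1# ∷ []

  polyRawSemiring : RawSemiring 0ℓ 0ℓ
  polyRawSemiring = record
    { Carrier = Poly ; _≈_ = _≈ₚ_ ; _+_ = _+ₚ_ ; _*_ = _*ₚ_
    ; 0# = [] ; 1# = 1ₚ }

  open RawSemiringDefs polyRawSemiring public using (Coprime)
    renaming (_∣_ to _∣ₚ_)

  ≈[]? : ∀ f → Dec (∀ k → 0# ≡ coeff f k)
  ≈[]? []      = yes λ _ → refl
  ≈[]? (a ∷ f) with 0# F.≟ a | ≈[]? f
  ... | yes p | yes ps = yes λ { zero → p ; (suc k) → ps k }
  ... | no ¬p | _      = no λ eq → ¬p (eq 0)
  ... | yes _ | no ¬ps = no λ eq → ¬ps (eq ∘ suc)

  _≟ₚ_ : ∀ f g → Dec (f ≈ₚ g)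
  [] ≟ₚ g = ≈[]? g
  (a ∷ f) ≟ₚ [] with ≈[]? (a ∷ f)
  ... | yes p = yes (sym ∘ p)
  ... | no ¬p = no λ eq → ¬p (sym ∘ eq)
  (a ∷ f) ≟ₚ (b ∷ g) with a F.≟ b | f ≟ₚ g
  ... | yes p | yes ps = yes λ { zero → p ; (suc k) → ps k }
  ... | no ¬p | _      = no λ eq → ¬p (eq 0)
  ... | yes _ | no ¬ps = no λ eq → ¬ps (eq ∘ suc)

  -- A monic polynomial of degree n is given by its n lower coefficients.
  Monic : ℕ → Set
  Monic n = Vec 𝔽 n

  toPoly : ∀ {n} → Monic n → Poly
  toPoly []      = 1ₚ
  toPoly (a ∷ f) = a ∷ toPoly f

  monics : ∀ n → List (Monic n)
  monics zero    = [] ∷ []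
  monics (suc n) = List.cartesianProductWith _∷_ F.elements (monics n)

  -- The cofactor of a monic divisor of a monic polynomial is monic, of
  -- complementary degree.
  divisorsOfDegree : ∀ {n} → Monic n → (m : ℕ) → List (Monic m)
  divisorsOfDegree {n} f m = List.filter
    (λ h → any? (λ k → toPoly k *ₚ toPoly h ≟ₚ toPoly f) (monics (n ∸ m)))
    (monics m)

  d : ∀ {n} → Monic n → ℕ
  d {n} f = sum
    (List.map (λ m → List.length (divisorsOfDegree f m)) (List.upTo (suc n)))

  -- The Laurent series  Σ_{k ≥ 0} (coefs k) T^(top - k)  in 1/T.
  record Laurent : Set where
    constructor laurent
    field
      top   : ℤ
      coefs : ℕ → 𝔽
  open Laurent public

  infixl 7 _*ₗ_

  coefAt : Laurent → ℤ → 𝔽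
  coefAt α j with top α ℤ.- j
  ... | + k      = coefs α k
  ... | -[1+ _ ] = 0#

  _*ₗ_ : Laurent → Laurent → Laurent
  α *ₗ β = laurent (top α ℤ.+ top β) λ k →
    List.foldr F._+_ 0#
      (List.map (λ i → coefs α i F.* coefs β (k ∸ i)) (List.upTo (suc k)))

  fromPoly : Poly → Laurent
  fromPoly f = laurent (+ List.length f ℤ.- + 1) (coeff (List.reverse f))

  -- [r_n, …, r_0], where Σ r_k x^k = (1 + b_1 x + b_2 x² + …)⁻¹, i.e.
  -- r_0 = 1 and r_n = - Σ_{1 ≤ i ≤ n} b_i r_{n-i}.
  reciprocals : (ℕ → 𝔽) → (n : ℕ) → Vec 𝔽 (suc n)
  reciprocals b zero    = 1# ∷ []
  reciprocals b (suc n) =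
    (F.- Vec.foldr′ F._+_ 0# (Vec.zipWith F._*_ bs rs)) ∷ rs
    where
    rs bs : Vec 𝔽 (suc n)
    rs = reciprocals b n
    bs = Vec.tabulate (λ i → b (suc (toℕ i)))

  -- The inverse of a Laurent series whose leading coefficient (coefs 0) is 1.
  inverseₗ : Laurent → Laurent
  inverseₗ α = laurent (ℤ.- top α) λ k → Vec.head (reciprocals (coefs α) k)

  infixl 7 _/ₗ_
  _/ₗ_ : ∀ {n} → Poly → Monic n → Laurent
  a /ₗ g = fromPoly a *ₗ inverseₗ (fromPoly (toPoly g))

module Estermann
  (R : RealField) (exp : Complex.ℂ R → Complex.ℂ R) (π : RealField.ℝ R)
  (p η : ℕ) (F : FiniteField (p ℕ.^ η))
  where

  open Complex R
  open Polynomials F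
  private module F = FiniteField F
  open F using () renaming (Carrier to 𝔽)

  qℂ : ℂ
  qℂ = ofℕ (p ℕ.^ η)

  Tr : 𝔽 → 𝔽
  Tr y = List.foldr F._+_ F.0#
    (List.map (λ j → y F.^ (p ℕ.^ j)) (List.upTo η))

  -- The representative k < p of an element k · 1 of the prime field
  -- (0 outside the prime field).
  residue : 𝔽 → ℕ
  residue x = fromMaybe 0 (List.head
    (List.filter (λ k → k F.· F.1# F.≟ x) (List.upTo p)))

  e_q : 𝔽 → ℂ
  e_q y = exp (ofℕ 2 * ofReal π * 𝕚 * ofℕ (residue (Tr y)) * ofℕ p ⁻¹)

  e : Laurent → ℂ
  e α = e_q (coefAt α -[1+ 0 ])

  Kl₂ : 𝔽 → 𝔽 → ℂ
  Kl₂ α β = ∑ F.units λ γ → e_q (α F.* γ F.+ β F.* γ F.⁻¹)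

  -- The terms of Σ_f d(f) e(af/g) u^(deg f), grouped by n = deg f.
  estermannTerm : ∀ {m} → Poly → Monic m → ℂ → ℕ → ℂ
  estermannTerm a g u n =
    ∑ (monics n) λ f → ofℕ (d f) * e ((a *ₚ toPoly f) /ₗ g) * u ^ n

  -- D is the meromorphic continuation of u ↦ 𝓓₂(u; a/g); the condition
  -- |u| < 1/q is written |qu| < 1.
  IsEstermann : ∀ {m} → Poly → Monic m → (ℂ → ℂ) → Set
  IsEstermann a g D = Meromorphic D ×
    (∀ u → ∣ qℂ * u ∣< RealField.1# R → HasSum (estermannTerm a g u) (D u))

  𝒜 : 𝔽 → ℂ → ℂ
  𝒜 l u = ∑ (0 ∷ 1 ∷ []) λ η₁ → ∑ (0 ∷ 1 ∷ []) λ η₂ →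
    (- 1ℂ) ^ (η₁ ℕ.+ η₂)
    * Kl₂ (η₁ F.· F.1# F.+ F.- F.1#) ((F.1# F.+ F.- (η₂ F.· F.1#)) F.* l)
    * (qℂ * (1ℂ - qℂ * u) ^ (η₁ ℕ.+ η₂)) ⁻¹

-- Let ψ(h) = e(h/g), an additive character of 𝔽_q[T] modulo g. For a function
-- φ of residues put Z_u(φ) = Σ_f φ(f) u^deg f over all monic f; since the monic
-- f of degree ≥ n = deg g are equidistributed modulo g, Z_u is a combination of
-- the sums over monic residues of degree i < n with weights u^i and the sum
-- over all residues with weight u^n / (1 - qu). Hence
-- 𝓓₂(u; a/g) = Z_u(x ↦ Z_u(y ↦ ψ(axy))) is a rational function of u, with a
-- pole at most at 1/q.
--
-- With c = 1/(1 - qu) and v = 1/(qu), the transform Ẑ(x) = Z_u(y ↦ ψ(xy)) is c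
-- at x = 0 and c + (qu)^(n-1) v^m (e_q(l) - c) when x = l f with f monic of
-- degree m < n. Poisson summation over the residues turns 𝓓₂(u; b/g) into
-- q^(-n) Σ_{w,z} Ẑ(-w) Ẑ(z) ψ(b̄wz). Expanding in powers of c, the terms mixed
-- in c vanish by orthogonality, and sorting the rest by the leading coefficients
-- of w and z gives
--   Σ_{ν ≠ 0} [Σ_l (e_q(-l) - c)(e_q(ν/l) - c)] 𝓓₂(v; νb̄/g)
-- up to the stated power of qu², because the inner sum is q 𝒜_ν(u).
--
-- That e_q is a nontrivial character rests on the trace being nonzero (a
-- polynomial of degree < q cannot vanish on the whole field) and on
-- exp(2πi/p) ≠ 1, which is the minimality of π.

module Submission where

open import Defs
import Algebra.Definitions.RawMagma as RawMagma
open import Algebra.Bundles using (CommutativeRing; CommutativeMonoid; RawRing)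
import Algebra.Properties.AbelianGroup as AbelianGroupProps
import Algebra.Properties.CommutativeMonoid.Sum as MonoidSum
import Algebra.Properties.CommutativeSemiring.Binomial as Binomial
import Algebra.Properties.CommutativeSemiring.Exp as CommSemiringExp
import Algebra.Properties.Monoid.Mult as MonoidMult
import Algebra.Properties.Ring as RingProps
import Algebra.Properties.Semiring.Exp as SemiringExp
import Algebra.Properties.Semiring.Mult as SemiringMult
import Algebra.Solver.Ring as RingSolver
import Algebra.Solver.Ring.AlmostCommutativeRing as ACR
open import Data.Fin.Base as Fin using (Fin)
import Data.Fin.Properties as Fin
open import Data.Integer.Base as ℤ using (ℤ; -[1+_])
import Data.Integer.Properties as ℤ
open import Data.List.Base as List using (List; []; _∷_)
import Data.List.Properties as List
open import Data.List.Relation.Unary.All as All using (All; []; _∷_)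
import Data.List.Relation.Unary.All.Properties as All
open import Data.List.Relation.Unary.Any as Any using (any?)
open import Data.List.Relation.Unary.Unique.Propositional using (Unique; []; _∷_)
import Data.List.Relation.Unary.Unique.Propositional.Properties as Unique
open import Data.Maybe.Base using (Maybe; just; nothing; fromMaybe)
open import Data.Nat.Base as ℕ using (ℕ; zero; suc; _∸_; s≤s; z≤n; _!)
open import Data.Nat.Combinatorics using (nCk≡n!/k![n-k]!; k![n∸k]!∣n!; nCn≡1) renaming (_C_ to _choose_)
open import Data.Nat.DivMod using (m/n*n≡m)
open import Data.Nat.Divisibility as ℕ∣ using (_∣_; divides)
open import Data.Nat.GCD using (module Bézout; gcd; gcd[m,n]∣m; gcd[m,n]∣n; gcd-GCD)
open import Data.Nat.ListAction using () renaming (sum to sumℕ)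
open import Data.Nat.Primality using (Prime; euclidsLemma; prime⇒irreducible; prime⇒nonZero; prime⇒nonTrivial)
import Data.Nat.Properties as ℕ
open import Data.Product.Base using (_×_; _,_; ∃-syntax; proj₁; proj₂; Σ)
open import Data.Sign.Base as Sign using (Sign)
open import Data.Sum.Base using (_⊎_; inj₁; inj₂)
open import Data.Vec.Base as Vec using (Vec; []; _∷_)
open import Function.Base using (_∘_; id)
open import Function.Bundles using (Inverse)
open import Level using (0ℓ)
open import Relation.Binary.Bundles using (StrictPartialOrder)
open import Relation.Binary.Definitions using (DecidableEquality; tri<; tri≈; tri>)
open import Relation.Binary.PropositionalEquality as ≡ using (_≡_)
import Relation.Binary.Reasoning.Setoid as SetoidReasoning
import Relation.Binary.Reasoning.StrictPartialOrder as OrderReasoning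
open import Relation.Binary.Structures using (IsStrictTotalOrder)
open import Relation.Nullary using (¬_; Dec; yes; no; ¬?; contradiction)
open import Relation.Unary using (Pred; Decidable)

-- Up to the functional equation all is algebra over an arbitrary commutative ring: `c`, `v` and
-- `c′` are variables bound by (1 - q u) c = 1, q u v = 1 and (1 - q v) c′ = 1, and no limit occurs.
-- The delicate point is the fate of the polar terms. After Poisson summation the zero frequency
-- leaves c² q^n, while the other terms yield only the part of 𝓓₂(v; ν b̄/g) that is polynomial in
-- v; completing it costs v^(2n) c′² q^n for each ν. The two corrections cancel because the
-- amplitudes sum to the perfect square (1 + (q - 1) c)² and because v c′ (1 + (q - 1) c) = -c.
-- Analysis is needed to match the rational function with the series for |qu| < 1, to see that it is
-- meromorphic, and for the exponential. All series that occur converge geometrically, a property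
-- that Cauchy products preserve. Norms are compared through their squares, so no square root is
-- taken. The equation is proved away from u = 0, 1/q and 1, as equality of meromorphic functions
-- permits.

-- Normalisation of ring expressions with integer coefficients.

module IntegerSolver (R : CommutativeRing 0ℓ 0ℓ) where

  open CommutativeRing R
  open RingProps ring using (-‿distribˡ-*; -‿distribʳ-*; -0#≈0#; -‿involutive)
  open AbelianGroupProps +-abelianGroup using () renaming (⁻¹-∙-comm to -‿+-comm)
  open SemiringMult semiring
    using (×-homo-+; ×1-homo-*) renaming (_×_ to _·_)
  open SetoidReasoning setoid

  -- The separate clause for 1 makes the image of the integer 1 equal to `1#` by definition, so that
  -- `:1` stands for `1#` and not for `1# + 0#`.
  fromℕ : ℕ → Carrier
  fromℕ zero          = 0#
  fromℕ (suc zero)    = 1#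
  fromℕ (suc (suc n)) = 1# + fromℕ (suc n)

  fromℕ≈· : ∀ n → fromℕ n ≈ n · 1#
  fromℕ≈· zero          = refl
  fromℕ≈· (suc zero)    = sym (+-identityʳ 1#)
  fromℕ≈· (suc (suc n)) = +-congˡ (fromℕ≈· (suc n))

  fromℤ : ℤ → Carrier
  fromℤ (ℤ.+ n)    = fromℕ n
  fromℤ -[1+ n ] = - fromℕ (suc n)

  cancel-+ : ∀ a b c → (a + b) - (a + c) ≈ b - c
  cancel-+ a b c = begin
    a + b - (a + c)       ≈⟨ +-cong (+-comm a b) (sym (-‿+-comm a c)) ⟩
    b + a + (- a + - c)   ≈⟨ +-assoc b a _ ⟩
    b + (a + (- a + - c)) ≈⟨ +-congˡ (sym (+-assoc a _ _)) ⟩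
    b + (a - a + - c)     ≈⟨ +-congˡ (+-congʳ (-‿inverseʳ a)) ⟩
    b + (0# + - c)        ≈⟨ +-congˡ (+-identityˡ _) ⟩
    b - c                 ∎

  fromℤ-⊖ : ∀ m n → fromℤ (m ℤ.⊖ n) ≈ m · 1# - n · 1#
  fromℤ-⊖ m zero = begin
    fromℕ m      ≈⟨ fromℕ≈· m ⟩
    m · 1#       ≈⟨ sym (+-identityʳ _) ⟩
    m · 1# + 0#  ≈⟨ +-congˡ (sym -0#≈0#) ⟩
    m · 1# - 0#  ∎
  fromℤ-⊖ zero (suc n) = begin
    - fromℕ (suc n)      ≈⟨ -‿cong (fromℕ≈· (suc n)) ⟩
    - (suc n · 1#)       ≈⟨ sym (+-identityˡ _) ⟩
    0# - suc n · 1#      ∎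
  fromℤ-⊖ (suc m) (suc n) = begin
    fromℤ (suc m ℤ.⊖ suc n)  ≡⟨ ≡.cong fromℤ (ℤ.[1+m]⊖[1+n]≡m⊖n m n) ⟩
    fromℤ (m ℤ.⊖ n)          ≈⟨ fromℤ-⊖ m n ⟩
    m · 1# - n · 1#          ≈⟨ sym (cancel-+ 1# _ _) ⟩
    suc m · 1# - suc n · 1#  ∎

  fromℤ-+ : ∀ i j → fromℤ (i ℤ.+ j) ≈ fromℤ i + fromℤ j
  fromℤ-+ (ℤ.+ m) (ℤ.+ n) = begin
    fromℕ (m ℕ.+ n)    ≈⟨ fromℕ≈· (m ℕ.+ n) ⟩
    (m ℕ.+ n) · 1#     ≈⟨ ×-homo-+ 1# m n ⟩
    m · 1# + n · 1#    ≈⟨ +-cong (sym (fromℕ≈· m)) (sym (fromℕ≈· n)) ⟩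
    fromℕ m + fromℕ n  ∎
  fromℤ-+ (ℤ.+ m) -[1+ n ] = begin
    fromℤ (m ℤ.⊖ suc n)      ≈⟨ fromℤ-⊖ m (suc n) ⟩
    m · 1# - suc n · 1#      ≈⟨ +-cong (sym (fromℕ≈· m)) (-‿cong (sym (fromℕ≈· (suc n)))) ⟩
    fromℕ m - fromℕ (suc n)  ∎
  fromℤ-+ -[1+ m ] (ℤ.+ n) = begin
    fromℤ (n ℤ.⊖ suc m)        ≈⟨ fromℤ-⊖ n (suc m) ⟩
    n · 1# - suc m · 1#        ≈⟨ +-comm _ _ ⟩
    - (suc m · 1#) + n · 1#    ≈⟨ +-cong (-‿cong (sym (fromℕ≈· (suc m)))) (sym (fromℕ≈· n)) ⟩
    - fromℕ (suc m) + fromℕ n  ∎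
  fromℤ-+ -[1+ m ] -[1+ n ] = begin
    - fromℕ (suc (suc (m ℕ.+ n)))        ≡⟨ ≡.cong (λ k → - fromℕ (suc k)) (≡.sym (ℕ.+-suc m n)) ⟩
    - fromℕ (suc m ℕ.+ suc n)            ≈⟨ -‿cong (fromℤ-+ (ℤ.+ suc m) (ℤ.+ suc n)) ⟩
    - (fromℕ (suc m) + fromℕ (suc n))    ≈⟨ sym (-‿+-comm _ _) ⟩
    - fromℕ (suc m) + - fromℕ (suc n)    ∎

  fromℕ-* : ∀ m n → fromℕ (m ℕ.* n) ≈ fromℕ m * fromℕ n
  fromℕ-* m n = begin
    fromℕ (m ℕ.* n)      ≈⟨ fromℕ≈· (m ℕ.* n) ⟩
    (m ℕ.* n) · 1#       ≈⟨ ×1-homo-* m n ⟩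
    (m · 1#) * (n · 1#)  ≈⟨ *-cong (sym (fromℕ≈· m)) (sym (fromℕ≈· n)) ⟩
    fromℕ m * fromℕ n    ∎

  fromℤ-◃ : ∀ n → fromℤ (Sign.- ℤ.◃ n) ≈ - fromℕ n
  fromℤ-◃ zero    = sym -0#≈0#
  fromℤ-◃ (suc n) = refl

  fromℤ-* : ∀ i j → fromℤ (i ℤ.* j) ≈ fromℤ i * fromℤ j
  fromℤ-* (ℤ.+ m) (ℤ.+ n) = trans (reflexive (≡.cong fromℤ (ℤ.+◃n≡+n (m ℕ.* n)))) (fromℕ-* m n)
  fromℤ-* (ℤ.+ m) -[1+ n ] =
    trans (fromℤ-◃ (m ℕ.* suc n)) (trans (-‿cong (fromℕ-* m (suc n))) (-‿distribʳ-* _ _))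
  fromℤ-* -[1+ m ] (ℤ.+ n) =
    trans (fromℤ-◃ (suc m ℕ.* n)) (trans (-‿cong (fromℕ-* (suc m) n)) (-‿distribˡ-* _ _))
  fromℤ-* -[1+ m ] -[1+ n ] = begin
    fromℕ (suc m ℕ.* suc n)              ≈⟨ fromℕ-* (suc m) (suc n) ⟩
    fromℕ (suc m) * fromℕ (suc n)        ≈⟨ sym (-‿involutive _) ⟩
    - - (fromℕ (suc m) * fromℕ (suc n))  ≈⟨ -‿cong (-‿distribˡ-* _ _) ⟩
    - (- fromℕ (suc m) * fromℕ (suc n))  ≈⟨ -‿distribʳ-* _ _ ⟩
    - fromℕ (suc m) * - fromℕ (suc n)    ∎

  fromℤ-neg : ∀ i → fromℤ (ℤ.- i) ≈ - fromℤ i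
  fromℤ-neg (ℤ.+ zero)  = sym -0#≈0#
  fromℤ-neg (ℤ.+ suc n) = refl
  fromℤ-neg -[1+ n ]  = sym (-‿involutive _)

  private
    ℤ-rawRing : RawRing 0ℓ 0ℓ
    ℤ-rawRing = record
      { Carrier = ℤ ; _≈_ = _≡_ ; _+_ = ℤ._+_ ; _*_ = ℤ._*_ ; -_ = ℤ.-_ ; 0# = ℤ.+ 0 ; 1# = ℤ.+ 1 }

    almostRing : ACR.AlmostCommutativeRing 0ℓ 0ℓ
    almostRing = ACR.fromCommutativeRing R

    morphism : ℤ-rawRing ACR.-Raw-AlmostCommutative⟶ almostRing
    morphism = record
      { ⟦_⟧ = fromℤ ; +-homo = fromℤ-+ ; *-homo = fromℤ-* ; -‿homo = fromℤ-neg
      ; 0-homo = refl ; 1-homo = refl }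

    -- Only a sufficient test: distinct integers may still agree in a ring of positive
    -- characteristic.
    coeff≟ : ∀ i j → Maybe (fromℤ i ≈ fromℤ j)
    coeff≟ i j with i ℤ.≟ j
    ... | yes i≡j = just (reflexive (≡.cong fromℤ i≡j))
    ... | no  _   = nothing

  open RingSolver ℤ-rawRing almostRing morphism coeff≟ public
    using (solve; con; _:+_; _:*_; :-_; _:-_; _:=_; Polynomial)

  :0 :1 : ∀ {n} → Polynomial n
  :0 = con (ℤ.+ 0)
  :1 = con (ℤ.+ 1)

-- Finite sums over lists in a commutative monoid; the multiplicative monoid gives finite products.

module ListSum (M : CommutativeMonoid 0ℓ 0ℓ) where

  open CommutativeMonoid M renaming
    ( _∙_ to infixl 6 _+_ ; ε to 0# ; ∙-cong to +-cong ; ∙-congˡ to +-congˡ ; ∙-congʳ to +-congʳ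
    ; identityˡ to +-identityˡ ; identityʳ to +-identityʳ ; assoc to +-assoc ; comm to +-comm )
  open SetoidReasoning setoid

  private variable
    A B : Set

  ∑ : List A → (A → Carrier) → Carrier
  ∑ xs f = List.foldr (λ x s → f x + s) 0# xs

  interchange : ∀ a b c d → (a + b) + (c + d) ≈ (a + c) + (b + d)
  interchange a b c d = begin
    (a + b) + (c + d)  ≈⟨ +-assoc a b _ ⟩
    a + (b + (c + d))  ≈⟨ +-congˡ (sym (+-assoc b c d)) ⟩
    a + ((b + c) + d)  ≈⟨ +-congˡ (+-congʳ (+-comm b c)) ⟩
    a + ((c + b) + d)  ≈⟨ +-congˡ (+-assoc c b d) ⟩
    a + (c + (b + d))  ≈⟨ sym (+-assoc a c _) ⟩
    (a + c) + (b + d)  ∎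

  ∑-cong : ∀ (xs : List A) {f g : A → Carrier} → (∀ x → f x ≈ g x) → ∑ xs f ≈ ∑ xs g
  ∑-cong []       f≈g = refl
  ∑-cong (x ∷ xs) f≈g = +-cong (f≈g x) (∑-cong xs f≈g)

  ∑-zero : ∀ (xs : List A) {f : A → Carrier} → (∀ x → f x ≈ 0#) → ∑ xs f ≈ 0#
  ∑-zero []       f≈0 = refl
  ∑-zero (x ∷ xs) f≈0 = trans (+-cong (f≈0 x) (∑-zero xs f≈0)) (+-identityˡ 0#)

  ∑-+ : ∀ (xs : List A) (f g : A → Carrier) → ∑ xs (λ x → f x + g x) ≈ ∑ xs f + ∑ xs g
  ∑-+ []       f g = sym (+-identityˡ 0#)
  ∑-+ (x ∷ xs) f g = trans (+-congˡ (∑-+ xs f g)) (interchange (f x) (g x) _ _)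

  ∑-swap : ∀ (xs : List A) (ys : List B) (f : A → B → Carrier) →
           ∑ xs (λ x → ∑ ys (f x)) ≈ ∑ ys (λ y → ∑ xs (λ x → f x y))
  ∑-swap []       ys f = sym (∑-zero ys (λ _ → refl))
  ∑-swap (x ∷ xs) ys f = trans (+-congˡ (∑-swap xs ys f)) (sym (∑-+ ys (f x) _))

  ∑-map : ∀ (h : A → B) (xs : List A) (f : B → Carrier) → ∑ (List.map h xs) f ≡ ∑ xs (f ∘ h)
  ∑-map h []       f = ≡.refl
  ∑-map h (x ∷ xs) f = ≡.cong (f (h x) +_) (∑-map h xs f)

  ∑-++ : ∀ (xs ys : List A) (f : A → Carrier) → ∑ (xs List.++ ys) f ≈ ∑ xs f + ∑ ys f
  ∑-++ []       ys f = sym (+-identityˡ _)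
  ∑-++ (x ∷ xs) ys f = trans (+-congˡ (∑-++ xs ys f)) (sym (+-assoc _ _ _))

  ∑-cartesian : ∀ {C : Set} (h : A → B → C) xs ys (f : C → Carrier) →
    ∑ (List.cartesianProductWith h xs ys) f ≈ ∑ xs (λ x → ∑ ys (λ y → f (h x y)))
  ∑-cartesian h []       ys f = refl
  ∑-cartesian h (x ∷ xs) ys f = trans (∑-++ (List.map (h x) ys) _ f)
    (+-cong (reflexive (∑-map (h x) ys f)) (∑-cartesian h xs ys f))

  infix 9 [_]_
  -- An Iverson bracket that uses only the monoid structure.
  [_]_ : ∀ {P : Set} → Dec P → Carrier → Carrier
  [ yes _ ] a = a
  [ no  _ ] a = 0#

  []-yes : ∀ {P : Set} (d : Dec P) {a} → P → [ d ] a ≈ a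
  []-yes (yes _) _ = refl
  []-yes (no ¬p) p = contradiction p ¬p

  []-no : ∀ {P : Set} (d : Dec P) {a} → ¬ P → [ d ] a ≈ 0#
  []-no (yes p) ¬p = contradiction p ¬p
  []-no (no _)  _  = refl

  ∑-filter : ∀ {P : Pred A 0ℓ} (P? : Decidable P) xs (f : A → Carrier) →
             ∑ (List.filter P? xs) f ≈ ∑ xs (λ x → [ P? x ] f x)
  ∑-filter P? []       f = refl
  ∑-filter P? (x ∷ xs) f with P? x
  ... | yes _ = +-congˡ (∑-filter P? xs f)
  ... | no  _ = trans (∑-filter P? xs f) (sym (+-identityˡ _))

  ∑-applyUpTo : ∀ (h : ℕ → A) n (f : A → Carrier) →
                ∑ (List.applyUpTo h n) f ≡ ∑ (List.upTo n) (f ∘ h)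
  ∑-applyUpTo h zero    f = ≡.refl
  ∑-applyUpTo h (suc n) f = ≡.cong (f (h 0) +_)
    (≡.trans (∑-applyUpTo (h ∘ suc) n f) (≡.sym (∑-applyUpTo suc n (f ∘ h))))

  ∑-upTo-suc : ∀ n (f : ℕ → Carrier) →
               ∑ (List.upTo (suc n)) f ≡ f 0 + ∑ (List.upTo n) (f ∘ suc)
  ∑-upTo-suc n f = ≡.cong (f 0 +_) (∑-applyUpTo suc n f)

  ∑-upTo-+ : ∀ m n (f : ℕ → Carrier) → ∑ (List.upTo (m ℕ.+ n)) f ≈
             ∑ (List.upTo m) f + ∑ (List.upTo n) (λ k → f (m ℕ.+ k))
  ∑-upTo-+ zero    n f = sym (+-identityˡ _)
  ∑-upTo-+ (suc m) n f = begin
    ∑ (List.upTo (suc m ℕ.+ n)) f                        ≡⟨ ∑-upTo-suc (m ℕ.+ n) f ⟩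
    f 0 + ∑ (List.upTo (m ℕ.+ n)) (f ∘ suc)              ≈⟨ +-congˡ (∑-upTo-+ m n (f ∘ suc)) ⟩
    f 0 + (∑ (List.upTo m) (f ∘ suc) + _)                ≈⟨ sym (+-assoc _ _ _) ⟩
    f 0 + ∑ (List.upTo m) (f ∘ suc) + _                  ≈⟨ +-congʳ (reflexive (≡.sym (∑-upTo-suc m f))) ⟩
    ∑ (List.upTo (suc m)) f + ∑ (List.upTo n) (λ k → f (suc m ℕ.+ k)) ∎

  ∑-upTo-snoc : ∀ n (f : ℕ → Carrier) →
                ∑ (List.upTo (suc n)) f ≈ ∑ (List.upTo n) f + f n
  ∑-upTo-snoc n f = begin
    ∑ (List.upTo (suc n)) f                   ≡⟨ ≡.cong (λ k → ∑ (List.upTo k) f) (ℕ.+-comm 1 n) ⟩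
    ∑ (List.upTo (n ℕ.+ 1)) f                 ≈⟨ ∑-upTo-+ n 1 f ⟩
    ∑ (List.upTo n) f + (f (n ℕ.+ 0) + 0#)    ≈⟨ +-congˡ (+-identityʳ _) ⟩
    ∑ (List.upTo n) f + f (n ℕ.+ 0)           ≡⟨ ≡.cong (λ k → ∑ (List.upTo n) f + f k) (ℕ.+-identityʳ n) ⟩
    ∑ (List.upTo n) f + f n                   ∎

  ∑-upTo-cong : ∀ n {f g : ℕ → Carrier} → (∀ k → k ℕ.< n → f k ≈ g k) →
                ∑ (List.upTo n) f ≈ ∑ (List.upTo n) g
  ∑-upTo-cong zero    f≈g = refl
  ∑-upTo-cong (suc n) {f} {g} f≈g = begin
    ∑ (List.upTo (suc n)) f            ≡⟨ ∑-upTo-suc n f ⟩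
    f 0 + ∑ (List.upTo n) (f ∘ suc)    ≈⟨ +-cong (f≈g 0 (s≤s z≤n)) (∑-upTo-cong n (λ k k<n → f≈g (suc k) (s≤s k<n))) ⟩
    g 0 + ∑ (List.upTo n) (g ∘ suc)    ≡⟨ ≡.sym (∑-upTo-suc n g) ⟩
    ∑ (List.upTo (suc n)) g            ∎

  ∑-upTo-zero : ∀ n {f : ℕ → Carrier} → (∀ k → k ℕ.< n → f k ≈ 0#) → ∑ (List.upTo n) f ≈ 0#
  ∑-upTo-zero n f≈0 = trans (∑-upTo-cong n f≈0) (∑-zero (List.upTo n) (λ _ → refl))

  -- Every element of A occurs exactly once in the list, phrased so that it
  -- needs no equality test on A.
  Enumerates : List A → Set
  Enumerates {A} xs = ∀ a (f : A → Carrier) → (∀ x → ¬ x ≡ a → f x ≈ 0#) → ∑ xs f ≈ f a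

  ∑-upTo-point : ∀ n k → k ℕ.< n → (f : ℕ → Carrier) →
                 (∀ j → j ℕ.< n → ¬ j ≡ k → f j ≈ 0#) → ∑ (List.upTo n) f ≈ f k
  ∑-upTo-point (suc n) zero _ f f≈0 = trans (reflexive (∑-upTo-suc n f))
    (trans (+-congˡ (∑-upTo-zero n (λ j j<n → f≈0 (suc j) (s≤s j<n) λ ()))) (+-identityʳ _))
  ∑-upTo-point (suc n) (suc k) (s≤s k<n) f f≈0 = trans (reflexive (∑-upTo-suc n f))
    (trans (+-cong (f≈0 0 (s≤s z≤n) λ ())
      (∑-upTo-point n k k<n (f ∘ suc) (λ j j<n j≢k → f≈0 (suc j) (s≤s j<n) (j≢k ∘ ℕ.suc-injective))))
      (+-identityˡ _))

  ∑-tabulate : ∀ {n} (h : Fin n → A) (f : A → Carrier) →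
               ∑ (List.tabulate h) f ≡ ∑ (List.allFin n) (f ∘ h)
  ∑-tabulate {n = zero}  h f = ≡.refl
  ∑-tabulate {n = suc n} h f = ≡.cong (f (h Fin.zero) +_)
    (≡.trans (∑-tabulate (h ∘ Fin.suc) f) (≡.sym (∑-tabulate Fin.suc (f ∘ h))))

  allFin-enumerates : ∀ n → Enumerates (List.allFin n)
  allFin-enumerates (suc n) Fin.zero f f≈0 = trans
    (+-congˡ (trans (reflexive (∑-tabulate Fin.suc f)) (∑-zero (List.allFin n) λ x → f≈0 (Fin.suc x) λ ())))
    (+-identityʳ _)
  allFin-enumerates (suc n) (Fin.suc a) f f≈0 = trans
    (+-cong (f≈0 Fin.zero λ ()) (trans (reflexive (∑-tabulate Fin.suc f))
      (allFin-enumerates n a (f ∘ Fin.suc) (λ x x≢a → f≈0 (Fin.suc x) λ { ≡.refl → x≢a ≡.refl }))))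
    (+-identityˡ _)

  map-enumerates : ∀ (h : A → B) (h⁻¹ : B → A) → (∀ b → h (h⁻¹ b) ≡ b) → (∀ a → h⁻¹ (h a) ≡ a) →
                   ∀ xs → Enumerates xs → Enumerates (List.map h xs)
  map-enumerates h h⁻¹ hh⁻¹ h⁻¹h xs enum b f f≈0 = begin
    ∑ (List.map h xs) f  ≡⟨ ∑-map h xs f ⟩
    ∑ xs (f ∘ h)         ≈⟨ enum (h⁻¹ b) (f ∘ h) (λ x x≢ → f≈0 (h x)
                               (λ hx≡b → x≢ (≡.trans (≡.sym (h⁻¹h x)) (≡.cong h⁻¹ hx≡b)))) ⟩
    f (h (h⁻¹ b))        ≡⟨ ≡.cong f (hh⁻¹ b) ⟩
    f b                  ∎

  ∷-enumerates : ∀ {n} (xs : List A) (vs : List (Vec A n)) → DecidableEquality A →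
                 Enumerates xs → Enumerates vs →
                 Enumerates (List.cartesianProductWith Vec._∷_ xs vs)
  ∷-enumerates xs vs _≟_ enum-xs enum-vs (a ∷ as) f f≈0 = begin
    ∑ (List.cartesianProductWith Vec._∷_ xs vs) f  ≈⟨ ∑-cartesian Vec._∷_ xs vs f ⟩
    ∑ xs (λ x → ∑ vs (λ v → f (x ∷ v)))            ≈⟨ enum-xs a _ (λ x x≢a → ∑-zero vs (λ v →
                                                        f≈0 (x ∷ v) λ { ≡.refl → x≢a ≡.refl })) ⟩
    ∑ vs (λ v → f (a ∷ v))                         ≈⟨ enum-vs as _ (λ v v≢as →
                                                        f≈0 (a ∷ v) λ { ≡.refl → v≢as ≡.refl }) ⟩
    f (a ∷ as)                                     ∎

  -- No permutation of the list is built: f (σ x) is expanded into a sum over y with the indicator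
  -- of y = σ x, the two sums are exchanged, and the sum over x collapses at τ y.
  ∑-reindex : DecidableEquality A → ∀ (xs : List A) → Enumerates xs → (σ τ : A → A) →
              (∀ x → σ (τ x) ≡ x) → (∀ x → τ (σ x) ≡ x) →
              ∀ (f : A → Carrier) → ∑ xs (f ∘ σ) ≈ ∑ xs f
  ∑-reindex _≟_ xs enum σ τ στ τσ f = begin
    ∑ xs (λ x → f (σ x))                          ≈⟨ ∑-cong xs (λ x → sym (trans
                                                       (enum (σ x) _ (λ y y≢ → []-no (y ≟ σ x) y≢))
                                                       ([]-yes (σ x ≟ σ x) ≡.refl))) ⟩
    ∑ xs (λ x → ∑ xs (λ y → [ y ≟ σ x ] f y))     ≈⟨ ∑-swap xs xs _ ⟩
    ∑ xs (λ y → ∑ xs (λ x → [ y ≟ σ x ] f y))     ≈⟨ ∑-cong xs (λ y → trans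
                                                       (enum (τ y) _ (λ x x≢ → []-no (y ≟ σ x)
                                                         (λ y≡σx → x≢ (≡.trans (≡.sym (τσ x)) (≡.cong τ (≡.sym y≡σx))))))
                                                       ([]-yes (y ≟ σ (τ y)) (≡.sym (στ y)))) ⟩
    ∑ xs f                                        ∎

module RingSum (K : CommutativeRing 0ℓ 0ℓ) where

  open CommutativeRing K
  open ListSum +-commutativeMonoid public
  open SemiringMult semiring public using () renaming (_×_ to _·_)
  open SemiringExp semiring public using (_^_)
  open SetoidReasoning setoid

  private variable
    A B : Set

  ∑-*ˡ : ∀ (xs : List A) c (f : A → Carrier) → ∑ xs (λ x → c * f x) ≈ c * ∑ xs f
  ∑-*ˡ []       c f = sym (zeroʳ c)
  ∑-*ˡ (x ∷ xs) c f = trans (+-congˡ (∑-*ˡ xs c f)) (sym (distribˡ c _ _))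

  ∑-*ʳ : ∀ (xs : List A) c (f : A → Carrier) → ∑ xs (λ x → f x * c) ≈ ∑ xs f * c
  ∑-*ʳ xs c f = trans (∑-cong xs (λ x → *-comm (f x) c)) (trans (∑-*ˡ xs c f) (*-comm c _))

  ∑-neg : ∀ (xs : List A) (f : A → Carrier) → ∑ xs (λ x → - f x) ≈ - ∑ xs f
  ∑-neg []       f = sym (RingProps.-0#≈0# ring)
  ∑-neg (x ∷ xs) f = trans (+-congˡ (∑-neg xs f)) (AbelianGroupProps.⁻¹-∙-comm +-abelianGroup _ _)

  1^ : ∀ n → 1# ^ n ≈ 1#
  1^ zero    = refl
  1^ (suc n) = trans (*-identityˡ _) (1^ n)

  ∑-const : ∀ (xs : List A) c → ∑ xs (λ _ → c) ≈ (List.length xs · 1#) * c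
  ∑-const []       c = sym (zeroˡ c)
  ∑-const (x ∷ xs) c = trans (+-cong (sym (*-identityˡ c)) (∑-const xs c)) (sym (distribʳ c 1# _))

-- Cauchy products of sequences.

module Convolution (K : CommutativeRing 0ℓ 0ℓ) where

  open CommutativeRing K
  open RingSum K
  open IntegerSolver K
  open SetoidReasoning setoid

  -- The Cauchy product, unrolled by shifting the first sequence: inductions on n then need no
  -- subtraction of indices.
  conv : (ℕ → Carrier) → (ℕ → Carrier) → ℕ → Carrier
  conv a b zero    = a 0 * b 0
  conv a b (suc n) = a 0 * b (suc n) + conv (a ∘ suc) b n

  conv-cong : ∀ {a a′ b b′} → (∀ k → a k ≈ a′ k) → (∀ k → b k ≈ b′ k) →
              ∀ n → conv a b n ≈ conv a′ b′ n
  conv-cong a≈ b≈ zero    = *-cong (a≈ 0) (b≈ 0)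
  conv-cong a≈ b≈ (suc n) = +-cong (*-cong (a≈ 0) (b≈ (suc n))) (conv-cong (a≈ ∘ suc) b≈ n)

  conv-snoc : ∀ a b n → conv a b (suc n) ≈ conv a (b ∘ suc) n + a (suc n) * b 0
  conv-snoc a b zero    = refl
  conv-snoc a b (suc n) = trans (+-congˡ (conv-snoc (a ∘ suc) b n)) (sym (+-assoc _ _ _))

  conv-comm : ∀ a b n → conv a b n ≈ conv b a n
  conv-comm a b zero    = *-comm _ _
  conv-comm a b (suc n) = begin
    a 0 * b (suc n) + conv (a ∘ suc) b n  ≈⟨ +-cong (*-comm _ _) (conv-comm (a ∘ suc) b n) ⟩
    b (suc n) * a 0 + conv b (a ∘ suc) n  ≈⟨ +-comm _ _ ⟩
    conv b (a ∘ suc) n + b (suc n) * a 0  ≈⟨ sym (conv-snoc b a n) ⟩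
    conv b a (suc n)                      ∎

  conv-+ˡ : ∀ a a′ b n → conv (λ k → a k + a′ k) b n ≈ conv a b n + conv a′ b n
  conv-+ˡ a a′ b zero    = distribʳ _ _ _
  conv-+ˡ a a′ b (suc n) = trans (+-cong (distribʳ _ _ _) (conv-+ˡ (a ∘ suc) (a′ ∘ suc) b n))
                                 (interchange _ _ _ _)

  conv-*ˡ : ∀ c a b n → conv (λ k → c * a k) b n ≈ c * conv a b n
  conv-*ˡ c a b zero    = *-assoc _ _ _
  conv-*ˡ c a b (suc n) = trans (+-cong (*-assoc _ _ _) (conv-*ˡ c (a ∘ suc) b n)) (sym (distribˡ _ _ _))

  conv-zeroˡ : ∀ b n → conv (λ _ → 0#) b n ≈ 0#
  conv-zeroˡ b zero    = zeroˡ _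
  conv-zeroˡ b (suc n) = trans (+-cong (zeroˡ _) (conv-zeroˡ b n)) (+-identityˡ 0#)

  conv-+ʳ : ∀ a b b′ n → conv a (λ k → b k + b′ k) n ≈ conv a b n + conv a b′ n
  conv-+ʳ a b b′ n = trans (conv-comm a _ n)
    (trans (conv-+ˡ b b′ a n) (+-cong (conv-comm b a n) (conv-comm b′ a n)))

  conv-*ʳ : ∀ c a b n → conv a (λ k → c * b k) n ≈ c * conv a b n
  conv-*ʳ c a b n = trans (conv-comm a _ n) (trans (conv-*ˡ c b a n) (*-congˡ (conv-comm b a n)))

  conv-assoc : ∀ a b c n → conv (conv a b) c n ≈ conv a (conv b c) n
  conv-assoc a b c zero    = *-assoc _ _ _
  conv-assoc a b c (suc n) = begin
    a 0 * b 0 * c (suc n) + conv (λ k → a 0 * b (suc k) + conv (a ∘ suc) b k) c n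
      ≈⟨ +-cong (*-assoc _ _ _) (conv-+ˡ (λ k → a 0 * b (suc k)) (conv (a ∘ suc) b) c n) ⟩
    a 0 * (b 0 * c (suc n)) + (conv (λ k → a 0 * b (suc k)) c n + conv (conv (a ∘ suc) b) c n)
      ≈⟨ +-congˡ (+-cong (conv-*ˡ (a 0) (b ∘ suc) c n) (conv-assoc (a ∘ suc) b c n)) ⟩
    a 0 * (b 0 * c (suc n)) + (a 0 * conv (b ∘ suc) c n + conv (a ∘ suc) (conv b c) n)
      ≈⟨ sym (+-assoc _ _ _) ⟩
    a 0 * (b 0 * c (suc n)) + a 0 * conv (b ∘ suc) c n + conv (a ∘ suc) (conv b c) n
      ≈⟨ +-congʳ (sym (distribˡ _ _ _)) ⟩
    conv a (conv b c) (suc n) ∎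

  conv≈∑ : ∀ a b n → conv a b n ≈ ∑ (List.upTo (suc n)) (λ k → a k * b (n ∸ k))
  conv≈∑ a b zero    = sym (+-identityʳ _)
  conv≈∑ a b (suc n) = trans (+-congˡ (conv≈∑ (a ∘ suc) b n))
    (reflexive (≡.sym (∑-upTo-suc (suc n) (λ k → a k * b (suc n ∸ k)))))

  -- The substitution of u x for x in generating functions commutes with their product.
  conv-powers : ∀ u a b n → conv (λ k → a k * u ^ k) (λ k → b k * u ^ k) n ≈ conv a b n * u ^ n
  conv-powers u a b zero    = solve 2 (λ a b → a :* :1 :* (b :* :1) := a :* b :* :1) refl (a 0) (b 0)
  conv-powers u a b (suc n) = begin
    a 0 * 1# * (b (suc n) * (u * u ^ n)) + conv (λ k → a (suc k) * (u * u ^ k)) (λ k → b k * u ^ k) n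
      ≈⟨ +-congˡ (trans (conv-cong (λ k → solve 3 (λ a u v → a :* (u :* v) := u :* (a :* v)) refl (a (suc k)) u (u ^ k))
           (λ _ → refl) n) (conv-*ˡ u (λ k → a (suc k) * u ^ k) _ n)) ⟩
    a 0 * 1# * (b (suc n) * (u * u ^ n)) + u * conv (λ k → a (suc k) * u ^ k) (λ k → b k * u ^ k) n
      ≈⟨ +-congˡ (*-congˡ (conv-powers u (a ∘ suc) b n)) ⟩
    a 0 * 1# * (b (suc n) * (u * u ^ n)) + u * (conv (a ∘ suc) b n * u ^ n)
      ≈⟨ solve 5 (λ a b u v c → a :* :1 :* (b :* (u :* v)) :+ u :* (c :* v) := (a :* b :+ c) :* (u :* v))
           refl (a 0) (b (suc n)) u (u ^ n) _ ⟩
    conv a b (suc n) * u ^ suc n ∎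

  -- The Leibniz rule for generating functions, the derivative of Σ aₙ xⁿ
  -- being Σ (n + 1) aₙ₊₁ xⁿ.
  conv-leibniz : ∀ a b n → (suc n · 1#) * conv a b (suc n) ≈
    conv (λ k → (suc k · 1#) * a (suc k)) b n + conv a (λ k → (suc k · 1#) * b (suc k)) n
  conv-leibniz a b zero = solve 4 (λ a₀ a₁ b₀ b₁ →
    (:1 :+ :0) :* (a₀ :* b₁ :+ a₁ :* b₀) :=
    (:1 :+ :0) :* a₁ :* b₀ :+ a₀ :* ((:1 :+ :0) :* b₁)) refl (a 0) (a 1) (b 0) (b 1)
  conv-leibniz a b (suc n) = begin
    (1# + N) * (a 0 * b (2 ℕ.+ n) + X)
      ≈⟨ solve 4 (λ N a₀ b₂ X → (:1 :+ N) :* (a₀ :* b₂ :+ X) := X :+ N :* X :+ a₀ :* ((:1 :+ N) :* b₂))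
           refl N (a 0) (b (2 ℕ.+ n)) X ⟩
    X + N * X + W
      ≈⟨ +-congʳ (+-congˡ (conv-leibniz (a ∘ suc) b n)) ⟩
    a 1 * b (suc n) + conv (a ∘ suc ∘ suc) b n + (conv (λ k → (suc k · 1#) * a (2 ℕ.+ k)) b n + Z) + W
      ≈⟨ solve 6 (λ p q r s z w → (p :* q :+ r) :+ (s :+ z) :+ w :=
                   ((:1 :+ :0) :* p :* q :+ (r :+ s)) :+ (w :+ z))
           refl (a 1) (b (suc n)) _ _ Z W ⟩
    (1# + 0#) * a 1 * b (suc n) + (conv (a ∘ suc ∘ suc) b n + conv (λ k → (suc k · 1#) * a (2 ℕ.+ k)) b n)
      + (W + Z)
      ≈⟨ +-congʳ (+-congˡ (sym (conv-+ˡ _ _ b n))) ⟩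
    (1# + 0#) * a 1 * b (suc n) + conv (λ k → a (2 ℕ.+ k) + (suc k · 1#) * a (2 ℕ.+ k)) b n + (W + Z)
      ≈⟨ +-congʳ (+-congˡ (conv-cong (λ k → solve 2 (λ x m → x :+ m :* x := (:1 :+ m) :* x)
           refl (a (2 ℕ.+ k)) (suc k · 1#)) (λ _ → refl) n)) ⟩
    conv (λ k → (suc k · 1#) * a (suc k)) b (suc n) + conv a (λ k → (suc k · 1#) * b (suc k)) (suc n) ∎
    where
    N = suc n · 1#
    X = conv (a ∘ suc) b (suc n)
    W = a 0 * ((1# + N) * b (2 ℕ.+ n))
    Z = conv (a ∘ suc) (λ k → (suc k · 1#) * b (suc k)) n

-- Binomial coefficients modulo a prime.

prime∤! : ∀ {p} → Prime p → ∀ k → k ℕ.< p → ¬ p ∣ k !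
prime∤! {p} pr zero k<p p∣1 =
  ℕ.<⇒≱ (ℕ.nonTrivial⇒n>1 p {{prime⇒nonTrivial pr}}) (ℕ∣.∣⇒≤ p∣1)
prime∤! pr (suc k) k<p p∣k! with euclidsLemma (suc k) (k !) pr p∣k!
... | inj₁ p∣k = ℕ.<⇒≱ k<p (ℕ∣.∣⇒≤ p∣k)
... | inj₂ p∣k! = prime∤! pr k (ℕ.<-trans (ℕ.n<1+n k) k<p) p∣k!

-- p divides p!, which is the binomial coefficient times k! (p - k)!, and p divides neither of these
-- factorials.
prime∣C : ∀ {p} → Prime p → ∀ k → 0 ℕ.< k → k ℕ.< p → p ∣ p choose k
prime∣C {p} pr k 0<k k<p with euclidsLemma (p choose k) (k ! ℕ.* (p ∸ k) !) pr p∣product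
  where
  instance _ = k ℕ.!* (p ∸ k) !≢0
  product≡ : (p choose k) ℕ.* (k ! ℕ.* (p ∸ k) !) ≡ p !
  product≡ = ≡.trans (≡.cong (ℕ._* (k ! ℕ.* (p ∸ k) !)) (nCk≡n!/k![n-k]! (ℕ.<⇒≤ k<p)))
                     (m/n*n≡m (k![n∸k]!∣n! (ℕ.<⇒≤ k<p)))
  p∣p! : ∀ {p} → 0 ℕ.< p → p ∣ p !
  p∣p! {suc p} _ = divides (p !) (ℕ.*-comm (suc p) (p !))
  p∣product : p ∣ (p choose k) ℕ.* (k ! ℕ.* (p ∸ k) !)
  p∣product = ≡.subst (p ∣_) (≡.sym product≡) (p∣p! (ℕ.<-trans 0<k k<p))
... | inj₁ p∣C = p∣C
... | inj₂ p∣rest with euclidsLemma (k !) ((p ∸ k) !) pr p∣rest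
...   | inj₁ p∣k! = contradiction p∣k! (prime∤! pr k k<p)
...   | inj₂ p∣k! = contradiction p∣k! (prime∤! pr (p ∸ k) (ℕ.∸-monoʳ-< 0<k (ℕ.<⇒≤ k<p)))

-- Sums over a finite field and over its units.

module FieldSum {q : ℕ} (F : FiniteField q) where

  open FiniteField F
  open Polynomials F using (monics)

  ⁻¹-inverseˡ : ∀ x → ¬ x ≡ 0# → x ⁻¹ * x ≡ 1#
  ⁻¹-inverseˡ x x≢0 = ≡.trans (CommutativeRing.*-comm commutativeRing _ _) (*-inverse x x≢0)

  x*y≡0⇒y≡0 : ∀ {x y} → ¬ x ≡ 0# → x * y ≡ 0# → y ≡ 0#
  x*y≡0⇒y≡0 {x} {y} x≢0 xy≡0 = begin
    y                ≡⟨ ≡.sym (*-identityˡ y) ⟩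
    1# * y           ≡⟨ ≡.cong (_* y) (≡.sym (⁻¹-inverseˡ x x≢0)) ⟩
    x ⁻¹ * x * y     ≡⟨ *-assoc _ _ _ ⟩
    x ⁻¹ * (x * y)   ≡⟨ ≡.cong (x ⁻¹ *_) xy≡0 ⟩
    x ⁻¹ * 0#        ≡⟨ zeroʳ _ ⟩
    0#               ∎
    where
    open ≡.≡-Reasoning
    open CommutativeRing commutativeRing using (*-identityˡ; *-assoc; zeroʳ)

  ⁻¹-cancelˡ : ∀ x y → ¬ x ≡ 0# → x * (x ⁻¹ * y) ≡ y
  ⁻¹-cancelˡ x y x≢0 = ≡.trans (≡.sym (*-assoc _ _ _))
    (≡.trans (≡.cong (_* y) (*-inverse x x≢0)) (*-identityˡ y))
    where open CommutativeRing commutativeRing using (*-identityˡ; *-assoc)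

  *-cancelˡ⁻¹ : ∀ x y → ¬ x ≡ 0# → x ⁻¹ * (x * y) ≡ y
  *-cancelˡ⁻¹ x y x≢0 = ≡.trans (≡.sym (*-assoc _ _ _))
    (≡.trans (≡.cong (_* y) (⁻¹-inverseˡ x x≢0)) (*-identityˡ y))
    where open CommutativeRing commutativeRing using (*-identityˡ; *-assoc)

  length-elements : List.length elements ≡ q
  length-elements = ≡.trans (List.length-map _ (List.allFin q)) (List.length-tabulate id)

  elements-unique : Unique elements
  elements-unique = Unique.map⁺ injective (Unique.allFin⁺ q)
    where
    injective : ∀ {i j} → Inverse.from enumeration i ≡ Inverse.from enumeration j → i ≡ j
    injective eq = ≡.trans (≡.sym (Inverse.strictlyInverseˡ enumeration _))
      (≡.trans (≡.cong (Inverse.to enumeration) eq) (Inverse.strictlyInverseˡ enumeration _))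

  module _ (M : CommutativeMonoid 0ℓ 0ℓ) where

    open ListSum M
    private module M = CommutativeMonoid M

    elements-enumerates : Enumerates elements
    elements-enumerates = map-enumerates (Inverse.from enumeration) (Inverse.to enumeration)
      (Inverse.strictlyInverseʳ enumeration) (Inverse.strictlyInverseˡ enumeration)
      (List.allFin q) (allFin-enumerates q)

    monics-enumerates : ∀ n → Enumerates (monics n)
    monics-enumerates zero    [] f _ = M.identityʳ _
    monics-enumerates (suc n) =
      ∷-enumerates elements (monics n) _≟_ elements-enumerates (monics-enumerates n)

    ∑-shift : ∀ a (f : Carrier → M.Carrier) → ∑ elements (λ x → f (x + a)) M.≈ ∑ elements f
    ∑-shift a = ∑-reindex _≟_ elements elements-enumerates (_+ a) (_+ - a)
      (λ x → solve 2 (λ x a → (x :+ :- a) :+ a := x) ≡.refl x a)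
      (λ x → solve 2 (λ x a → (x :+ a) :+ :- a := x) ≡.refl x a)
      where open IntegerSolver commutativeRing

    ∑-scale : ∀ a → ¬ a ≡ 0# → (f : Carrier → M.Carrier) →
              ∑ elements (λ x → f (a * x)) M.≈ ∑ elements f
    ∑-scale a a≢0 = ∑-reindex _≟_ elements elements-enumerates (a *_) (a ⁻¹ *_)
      (λ x → ⁻¹-cancelˡ a x a≢0) (λ x → *-cancelˡ⁻¹ a x a≢0)

    ∑-elements : ∀ (f : Carrier → M.Carrier) → ∑ elements f M.≈ f 0# M.∙ ∑ units f
    ∑-elements f = begin
      ∑ elements f
        ≈⟨ ∑-cong elements split ⟩
      ∑ elements (λ x → [ x ≟ 0# ] f x M.∙ [ ¬? (x ≟ 0#) ] f x)
        ≈⟨ ∑-+ elements _ _ ⟩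
      ∑ elements (λ x → [ x ≟ 0# ] f x) M.∙ ∑ elements (λ x → [ ¬? (x ≟ 0#) ] f x)
        ≈⟨ M.∙-cong (M.trans (elements-enumerates 0# _ (λ x x≢0 → []-no (x ≟ 0#) x≢0))
                             ([]-yes (0# ≟ 0#) ≡.refl))
                    (M.sym (∑-filter (λ x → ¬? (x ≟ 0#)) elements f)) ⟩
      f 0# M.∙ ∑ units f ∎
      where
      open import Relation.Binary.Reasoning.Setoid M.setoid
      split : ∀ x → f x M.≈ [ x ≟ 0# ] f x M.∙ [ ¬? (x ≟ 0#) ] f x
      split x with x ≟ 0#
      ... | yes _ = M.sym (M.identityʳ _)
      ... | no  _ = M.sym (M.identityˡ _)

    ∑-units-cong : ∀ {f g : Carrier → M.Carrier} → (∀ x → ¬ x ≡ 0# → f x M.≈ g x) →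
                   ∑ units f M.≈ ∑ units g
    ∑-units-cong {f} {g} f≈g = M.trans (∑-filter (λ x → ¬? (x ≟ 0#)) elements f)
      (M.trans (∑-cong elements pointwise) (M.sym (∑-filter (λ x → ¬? (x ≟ 0#)) elements g)))
      where
      pointwise : ∀ x → [ ¬? (x ≟ 0#) ] f x M.≈ [ ¬? (x ≟ 0#) ] g x
      pointwise x with x ≟ 0#
      ... | yes _  = M.refl
      ... | no x≢0 = f≈g x x≢0

    -- The maps are controlled only off zero, since the field inverse has no prescribed value there.
    -- Sending 0 to 0 extends them to mutually inverse maps of the whole field, where `∑-reindex`
    -- applies.
    ∑-units-reindex : ∀ (σ τ : Carrier → Carrier) → (∀ x → ¬ x ≡ 0# → ¬ σ x ≡ 0#) →
      (∀ x → ¬ x ≡ 0# → ¬ τ x ≡ 0#) → (∀ x → ¬ x ≡ 0# → σ (τ x) ≡ x) →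
      (∀ x → ¬ x ≡ 0# → τ (σ x) ≡ x) → ∀ (f : Carrier → M.Carrier) →
      ∑ units (f ∘ σ) M.≈ ∑ units f
    ∑-units-reindex σ τ σ≢0 τ≢0 στ τσ f = begin
      ∑ units (f ∘ σ)
        ≈⟨ ∑-units-cong (λ x x≢0 → M.reflexive (≡.cong f (≡.sym (extend-≢0 σ x x≢0)))) ⟩
      ∑ units (f ∘ extend σ)
        ≈⟨ ∑-filter (λ x → ¬? (x ≟ 0#)) elements (f ∘ extend σ) ⟩
      ∑ elements (λ x → [ ¬? (x ≟ 0#) ] f (extend σ x))
        ≈⟨ ∑-cong elements pointwise ⟩
      ∑ elements (λ x → [ ¬? (extend σ x ≟ 0#) ] f (extend σ x))
        ≈⟨ ∑-reindex _≟_ elements elements-enumerates (extend σ) (extend τ)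
             (extend-inverse σ τ τ≢0 στ) (extend-inverse τ σ σ≢0 τσ) (λ x → [ ¬? (x ≟ 0#) ] f x) ⟩
      ∑ elements (λ x → [ ¬? (x ≟ 0#) ] f x)
        ≈⟨ M.sym (∑-filter (λ x → ¬? (x ≟ 0#)) elements f) ⟩
      ∑ units f ∎
      where
      open import Relation.Binary.Reasoning.Setoid M.setoid
      extend : (Carrier → Carrier) → Carrier → Carrier
      extend σ x with x ≟ 0#
      ... | yes _ = 0#
      ... | no  _ = σ x
      extend-≢0 : ∀ σ x → ¬ x ≡ 0# → extend σ x ≡ σ x
      extend-≢0 σ x x≢0 with x ≟ 0#
      ... | yes x≡0 = contradiction x≡0 x≢0
      ... | no  _   = ≡.refl
      extend-0 : ∀ σ → extend σ 0# ≡ 0#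
      extend-0 σ with 0# ≟ 0#
      ... | yes _  = ≡.refl
      ... | no 0≢0 = contradiction ≡.refl 0≢0
      extend-inverse : ∀ σ τ → (∀ x → ¬ x ≡ 0# → ¬ τ x ≡ 0#) → (∀ x → ¬ x ≡ 0# → σ (τ x) ≡ x) →
                       ∀ x → extend σ (extend τ x) ≡ x
      extend-inverse σ τ τ≢0 στ x with x ≟ 0#
      ... | yes x≡0 = ≡.trans (extend-0 σ) (≡.sym x≡0)
      ... | no x≢0  = ≡.trans (extend-≢0 σ (τ x) (τ≢0 x x≢0)) (στ x x≢0)
      pointwise : ∀ x → [ ¬? (x ≟ 0#) ] f (extend σ x) M.≈ [ ¬? (extend σ x ≟ 0#) ] f (extend σ x)
      pointwise x with x ≟ 0#
      ... | yes _  = M.sym ([]-no (¬? (0# ≟ 0#)) (λ 0≢0 → 0≢0 ≡.refl))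
      ... | no x≢0 = M.sym ([]-yes (¬? (σ x ≟ 0#)) (σ≢0 x x≢0))

    ∑-const· : ∀ {A : Set} (xs : List A) c →
               ∑ xs (λ _ → c) M.≈ MonoidMult._×_ M.monoid (List.length xs) c
    ∑-const· []       c = M.refl
    ∑-const· (x ∷ xs) c = M.∙-congˡ (∑-const· xs c)

-- Finite fields: Fermat's theorem, bounds on roots, Frobenius.

module FieldTheory {q : ℕ} (F : FiniteField q) where

  open FiniteField F
  open FieldSum F
  open IntegerSolver commutativeRing
  open RingSum commutativeRing using (∑; ∑-+; 1^)
  open CommutativeRing commutativeRing
    using (+-identityˡ; +-identityʳ; *-identityˡ; *-identityʳ; +-comm; *-assoc; zeroˡ; zeroʳ; semiring; commutativeSemiring; +-commutativeMonoid; *-commutativeMonoid)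
  open ≡.≡-Reasoning

  *-≢0 : ∀ {x y} → ¬ x ≡ 0# → ¬ y ≡ 0# → ¬ x * y ≡ 0#
  *-≢0 x≢0 y≢0 xy≡0 = y≢0 (x*y≡0⇒y≡0 x≢0 xy≡0)

  ⁻¹-≢0 : ∀ {x} → ¬ x ≡ 0# → ¬ x ⁻¹ ≡ 0#
  ⁻¹-≢0 {x} x≢0 eq = 0≢1 (≡.trans (≡.sym (zeroʳ x)) (≡.trans (≡.cong (x *_) (≡.sym eq)) (*-inverse x x≢0)))

  -‿≢0 : ∀ {x} → ¬ x ≡ 0# → ¬ - x ≡ 0#
  -‿≢0 {x} x≢0 eq = x≢0 (≡.trans (≡.sym (+-identityˡ x))
    (≡.trans (≡.cong (_+ x) (≡.sym eq)) (CommutativeRing.-‿inverseˡ commutativeRing x)))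

  0^ : ∀ {n} → 0 ℕ.< n → 0# ^ n ≡ 0#
  0^ {suc n} _ = zeroˡ _

  ^-≢0 : ∀ {x} → ¬ x ≡ 0# → ∀ n → ¬ x ^ n ≡ 0#
  ^-≢0 x≢0 zero    = 0≢1 ∘ ≡.sym
  ^-≢0 x≢0 (suc n) = *-≢0 x≢0 (^-≢0 x≢0 n)

  ^≡0⇒≡0 : ∀ {x} n → x ^ n ≡ 0# → x ≡ 0#
  ^≡0⇒≡0 {x} n xⁿ≡0 with x ≟ 0#
  ... | yes x≡0 = x≡0
  ... | no x≢0  = contradiction xⁿ≡0 (^-≢0 x≢0 n)

  -- Translation by 1 permutes the field, so the sum of all elements equals itself plus q · 1.
  q·1≡0 : q · 1# ≡ 0#
  q·1≡0 = begin
    q · 1#                           ≡⟨ solve 2 (λ a s → a := (s :+ a) :- s) ≡.refl (q · 1#) (∑ elements id) ⟩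
    ∑ elements id + q · 1# + - ∑ elements id  ≡⟨ ≡.cong (_+ - ∑ elements id) (≡.trans (≡.sym shifted) (∑-shift +-commutativeMonoid 1# id)) ⟩
    ∑ elements id + - ∑ elements id  ≡⟨ CommutativeRing.-‿inverseʳ commutativeRing _ ⟩
    0#                               ∎
    where
    shifted : ∑ elements (_+ 1#) ≡ ∑ elements id + q · 1#
    shifted = ≡.trans (∑-+ elements id (λ _ → 1#)) (≡.cong (∑ elements id +_)
      (≡.trans (∑-const· +-commutativeMonoid elements 1#) (≡.cong (_· 1#) length-elements)))

  -- Multiplication by x permutes the units, so it fixes their product;
  -- replacing the zero factor by 1 lets the product run over the whole field.
  fermat : ∀ x → x ^ q ≡ x
  fermat x with x ≟ 0#
  ... | yes ≡.refl = 0^ (ℕ.≤-<-trans z≤n (Fin.toℕ<n (Inverse.to enumeration 0#)))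
  ... | no x≢0 = begin
    x ^ q                         ≡⟨ *-cancel (x ^ q) ⟩
    x ^ q * ∏ elements g * P⁻¹    ≡⟨ ≡.cong (_* P⁻¹) step ⟩
    x * ∏ elements g * P⁻¹        ≡⟨ ≡.sym (*-cancel x) ⟩
    x                             ∎
    where
    open ListSum *-commutativeMonoid
      using () renaming (∑ to ∏; ∑-+ to ∏-*; ∑-cong to ∏-cong)
    -- `g` is the identity with 0 replaced by 1. `c` carries the factor x that `g (x * y)` gains
    -- over `g y`, so it is 1 at 0; `c′` carries the one factor x left over there. This is why the
    -- exponent is q and not q - 1.
    g c c′ : Carrier → Carrier
    g y with y ≟ 0#
    ... | yes _ = 1#
    ... | no  _ = y
    c y with y ≟ 0#
    ... | yes _ = 1#
    ... | no  _ = x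
    c′ y with y ≟ 0#
    ... | yes _ = x
    ... | no  _ = 1#
    cc′ : ∀ y → c y * c′ y ≡ x
    cc′ y with y ≟ 0#
    ... | yes _ = *-identityˡ x
    ... | no  _ = *-identityʳ x
    cg : ∀ y → c y * g y ≡ g (x * y)
    cg y with y ≟ 0# | x * y ≟ 0#
    ... | yes _      | yes _   = *-identityˡ _
    ... | yes ≡.refl | no x0≢0 = contradiction (zeroʳ x) x0≢0
    ... | no y≢0     | yes xy≡0 = contradiction xy≡0 (*-≢0 x≢0 y≢0)
    ... | no _       | no _    = ≡.refl
    c′0 : c′ 0# ≡ x
    c′0 with 0# ≟ 0#
    ... | yes _  = ≡.refl
    ... | no 0≢0 = contradiction ≡.refl 0≢0
    c′-other : ∀ y → ¬ y ≡ 0# → c′ y ≡ 1#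
    c′-other y y≢0 with y ≟ 0#
    ... | yes y≡0 = contradiction y≡0 y≢0
    ... | no _    = ≡.refl
    g≢0 : ∀ y → ¬ g y ≡ 0#
    g≢0 y with y ≟ 0#
    ... | yes _  = 0≢1 ∘ ≡.sym
    ... | no y≢0 = y≢0
    ∏g≢0 : ∀ xs → ¬ ∏ xs g ≡ 0#
    ∏g≢0 []       = 0≢1 ∘ ≡.sym
    ∏g≢0 (y ∷ ys) = *-≢0 (g≢0 y) (∏g≢0 ys)
    P⁻¹ : Carrier
    P⁻¹ = (∏ elements g) ⁻¹
    *-cancel : ∀ y → y ≡ y * ∏ elements g * P⁻¹
    *-cancel y = ≡.sym (≡.trans (*-assoc y _ _)
      (≡.trans (≡.cong (y *_) (*-inverse _ (∏g≢0 elements))) (*-identityʳ y)))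
    xq : x ^ q ≡ ∏ elements c * x
    xq = begin
      x ^ q                          ≡⟨ ≡.cong (x ^_) (≡.sym length-elements) ⟩
      x ^ List.length elements       ≡⟨ ≡.sym (∑-const· *-commutativeMonoid elements x) ⟩
      ∏ elements (λ _ → x)           ≡⟨ ≡.sym (∏-cong elements cc′) ⟩
      ∏ elements (λ y → c y * c′ y)  ≡⟨ ∏-* elements c c′ ⟩
      ∏ elements c * ∏ elements c′   ≡⟨ ≡.cong (∏ elements c *_) (≡.trans
                                          (elements-enumerates *-commutativeMonoid 0# c′ c′-other) c′0) ⟩
      ∏ elements c * x               ∎
    step : x ^ q * ∏ elements g ≡ x * ∏ elements g
    step = begin
      x ^ q * ∏ elements g                ≡⟨ ≡.cong (_* ∏ elements g) xq ⟩
      ∏ elements c * x * ∏ elements g     ≡⟨ solve 3 (λ a b d → a :* b :* d := b :* (a :* d)) ≡.refl _ x _ ⟩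
      x * (∏ elements c * ∏ elements g)   ≡⟨ ≡.cong (x *_) (≡.sym (∏-* elements c g)) ⟩
      x * ∏ elements (λ y → c y * g y)    ≡⟨ ≡.cong (x *_) (∏-cong elements cg) ⟩
      x * ∏ elements (λ y → g (x * y))    ≡⟨ ≡.cong (x *_) (∑-scale *-commutativeMonoid x x≢0 g) ⟩
      x * ∏ elements g                    ∎

  -- The functions given by monic polynomials of degree d, and by polynomials
  -- of degree < d, in terms of divided differences.
  MonicFn SmallFn : ℕ → (Carrier → Carrier) → Set
  MonicFn zero    f = ∀ x → f x ≡ 1#
  MonicFn (suc d) f = ∀ a → ∃[ g ] MonicFn d g × (∀ x → f x ≡ f a + (x + - a) * g x)
  SmallFn zero    f = ∀ x → f x ≡ 0#
  SmallFn (suc d) f = ∀ a → ∃[ g ] SmallFn d g × (∀ x → f x ≡ f a + (x + - a) * g x)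

  -- A root a splits off: the divided difference at a is monic of degree one less and vanishes at
  -- every other root, because x - a is then invertible.
  root-bound : ∀ d {f} → MonicFn d f → ∀ {xs} → Unique xs → All (λ x → f x ≡ 0#) xs →
               List.length xs ℕ.≤ d
  root-bound d f-monic [] [] = z≤n
  root-bound zero f-monic (_ ∷ _) (fx≡0 ∷ _) = contradiction (≡.trans (≡.sym fx≡0) (f-monic _)) 0≢1
  root-bound (suc d) {f} f-monic {a ∷ xs} (a∉xs ∷ uniq) (fa≡0 ∷ fxs≡0) =
    s≤s (root-bound d g-monic uniq (All.zipWith g-root (a∉xs , fxs≡0)))
    where
    g = proj₁ (f-monic a)
    g-monic = proj₁ (proj₂ (f-monic a))
    g-root : ∀ {x} → (¬ a ≡ x) × f x ≡ 0# → g x ≡ 0#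
    g-root {x} (a≢x , fx≡0) = x*y≡0⇒y≡0 x-a≢0 (begin
      (x + - a) * g x        ≡⟨ ≡.sym (+-identityˡ _) ⟩
      0# + (x + - a) * g x   ≡⟨ ≡.cong (_+ (x + - a) * g x) (≡.sym fa≡0) ⟩
      f a + (x + - a) * g x  ≡⟨ ≡.sym (proj₂ (proj₂ (f-monic a)) x) ⟩
      f x                    ≡⟨ fx≡0 ⟩
      0#                     ∎)
      where
      x-a≢0 : ¬ x + - a ≡ 0#
      x-a≢0 eq = a≢x (≡.sym (begin
        x            ≡⟨ solve 2 (λ x a → x := (x :- a) :+ a) ≡.refl x a ⟩
        x + - a + a  ≡⟨ ≡.cong (_+ a) eq ⟩
        0# + a       ≡⟨ +-identityˡ a ⟩
        a            ∎))

  monic+small : ∀ d {f h} → MonicFn d f → SmallFn d h → MonicFn d (λ x → f x + h x)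
  monic+small zero f-monic h-small x =
    ≡.trans (≡.cong₂ _+_ (f-monic x) (h-small x)) (+-identityʳ 1#)
  monic+small (suc d) {f} {h} f-monic h-small a with f-monic a | h-small a
  ... | g , g-monic , f≡ | k , k-small , h≡ =
    (λ x → g x + k x) , monic+small d g-monic k-small , λ x → ≡.trans (≡.cong₂ _+_ (f≡ x) (h≡ x))
      (solve 5 (λ fa ha y g k → (fa :+ y :* g) :+ (ha :+ y :* k) := (fa :+ ha) :+ y :* (g :+ k))
        ≡.refl (f a) (h a) (x + - a) (g x) (k x))

  small+small : ∀ d {f h} → SmallFn d f → SmallFn d h → SmallFn d (λ x → f x + h x)
  small+small zero f-small h-small x =
    ≡.trans (≡.cong₂ _+_ (f-small x) (h-small x)) (+-identityʳ 0#)
  small+small (suc d) {f} {h} f-small h-small a with f-small a | h-small a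
  ... | g , g-small , f≡ | k , k-small , h≡ =
    (λ x → g x + k x) , small+small d g-small k-small , λ x → ≡.trans (≡.cong₂ _+_ (f≡ x) (h≡ x))
      (solve 5 (λ fa ha y g k → (fa :+ y :* g) :+ (ha :+ y :* k) := (fa :+ ha) :+ y :* (g :+ k))
        ≡.refl (f a) (h a) (x + - a) (g x) (k x))

  small-* : ∀ d c {f} → SmallFn d f → SmallFn d (λ x → c * f x)
  small-* zero    c f-small x = ≡.trans (≡.cong (c *_) (f-small x)) (zeroʳ c)
  small-* (suc d) c {f} f-small a with f-small a
  ... | g , g-small , f≡ = (λ x → c * g x) , small-* d c g-small , λ x → ≡.trans (≡.cong (c *_) (f≡ x))
    (solve 4 (λ c fa y g → c :* (fa :+ y :* g) := c :* fa :+ y :* (c :* g)) ≡.refl c (f a) (x + - a) (g x))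

  small-0 : ∀ d → SmallFn d (λ _ → 0#)
  small-0 zero    x = ≡.refl
  small-0 (suc d) a = (λ _ → 0#) , small-0 d , λ x → ≡.sym (≡.trans (+-identityˡ _) (zeroʳ _))

  small-suc : ∀ d {f} → SmallFn d f → SmallFn (suc d) f
  small-suc zero f≡0 a = (λ _ → 0#) , small-0 0 , λ x → ≡.trans (f≡0 x)
    (≡.sym (≡.trans (≡.cong₂ _+_ (f≡0 a) (zeroʳ _)) (+-identityˡ 0#)))
  small-suc (suc d) f-small a with f-small a
  ... | g , g-small , f≡ = g , small-suc d g-small , f≡

  monic⇒small : ∀ d {f} → MonicFn d f → SmallFn (suc d) f
  monic⇒small zero f≡1 a = (λ _ → 0#) , small-0 0 , λ x → ≡.trans (f≡1 x)
    (≡.sym (≡.trans (≡.cong₂ _+_ (f≡1 a) (zeroʳ _)) (+-identityʳ 1#)))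
  monic⇒small (suc d) f-monic a with f-monic a
  ... | g , g-monic , f≡ = g , monic⇒small d g-monic , f≡

  small-≤ : ∀ {d e f} → d ℕ.≤′ e → SmallFn d f → SmallFn e f
  small-≤ ℕ.≤′-refl       f-small = f-small
  small-≤ (ℕ.≤′-step d≤e) f-small = small-suc _ (small-≤ d≤e f-small)

  -- If g is the divided difference of f at a, then that of x f(x) is f + a g, again monic because a
  -- g has smaller degree.
  id*-monic : ∀ d {f} → MonicFn d f → MonicFn (suc d) (λ x → x * f x)
  id*-monic zero {f} f≡1 a = f , f≡1 , λ x → begin
    x * f x                     ≡⟨ ≡.cong (x *_) (f≡1 x) ⟩
    x * 1#                      ≡⟨ solve 2 (λ x a → x :* :1 := a :* :1 :+ (x :- a) :* :1) ≡.refl x a ⟩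
    a * 1# + (x + - a) * 1#     ≡⟨ ≡.cong₂ (λ u v → a * u + (x + - a) * v) (≡.sym (f≡1 a)) (≡.sym (f≡1 x)) ⟩
    a * f a + (x + - a) * f x   ∎
  id*-monic (suc d) {f} f-monic a with f-monic a
  ... | g , g-monic , f≡ = (λ x → f x + a * g x) ,
    monic+small (suc d) f-monic (small-* (suc d) a (monic⇒small d g-monic)) , λ x → begin
      x * f x
        ≡⟨ solve 3 (λ x a f → x :* f := a :* f :+ (x :- a) :* f) ≡.refl x a (f x) ⟩
      a * f x + (x + - a) * f x
        ≡⟨ ≡.cong (λ u → a * u + (x + - a) * f x) (f≡ x) ⟩
      a * (f a + (x + - a) * g x) + (x + - a) * f x
        ≡⟨ solve 5 (λ a fa y g fx → a :* (fa :+ y :* g) :+ y :* fx := a :* fa :+ y :* (fx :+ a :* g))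
             ≡.refl a (f a) (x + - a) (g x) (f x) ⟩
      a * f a + (x + - a) * (f x + a * g x) ∎

  ^-monic : ∀ d → MonicFn d (_^ d)
  ^-monic zero    x = ≡.refl
  ^-monic (suc d) = id*-monic d (^-monic d)

  module Characteristic {p : ℕ} (p-prime : Prime p) (p·1≡0 : p · 1# ≡ 0#) where

    open SemiringMult semiring using (×1-homo-*; ×-homo-+; ×-assoc-*)
    open SemiringExp semiring using (^-assocʳ)

    p∣⇒·1≡0 : ∀ m → p ∣ m → m · 1# ≡ 0#
    p∣⇒·1≡0 m (divides k ≡.refl) = ≡.trans (×1-homo-* k p)
      (≡.trans (≡.cong (k · 1# *_) p·1≡0) (zeroʳ _))

    -- The gcd of m and p is 1 or p. In the first case a Bézout relation maps to 0 = 1 in the field.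
    ·1≡0⇒p∣ : ∀ m → m · 1# ≡ 0# → p ∣ m
    ·1≡0⇒p∣ m m·1≡0 with prime⇒irreducible p-prime (gcd[m,n]∣n m p)
    ... | inj₂ gcd≡p = ≡.subst (_∣ m) gcd≡p (gcd[m,n]∣m m p)
    ... | inj₁ gcd≡1 = contradiction (absurd (Bézout.identity (gcd-GCD m p))) 0≢1
      where
      multiple≡0 : ∀ k n → n · 1# ≡ 0# → (k ℕ.* n) · 1# ≡ 0#
      multiple≡0 k n n·1≡0 = ≡.trans (×1-homo-* k n) (≡.trans (≡.cong (k · 1# *_) n·1≡0) (zeroʳ _))
      bezout≡ : ∀ k n → n · 1# ≡ 0# → (gcd m p ℕ.+ k ℕ.* n) · 1# ≡ 1#
      bezout≡ k n n·1≡0 = begin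
        (gcd m p ℕ.+ k ℕ.* n) · 1#        ≡⟨ ≡.cong (λ d → (d ℕ.+ k ℕ.* n) · 1#) gcd≡1 ⟩
        1# + (k ℕ.* n) · 1#               ≡⟨ ≡.cong (1# +_) (multiple≡0 k n n·1≡0) ⟩
        1# + 0#                           ≡⟨ +-identityʳ 1# ⟩
        1#                                ∎
      absurd : Bézout.Identity (gcd m p) m p → 0# ≡ 1#
      absurd (Bézout.+- x y eq) = ≡.trans (≡.sym (multiple≡0 x m m·1≡0))
        (≡.trans (≡.cong (_· 1#) (≡.sym eq)) (bezout≡ y p p·1≡0))
      absurd (Bézout.-+ x y eq) = ≡.trans (≡.sym (multiple≡0 y p p·1≡0))
        (≡.trans (≡.cong (_· 1#) (≡.sym eq)) (bezout≡ x m m·1≡0))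

    private
      1<p : 1 ℕ.< p
      1<p = ℕ.nonTrivial⇒n>1 p {{prime⇒nonTrivial p-prime}}

    -- In the binomial expansion all inner coefficients are multiples of p and vanish in
    -- characteristic p.
    frobenius-+ : ∀ x y → (x + y) ^ p ≡ x ^ p + y ^ p
    frobenius-+ x y = go p ≡.refl
      where
      -- The exponent is freed from p so that it can be matched as a successor; only then do both
      -- ends of the sum over `Fin` split off.
      go : ∀ n → p ≡ n → (x + y) ^ n ≡ x ^ n + y ^ n
      go zero p≡ = contradiction (≡.subst (1 ℕ.<_) p≡ 1<p) λ ()
      go (suc r) p≡ = begin
        (x + y) ^ suc r                              ≡⟨ Binomial.theorem commutativeSemiring (suc r) x y ⟩
        sum term                                     ≡⟨ sum-init-last term ⟩
        term Fin.zero + sum (λ i → term (Fin.suc (Fin.inject₁ i))) + term (Fin.fromℕ (suc r))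
          ≡⟨ ≡.cong₂ (λ u v → term Fin.zero + u + v)
               (≡.trans (sum-cong-≋ middle) (sum-replicate-zero r)) last-term ⟩
        term Fin.zero + 0# + x ^ suc r               ≡⟨ ≡.cong (λ u → u + 0# + x ^ suc r) first-term ⟩
        y ^ suc r + 0# + x ^ suc r                   ≡⟨ ≡.cong (_+ x ^ suc r) (+-identityʳ _) ⟩
        y ^ suc r + x ^ suc r                        ≡⟨ +-comm _ _ ⟩
        x ^ suc r + y ^ suc r                        ∎
        where
        open MonoidSum +-commutativeMonoid
        term : Fin (suc (suc r)) → Carrier
        term k = (suc r choose Fin.toℕ k) · (x ^ Fin.toℕ k * y ^ (suc r ∸ Fin.toℕ k))
        first-term : term Fin.zero ≡ y ^ suc r
        first-term = ≡.trans (+-identityʳ _) (*-identityˡ _)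
        last-term : term (Fin.fromℕ (suc r)) ≡ x ^ suc r
        last-term = begin
          term (Fin.fromℕ (suc r))
            ≡⟨ ≡.cong (λ k → (suc r choose k) · (x ^ k * y ^ (suc r ∸ k))) (Fin.toℕ-fromℕ (suc r)) ⟩
          (suc r choose suc r) · (x ^ suc r * y ^ (r ∸ r))
            ≡⟨ ≡.cong₂ (λ c e → c · (x ^ suc r * y ^ e)) (nCn≡1 (suc r)) (ℕ.n∸n≡0 r) ⟩
          x ^ suc r * 1# + 0#
            ≡⟨ ≡.trans (+-identityʳ _) (*-identityʳ _) ⟩
          x ^ suc r ∎
        middle : ∀ i → term (Fin.suc (Fin.inject₁ i)) ≡ 0#
        middle i = begin
          c · t           ≡⟨ ≡.cong (c ·_) (≡.sym (*-identityˡ t)) ⟩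
          c · (1# * t)    ≡⟨ ≡.sym (×-assoc-* c 1# t) ⟩
          c · 1# * t      ≡⟨ ≡.cong (_* t) (p∣⇒·1≡0 c p∣c) ⟩
          0# * t          ≡⟨ zeroˡ t ⟩
          0#              ∎
          where
          j = suc (Fin.toℕ (Fin.inject₁ i))
          c = suc r choose j
          t = x ^ j * y ^ (suc r ∸ j)
          j<p : j ℕ.< suc r
          j<p = s≤s (≡.subst (ℕ._< r) (≡.sym (Fin.toℕ-inject₁ i)) (Fin.toℕ<n i))
          p∣c : p ∣ c
          p∣c = ≡.subst (λ n → p ∣ n choose j) p≡ (prime∣C p-prime j (s≤s z≤n) (≡.subst (j ℕ.<_) (≡.sym p≡) j<p))

    frobenius^-+ : ∀ j x y → (x + y) ^ (p ℕ.^ j) ≡ x ^ (p ℕ.^ j) + y ^ (p ℕ.^ j)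
    frobenius^-+ zero x y = solve 2 (λ x y → (x :+ y) :* :1 := x :* :1 :+ y :* :1) ≡.refl x y
    frobenius^-+ (suc j) x y = begin
      (x + y) ^ (p ℕ.* p ℕ.^ j)                     ≡⟨ ≡.sym (^-assocʳ (x + y) p _) ⟩
      ((x + y) ^ p) ^ (p ℕ.^ j)                     ≡⟨ ≡.cong (_^ (p ℕ.^ j)) (frobenius-+ x y) ⟩
      (x ^ p + y ^ p) ^ (p ℕ.^ j)                   ≡⟨ frobenius^-+ j (x ^ p) (y ^ p) ⟩
      (x ^ p) ^ (p ℕ.^ j) + (y ^ p) ^ (p ℕ.^ j)     ≡⟨ ≡.cong₂ _+_ (^-assocʳ x p _) (^-assocʳ y p _) ⟩
      x ^ (p ℕ.* p ℕ.^ j) + y ^ (p ℕ.* p ℕ.^ j)     ∎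

    frobenius-∑ : ∀ {A : Set} (xs : List A) f → ∑ xs f ^ p ≡ ∑ xs (λ x → f x ^ p)
    frobenius-∑ []       f = 0^ (ℕ.<-trans (s≤s z≤n) 1<p)
    frobenius-∑ (x ∷ xs) f = ≡.trans (frobenius-+ (f x) _) (≡.cong (f x ^ p +_) (frobenius-∑ xs f))

    prime-subfield-unique : Unique (List.applyUpTo (_· 1#) p)
    prime-subfield-unique = Unique.applyUpTo⁺₁ (_· 1#) p distinct
      where
      distinct : ∀ {i j} → i ℕ.< j → j ℕ.< p → ¬ i · 1# ≡ j · 1#
      distinct {i} {j} i<j j<p eq = ℕ.<⇒≱ (ℕ.≤-<-trans (ℕ.m∸n≤m j i) j<p)
        (ℕ∣.∣⇒≤ {{ℕ.>-nonZero (ℕ.m<n⇒0<n∸m i<j)}} (·1≡0⇒p∣ (j ∸ i) (begin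
          (j ∸ i) · 1#
            ≡⟨ solve 2 (λ a b → a := (b :+ a) :- b) ≡.refl ((j ∸ i) · 1#) (i · 1#) ⟩
          i · 1# + (j ∸ i) · 1# + - (i · 1#)
            ≡⟨ ≡.cong (_+ - (i · 1#)) (≡.sym (×-homo-+ 1# i (j ∸ i))) ⟩
          (i ℕ.+ (j ∸ i)) · 1# + - (i · 1#)
            ≡⟨ ≡.cong (λ k → k · 1# + - (i · 1#)) (ℕ.m+[n∸m]≡n (ℕ.<⇒≤ i<j)) ⟩
          j · 1# + - (i · 1#)
            ≡⟨ ≡.cong (λ u → u + - (i · 1#)) (≡.sym eq) ⟩
          i · 1# + - (i · 1#)
            ≡⟨ CommutativeRing.-‿inverseʳ commutativeRing _ ⟩
          0# ∎)))

    ·1-frobenius : ∀ k → (k · 1#) ^ p ≡ k · 1#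
    ·1-frobenius zero = 0^ (ℕ.<-trans (s≤s z≤n) 1<p)
    ·1-frobenius (suc k) = ≡.trans (frobenius-+ 1# (k · 1#)) (≡.cong₂ _+_ (1^ p) (·1-frobenius k))

    -- x^p - x has at most p roots, and the prime field already provides p.
    frobenius-fixed : ∀ x → x ^ p ≡ x → ¬ All (λ k → ¬ k · 1# ≡ x) (List.upTo p)
    frobenius-fixed x x^p≡x all≢ =
      ℕ.<⇒≱ (ℕ.n<1+n p) (≡.subst (ℕ._≤ p) length≡ (root-bound p x^p-x-monic unique roots))
      where
      xs = x ∷ List.applyUpTo (_· 1#) p
      length≡ : List.length xs ≡ suc p
      length≡ = ≡.cong suc (List.length-applyUpTo (_· 1#) p)
      -x-small : SmallFn 2 (λ x → - 1# * (x ^ 1))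
      -x-small = small-* 2 (- 1#) (monic⇒small 1 (^-monic 1))
      x^p-x-monic : MonicFn p (λ x → x ^ p + - 1# * (x ^ 1))
      x^p-x-monic = monic+small p (^-monic p) (small-≤ (ℕ.≤⇒≤′ 1<p) -x-small)
      root : ∀ y → y ^ p ≡ y → y ^ p + - 1# * (y ^ 1) ≡ 0#
      root y y^p≡y = ≡.trans (≡.cong (_+ - 1# * (y ^ 1)) y^p≡y)
        (solve 1 (λ y → y :+ :- :1 :* (y :* :1) := :0) ≡.refl y)
      unique : Unique xs
      unique = All.applyUpTo⁺₁ (_· 1#) p (λ {i} i<p x≡ → All.applyUpTo⁻ id p all≢ i<p (≡.sym x≡))
        ∷ prime-subfield-unique
      roots : All (λ y → y ^ p + - 1# * (y ^ 1) ≡ 0#) xs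
      roots = root x x^p≡x ∷ All.applyUpTo⁺₂ (_· 1#) p (λ k → root (k · 1#) (·1-frobenius k))

-- The hypothesis is a negated `All` because `frobenius-fixed` shows by contradiction that some
-- multiple of 1 must be hit; running through the finite list turns this into a witness.
head-filter : ∀ {A : Set} {P : Pred A 0ℓ} (P? : Decidable P) d xs → ¬ All (λ x → ¬ P x) xs →
              P (fromMaybe d (List.head (List.filter P? xs)))
head-filter P? d []       none = contradiction [] none
head-filter P? d (x ∷ xs) none with P? x
... | yes px = px
... | no ¬px = head-filter P? d xs (λ all → none (¬px ∷ all))

-- The trace, and the character attached to a p-th root of unity.

module TraceTheory (R : RealField) (exp : Complex.ℂ R → Complex.ℂ R) (π : RealField.ℝ R)
  (p η : ℕ) (p-prime : Prime p) (1≤η : 1 ℕ.≤ η) (F : FiniteField (p ℕ.^ η)) where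

  open Estermann R exp π p η F using (Tr; residue)
  open FiniteField F
  open FieldSum F
  open FieldTheory F
  open RingSum commutativeRing using (∑; ∑-+; ∑-cong; ∑-upTo-suc; ∑-upTo-snoc; ∑-*ˡ; ∑-map; 1^)
  open CommutativeRing commutativeRing
    using (+-identityˡ; +-identityʳ; *-identityʳ; +-comm; *-comm; semiring; commutativeSemiring)
  open SemiringMult semiring using (×1-homo-*; ×-homo-+)
  open SemiringExp semiring using (^-homo-*; ^-assocʳ)
  open CommSemiringExp commutativeSemiring using (^-distrib-*)
  open ≡.≡-Reasoning

  p^·1≡[p·1]^ : ∀ j → (p ℕ.^ j) · 1# ≡ (p · 1#) ^ j
  p^·1≡[p·1]^ zero    = +-identityʳ 1#
  p^·1≡[p·1]^ (suc j) = ≡.trans (×1-homo-* p (p ℕ.^ j)) (≡.cong (p · 1# *_) (p^·1≡[p·1]^ j))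

  -- The field is only known to have p^η elements. Hence (p · 1)^η = 0, and a field has no nilpotent
  -- elements.
  p·1≡0 : p · 1# ≡ 0#
  p·1≡0 = ^≡0⇒≡0 η (≡.trans (≡.sym (p^·1≡[p·1]^ η)) q·1≡0)

  open Characteristic p-prime p·1≡0

  trace : Carrier → Carrier
  trace y = ∑ (List.upTo η) (λ j → y ^ (p ℕ.^ j))

  Tr≡trace : ∀ y → Tr y ≡ trace y
  Tr≡trace y = ∑-map (λ j → y ^ (p ℕ.^ j)) (List.upTo η) id

  trace-+ : ∀ x y → trace (x + y) ≡ trace x + trace y
  trace-+ x y = ≡.trans (∑-cong (List.upTo η) (λ j → frobenius^-+ j x y))
    (∑-+ (List.upTo η) (λ j → x ^ (p ℕ.^ j)) (λ j → y ^ (p ℕ.^ j)))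

  -- Raising to the power p moves each conjugate to the next one; the last becomes y^q = y, which
  -- replaces the first. This places the trace in the prime field.
  trace-frobenius : ∀ y → trace y ^ p ≡ trace y
  trace-frobenius y = begin
    trace y ^ p                                       ≡⟨ frobenius-∑ (List.upTo η) _ ⟩
    ∑ (List.upTo η) (λ j → (y ^ (p ℕ.^ j)) ^ p)       ≡⟨ ∑-cong (List.upTo η) (λ j →
                                                           ≡.trans (^-assocʳ y (p ℕ.^ j) p)
                                                                   (≡.cong (y ^_) (ℕ.*-comm (p ℕ.^ j) p))) ⟩
    s                                                 ≡⟨ solve 2 (λ s y → s := (y :+ s) :- y) ≡.refl s y ⟩
    y + s + - y                                       ≡⟨ ≡.cong (λ u → u + s + - y) (≡.sym (*-identityʳ y)) ⟩
    y ^ 1 + s + - y                                   ≡⟨ ≡.cong (_+ - y) (≡.sym (∑-upTo-suc η _)) ⟩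
    ∑ (List.upTo (suc η)) (λ j → y ^ (p ℕ.^ j)) + - y ≡⟨ ≡.cong (_+ - y) (∑-upTo-snoc η _) ⟩
    trace y + y ^ (p ℕ.^ η) + - y                     ≡⟨ ≡.cong (λ u → trace y + u + - y) (fermat y) ⟩
    trace y + y + - y                                 ≡⟨ solve 2 (λ t y → (t :+ y) :- y := t) ≡.refl (trace y) y ⟩
    trace y                                           ∎
    where
    open IntegerSolver commutativeRing
    s = ∑ (List.upTo η) (λ j → y ^ (p ℕ.^ suc j))

  private
    1<p : 1 ℕ.< p
    1<p = ℕ.nonTrivial⇒n>1 p {{prime⇒nonTrivial p-prime}}

  -- The trace is given by a polynomial of degree p^(η-1) < |F|.
  trace-nonzero : ∃[ x ] ¬ trace x ≡ 0#
  trace-nonzero with All.all? (λ x → trace x ≟ 0#) elements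
  ... | no ¬all = Any.satisfied (All.¬All⇒Any¬ (λ x → trace x ≟ 0#) elements ¬all)
  ... | yes all = contradiction
    (root-bound (p ℕ.^ m) trace-monic elements-unique (All.map (λ {x} → ≡.trans (≡.sym (trace≡ x))) all′))
    (ℕ.<⇒≱ (≡.subst (p ℕ.^ m ℕ.<_) (≡.sym length≡) (ℕ.^-monoʳ-< p 1<p (ℕ.n<1+n m))))
    where
    m = ℕ.pred η
    η≡ : η ≡ suc m
    η≡ = ≡.sym (ℕ.suc-pred η {{ℕ.>-nonZero 1≤η}})
    length≡ : List.length elements ≡ p ℕ.^ suc m
    length≡ = ≡.trans length-elements (≡.cong (p ℕ.^_) η≡)
    all′ : All (λ x → ∑ (List.upTo (suc m)) (λ j → x ^ (p ℕ.^ j)) ≡ 0#) elements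
    all′ = All.map (λ {x} → ≡.trans (≡.cong (λ n → ∑ (List.upTo n) (λ j → x ^ (p ℕ.^ j))) (≡.sym η≡))) all
    lower : ℕ → Carrier → Carrier
    lower zero    x = 0#
    lower (suc k) x = lower k x + x ^ (p ℕ.^ k)
    lower≡ : ∀ k x → ∑ (List.upTo k) (λ j → x ^ (p ℕ.^ j)) ≡ lower k x
    lower≡ zero    x = ≡.refl
    lower≡ (suc k) x = ≡.trans (∑-upTo-snoc k _) (≡.cong (_+ x ^ (p ℕ.^ k)) (lower≡ k x))
    lower-small : ∀ k → k ℕ.≤ m → SmallFn (p ℕ.^ m) (lower k)
    lower-small zero    _   = small-0 (p ℕ.^ m)
    lower-small (suc k) k<m = small+small (p ℕ.^ m) (lower-small k (ℕ.<⇒≤ k<m))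
      (small-≤ (ℕ.≤⇒≤′ (ℕ.^-monoʳ-< p 1<p k<m)) (monic⇒small _ (^-monic (p ℕ.^ k))))
    trace-monic : MonicFn (p ℕ.^ m) (λ x → x ^ (p ℕ.^ m) + lower m x)
    trace-monic = monic+small (p ℕ.^ m) (^-monic (p ℕ.^ m)) (lower-small m ℕ.≤-refl)
    trace≡ : ∀ x → ∑ (List.upTo (suc m)) (λ j → x ^ (p ℕ.^ j)) ≡ x ^ (p ℕ.^ m) + lower m x
    trace≡ x = ≡.trans (lower≡ (suc m) x) (+-comm _ _)

  trace-scale : ∀ c y → c ^ p ≡ c → trace (c * y) ≡ c * trace y
  trace-scale c y c^p≡c = ≡.trans
    (∑-cong (List.upTo η) (λ j → ≡.trans (^-distrib-* c y (p ℕ.^ j)) (≡.cong (_* y ^ (p ℕ.^ j)) (c^p^ j))))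
    (∑-*ˡ (List.upTo η) c (λ j → y ^ (p ℕ.^ j)))
    where
    c^p^ : ∀ j → c ^ (p ℕ.^ j) ≡ c
    c^p^ zero    = *-identityʳ c
    c^p^ (suc j) = ≡.trans (≡.sym (^-assocʳ c p _)) (≡.trans (≡.cong (_^ (p ℕ.^ j)) c^p≡c) (c^p^ j))

  ⁻¹-frobenius : ∀ c → ¬ c ≡ 0# → c ^ p ≡ c → (c ⁻¹) ^ p ≡ c ⁻¹
  ⁻¹-frobenius c c≢0 c^p≡c = begin
    (c ⁻¹) ^ p                ≡⟨ ≡.sym (⁻¹-cancelˡ c _ c≢0) ⟩
    c * (c ⁻¹ * (c ⁻¹) ^ p)   ≡⟨ ≡.cong (_* (c ⁻¹ * (c ⁻¹) ^ p)) (≡.sym c^p≡c) ⟩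
    c ^ p * (c ⁻¹ * (c ⁻¹) ^ p)
      ≡⟨ solve 3 (λ a b d → a :* (b :* d) := b :* (a :* d)) ≡.refl (c ^ p) (c ⁻¹) _ ⟩
    c ⁻¹ * (c ^ p * (c ⁻¹) ^ p)   ≡⟨ ≡.cong (c ⁻¹ *_) (≡.sym (^-distrib-* c (c ⁻¹) p)) ⟩
    c ⁻¹ * (c * c ⁻¹) ^ p     ≡⟨ ≡.cong (λ u → c ⁻¹ * u ^ p) (*-inverse c c≢0) ⟩
    c ⁻¹ * 1# ^ p             ≡⟨ ≡.cong (c ⁻¹ *_) (1^ p) ⟩
    c ⁻¹ * 1#                 ≡⟨ *-identityʳ _ ⟩
    c ⁻¹                      ∎
    where open IntegerSolver commutativeRing

  -- A nonzero trace t lies in the prime field, so the scalar 1 / t can be moved inside the trace.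
  trace-one : ∃[ x ] trace x ≡ 1#
  trace-one with trace-nonzero
  ... | x , t≢0 = trace x ⁻¹ * x ,
    ≡.trans (trace-scale (trace x ⁻¹) x (⁻¹-frobenius (trace x) t≢0 (trace-frobenius x))) (⁻¹-inverseˡ _ t≢0)

  residue-spec : ∀ x → x ^ p ≡ x → residue x · 1# ≡ x
  residue-spec x x^p≡x = head-filter (λ k → k · 1# ≟ x) 0 (List.upTo p) (frobenius-fixed x x^p≡x)

  module RootOfUnity (K : CommutativeRing 0ℓ 0ℓ) (ζ : CommutativeRing.Carrier K) where

    private
      module K = CommutativeRing K
      module KExp = SemiringExp K.semiring
    open KExp using () renaming (_^_ to _^ᴷ_)
    open RingSum K using () renaming (1^ to 1^ᴷ)

    module _ (ζ^p≈1 : ζ ^ᴷ p K.≈ K.1#) where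

      ζ^-periodic-≤ : ∀ {m n} → m ℕ.≤ n → m · 1# ≡ n · 1# → ζ ^ᴷ m K.≈ ζ ^ᴷ n
      ζ^-periodic-≤ {m} {n} m≤n eq with ·1≡0⇒p∣ (n ∸ m) n∸m·1≡0
        where
        open IntegerSolver commutativeRing
        n∸m·1≡0 : (n ∸ m) · 1# ≡ 0#
        n∸m·1≡0 = begin
          (n ∸ m) · 1#
            ≡⟨ solve 2 (λ a b → a := (b :+ a) :- b) ≡.refl ((n ∸ m) · 1#) (m · 1#) ⟩
          m · 1# + (n ∸ m) · 1# + - (m · 1#)
            ≡⟨ ≡.cong (_+ - (m · 1#)) (≡.sym (×-homo-+ 1# m (n ∸ m))) ⟩
          (m ℕ.+ (n ∸ m)) · 1# + - (m · 1#)
            ≡⟨ ≡.cong (λ k → k · 1# + - (m · 1#)) (ℕ.m+[n∸m]≡n m≤n) ⟩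
          n · 1# + - (m · 1#)
            ≡⟨ ≡.cong (λ u → u + - (m · 1#)) (≡.sym eq) ⟩
          m · 1# + - (m · 1#)
            ≡⟨ CommutativeRing.-‿inverseʳ commutativeRing _ ⟩
          0# ∎
      ... | divides k n∸m≡k*p = K.sym
        (K.trans (K.reflexive (≡.cong (ζ ^ᴷ_) (≡.trans (≡.sym (ℕ.m+[n∸m]≡n m≤n))
                   (≡.cong (m ℕ.+_) (≡.trans n∸m≡k*p (ℕ.*-comm k p))))))
        (K.trans (KExp.^-homo-* ζ m (p ℕ.* k))
        (K.trans (K.*-congˡ (K.trans (K.sym (KExp.^-assocʳ ζ p k)) (K.trans (KExp.^-congˡ k ζ^p≈1) (1^ᴷ k))))
                 (K.*-identityʳ _))))

      ζ^-periodic : ∀ m n → m · 1# ≡ n · 1# → ζ ^ᴷ m K.≈ ζ ^ᴷ n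
      ζ^-periodic m n eq with ℕ.≤-total m n
      ... | inj₁ m≤n = ζ^-periodic-≤ m≤n eq
      ... | inj₂ n≤m = K.sym (ζ^-periodic-≤ n≤m (≡.sym eq))

      χ : Carrier → K.Carrier
      χ y = ζ ^ᴷ residue (Tr y)

      -- A power of ζ depends on its exponent only modulo p, that is, only on the image of the
      -- exponent in the field; there additivity is that of the trace.
      χ-+ : ∀ x y → χ (x + y) K.≈ χ x K.* χ y
      χ-+ x y = K.trans (ζ^-periodic (residue (Tr (x + y))) (residue (Tr x) ℕ.+ residue (Tr y)) eq)
        (KExp.^-homo-* ζ (residue (Tr x)) (residue (Tr y)))
        where
        spec : ∀ y → residue (Tr y) · 1# ≡ trace y
        spec y = ≡.trans (≡.cong (λ t → residue t · 1#) (Tr≡trace y)) (residue-spec _ (trace-frobenius y))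
        eq : residue (Tr (x + y)) · 1# ≡ (residue (Tr x) ℕ.+ residue (Tr y)) · 1#
        eq = begin
          residue (Tr (x + y)) · 1#                      ≡⟨ spec (x + y) ⟩
          trace (x + y)                                  ≡⟨ trace-+ x y ⟩
          trace x + trace y                              ≡⟨ ≡.sym (≡.cong₂ _+_ (spec x) (spec y)) ⟩
          residue (Tr x) · 1# + residue (Tr y) · 1#      ≡⟨ ≡.sym (×-homo-+ 1# (residue (Tr x)) (residue (Tr y))) ⟩
          (residue (Tr x) ℕ.+ residue (Tr y)) · 1#       ∎

      χ-0 : χ 0# K.≈ K.1#
      χ-0 = ζ^-periodic (residue (Tr 0#)) 0 (begin
        residue (Tr 0#) · 1#               ≡⟨ ≡.cong (λ t → residue t · 1#) (Tr≡trace 0#) ⟩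
        residue (trace 0#) · 1#            ≡⟨ residue-spec _ (trace-frobenius 0#) ⟩
        trace 0#                           ≡⟨ solve 1 (λ t → t := (t :+ t) :- t) ≡.refl (trace 0#) ⟩
        trace 0# + trace 0# + - trace 0#   ≡⟨ ≡.cong (_+ - trace 0#) (≡.sym (trace-+ 0# 0#)) ⟩
        trace (0# + 0#) + - trace 0#       ≡⟨ ≡.cong (λ x → trace x + - trace 0#) (+-identityˡ 0#) ⟩
        trace 0# + - trace 0#              ≡⟨ CommutativeRing.-‿inverseʳ commutativeRing _ ⟩
        0#                                 ∎)
        where open IntegerSolver commutativeRing

      -- Source of nontriviality: an element of trace 1 has residue 1 modulo p.
      χ-hits-ζ : ∃[ τ ] χ τ K.≈ ζ
      χ-hits-ζ = τ , K.trans (ζ^-periodic (residue (Tr τ)) 1 eq) (K.*-identityʳ ζ)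
        where
        τ = proj₁ trace-one
        1^p≡1 : 1# ^ p ≡ 1#
        1^p≡1 = ≡.subst (λ x → x ^ p ≡ x) (+-identityʳ 1#) (·1-frobenius 1)
        eq : residue (Tr τ) · 1# ≡ 1 · 1#
        eq = begin
          residue (Tr τ) · 1#     ≡⟨ ≡.cong (λ t → residue t · 1#) (≡.trans (Tr≡trace τ) (proj₂ trace-one)) ⟩
          residue 1# · 1#         ≡⟨ residue-spec 1# 1^p≡1 ⟩
          1#                      ≡⟨ ≡.sym (+-identityʳ 1#) ⟩
          1 · 1#                  ∎

-- The polynomial ring, monic polynomials, division with remainder.

module PolynomialRing {q : ℕ} (F : FiniteField q) where

  open Polynomials F
  open FiniteField F using () renaming (Carrier to 𝔽; commutativeRing to 𝔽-ring)
  open CommutativeRing 𝔽-ring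
    using (_+_; _*_; -_; 0#; 1#; +-identityˡ; +-identityʳ; *-identityˡ; *-identityʳ; +-assoc; +-comm; *-assoc; *-comm; zeroʳ; -‿inverseʳ)
  open Convolution 𝔽-ring
  open ≡.≡-Reasoning

  infix 4 _≋_
  -- Coefficientwise equality boxed in a record: the type then still determines both polynomials,
  -- whereas `_≈ₚ_` unfolds to a statement about their coefficients.
  record _≋_ (f g : Poly) : Set where
    constructor coeffs≡
    field at : ∀ k → coeff f k ≡ coeff g k
  open _≋_ public

  infix 8 -ₚ_
  -ₚ_ : Poly → Poly
  -ₚ_ = List.map -_

  coeff-+ : ∀ f g k → coeff (f +ₚ g) k ≡ coeff f k + coeff g k
  coeff-+ []      g       k       = ≡.sym (+-identityˡ _)
  coeff-+ (a ∷ f) []      k       = ≡.sym (+-identityʳ _)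
  coeff-+ (a ∷ f) (b ∷ g) zero    = ≡.refl
  coeff-+ (a ∷ f) (b ∷ g) (suc k) = coeff-+ f g k

  coeff-∙ : ∀ a f k → coeff (a ∙ₚ f) k ≡ a * coeff f k
  coeff-∙ a []      k       = ≡.sym (zeroʳ a)
  coeff-∙ a (b ∷ f) zero    = ≡.refl
  coeff-∙ a (b ∷ f) (suc k) = coeff-∙ a f k

  coeff-neg : ∀ f k → coeff (-ₚ f) k ≡ - coeff f k
  coeff-neg []      k       = ≡.trans (≡.sym (-‿inverseʳ 0#)) (+-identityˡ _)
  coeff-neg (b ∷ f) zero    = ≡.refl
  coeff-neg (b ∷ f) (suc k) = coeff-neg f k

  coeff-* : ∀ f g k → coeff (f *ₚ g) k ≡ conv (coeff f) (coeff g) k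
  coeff-* []      g k       = ≡.sym (conv-zeroˡ (coeff g) k)
  coeff-* (a ∷ f) g zero    = ≡.trans (coeff-+ (a ∙ₚ g) _ 0)
    (≡.trans (+-identityʳ _) (coeff-∙ a g 0))
  coeff-* (a ∷ f) g (suc k) = ≡.trans (coeff-+ (a ∙ₚ g) _ (suc k))
    (≡.cong₂ _+_ (coeff-∙ a g (suc k)) (coeff-* f g k))

  ∷-cong : ∀ {a b f g} → a ≡ b → f ≋ g → a ∷ f ≋ b ∷ g
  ∷-cong a≡b f≋g .at zero    = a≡b
  ∷-cong a≡b f≋g .at (suc k) = f≋g .at k

  *ₚ-identityˡ : ∀ f → 1ₚ *ₚ f ≋ f
  *ₚ-identityˡ f .at zero    = ≡.trans (coeff-* 1ₚ f 0) (*-identityˡ _)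
  *ₚ-identityˡ f .at (suc k) = ≡.trans (coeff-* 1ₚ f (suc k))
    (≡.trans (≡.cong₂ _+_ (*-identityˡ _) (conv-zeroˡ (coeff f) k)) (+-identityʳ _))

  *ₚ-comm : ∀ f g → f *ₚ g ≋ g *ₚ f
  *ₚ-comm f g .at k = ≡.trans (coeff-* f g k)
    (≡.trans (conv-comm (coeff f) (coeff g) k) (≡.sym (coeff-* g f k)))

  *ₚ-assoc : ∀ f g h → (f *ₚ g) *ₚ h ≋ f *ₚ (g *ₚ h)
  *ₚ-assoc f g h .at k = begin
    coeff (f *ₚ g *ₚ h) k                            ≡⟨ coeff-* (f *ₚ g) h k ⟩
    conv (coeff (f *ₚ g)) (coeff h) k                ≡⟨ conv-cong (coeff-* f g) (λ _ → ≡.refl) k ⟩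
    conv (conv (coeff f) (coeff g)) (coeff h) k      ≡⟨ conv-assoc (coeff f) (coeff g) (coeff h) k ⟩
    conv (coeff f) (conv (coeff g) (coeff h)) k      ≡⟨ conv-cong (λ _ → ≡.refl) (≡.sym ∘ coeff-* g h) k ⟩
    conv (coeff f) (coeff (g *ₚ h)) k                ≡⟨ ≡.sym (coeff-* f (g *ₚ h) k) ⟩
    coeff (f *ₚ (g *ₚ h)) k                          ∎

  *ₚ-distribʳ : ∀ f g h → (g +ₚ h) *ₚ f ≋ g *ₚ f +ₚ h *ₚ f
  *ₚ-distribʳ f g h .at k = begin
    coeff ((g +ₚ h) *ₚ f) k                              ≡⟨ coeff-* (g +ₚ h) f k ⟩
    conv (coeff (g +ₚ h)) (coeff f) k                    ≡⟨ conv-cong (coeff-+ g h) (λ _ → ≡.refl) k ⟩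
    conv (λ j → coeff g j + coeff h j) (coeff f) k       ≡⟨ conv-+ˡ (coeff g) (coeff h) (coeff f) k ⟩
    conv (coeff g) (coeff f) k + conv (coeff h) (coeff f) k
      ≡⟨ ≡.cong₂ _+_ (≡.sym (coeff-* g f k)) (≡.sym (coeff-* h f k)) ⟩
    coeff (g *ₚ f) k + coeff (h *ₚ f) k                  ≡⟨ ≡.sym (coeff-+ (g *ₚ f) (h *ₚ f) k) ⟩
    coeff (g *ₚ f +ₚ h *ₚ f) k                           ∎

  private
    ≋-trans : ∀ {f g h} → f ≋ g → g ≋ h → f ≋ h
    ≋-trans f≋g g≋h .at k = ≡.trans (f≋g .at k) (g≋h .at k)

    +ₚ-cong : ∀ {f f′ g g′} → f ≋ f′ → g ≋ g′ → f +ₚ g ≋ f′ +ₚ g′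
    +ₚ-cong {f} {f′} {g} {g′} f≋ g≋ .at k = ≡.trans (coeff-+ f g k)
      (≡.trans (≡.cong₂ _+_ (f≋ .at k) (g≋ .at k)) (≡.sym (coeff-+ f′ g′ k)))

    +ₚ-assoc : ∀ f g h → (f +ₚ g) +ₚ h ≋ f +ₚ (g +ₚ h)
    +ₚ-assoc f g h .at k = begin
      coeff (f +ₚ g +ₚ h) k                 ≡⟨ coeff-+ (f +ₚ g) h k ⟩
      coeff (f +ₚ g) k + coeff h k          ≡⟨ ≡.cong (_+ coeff h k) (coeff-+ f g k) ⟩
      coeff f k + coeff g k + coeff h k     ≡⟨ +-assoc _ _ _ ⟩
      coeff f k + (coeff g k + coeff h k)   ≡⟨ ≡.cong (coeff f k +_) (≡.sym (coeff-+ g h k)) ⟩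
      coeff f k + coeff (g +ₚ h) k          ≡⟨ ≡.sym (coeff-+ f (g +ₚ h) k) ⟩
      coeff (f +ₚ (g +ₚ h)) k               ∎

    +ₚ-comm : ∀ f g → f +ₚ g ≋ g +ₚ f
    +ₚ-comm f g .at k = ≡.trans (coeff-+ f g k) (≡.trans (+-comm _ _) (≡.sym (coeff-+ g f k)))

    +ₚ-inverseʳ : ∀ f → f +ₚ -ₚ f ≋ []
    +ₚ-inverseʳ f .at k = ≡.trans (coeff-+ f (-ₚ f) k)
      (≡.trans (≡.cong (coeff f k +_) (coeff-neg f k)) (-‿inverseʳ _))

    -ₚ-cong : ∀ {f g} → f ≋ g → -ₚ f ≋ -ₚ g
    -ₚ-cong {f} {g} f≋g .at k = ≡.trans (coeff-neg f k)
      (≡.trans (≡.cong -_ (f≋g .at k)) (≡.sym (coeff-neg g k)))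

    *ₚ-cong : ∀ {f f′ g g′} → f ≋ f′ → g ≋ g′ → f *ₚ g ≋ f′ *ₚ g′
    *ₚ-cong {f} {f′} {g} {g′} f≋ g≋ .at k = ≡.trans (coeff-* f g k)
      (≡.trans (conv-cong (f≋ .at) (g≋ .at) k) (≡.sym (coeff-* f′ g′ k)))

  polyRing : CommutativeRing 0ℓ 0ℓ
  polyRing = record
    { Carrier = Poly ; _≈_ = _≋_ ; _+_ = _+ₚ_ ; _*_ = _*ₚ_ ; -_ = -ₚ_ ; 0# = [] ; 1# = 1ₚ
    ; isCommutativeRing = record
      { isRing = record
        { +-isAbelianGroup = record
          { isGroup = record
            { isMonoid = record
              { isSemigroup = record
                { isMagma = record
                  { isEquivalence = record
                    { refl  = coeffs≡ λ _ → ≡.refl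
                    ; sym   = λ f≋g → coeffs≡ λ k → ≡.sym (f≋g .at k)
                    ; trans = ≋-trans }
                  ; ∙-cong = +ₚ-cong }
                ; assoc = +ₚ-assoc }
              ; identity = (λ f → coeffs≡ λ _ → ≡.refl)
                         , (λ f → ≋-trans (+ₚ-comm f []) (coeffs≡ λ _ → ≡.refl)) }
            ; inverse = (λ f → ≋-trans (+ₚ-comm (-ₚ f) f) (+ₚ-inverseʳ f)) , +ₚ-inverseʳ
            ; ⁻¹-cong = -ₚ-cong }
          ; comm = +ₚ-comm }
        ; *-cong = *ₚ-cong
        ; *-assoc = *ₚ-assoc
        ; *-identity = *ₚ-identityˡ , (λ f → ≋-trans (*ₚ-comm f 1ₚ) (*ₚ-identityˡ f))
        ; distrib = (λ f g h → ≋-trans (*ₚ-comm f (g +ₚ h))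
                      (≋-trans (*ₚ-distribʳ f g h) (+ₚ-cong (*ₚ-comm g f) (*ₚ-comm h f))))
                  , *ₚ-distribʳ }
      ; *-comm = *ₚ-comm } }

  module P = CommutativeRing polyRing

  const : 𝔽 → Poly
  const a = a ∷ []

  const-* : ∀ a f → const a *ₚ f ≋ a ∙ₚ f
  const-* a f = P.trans (P.+-congˡ zeros) (P.+-identityʳ _)
    where
    zeros : 0# ∷ [] ≋ []
    zeros .at zero    = ≡.refl
    zeros .at (suc k) = ≡.refl

  SmallSeq MonicSeq : ℕ → (ℕ → 𝔽) → Set
  SmallSeq d α = ∀ k → d ℕ.≤ k → α k ≡ 0#
  MonicSeq d α = α d ≡ 1# × SmallSeq (suc d) α

  toPoly-monic : ∀ {d} (f : Monic d) → MonicSeq d (coeff (toPoly f))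
  toPoly-monic [] = ≡.refl , λ { (suc k) _ → ≡.refl }
  toPoly-monic (a ∷ f) = proj₁ (toPoly-monic f) , λ { (suc k) (s≤s d≤k) → proj₂ (toPoly-monic f) k d≤k }

  toList-small : ∀ {d} (v : Vec 𝔽 d) → SmallSeq d (coeff (Vec.toList v))
  toList-small []      k       _         = ≡.refl
  toList-small (a ∷ v) (suc k) (s≤s d≤k) = toList-small v k d≤k

  coeffs : ∀ d → (ℕ → 𝔽) → Vec 𝔽 d
  coeffs zero    α = []
  coeffs (suc d) α = α 0 ∷ coeffs d (α ∘ suc)

  coeff-toPoly-coeffs : ∀ d {α} → MonicSeq d α → ∀ k → coeff (toPoly (coeffs d α)) k ≡ α k
  coeff-toPoly-coeffs zero    (α0 , small) zero    = ≡.sym α0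
  coeff-toPoly-coeffs zero    (α0 , small) (suc k) = ≡.sym (small (suc k) (s≤s z≤n))
  coeff-toPoly-coeffs (suc d) (αd , small) zero    = ≡.refl
  coeff-toPoly-coeffs (suc d) (αd , small) (suc k) =
    coeff-toPoly-coeffs d (αd , λ j d<j → small (suc j) (s≤s d<j)) k

  coeff-toList-coeffs : ∀ d {α} → SmallSeq d α → ∀ k → coeff (Vec.toList (coeffs d α)) k ≡ α k
  coeff-toList-coeffs zero    small k       = ≡.sym (small k z≤n)
  coeff-toList-coeffs (suc d) small zero    = ≡.refl
  coeff-toList-coeffs (suc d) small (suc k) = coeff-toList-coeffs d (λ j d≤j → small (suc j) (s≤s d≤j)) k

  -- Induction on the degree of the first factor by dropping its lowest coefficient, whose products
  -- with coefficients of β beyond degree b vanish.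
  conv-monic : ∀ a {b α β} → MonicSeq a α → MonicSeq b β → MonicSeq (a ℕ.+ b) (conv α β)
  conv-monic zero {b} {α} {β} (α0 , α-small) (βb , β-small) =
    ≡.trans (conv≡β b) βb , λ k b<k → ≡.trans (conv≡β k) (β-small k b<k)
    where
    conv≡β : ∀ k → conv α β k ≡ β k
    conv≡β zero    = ≡.trans (≡.cong (_* β 0) α0) (*-identityˡ _)
    conv≡β (suc k) = ≡.trans (≡.cong₂ _+_ (≡.trans (≡.cong (_* β (suc k)) α0) (*-identityˡ _))
      (≡.trans (conv-cong (λ j → α-small (suc j) (s≤s z≤n)) (λ _ → ≡.refl) k) (conv-zeroˡ β k))) (+-identityʳ _)
  conv-monic (suc a) {b} {α} {β} (αa , α-small) (βb , β-small) =
    ≡.trans (head-vanishes (a ℕ.+ b) (s≤s (ℕ.m≤n+m b a))) (proj₁ ih) ,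
    λ { (suc k) (s≤s a+b<k) → ≡.trans (head-vanishes k (ℕ.<-trans (ℕ.≤-<-trans (ℕ.m≤n+m b a) a+b<k) (ℕ.n<1+n k)))
                                      (proj₂ ih k a+b<k) }
    where
    ih = conv-monic a {α = α ∘ suc} (αa , λ j a<j → α-small (suc j) (s≤s a<j)) (βb , β-small)
    head-vanishes : ∀ k → b ℕ.< suc k → conv α β (suc k) ≡ conv (α ∘ suc) β k
    head-vanishes k b<k = ≡.trans (≡.cong (_+ conv (α ∘ suc) β k)
      (≡.trans (≡.cong (α 0 *_) (β-small (suc k) b<k)) (zeroʳ _))) (+-identityˡ _)

  infixl 7 _⊛_
  _⊛_ : ∀ {a b} → Monic a → Monic b → Monic (a ℕ.+ b)
  _⊛_ {a} {b} f h = coeffs (a ℕ.+ b) (coeff (toPoly f *ₚ toPoly h))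

  toPoly-⊛ : ∀ {a b} (f : Monic a) (h : Monic b) → toPoly (f ⊛ h) ≋ toPoly f *ₚ toPoly h
  toPoly-⊛ {a} {b} f h .at = coeff-toPoly-coeffs (a ℕ.+ b)
    (≡.trans (coeff-* (toPoly f) (toPoly h) (a ℕ.+ b)) (proj₁ product) ,
     λ k a+b<k → ≡.trans (coeff-* (toPoly f) (toPoly h) k) (proj₂ product k a+b<k))
    where product = conv-monic a (toPoly-monic f) (toPoly-monic h)

  toPoly-injective : ∀ {d} (f h : Monic d) → toPoly f ≋ toPoly h → f ≡ h
  toPoly-injective []      []      _   = ≡.refl
  toPoly-injective (a ∷ f) (b ∷ h) f≋h =
    ≡.cong₂ _∷_ (f≋h .at 0) (toPoly-injective f h (coeffs≡ λ k → f≋h .at (suc k)))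

  -- Comparing coefficients from degree d on determines all of x, because h
  -- has degree d and leading coefficient 1.
  *-monic-zero : ∀ x {d β} → MonicSeq d β → SmallSeq d (conv (coeff x) β) → ∀ k → coeff x k ≡ 0#
  *-monic-zero []      _ _ _ = ≡.refl
  *-monic-zero (a ∷ x) {d} {β} (βd , β-small) small = λ { zero → a≡0 ; (suc k) → x≡0 k }
    where
    x≡0 : ∀ k → coeff x k ≡ 0#
    x≡0 = *-monic-zero x (βd , β-small) λ k d≤k → begin
      conv (coeff x) β k                        ≡⟨ ≡.sym (+-identityˡ _) ⟩
      0# + conv (coeff x) β k                   ≡⟨ ≡.cong (_+ conv (coeff x) β k) (≡.sym (≡.trans
                                                     (≡.cong (a *_) (β-small (suc k) (s≤s d≤k))) (zeroʳ a))) ⟩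
      a * β (suc k) + conv (coeff x) β k        ≡⟨ small (suc k) (ℕ.m≤n⇒m≤1+n d≤k) ⟩
      0#                                        ∎
    conv≡0 : ∀ k → conv (coeff x) β k ≡ 0#
    conv≡0 k = ≡.trans (conv-cong x≡0 (λ _ → ≡.refl) k) (conv-zeroˡ β k)
    conv≡a* : ∀ k → conv (coeff (a ∷ x)) β k ≡ a * β k
    conv≡a* zero    = ≡.refl
    conv≡a* (suc k) = ≡.trans (≡.cong (a * β (suc k) +_) (conv≡0 k)) (+-identityʳ _)
    a≡0 : a ≡ 0#
    a≡0 = begin
      a                      ≡⟨ ≡.sym (*-identityʳ a) ⟩
      a * 1#                 ≡⟨ ≡.cong (a *_) (≡.sym βd) ⟩
      a * β d                ≡⟨ ≡.sym (conv≡a* d) ⟩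
      conv (coeff (a ∷ x)) β d ≡⟨ small d ℕ.≤-refl ⟩
      0#                     ∎

  *-monic-cancel : ∀ {d} x y (h : Monic d) → x *ₚ toPoly h ≋ y *ₚ toPoly h → x ≋ y
  *-monic-cancel x y h eq = P.trans (solve 2 (λ x y → x := (x :- y) :+ y) P.refl x y)
    (P.trans (P.+-congʳ {x = y} (coeffs≡ (*-monic-zero (x -ₚ y) (toPoly-monic h)
      λ k _ → ≡.trans (≡.sym (coeff-* (x -ₚ y) (toPoly h) k)) (difference≋0 .at k)))) (P.+-identityˡ y))
    where
    open IntegerSolver polyRing
    difference≋0 : (x -ₚ y) *ₚ toPoly h ≋ []
    difference≋0 = P.trans (solve 3 (λ x y h → (x :- y) :* h := x :* h :- y :* h) P.refl x y (toPoly h))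
      (P.trans (P.+-congʳ eq) (P.-‿inverseʳ (y *ₚ toPoly h)))

  -- Horner's scheme: for a + T h the remainder y of h gives a + T y, of degree at most n, and one
  -- multiple of g removes its coefficient of T^n. The remainder is a vector of length n, hence one
  -- of the residues summed over later.
  remainder : ∀ {n} (g : Monic n) h → ∃[ y ] ∃[ k ] h ≋ Vec.toList {n = n} y +ₚ k *ₚ toPoly g
  remainder {n} g [] = coeffs n (λ _ → 0#) , [] , P.sym (P.trans (P.+-identityʳ _)
    (coeffs≡ (coeff-toList-coeffs n (λ _ _ → ≡.refl))))
  remainder {n} g (a ∷ h) with remainder g h
  ... | y , k , h≋ = coeffs n (coeff r) , c ∷ k , P.trans (∷-cong ≡.refl h≋) (P.trans split
    (P.+-congʳ {(c ∷ k) *ₚ toPoly g} {r} {Vec.toList (coeffs n (coeff r))}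
      (coeffs≡ λ j → ≡.sym (coeff-toList-coeffs n r-small j))))
    where
    open IntegerSolver polyRing
    z = a ∷ Vec.toList y
    c = coeff z n
    r = z -ₚ c ∙ₚ toPoly g
    c-top : coeff (c ∙ₚ toPoly g) n ≡ c
    c-top = ≡.trans (coeff-∙ c (toPoly g) n) (≡.trans (≡.cong (c *_) (proj₁ (toPoly-monic g))) (*-identityʳ c))
    r-small : SmallSeq n (coeff r)
    r-small k n≤k with ℕ.m≤n⇒m<n∨m≡n n≤k
    ... | inj₂ ≡.refl = ≡.trans (coeff-+ z (-ₚ (c ∙ₚ toPoly g)) n)
      (≡.trans (≡.cong (c +_) (≡.trans (coeff-neg (c ∙ₚ toPoly g) n) (≡.cong -_ c-top))) (-‿inverseʳ c))
    ... | inj₁ n<k = begin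
      coeff r k                                 ≡⟨ coeff-+ z (-ₚ (c ∙ₚ toPoly g)) k ⟩
      coeff z k + coeff (-ₚ (c ∙ₚ toPoly g)) k  ≡⟨ ≡.cong₂ _+_ (toList-small (a ∷ y) k n<k)
                                                     (≡.trans (coeff-neg (c ∙ₚ toPoly g) k) (≡.cong -_
                                                       (≡.trans (coeff-∙ c (toPoly g) k)
                                                         (≡.trans (≡.cong (c *_) (proj₂ (toPoly-monic g) k n<k)) (zeroʳ c))))) ⟩
      0# + - 0#                                 ≡⟨ -‿inverseʳ 0# ⟩
      0#                                        ∎
    split : a ∷ (Vec.toList y +ₚ k *ₚ toPoly g) ≋ r +ₚ (c ∷ k) *ₚ toPoly g
    split = P.trans (coeffs≡ λ { zero → ≡.sym (+-identityʳ a) ; (suc j) → ≡.refl })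
      (solve 3 (λ z cg s → z :+ s := (z :- cg) :+ (cg :+ s)) P.refl z (c ∙ₚ toPoly g) (0# ∷ (k *ₚ toPoly g)))

-- The coefficient of 1/T in h/g as a linear functional of h.

module ResidueFunctional {q : ℕ} (F : FiniteField q) where

  open Polynomials F
  open PolynomialRing F
  open FiniteField F using () renaming (Carrier to 𝔽; commutativeRing to 𝔽-ring)
  open CommutativeRing 𝔽-ring
    using (_+_; _*_; -_; 0#; 1#; +-identityˡ; +-identityʳ; *-identityˡ; +-assoc; +-comm; *-assoc; zeroˡ; zeroʳ; distribˡ; distribʳ; -‿inverseˡ)
  open Convolution 𝔽-ring
  open RingSum 𝔽-ring using (∑; ∑-map; interchange)
  open ≡.≡-Reasoning

  -- The linear functional that takes the value t k on T^k.
  pairing : Poly → (ℕ → 𝔽) → 𝔽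
  pairing []      t = 0#
  pairing (a ∷ h) t = a * t 0 + pairing h (t ∘ suc)

  pairing-zero : ∀ h t → (∀ k → coeff h k ≡ 0#) → pairing h t ≡ 0#
  pairing-zero []      t _    = ≡.refl
  pairing-zero (a ∷ h) t h≡0 = ≡.trans (≡.cong₂ _+_
    (≡.trans (≡.cong (_* t 0) (h≡0 0)) (zeroˡ _)) (pairing-zero h (t ∘ suc) (h≡0 ∘ suc))) (+-identityˡ 0#)

  pairing-cong : ∀ {f h} t → f ≋ h → pairing f t ≡ pairing h t
  pairing-cong {[]}    {h}     t f≋h = ≡.sym (pairing-zero h t (≡.sym ∘ f≋h .at))
  pairing-cong {a ∷ f} {[]}    t f≋h = pairing-zero (a ∷ f) t (f≋h .at)
  pairing-cong {a ∷ f} {b ∷ h} t f≋h = ≡.cong₂ _+_ (≡.cong (_* t 0) (f≋h .at 0))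
    (pairing-cong {f} {h} (t ∘ suc) (coeffs≡ (f≋h .at ∘ suc)))

  pairing-+ : ∀ f h t → pairing (f +ₚ h) t ≡ pairing f t + pairing h t
  pairing-+ []      h       t = ≡.sym (+-identityˡ _)
  pairing-+ (a ∷ f) []      t = ≡.sym (+-identityʳ _)
  pairing-+ (a ∷ f) (b ∷ h) t = ≡.trans (≡.cong₂ _+_ (distribʳ _ _ _) (pairing-+ f h (t ∘ suc)))
    (interchange _ _ _ _)

  pairing-∙ : ∀ a f t → pairing (a ∙ₚ f) t ≡ a * pairing f t
  pairing-∙ a []      t = ≡.sym (zeroʳ a)
  pairing-∙ a (b ∷ f) t = ≡.trans (≡.cong₂ _+_ (*-assoc a b _) (pairing-∙ a f (t ∘ suc))) (≡.sym (distribˡ _ _ _))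

  -- Multiplication by T amounts to a shift of t, so a functional kills all multiples of g once
  -- every shift of t kills g.
  pairing-*-zero : ∀ k g t → (∀ i → pairing g (λ j → t (i ℕ.+ j)) ≡ 0#) → pairing (k *ₚ g) t ≡ 0#
  pairing-*-zero []      g t g⊥ = ≡.refl
  pairing-*-zero (a ∷ k) g t g⊥ = begin
    pairing ((a ∙ₚ g) +ₚ (0# ∷ (k *ₚ g))) t          ≡⟨ pairing-+ (a ∙ₚ g) _ t ⟩
    pairing (a ∙ₚ g) t + (0# * t 0 + pairing (k *ₚ g) (t ∘ suc))
      ≡⟨ ≡.cong₂ _+_ (≡.trans (pairing-∙ a g t) (≡.trans (≡.cong (a *_) (g⊥ 0)) (zeroʳ a)))
           (≡.cong₂ _+_ (zeroˡ (t 0)) (pairing-*-zero k g (t ∘ suc) (g⊥ ∘ suc))) ⟩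
    0# + (0# + 0#)                                   ≡⟨ ≡.trans (+-identityˡ _) (+-identityˡ 0#) ⟩
    0#                                               ∎

  -- h ends at degree m and t starts there, so they overlap in a single place.
  pairing-support : ∀ h t m → (∀ j → m ℕ.< j → coeff h j ≡ 0#) → (∀ j → j ℕ.< m → t j ≡ 0#) →
                    pairing h t ≡ coeff h m * t m
  pairing-support []      t m       _    _   = ≡.sym (zeroˡ _)
  pairing-support (a ∷ h) t zero    h≡0 _   =
    ≡.trans (≡.cong (a * t 0 +_) (pairing-zero h (t ∘ suc) (λ k → h≡0 (suc k) (s≤s z≤n)))) (+-identityʳ _)
  pairing-support (a ∷ h) t (suc m) h≡0 t≡0 = ≡.trans (≡.cong₂ _+_
    (≡.trans (≡.cong (a *_) (t≡0 0 (s≤s z≤n))) (zeroʳ a))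
    (pairing-support h (t ∘ suc) m (λ j m<j → h≡0 (suc j) (s≤s m<j)) (λ j j<m → t≡0 (suc j) (s≤s j<m)))) (+-identityˡ _)

  coeff-∷ʳ-< : ∀ xs a i → i ℕ.< List.length xs → coeff (xs List.∷ʳ a) i ≡ coeff xs i
  coeff-∷ʳ-< (x ∷ xs) a zero    _         = ≡.refl
  coeff-∷ʳ-< (x ∷ xs) a (suc i) (s≤s i<l) = coeff-∷ʳ-< xs a i i<l

  conv-∷ʳ-< : ∀ xs a s k → k ℕ.< List.length xs →
              conv (coeff (xs List.∷ʳ a)) s k ≡ conv (coeff xs) s k
  conv-∷ʳ-< (x ∷ xs) a s zero    _         = ≡.refl
  conv-∷ʳ-< (x ∷ xs) a s (suc k) (s≤s k<l) = ≡.cong (x * s (suc k) +_) (conv-∷ʳ-< xs a s k k<l)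

  conv-∷ʳ-+ : ∀ xs a s i → conv (coeff (xs List.∷ʳ a)) s (i ℕ.+ List.length xs) ≡
              a * s i + conv (coeff xs) s (i ℕ.+ List.length xs)
  conv-∷ʳ-+ [] a s i = ≡.trans (≡.cong (conv (coeff (a ∷ [])) s) (ℕ.+-identityʳ i))
    (≡.trans (only i) (≡.sym (≡.trans (≡.cong (a * s i +_) (conv-zeroˡ s (i ℕ.+ 0))) (+-identityʳ _))))
    where
    only : ∀ i → conv (coeff (a ∷ [])) s i ≡ a * s i
    only zero    = ≡.refl
    only (suc i) = ≡.trans (≡.cong (a * s (suc i) +_) (conv-zeroˡ s i)) (+-identityʳ _)
  conv-∷ʳ-+ (x ∷ xs) a s i = begin
    conv (coeff (x ∷ xs List.∷ʳ a)) s (i ℕ.+ suc l)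
      ≡⟨ ≡.cong (conv (coeff (x ∷ xs List.∷ʳ a)) s) (ℕ.+-suc i l) ⟩
    x * s (suc (i ℕ.+ l)) + conv (coeff (xs List.∷ʳ a)) s (i ℕ.+ l)
      ≡⟨ ≡.cong (x * s (suc (i ℕ.+ l)) +_) (conv-∷ʳ-+ xs a s i) ⟩
    x * s (suc (i ℕ.+ l)) + (a * s i + conv (coeff xs) s (i ℕ.+ l))
      ≡⟨ solve 3 (λ x a c → x :+ (a :+ c) := a :+ (x :+ c)) ≡.refl _ (a * s i) _ ⟩
    a * s i + conv (coeff (x ∷ xs)) s (suc (i ℕ.+ l))
      ≡⟨ ≡.cong (λ k → a * s i + conv (coeff (x ∷ xs)) s k) (≡.sym (ℕ.+-suc i l)) ⟩
    a * s i + conv (coeff (x ∷ xs)) s (i ℕ.+ suc l) ∎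
    where
    open IntegerSolver 𝔽-ring
    l = List.length xs

  -- Convolving the reversed coefficient list with s pairs the list with a
  -- shift of s: t j = s (j + k + 1 - length h), extended by zero.
  conv-reverse : ∀ h s k t →
    (∀ j i → i ℕ.+ List.length h ≡ suc (j ℕ.+ k) → t j ≡ s i) →
    (∀ j → suc (j ℕ.+ k) ℕ.< List.length h → t j ≡ 0#) →
    conv (coeff (List.reverse h)) s k ≡ pairing h t
  conv-reverse []      s k t t≡s t≡0 = conv-zeroˡ s k
  conv-reverse (a ∷ h) s k t t≡s t≡0 = ≡.trans (≡.cong (λ xs → conv (coeff xs) s k) (List.unfold-reverse a h))
    (≡.trans (step (ℕ.<-≤-connex k l)) (≡.cong (a * t 0 +_) ih))
    where
    l = List.length (List.reverse h)
    l≡ : l ≡ List.length h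
    l≡ = List.length-reverse h
    ih : conv (coeff (List.reverse h)) s k ≡ pairing h (t ∘ suc)
    ih = conv-reverse h s k (t ∘ suc)
      (λ j i eq → t≡s (suc j) i (≡.trans (ℕ.+-suc i _) (≡.cong suc eq)))
      (λ j lt → t≡0 (suc j) (s≤s lt))
    step : k ℕ.< l ⊎ l ℕ.≤ k →
      conv (coeff (List.reverse h List.∷ʳ a)) s k ≡ a * t 0 + conv (coeff (List.reverse h)) s k
    step (inj₁ k<l) = ≡.trans (conv-∷ʳ-< (List.reverse h) a s k k<l) (≡.sym (≡.trans (≡.cong (_+ conv (coeff (List.reverse h)) s k)
      (≡.trans (≡.cong (a *_) (t≡0 0 (s≤s (≡.subst (k ℕ.<_) l≡ k<l)))) (zeroʳ a))) (+-identityˡ _)))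
    step (inj₂ l≤k) = ≡.subst (λ k′ → conv (coeff (List.reverse h List.∷ʳ a)) s k′ ≡
                                      a * t 0 + conv (coeff (List.reverse h)) s k′)
      (ℕ.m∸n+n≡m l≤k) (≡.trans (conv-∷ʳ-+ (List.reverse h) a s (k ∸ l))
        (≡.cong (λ x → a * x + conv (coeff (List.reverse h)) s (k ∸ l ℕ.+ l)) (≡.sym (t≡s 0 (k ∸ l)
          (≡.trans (ℕ.+-suc (k ∸ l) _) (≡.cong suc (≡.trans (≡.cong (k ∸ l ℕ.+_) (≡.sym l≡)) (ℕ.m∸n+n≡m l≤k))))))))

  reciprocal : (ℕ → 𝔽) → ℕ → 𝔽
  reciprocal b k = Vec.head (reciprocals b k)

  -- `reciprocals` stores the earlier values in descending order, so the scalar product in its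
  -- recursion is already a Cauchy product.
  conv-reciprocals : ∀ (f : ℕ → 𝔽) b m →
    Vec.foldr′ _+_ 0# (Vec.zipWith _*_ (Vec.tabulate {n = suc m} (f ∘ Fin.toℕ)) (reciprocals b m)) ≡
    conv f (reciprocal b) m
  conv-reciprocals f b zero    = +-identityʳ _
  conv-reciprocals f b (suc m) = ≡.cong (f 0 * reciprocal b (suc m) +_) (conv-reciprocals (f ∘ suc) b m)

  conv-reciprocal : ∀ b → b 0 ≡ 1# → ∀ m → conv b (reciprocal b) (suc m) ≡ 0#
  conv-reciprocal b b0≡1 m = begin
    b 0 * reciprocal b (suc m) + S
      ≡⟨ ≡.cong (λ x → x * reciprocal b (suc m) + S) b0≡1 ⟩
    1# * reciprocal b (suc m) + S
      ≡⟨ ≡.cong (_+ S) (*-identityˡ _) ⟩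
    reciprocal b (suc m) + S
      ≡⟨ ≡.cong (λ x → - x + S) (conv-reciprocals (b ∘ suc) b m) ⟩
    - S + S
      ≡⟨ -‿inverseˡ S ⟩
    0# ∎
    where S = conv (b ∘ suc) (reciprocal b) m

  length-toPoly : ∀ {n} (g : Monic n) → List.length (toPoly g) ≡ suc n
  length-toPoly []      = ≡.refl
  length-toPoly (_ ∷ g) = ≡.cong suc (length-toPoly g)

  coeff-reverse-toPoly : ∀ {n} (g : Monic n) → coeff (List.reverse (toPoly g)) 0 ≡ 1#
  coeff-reverse-toPoly []      = ≡.refl
  coeff-reverse-toPoly (a ∷ g) = ≡.trans (≡.cong (λ xs → coeff xs 0) (List.unfold-reverse a (toPoly g)))
    (≡.trans (coeff-∷ʳ-< (List.reverse (toPoly g)) a 0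
      (≡.subst (0 ℕ.<_) (≡.sym (≡.trans (List.length-reverse (toPoly g)) (length-toPoly g))) (s≤s z≤n)))
      (coeff-reverse-toPoly g))

  module _ {n : ℕ} (1≤n : 1 ℕ.≤ n) (g : Monic n) where

    -- The expansion 1/g = T^(-n) Σ s_k T^(-k): reversing the coefficients of g gives the power
    -- series in 1/T whose reciprocal this is.
    s : ℕ → 𝔽
    s = reciprocal (coeff (List.reverse (toPoly g)))

    -- The coefficient of 1/T in T^j / g.
    weights : ℕ → 𝔽
    weights j with n ℕ.≤? suc j
    ... | yes _ = s (suc j ∸ n)
    ... | no  _ = 0#

    weights-+ : ∀ j i → i ℕ.+ n ≡ suc j → weights j ≡ s i
    weights-+ j i i+n≡ with n ℕ.≤? suc j
    ... | yes _ = ≡.cong s (≡.trans (≡.cong (_∸ n) (≡.sym i+n≡)) (ℕ.m+n∸n≡m i n))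
    ... | no n≰ = contradiction (≡.subst (n ℕ.≤_) i+n≡ (ℕ.m≤n+m n i)) n≰

    weights-< : ∀ j → suc j ℕ.< n → weights j ≡ 0#
    weights-< j j<n with n ℕ.≤? suc j
    ... | yes n≤ = contradiction n≤ (ℕ.<⇒≱ j<n)
    ... | no _   = ≡.refl

    ρ : Poly → 𝔽
    ρ h = pairing h weights

    -- The value at T^i g is the coefficient of index i + 1 in the product of the reversed g with
    -- its reciprocal series, hence 0. In other words, multiples of g divided by g have no 1/T term.
    ρ-multiple : ∀ k → ρ (k *ₚ toPoly g) ≡ 0#
    ρ-multiple k = pairing-*-zero k (toPoly g) weights λ i → ≡.trans
      (≡.sym (conv-reverse (toPoly g) s (suc i) _
        (λ j m m+l≡ → weights-+ (i ℕ.+ j) m (ℕ.suc-injective (≡.trans (≡.sym (ℕ.+-suc m n))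
          (≡.trans (≡.cong (m ℕ.+_) (≡.sym (length-toPoly g)))
          (≡.trans m+l≡ (≡.cong suc (≡.trans (ℕ.+-suc j i) (≡.cong suc (ℕ.+-comm j i)))))))))
        (λ j lt → weights-< (i ℕ.+ j) (ℕ.≤-pred (≡.subst₂ ℕ._<_
          (≡.cong suc (≡.trans (ℕ.+-suc j i) (≡.cong suc (ℕ.+-comm j i)))) (length-toPoly g) lt)))))
      (conv-reciprocal _ (coeff-reverse-toPoly g) i)

    weights-top : ∀ {m} → suc m ≡ n → weights m ≡ 1#
    weights-top {m} sm≡n = weights-+ m 0 (≡.sym sm≡n)

    ρ-monic-top : ∀ {m} (f : Monic m) → suc m ≡ n → ρ (toPoly f) ≡ 1#
    ρ-monic-top {m} f sm≡n = ≡.trans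
      (pairing-support (toPoly f) weights m (proj₂ (toPoly-monic f))
        (λ j j<m → weights-< j (≡.subst (suc j ℕ.<_) sm≡n (s≤s j<m))))
      (≡.trans (≡.cong₂ _*_ (proj₁ (toPoly-monic f)) (weights-top sm≡n)) (*-identityˡ 1#))

    ρ-monic-below : ∀ {m} (f : Monic m) → suc m ℕ.< n → ρ (toPoly f) ≡ 0#
    ρ-monic-below {m} f sm<n = ≡.trans
      (pairing-support (toPoly f) weights m (proj₂ (toPoly-monic f))
        (λ j j<m → weights-< j (ℕ.<-trans (s≤s j<m) sm<n)))
      (≡.trans (≡.cong (coeff (toPoly f) m *_) (weights-< m sm<n)) (zeroʳ _))

    -- With L the length of the coefficient list, trailing zeros included, the Laurent series of h/g
    -- is indexed from T^(L-1-n), so 1/T has index L - n. A negative index occurs when h is too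
    -- short to meet any nonzero weight.
    coefAt-/ : ∀ h → coefAt (h /ₗ g) -[1+ 0 ] ≡ ρ h
    coefAt-/ h = go (ℕ.<-≤-connex (List.length h) n)
      where
      L = List.length h
      α = h /ₗ g
      top≡ : top α ℤ.- -[1+ 0 ] ≡ L ℤ.⊖ n
      top≡ = begin
        (ℤ.+ L ℤ.- ℤ.+ 1) ℤ.+ ℤ.- (ℤ.+ List.length (toPoly g) ℤ.- ℤ.+ 1) ℤ.- -[1+ 0 ]
          ≡⟨ ≡.cong (λ l → (ℤ.+ L ℤ.- ℤ.+ 1) ℤ.+ ℤ.- (ℤ.+ l ℤ.- ℤ.+ 1) ℤ.- -[1+ 0 ]) (length-toPoly g) ⟩
        (ℤ.+ L ℤ.- ℤ.+ 1) ℤ.+ ℤ.- (ℤ.+ n) ℤ.+ ℤ.+ 1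
          ≡⟨ solve 3 (λ l n e → (l :- e) :+ :- n :+ e := l :- n) ≡.refl (ℤ.+ L) (ℤ.+ n) (ℤ.+ 1) ⟩
        ℤ.+ L ℤ.- ℤ.+ n
          ≡⟨ ℤ.m-n≡m⊖n L n ⟩
        L ℤ.⊖ n ∎
        where open IntegerSolver ℤ.+-*-commutativeRing
      at-top : ∀ j → top α ℤ.- -[1+ 0 ] ≡ ℤ.+ j → coefAt α -[1+ 0 ] ≡ coefs α j
      at-top j eq with top α ℤ.- -[1+ 0 ]
      at-top j ≡.refl | .(ℤ.+ j) = ≡.refl
      below : ∀ j → top α ℤ.- -[1+ 0 ] ≡ -[1+ j ] → coefAt α -[1+ 0 ] ≡ 0#
      below j eq with top α ℤ.- -[1+ 0 ]
      below j ≡.refl | .(-[1+ j ]) = ≡.refl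
      shifted : n ℕ.≤ L → ∀ j → suc (j ℕ.+ (L ∸ n)) ℕ.+ n ≡ suc j ℕ.+ L
      shifted n≤L j = ≡.trans (ℕ.+-assoc (suc j) (L ∸ n) n) (≡.cong (suc j ℕ.+_) (ℕ.m∸n+n≡m n≤L))
      go : L ℕ.< n ⊎ n ℕ.≤ L → coefAt α -[1+ 0 ] ≡ ρ h
      go (inj₁ L<n) = ≡.trans
        (below (ℕ.pred (n ∸ L)) (≡.trans top≡ (≡.trans (ℤ.⊖-< L<n)
          (≡.cong (λ k → ℤ.- (ℤ.+ k)) (≡.sym (ℕ.suc-pred (n ∸ L) {{ℕ.>-nonZero (ℕ.m<n⇒0<n∸m L<n)}}))))))
        (≡.sym (short h weights (λ j j<L → weights-< j (ℕ.≤-<-trans j<L L<n))))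
        where
        short : ∀ h t → (∀ j → j ℕ.< List.length h → t j ≡ 0#) → pairing h t ≡ 0#
        short []      t _   = ≡.refl
        short (a ∷ h) t t≡0 = ≡.trans (≡.cong₂ _+_ (≡.trans (≡.cong (a *_) (t≡0 0 (s≤s z≤n))) (zeroʳ a))
          (short h (t ∘ suc) (λ j j<l → t≡0 (suc j) (s≤s j<l)))) (+-identityˡ 0#)
      go (inj₂ n≤L) = begin
        coefAt α -[1+ 0 ]
          ≡⟨ at-top (L ∸ n) (≡.trans top≡ (ℤ.⊖-≥ n≤L)) ⟩
        coefs α (L ∸ n)
          ≡⟨ ∑-map _ (List.upTo (suc (L ∸ n))) id ⟩
        ∑ (List.upTo (suc (L ∸ n))) (λ i → coeff (List.reverse h) i * s (L ∸ n ∸ i))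
          ≡⟨ ≡.sym (conv≈∑ _ s (L ∸ n)) ⟩
        conv (coeff (List.reverse h)) s (L ∸ n)
          ≡⟨ conv-reverse h s (L ∸ n) weights
               (λ j i eq → weights-+ j i (ℕ.+-cancelʳ-≡ L (i ℕ.+ n) (suc j) (begin
                 i ℕ.+ n ℕ.+ L                  ≡⟨ ℕ.+-assoc i n L ⟩
                 i ℕ.+ (n ℕ.+ L)                ≡⟨ ≡.cong (i ℕ.+_) (ℕ.+-comm n L) ⟩
                 i ℕ.+ (L ℕ.+ n)                ≡⟨ ≡.sym (ℕ.+-assoc i L n) ⟩
                 i ℕ.+ L ℕ.+ n                  ≡⟨ ≡.cong (ℕ._+ n) eq ⟩
                 suc (j ℕ.+ (L ∸ n)) ℕ.+ n      ≡⟨ shifted n≤L j ⟩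
                 suc j ℕ.+ L                    ∎)))
               (λ j lt → weights-< j (ℕ.+-cancelʳ-< L (suc j) n
                 (≡.subst₂ ℕ._<_ (shifted n≤L j) (ℕ.+-comm L n) (ℕ.+-monoˡ-< n lt)))) ⟩
        ρ h ∎

-- Sums over monic polynomials and over residues modulo g.

module PolynomialSums {q : ℕ} (F : FiniteField q) (K : CommutativeRing 0ℓ 0ℓ) where

  open Polynomials F hiding (d)
  open PolynomialRing F
  private
    module F = FiniteField F
    module F+ = CommutativeRing F.commutativeRing
  open F using (elements; units) renaming (Carrier to 𝔽)
  open FieldSum F
  open CommutativeRing K
  open RingSum K
  open SetoidReasoning setoid

  qᴷ : Carrier
  qᴷ = q · 1#

  -- The same coefficient vectors read in two ways: as the lower part of a monic polynomial of
  -- degree k, or as any polynomial of degree less than k. The latter, for k = n, are the residues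
  -- modulo g.
  ∑M ∑V : ℕ → (Poly → Carrier) → Carrier
  ∑M k φ = ∑ (monics k) (λ f → φ (toPoly f))
  ∑V k φ = ∑ (monics k) (λ v → φ (Vec.toList v))

  Congruent : (Poly → Carrier) → Set
  Congruent φ = ∀ {f h} → f ≋ h → φ f ≈ φ h

  ∑-monics-const : ∀ k c → ∑ (monics k) (λ _ → c) ≈ qᴷ ^ k * c
  ∑-monics-const zero    c = trans (+-identityʳ c) (sym (*-identityˡ c))
  ∑-monics-const (suc k) c = begin
    ∑ (monics (suc k)) (λ _ → c)                       ≈⟨ ∑-cartesian Vec._∷_ elements (monics k) (λ _ → c) ⟩
    ∑ elements (λ _ → ∑ (monics k) (λ _ → c))          ≈⟨ ∑-const elements _ ⟩
    (List.length elements · 1#) * ∑ (monics k) (λ _ → c)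
      ≈⟨ *-cong (reflexive (≡.cong (_· 1#) length-elements)) (∑-monics-const k c) ⟩
    qᴷ * (qᴷ ^ k * c)                                  ≈⟨ sym (*-assoc _ _ _) ⟩
    qᴷ ^ suc k * c                                     ∎

  ∑-monics-shift : ∀ {k} (w : Vec 𝔽 k) (G : Vec 𝔽 k → Carrier) →
    ∑ (monics k) (λ v → G (Vec.zipWith F._+_ v w)) ≈ ∑ (monics k) G
  ∑-monics-shift []      G = refl
  ∑-monics-shift (b ∷ w) G = begin
    ∑ (monics (suc _)) (λ v → G (Vec.zipWith F._+_ v (b ∷ w)))
      ≈⟨ ∑-cartesian Vec._∷_ elements (monics _) _ ⟩
    ∑ elements (λ a → ∑ (monics _) (λ v → G ((a F.+ b) ∷ Vec.zipWith F._+_ v w)))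
      ≈⟨ ∑-cong elements (λ a → ∑-monics-shift w (λ v → G ((a F.+ b) ∷ v))) ⟩
    ∑ elements (λ a → ∑ (monics _) (λ v → G ((a F.+ b) ∷ v)))
      ≈⟨ ∑-shift +-commutativeMonoid b (λ a → ∑ (monics _) (λ v → G (a ∷ v))) ⟩
    ∑ elements (λ a → ∑ (monics _) (λ v → G (a ∷ v)))
      ≈⟨ sym (∑-cartesian Vec._∷_ elements (monics _) G) ⟩
    ∑ (monics (suc _)) G ∎

  toList-zipWith : ∀ {k} (v w : Vec 𝔽 k) → Vec.toList (Vec.zipWith F._+_ v w) ≋ Vec.toList v +ₚ Vec.toList w
  toList-zipWith []      []      = P.refl
  toList-zipWith (a ∷ v) (b ∷ w) = ∷-cong ≡.refl (toList-zipWith v w)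

  toPoly-zipWith : ∀ {k} (v w : Vec 𝔽 k) → toPoly (Vec.zipWith F._+_ v w) ≋ toPoly v +ₚ Vec.toList w
  toPoly-zipWith []      []      = P.refl
  toPoly-zipWith (a ∷ v) (b ∷ w) = ∷-cong ≡.refl (toPoly-zipWith v w)

  ∑M-shift : ∀ k {φ} → Congruent φ → ∀ w → SmallSeq k (coeff w) →
             ∑M k (λ f → φ (f +ₚ w)) ≈ ∑M k φ
  ∑M-shift k {φ} φ-cong w small = trans
    (∑-cong (monics k) (λ f → φ-cong (P.sym (P.trans (toPoly-zipWith f w′)
      (P.+-congˡ {toPoly f} {Vec.toList w′} {w} w′≋w)))))
    (∑-monics-shift w′ (φ ∘ toPoly))
    where
    w′ = coeffs k (coeff w)
    w′≋w : Vec.toList w′ ≋ w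
    w′≋w = coeffs≡ (coeff-toList-coeffs k small)

  Periodic : ∀ {n} → Monic n → (Poly → Carrier) → Set
  Periodic g φ = ∀ h k → φ (h +ₚ k *ₚ toPoly g) ≈ φ h

  ∑V-shift : ∀ {n} (g : Monic n) {φ} → Congruent φ → Periodic g φ → ∀ w →
             ∑V n (λ y → φ (y +ₚ w)) ≈ ∑V n φ
  ∑V-shift {n} g {φ} φ-cong φ-periodic w = trans
    (∑-cong (monics n) (λ v → trans (φ-cong (eq v)) (trans (φ-periodic _ k) refl)))
    (∑-monics-shift y (φ ∘ Vec.toList))
    where
    y = proj₁ (remainder g w)
    k = proj₁ (proj₂ (remainder g w))
    eq : ∀ v → Vec.toList v +ₚ w ≋ Vec.toList (Vec.zipWith F._+_ v y) +ₚ k *ₚ toPoly g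
    eq v = P.trans (P.+-congˡ {Vec.toList v} (proj₂ (proj₂ (remainder g w))))
      (P.trans (P.sym (P.+-assoc (Vec.toList v) (Vec.toList y) (k *ₚ toPoly g)))
               (P.+-congʳ {k *ₚ toPoly g} (P.sym (toList-zipWith v y))))

  ∑-monics-++ : ∀ m k (G : Vec 𝔽 (m ℕ.+ k) → Carrier) →
    ∑ (monics (m ℕ.+ k)) G ≈ ∑ (monics m) (λ v → ∑ (monics k) (λ f → G (v Vec.++ f)))
  ∑-monics-++ zero    k G = sym (+-identityʳ _)
  ∑-monics-++ (suc m) k G = begin
    ∑ (monics (suc m ℕ.+ k)) G
      ≈⟨ ∑-cartesian Vec._∷_ elements (monics (m ℕ.+ k)) G ⟩
    ∑ elements (λ a → ∑ (monics (m ℕ.+ k)) (λ v → G (a ∷ v)))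
      ≈⟨ ∑-cong elements (λ a → ∑-monics-++ m k (λ v → G (a ∷ v))) ⟩
    ∑ elements (λ a → ∑ (monics m) (λ v → ∑ (monics k) (λ f → G (a ∷ v Vec.++ f))))
      ≈⟨ sym (∑-cartesian Vec._∷_ elements (monics m) _) ⟩
    ∑ (monics (suc m)) (λ v → ∑ (monics k) (λ f → G (v Vec.++ f))) ∎

  shiftₚ : ℕ → Poly → Poly
  shiftₚ zero    f = f
  shiftₚ (suc m) f = F.0# ∷ shiftₚ m f

  toPoly-++ : ∀ {m k} (v : Vec 𝔽 m) (f : Monic k) →
              toPoly (v Vec.++ f) ≋ Vec.toList v +ₚ shiftₚ m (toPoly f)
  toPoly-++ []      f = P.refl
  toPoly-++ (a ∷ v) f = ∷-cong (≡.sym (F+.+-identityʳ a)) (toPoly-++ v f)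

  -- The high coefficients of a monic polynomial of degree n + k only
  -- translate the residue class given by the n low ones.
  ∑M-equidistributed : ∀ {n} (g : Monic n) {φ} → Congruent φ → Periodic g φ → ∀ k →
                       ∑M (n ℕ.+ k) φ ≈ qᴷ ^ k * ∑V n φ
  ∑M-equidistributed {n} g {φ} φ-cong φ-periodic k = begin
    ∑M (n ℕ.+ k) φ
      ≈⟨ ∑-monics-++ n k (φ ∘ toPoly) ⟩
    ∑ (monics n) (λ v → ∑ (monics k) (λ f → φ (toPoly (v Vec.++ f))))
      ≈⟨ ∑-swap (monics n) (monics k) _ ⟩
    ∑ (monics k) (λ f → ∑ (monics n) (λ v → φ (toPoly (v Vec.++ f))))
      ≈⟨ ∑-cong (monics k) (λ f → trans (∑-cong (monics n) (λ v → φ-cong (toPoly-++ v f)))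
                                        (∑V-shift g φ-cong φ-periodic (shiftₚ n (toPoly f)))) ⟩
    ∑ (monics k) (λ f → ∑V n φ)
      ≈⟨ ∑-monics-const k _ ⟩
    qᴷ ^ k * ∑V n φ ∎

  -- Each nonzero polynomial is uniquely a unit times a monic polynomial. The induction peels off
  -- the constant term, so the unit found in the higher coefficients has to be spread over it as
  -- well.
  ∑V-by-degree : ∀ d {φ} → Congruent φ → ∑V d φ ≈
    φ [] + ∑ (List.upTo d) (λ k → ∑ units (λ l → ∑M k (λ f → φ (const l *ₚ f))))
  ∑V-by-degree zero    φ-cong = refl
  ∑V-by-degree (suc d) {φ} φ-cong = begin
    ∑V (suc d) φ
      ≈⟨ ∑-cartesian Vec._∷_ elements (monics d) _ ⟩
    ∑ elements (λ a → ∑V d (λ y → φ (a ∷ y)))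
      ≈⟨ ∑-cong elements (λ a → ∑V-by-degree d (λ f≋h → φ-cong (∷-cong ≡.refl f≋h))) ⟩
    ∑ elements (λ a → φ (a ∷ []) + ∑ (List.upTo d) (λ k → ∑ units (λ l → ∑M k (λ f → φ (a ∷ const l *ₚ f)))))
      ≈⟨ ∑-+ elements _ _ ⟩
    ∑ elements (λ a → φ (a ∷ [])) +
    ∑ elements (λ a → ∑ (List.upTo d) (λ k → ∑ units (λ l → ∑M k (λ f → φ (a ∷ const l *ₚ f)))))
      ≈⟨ +-cong (∑-elements +-commutativeMonoid (λ a → φ (a ∷ []))) (∑-swap elements (List.upTo d) _) ⟩
    φ (F.0# ∷ []) + ∑ units (λ l → φ (l ∷ [])) +
    ∑ (List.upTo d) (λ k → ∑ elements (λ a → ∑ units (λ l → ∑M k (λ f → φ (a ∷ const l *ₚ f)))))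
      ≈⟨ +-cong (+-cong (φ-cong (coeffs≡ λ { zero → ≡.refl ; (suc k) → ≡.refl }))
                        (∑-cong units (λ l → sym (trans (+-identityʳ _) (φ-cong
                          (P.*-identityʳ (const l)))))))
                (∑-cong (List.upTo d) higher) ⟩
    φ [] + T 0 + ∑ (List.upTo d) (λ k → T (suc k))
      ≈⟨ +-assoc _ _ _ ⟩
    φ [] + (T 0 + ∑ (List.upTo d) (λ k → T (suc k)))
      ≈⟨ +-congˡ (reflexive (≡.sym (∑-upTo-suc d T))) ⟩
    φ [] + ∑ (List.upTo (suc d)) T ∎
    where
    T : ℕ → Carrier
    T k = ∑ units (λ l → ∑M k (λ f → φ (const l *ₚ f)))
    scaled : ∀ l a f → (l F.* a) ∷ (const l *ₚ f) ≋ const l *ₚ (a ∷ f)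
    scaled l a f .at zero    = ≡.sym (F+.+-identityʳ _)
    scaled l a f .at (suc k) = ≡.trans (const-* l f .at k) (≡.sym (const-* l (a ∷ f) .at (suc k)))
    higher : ∀ k → ∑ elements (λ a → ∑ units (λ l → ∑M k (λ f → φ (a ∷ const l *ₚ f)))) ≈ T (suc k)
    higher k = begin
      ∑ elements (λ a → ∑ units (λ l → ∑M k (λ f → φ (a ∷ const l *ₚ f))))
        ≈⟨ ∑-swap elements units _ ⟩
      ∑ units (λ l → ∑ elements (λ a → ∑M k (λ f → φ (a ∷ const l *ₚ f))))
        -- Replacing the constant term a by l a permutes its values and lets the unit l be taken out
        -- of the whole polynomial.
        ≈⟨ ∑-units-cong +-commutativeMonoid (λ l l≢0 → trans
             (sym (∑-scale +-commutativeMonoid l l≢0 (λ a → ∑M k (λ f → φ (a ∷ const l *ₚ f)))))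
             (trans (∑-cong elements (λ a → ∑-cong (monics k) (λ f → φ-cong (scaled l a (toPoly f)))))
                    (sym (∑-cartesian Vec._∷_ elements (monics k) _)))) ⟩
      T (suc k) ∎

  -- The core of every orthogonality relation: a translation multiplies the sum s by c yet leaves it
  -- unchanged.
  *-cancel-vanish : ∀ {c κ s} → (1# - c) * κ ≈ 1# → c * s ≈ s → s ≈ 0#
  *-cancel-vanish {c} {κ} {s} inv cs≈s = begin
    s                       ≈⟨ sym (*-identityˡ s) ⟩
    1# * s                  ≈⟨ *-congʳ (sym inv) ⟩
    (1# - c) * κ * s        ≈⟨ solve 3 (λ c κ s → (:1 :- c) :* κ :* s := κ :* (s :- c :* s)) refl c κ s ⟩
    κ * (s - c * s)         ≈⟨ *-congˡ (+-congˡ (-‿cong cs≈s)) ⟩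
    κ * (s - s)             ≈⟨ *-congˡ (-‿inverseʳ s) ⟩
    κ * 0#                  ≈⟨ zeroʳ κ ⟩
    0#                      ∎
    where open IntegerSolver K

-- Additive characters, Kloosterman sums and orthogonality.

-- Nontriviality is an invertible 1 - χ τ, with inverse κ, rather than an inequality: the ring K may
-- have zero divisors.
record NontrivialCharacter {q : ℕ} (F : FiniteField q) (K : CommutativeRing 0ℓ 0ℓ) : Set where
  private
    module F = FiniteField F
    module K = CommutativeRing K
  field
    χ   : F.Carrier → K.Carrier
    χ-0 : χ F.0# K.≈ K.1#
    χ-+ : ∀ x y → χ (x F.+ y) K.≈ χ x K.* χ y
    τ   : F.Carrier
    κ   : K.Carrier
    τ-nontrivial : (K.1# K.- χ τ) K.* κ K.≈ K.1#

module AdditiveCharacter {q : ℕ} (F : FiniteField q) (K : CommutativeRing 0ℓ 0ℓ)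
                         (𝕏 : NontrivialCharacter F K) where

  open NontrivialCharacter 𝕏
  open Polynomials F hiding (d)
  open PolynomialRing F
  open PolynomialSums F K
  private
    module F = FiniteField F
    module F+ = CommutativeRing F.commutativeRing
  open F using (elements; units) renaming (Carrier to 𝔽)
  open FieldSum F
  open FieldTheory F using (*-≢0; ⁻¹-≢0; -‿≢0)
  open CommutativeRing K
  open RingSum K
  open SetoidReasoning setoid

  ∑χ-elements : ∑ elements χ ≈ 0#
  ∑χ-elements = *-cancel-vanish τ-nontrivial (begin
    χ τ * ∑ elements χ              ≈⟨ sym (∑-*ˡ elements (χ τ) χ) ⟩
    ∑ elements (λ x → χ τ * χ x)    ≈⟨ ∑-cong elements (λ x → trans (*-comm _ _) (sym (χ-+ x τ))) ⟩
    ∑ elements (λ x → χ (x F.+ τ))  ≈⟨ ∑-shift +-commutativeMonoid τ χ ⟩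
    ∑ elements χ                    ∎)

  ∑χ-units : ∑ units χ ≈ - 1#
  ∑χ-units = begin
    ∑ units χ                 ≈⟨ solve 1 (λ s → s := (:1 :+ s) :- :1) refl _ ⟩
    1# + ∑ units χ - 1#       ≈⟨ +-congʳ (+-congʳ (sym χ-0)) ⟩
    χ F.0# + ∑ units χ - 1#   ≈⟨ +-congʳ (sym (∑-elements +-commutativeMonoid χ)) ⟩
    ∑ elements χ - 1#         ≈⟨ +-congʳ ∑χ-elements ⟩
    0# - 1#                   ≈⟨ +-identityˡ _ ⟩
    - 1#                      ∎
    where open IntegerSolver K

  ∑1-units : ∑ units (λ _ → 1#) ≈ qᴷ - 1#
  ∑1-units = begin
    ∑ units (λ _ → 1#)                ≈⟨ solve 1 (λ s → s := (:1 :+ s) :- :1) refl _ ⟩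
    1# + ∑ units (λ _ → 1#) - 1#      ≈⟨ +-congʳ (sym (∑-elements +-commutativeMonoid (λ _ → 1#))) ⟩
    ∑ elements (λ _ → 1#) - 1#        ≈⟨ +-congʳ (∑-const elements 1#) ⟩
    (List.length elements · 1#) * 1# - 1#  ≈⟨ +-congʳ (trans (*-identityʳ _) (reflexive (≡.cong (_· 1#) length-elements))) ⟩
    qᴷ - 1#                           ∎
    where open IntegerSolver K

  ∑χ-units-reindex : ∀ (σ ς : 𝔽 → 𝔽) → (∀ x → ¬ x ≡ F.0# → ¬ σ x ≡ F.0#) →
    (∀ x → ¬ x ≡ F.0# → ¬ ς x ≡ F.0#) → (∀ x → ¬ x ≡ F.0# → σ (ς x) ≡ x) →
    (∀ x → ¬ x ≡ F.0# → ς (σ x) ≡ x) → ∑ units (χ ∘ σ) ≈ - 1#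
  ∑χ-units-reindex σ ς σ≢0 ς≢0 σς ςσ =
    trans (∑-units-reindex +-commutativeMonoid σ ς σ≢0 ς≢0 σς ςσ χ) ∑χ-units

  -‿involutive : ∀ x → F.- (F.- x) ≡ x
  -‿involutive x = solve 1 (λ x → :- :- x := x) ≡.refl x
    where open IntegerSolver F.commutativeRing

  ∑χ-neg : ∑ units (λ l → χ (F.- l)) ≈ - 1#
  ∑χ-neg = ∑χ-units-reindex F.-_ F.-_ (λ _ → -‿≢0) (λ _ → -‿≢0) (λ x _ → -‿involutive x) (λ x _ → -‿involutive x)

  -- The map l ↦ ν / l is an involution of the units.
  ∑χ-⁻¹ : ∀ {ν} → ¬ ν ≡ F.0# → ∑ units (λ l → χ (ν F.* l F.⁻¹)) ≈ - 1#
  ∑χ-⁻¹ {ν} ν≢0 = ∑χ-units-reindex (λ l → ν F.* l F.⁻¹) (λ l → ν F.* l F.⁻¹)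
    (λ _ x≢0 → *-≢0 ν≢0 (⁻¹-≢0 x≢0)) (λ _ x≢0 → *-≢0 ν≢0 (⁻¹-≢0 x≢0)) self-inverse self-inverse
    where
    self-inverse : ∀ x → ¬ x ≡ F.0# → ν F.* (ν F.* x F.⁻¹) F.⁻¹ ≡ x
    self-inverse x x≢0 = ≡R.begin
      ν F.* y F.⁻¹                          ≡R.≡⟨ ≡.cong (F._* y F.⁻¹) (≡.sym (≡.trans
                                                  (≡.cong (ν F.*_) (⁻¹-inverseˡ x x≢0)) (F+.*-identityʳ ν))) ⟩
      ν F.* (x F.⁻¹ F.* x) F.* y F.⁻¹       ≡R.≡⟨ solve 4 (λ ν i x z → ν :* (i :* x) :* z := x :* ((ν :* i) :* z))
                                                  ≡.refl ν (x F.⁻¹) x (y F.⁻¹) ⟩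
      x F.* (y F.* y F.⁻¹)                  ≡R.≡⟨ ≡.trans (≡.cong (x F.*_) (F.*-inverse y (*-≢0 ν≢0 (⁻¹-≢0 x≢0))))
                                                          (F+.*-identityʳ x) ⟩
      x                                     ≡R.∎
      where
      module ≡R = ≡.≡-Reasoning
      open IntegerSolver F.commutativeRing
      y = ν F.* x F.⁻¹

  Kl : 𝔽 → 𝔽 → Carrier
  Kl α β = ∑ units (λ γ → χ (α F.* γ F.+ β F.* γ F.⁻¹))

  Kl-product : ∀ ν → Kl (F.- F.1#) ν ≈ ∑ units (λ l → χ (F.- l) * χ (ν F.* l F.⁻¹))
  Kl-product ν = ∑-cong units (λ l → trans
    (reflexive (≡.cong (λ x → χ (x F.+ ν F.* l F.⁻¹)) (solve 1 (λ l → :- :1 :* l := :- l) ≡.refl l)))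
    (χ-+ (F.- l) (ν F.* l F.⁻¹)))
    where open IntegerSolver F.commutativeRing

  -- With the sum over ν taken first, each l contributes -χ(-l), and the sum over l gives a second
  -- factor -1.
  ∑Kl : ∑ units (λ ν → Kl (F.- F.1#) ν) ≈ 1#
  ∑Kl = begin
    ∑ units (λ ν → Kl (F.- F.1#) ν)
      ≈⟨ ∑-cong units Kl-product ⟩
    ∑ units (λ ν → ∑ units (λ l → χ (F.- l) * χ (ν F.* l F.⁻¹)))
      ≈⟨ ∑-swap units units _ ⟩
    ∑ units (λ l → ∑ units (λ ν → χ (F.- l) * χ (ν F.* l F.⁻¹)))
      ≈⟨ ∑-units-cong +-commutativeMonoid (λ l l≢0 → trans (∑-*ˡ units (χ (F.- l)) _)
           (*-congˡ (trans (∑-cong units (λ ν → reflexive (≡.cong χ (F+.*-comm ν (l F.⁻¹)))))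
             (∑χ-units-reindex (l F.⁻¹ F.*_) (l F.*_)
               (λ _ → *-≢0 (⁻¹-≢0 l≢0)) (λ _ → *-≢0 l≢0)
               (λ x _ → *-cancelˡ⁻¹ l x l≢0) (λ x _ → ⁻¹-cancelˡ l x l≢0))))) ⟩
    ∑ units (λ l → χ (F.- l) * - 1#)
      ≈⟨ ∑-*ʳ units (- 1#) _ ⟩
    ∑ units (λ l → χ (F.- l)) * - 1#
      ≈⟨ *-congʳ ∑χ-neg ⟩
    - 1# * - 1#
      ≈⟨ solve 0 (:- :1 :* :- :1 := :1) refl ⟩
    1# ∎
    where open IntegerSolver K

  amplitude : Carrier → 𝔽 → Carrier
  amplitude c ν = ∑ units (λ l → (χ (F.- l) - c) * (χ (ν F.* l F.⁻¹) - c))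

  -- In the expanded product the two linear terms are complete character sums over the units, each
  -- equal to -1, and c² is counted q - 1 times.
  amplitude-Kl : ∀ c {ν} → ¬ ν ≡ F.0# →
    amplitude c ν ≈ Kl (F.- F.1#) ν + ((1# + 1#) * c + (qᴷ - 1#) * (c * c))
  amplitude-Kl c {ν} ν≢0 = begin
    ∑ units (λ l → (a l - c) * (b l - c))
      ≈⟨ ∑-cong units (λ l → solve 3 (λ a b c → (a :- c) :* (b :- c) := a :* b :+ (:- c :* (a :+ b) :+ :1 :* (c :* c)))
           refl (a l) (b l) c) ⟩
    ∑ units (λ l → a l * b l + (- c * (a l + b l) + 1# * (c * c)))
      ≈⟨ ∑-+ units _ _ ⟩
    ∑ units (λ l → a l * b l) + ∑ units (λ l → - c * (a l + b l) + 1# * (c * c))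
      ≈⟨ +-cong (sym (Kl-product ν)) (trans (∑-+ units _ _) (+-cong
           (trans (∑-*ˡ units (- c) _) (*-congˡ (trans (∑-+ units a b) (+-cong ∑χ-neg (∑χ-⁻¹ ν≢0)))))
           (trans (∑-*ʳ units (c * c) _) (*-congʳ ∑1-units)))) ⟩
    Kl (F.- F.1#) ν + (- c * (- 1# + - 1#) + (qᴷ - 1#) * (c * c))
      ≈⟨ +-congˡ (+-congʳ (solve 1 (λ c → :- c :* (:- :1 :+ :- :1) := (:1 :+ :1) :* c) refl c)) ⟩
    Kl (F.- F.1#) ν + ((1# + 1#) * c + (qᴷ - 1#) * (c * c)) ∎
    where
    open IntegerSolver K
    a b : 𝔽 → Carrier
    a l = χ (F.- l)
    b l = χ (ν F.* l F.⁻¹)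

  -- The total is a perfect square, as it has to be to match the squared polar factors in
  -- `polar-part`.
  ∑amplitude : ∀ c → ∑ units (amplitude c) ≈ (1# + (qᴷ - 1#) * c) * (1# + (qᴷ - 1#) * c)
  ∑amplitude c = begin
    ∑ units (amplitude c)
      ≈⟨ ∑-units-cong +-commutativeMonoid (λ ν ν≢0 → trans (amplitude-Kl c ν≢0) (+-congˡ (sym (*-identityˡ r)))) ⟩
    ∑ units (λ ν → Kl (F.- F.1#) ν + 1# * r)
      ≈⟨ ∑-+ units _ _ ⟩
    ∑ units (Kl (F.- F.1#)) + ∑ units (λ _ → 1# * r)
      ≈⟨ +-cong ∑Kl (trans (∑-*ʳ units r (λ _ → 1#)) (*-congʳ ∑1-units)) ⟩
    1# + (qᴷ - 1#) * r
      ≈⟨ solve 2 (λ m c → :1 :+ m :* ((:1 :+ :1) :* c :+ m :* (c :* c)) := (:1 :+ m :* c) :* (:1 :+ m :* c))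
           refl (qᴷ - 1#) c ⟩
    (1# + (qᴷ - 1#) * c) * (1# + (qᴷ - 1#) * c) ∎
    where
    open IntegerSolver K
    r = (1# + 1#) * c + (qᴷ - 1#) * (c * c)

  module Modulus {n : ℕ} (1≤n : 1 ℕ.≤ n) (g : Monic n) where

    open ResidueFunctional F using (pairing-cong; pairing-+; pairing-∙)
    open ResidueFunctional F using () renaming (ρ to ρ′; ρ-multiple to ρ-multiple′
      ; ρ-monic-top to ρ-monic-top′; ρ-monic-below to ρ-monic-below′)

    ρ : Poly → 𝔽
    ρ = ρ′ 1≤n g

    ψ : Poly → Carrier
    ψ h = χ (ρ h)

    ψ-cong : Congruent ψ
    ψ-cong {f} {h} f≋h = reflexive (≡.cong χ (pairing-cong {f} {h} _ f≋h))

    ψ-+ : ∀ f h → ψ (f +ₚ h) ≈ ψ f * ψ h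
    ψ-+ f h = trans (reflexive (≡.cong χ (pairing-+ f h _))) (χ-+ (ρ f) (ρ h))

    ψ-0 : ψ [] ≈ 1#
    ψ-0 = χ-0

    ψ-mod : ∀ {f h} k → f ≋ h +ₚ k *ₚ toPoly g → ψ f ≈ ψ h
    ψ-mod {f} {h} k f≋ = begin
      ψ f                              ≈⟨ ψ-cong f≋ ⟩
      ψ (h +ₚ k *ₚ toPoly g)           ≈⟨ ψ-+ h (k *ₚ toPoly g) ⟩
      ψ h * ψ (k *ₚ toPoly g)          ≈⟨ *-congˡ (trans (reflexive (≡.cong χ (ρ-multiple′ 1≤n g k))) χ-0) ⟩
      ψ h * 1#                         ≈⟨ *-identityʳ _ ⟩
      ψ h                              ∎

    ρ-const : ∀ a h → ρ (const a *ₚ h) ≡ a F.* ρ h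
    ρ-const a h = ≡.trans (pairing-cong _ (const-* a h)) (pairing-∙ a h _)

    ψ-vanish-V : ∀ b w → ψ (b *ₚ w) ≈ χ τ → ∑V n (λ y → ψ (b *ₚ y)) ≈ 0#
    ψ-vanish-V b w ψbw = *-cancel-vanish τ-nontrivial (begin
      χ τ * ∑V n (λ y → ψ (b *ₚ y))         ≈⟨ sym (∑-*ˡ (monics n) (χ τ) _) ⟩
      ∑V n (λ y → χ τ * ψ (b *ₚ y))         ≈⟨ ∑-cong (monics n) (λ v → sym (shifted (Vec.toList v))) ⟩
      ∑V n (λ y → ψ (b *ₚ (y +ₚ w)))        ≈⟨ ∑V-shift g (λ f≋h → ψ-cong (P.*-congˡ {b} f≋h))
                                                 (λ h k → ψ-mod (b *ₚ k) (solve 4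
                                                   (λ b h k g → b :* (h :+ k :* g) := b :* h :+ (b :* k) :* g)
                                                   P.refl b h k (toPoly g))) w ⟩
      ∑V n (λ y → ψ (b *ₚ y))               ∎)
      where
      open IntegerSolver polyRing
      shifted : ∀ y → ψ (b *ₚ (y +ₚ w)) ≈ χ τ * ψ (b *ₚ y)
      shifted y = trans (ψ-cong (P.distribˡ b y w)) (trans (ψ-+ (b *ₚ y) (b *ₚ w)) (trans (*-congˡ ψbw) (*-comm _ _)))

    -- Same translation argument as for residues; here w must have degree less than k, so that
    -- adding it preserves the monic polynomials of degree k.
    ψ-vanish-M : ∀ k b w → SmallSeq k (coeff w) → ψ (b *ₚ w) ≈ χ τ → ∑M k (λ y → ψ (b *ₚ y)) ≈ 0#
    ψ-vanish-M k b w small ψbw = *-cancel-vanish τ-nontrivial (begin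
      χ τ * ∑M k (λ y → ψ (b *ₚ y))         ≈⟨ sym (∑-*ˡ (monics k) (χ τ) _) ⟩
      ∑M k (λ y → χ τ * ψ (b *ₚ y))         ≈⟨ ∑-cong (monics k) (λ v → sym (shifted (toPoly v))) ⟩
      ∑M k (λ y → ψ (b *ₚ (y +ₚ w)))        ≈⟨ ∑M-shift k (λ f≋h → ψ-cong (P.*-congˡ {b} f≋h)) w small ⟩
      ∑M k (λ y → ψ (b *ₚ y))               ∎)
      where
      shifted : ∀ y → ψ (b *ₚ (y +ₚ w)) ≈ χ τ * ψ (b *ₚ y)
      shifted y = trans (ψ-cong (P.distribˡ b y w)) (trans (ψ-+ (b *ₚ y) (b *ₚ w)) (trans (*-congˡ ψbw) (*-comm _ _)))

    ρ-product : ∀ l {m k} (f : Monic m) (h : Monic k) →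
                ρ (const l *ₚ toPoly f *ₚ toPoly h) ≡ l F.* ρ (toPoly (f ⊛ h))
    ρ-product l f h = ≡.trans (pairing-cong _ (P.trans (P.*-assoc (const l) (toPoly f) (toPoly h))
      (P.*-congˡ {const l} (P.sym (toPoly-⊛ f h))))) (ρ-const l (toPoly (f ⊛ h)))

    -- The polynomial (τ / l) T^j, built so that its product with l f has ρ-value τ when deg f + j =
    -- n - 1. It is the translation that detects cancellation in the sums below.
    dual : 𝔽 → ℕ → Poly
    dual l j = const (l F.⁻¹ F.* τ) *ₚ toPoly (Vec.replicate j F.0#)

    dual-small : ∀ l j → SmallSeq (suc j) (coeff (dual l j))
    dual-small l j k j<k = ≡.trans (const-* (l F.⁻¹ F.* τ) (toPoly (Vec.replicate j F.0#)) .at k)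
      (≡.trans (coeff-∙ _ (toPoly (Vec.replicate j F.0#)) k)
        (≡.trans (≡.cong (_ F.*_) (proj₂ (toPoly-monic (Vec.replicate j F.0#)) k j<k)) (F+.zeroʳ _)))

    ψ-dual : ∀ {l} → ¬ l ≡ F.0# → ∀ {m} (f : Monic m) j → suc (m ℕ.+ j) ≡ n →
             ψ (const l *ₚ toPoly f *ₚ dual l j) ≈ χ τ
    ψ-dual {l} l≢0 f j eq = reflexive (≡.cong χ (≡.trans
      (pairing-cong _ (P.trans (solve 4 (λ l f t x → l :* f :* (t :* x) := t :* (l :* f :* x)) P.refl
        (const l) (toPoly f) (const (l F.⁻¹ F.* τ)) X) P.refl))
      (≡.trans (ρ-const (l F.⁻¹ F.* τ) (const l *ₚ toPoly f *ₚ X))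
      (≡.trans (≡.cong ((l F.⁻¹ F.* τ) F.*_) (≡.trans (ρ-product l f (Vec.replicate j F.0#))
        (≡.cong (l F.*_) (ρ-monic-top′ 1≤n g (f ⊛ Vec.replicate j F.0#) eq))))
      (≡.trans (𝔽-solve 3 (λ i t l → (i :*′ t) :*′ (l :*′ :1′) :=′ i :*′ (l :*′ t)) ≡.refl (l F.⁻¹) τ l)
        (*-cancelˡ⁻¹ l τ l≢0))))))
      where
      open IntegerSolver polyRing
      open IntegerSolver F.commutativeRing using ()
        renaming (solve to 𝔽-solve; _:*_ to _:*′_; _:=_ to _:=′_; :1 to :1′)
      X = toPoly (Vec.replicate j F.0#)

    -- The factor b is undone modulo g by b̄, so b̄ times `dual` is a translation on which the
    -- character takes the value χ τ.
    ψ-vanish-monic : ∀ {l} → ¬ l ≡ F.0# → ∀ {m} (f : Monic m) → m ℕ.< n → ∀ b b̄ k →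
      b *ₚ b̄ ≋ 1ₚ +ₚ k *ₚ toPoly g → ∑V n (λ y → ψ (b *ₚ (const l *ₚ toPoly f) *ₚ y)) ≈ 0#
    ψ-vanish-monic {l} l≢0 {m} f m<n b b̄ k bb̄≋1 =
      ψ-vanish-V (b *ₚ x) (b̄ *ₚ d) (trans (ψ-mod (k *ₚ (x *ₚ d)) (P.trans
        (solve 4 (λ b x b̄ d → b :* x :* (b̄ :* d) := b :* b̄ :* (x :* d)) P.refl b x b̄ d)
        (P.trans (P.*-congʳ {x *ₚ d} bb̄≋1)
          (solve 3 (λ k g z → (:1 :+ k :* g) :* z := z :+ (k :* z) :* g) P.refl k (toPoly g) (x *ₚ d)))))
        (ψ-dual l≢0 f (n ∸ suc m) (ℕ.m+[n∸m]≡n m<n)))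
      where
      open IntegerSolver polyRing
      x = const l *ₚ toPoly f
      d = dual l (n ∸ suc m)

    -- If deg(f h) < n - 1, then f h / g has no 1/T term and every summand is 1. In degree n - 1,
    -- treated next, that term is the leading coefficient l.
    gauss-below : ∀ l {m} (f : Monic m) k → suc (m ℕ.+ k) ℕ.< n →
                  ∑M k (λ h → ψ (const l *ₚ toPoly f *ₚ h)) ≈ qᴷ ^ k
    gauss-below l f k lt = trans (∑-cong (monics k) (λ h → trans (reflexive (≡.cong χ (≡.trans (ρ-product l f h)
        (≡.trans (≡.cong (l F.*_) (ρ-monic-below′ 1≤n g (f ⊛ h) lt)) (F+.zeroʳ l))))) χ-0))
      (trans (∑-monics-const k 1#) (*-identityʳ _))

    gauss-top : ∀ l {m} (f : Monic m) k → suc (m ℕ.+ k) ≡ n →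
                ∑M k (λ h → ψ (const l *ₚ toPoly f *ₚ h)) ≈ qᴷ ^ k * χ l
    gauss-top l f k eq = trans (∑-cong (monics k) (λ h → reflexive (≡.cong χ (≡.trans (ρ-product l f h)
        (≡.trans (≡.cong (l F.*_) (ρ-monic-top′ 1≤n g (f ⊛ h) eq)) (F+.*-identityʳ l))))))
      (∑-monics-const k (χ l))

    -- Here h has room for the translation by `dual l j`, whose degree is below that of h, and the
    -- sum cancels.
    gauss-above : ∀ {l} → ¬ l ≡ F.0# → ∀ {m} (f : Monic m) j k → suc (m ℕ.+ j) ≡ n → j ℕ.< k →
                  ∑M k (λ h → ψ (const l *ₚ toPoly f *ₚ h)) ≈ 0#
    gauss-above {l} l≢0 f j k eq j<k = ψ-vanish-M k (const l *ₚ toPoly f) (dual l j)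
      (λ i k≤i → dual-small l j i (ℕ.≤-trans j<k k≤i)) (ψ-dual l≢0 f j eq)

-- The functional equation as an identity in a commutative ring.

module FunctionalEquation {q : ℕ} (F : FiniteField q) (K : CommutativeRing 0ℓ 0ℓ)
  (𝕏 : NontrivialCharacter F K) {n : ℕ} (1≤n : 1 ℕ.≤ n) (g : Polynomials.Monic F n) where

  open Polynomials F hiding (d; top)
  open PolynomialRing F
  open PolynomialSums F K
  open NontrivialCharacter 𝕏
  open AdditiveCharacter F K 𝕏
  open Modulus 1≤n g
  private
    module F = FiniteField F
    module F+ = CommutativeRing F.commutativeRing
  open F using (units) renaming (Carrier to 𝔽)
  open FieldSum F
  open FieldTheory F using (*-≢0; ⁻¹-≢0; -‿≢0)
  open CommutativeRing K
  open RingSum K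
  open SemiringExp semiring using (^-homo-*; ^-congˡ)
  open CommSemiringExp commutativeSemiring using (^-distrib-*)
  open SetoidReasoning setoid

  weight : Carrier → Carrier → ℕ → Carrier
  weight u c i with i ℕ.<? n
  ... | yes _ = u ^ i
  ... | no  _ = u ^ i * c

  weight-< : ∀ u c {i} → i ℕ.< n → weight u c i ≈ u ^ i
  weight-< u c {i} i<n with i ℕ.<? n
  ... | yes _  = refl
  ... | no i≮n = contradiction i<n i≮n

  weight-n : ∀ u c → weight u c n ≈ u ^ n * c
  weight-n u c with n ℕ.<? n
  ... | yes n<n = contradiction n<n (ℕ.n≮n n)
  ... | no _    = refl

  -- The indices i < n stand for the monic residues of degree i, the index n
  -- for all residues.
  embed : ∀ i → Vec 𝔽 i → Poly
  embed i v with i ℕ.<? n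
  ... | yes _ = toPoly v
  ... | no  _ = Vec.toList v

  embed-< : ∀ {i} → i ℕ.< n → ∀ v → embed i v ≡ toPoly v
  embed-< {i} i<n v with i ℕ.<? n
  ... | yes _  = ≡.refl
  ... | no i≮n = contradiction i<n i≮n

  embed-n : ∀ v → embed n v ≡ Vec.toList v
  embed-n v with n ℕ.<? n
  ... | yes n<n = contradiction n<n (ℕ.n≮n n)
  ... | no _    = ≡.refl

  ∑E : ℕ → (Poly → Carrier) → Carrier
  ∑E i φ = ∑ (monics i) (λ v → φ (embed i v))

  ∑E-< : ∀ {i} → i ℕ.< n → ∀ φ → ∑E i φ ≈ ∑M i φ
  ∑E-< i<n φ = ∑-cong (monics _) (λ v → reflexive (≡.cong φ (embed-< i<n v)))

  ∑E-n : ∀ φ → ∑E n φ ≈ ∑V n φ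
  ∑E-n φ = ∑-cong (monics n) (λ v → reflexive (≡.cong φ (embed-n v)))

  Z : (ℕ → Carrier) → (Poly → Carrier) → Carrier
  Z C φ = ∑ (List.upTo (suc n)) (λ i → C i * ∑E i φ)

  Z-cong : ∀ C {φ φ′} → (∀ x → φ x ≈ φ′ x) → Z C φ ≈ Z C φ′
  Z-cong C φ≈ = ∑-cong (List.upTo (suc n)) (λ i → *-congˡ (∑-cong (monics i) (λ v → φ≈ (embed i v))))

  Z-*ˡ : ∀ C a φ → Z C (λ x → a * φ x) ≈ a * Z C φ
  Z-*ˡ C a φ = trans (∑-cong (List.upTo (suc n)) (λ i → trans (*-congˡ (∑-*ˡ (monics i) a _))
    (solve 3 (λ c a s → c :* (a :* s) := a :* (c :* s)) refl (C i) a _))) (∑-*ˡ (List.upTo (suc n)) a _)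
    where open IntegerSolver K

  Z-*ʳ : ∀ C a φ → Z C (λ x → φ x * a) ≈ Z C φ * a
  Z-*ʳ C a φ = trans (Z-cong C (λ x → *-comm (φ x) a)) (trans (Z-*ˡ C a φ) (*-comm a _))

  Z-∑ : ∀ {A : Set} C (xs : List A) (φ : Poly → A → Carrier) →
        Z C (λ x → ∑ xs (φ x)) ≈ ∑ xs (λ a → Z C (λ x → φ x a))
  Z-∑ C xs φ = begin
    Z C (λ x → ∑ xs (φ x))
      ≈⟨ ∑-cong (List.upTo (suc n)) (λ i → trans (*-congˡ (∑-swap (monics i) xs _)) (sym (∑-*ˡ xs (C i) _))) ⟩
    ∑ (List.upTo (suc n)) (λ i → ∑ xs (λ a → C i * ∑E i (λ x → φ x a)))
      ≈⟨ ∑-swap (List.upTo (suc n)) xs _ ⟩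
    ∑ xs (λ a → Z C (λ x → φ x a)) ∎

  Z-∑V∑V : ∀ C (G : Poly → Poly → Poly → Carrier) → Z C (λ x → ∑V n (λ w → ∑V n (λ z → G w z x))) ≈
           ∑V n (λ w → ∑V n (λ z → Z C (G w z)))
  Z-∑V∑V C G = trans (Z-∑ C (monics n) (λ x w → ∑V n (λ z → G (Vec.toList w) z x)))
    (∑-cong (monics n) (λ w → Z-∑ C (monics n) (λ x z → G (Vec.toList w) (Vec.toList z) x)))

  Z-split : ∀ u c φ → Z (weight u c) φ ≈
            ∑ (List.upTo n) (λ i → u ^ i * ∑M i φ) + u ^ n * c * ∑V n φ
  Z-split u c φ = trans (∑-upTo-snoc n _) (+-cong
    (∑-upTo-cong n (λ i i<n → *-cong (weight-< u c i<n) (∑E-< i<n φ)))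
    (*-cong (weight-n u c) (∑E-n φ)))

  geometric : ∀ {x c} → (1# - x) * c ≈ 1# → ∀ j → ∑ (List.upTo j) (x ^_) + x ^ j * c ≈ c
  geometric {x} {c} inv zero    = trans (+-identityˡ _) (*-identityˡ c)
  geometric {x} {c} inv (suc j) = begin
    ∑ (List.upTo (suc j)) (x ^_) + x * x ^ j * c
      ≈⟨ +-congʳ (∑-upTo-snoc j (x ^_)) ⟩
    ∑ (List.upTo j) (x ^_) + x ^ j + x * x ^ j * c
      ≈⟨ solve 4 (λ s y x c → s :+ y :+ x :* y :* c := s :+ y :* c :+ y :* (:1 :- (:1 :- x) :* c)) refl _ (x ^ j) x c ⟩
    ∑ (List.upTo j) (x ^_) + x ^ j * c + x ^ j * (1# - (1# - x) * c)
      ≈⟨ +-cong (geometric inv j) (*-congˡ (trans (+-congˡ (-‿cong inv)) (-‿inverseʳ 1#))) ⟩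
    c + x ^ j * 0#
      ≈⟨ trans (+-congˡ (zeroʳ _)) (+-identityʳ c) ⟩
    c ∎
    where open IntegerSolver K

  D : Carrier → Carrier → Poly → Carrier
  D u c a = Z (weight u c) (λ x → Z (weight u c) (λ y → ψ (a *ₚ x *ₚ y)))

  module _ {u c v} (inv : (1# - qᴷ * u) * c ≈ 1#) (quv≈1 : qᴷ * u * v ≈ 1#) where

    private
      E : Carrier
      E = (qᴷ * u) ^ (n ∸ 1)

    Ẑ : Poly → Carrier
    Ẑ x = Z (weight u c) (λ y → ψ (x *ₚ y))

    Ẑ-0 : Ẑ [] ≈ c
    Ẑ-0 = begin
      Z (weight u c) (λ y → ψ [])
        ≈⟨ Z-split u c (λ _ → ψ []) ⟩
      ∑ (List.upTo n) (λ i → u ^ i * ∑M i (λ _ → ψ [])) + u ^ n * c * ∑V n (λ _ → ψ [])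
        ≈⟨ +-cong (∑-cong (List.upTo n) (λ i → trans (*-congˡ (count i)) (trans (*-comm _ _) (sym (^-distrib-* qᴷ u i)))))
                  (trans (*-congˡ (count n)) (trans (solve 3 (λ u c q → u :* c :* q := q :* u :* c) refl _ c _)
                    (*-congʳ (sym (^-distrib-* qᴷ u n))))) ⟩
      ∑ (List.upTo n) ((qᴷ * u) ^_) + (qᴷ * u) ^ n * c
        ≈⟨ geometric inv n ⟩
      c ∎
      where
      open IntegerSolver K
      count : ∀ i → ∑ (monics i) (λ _ → ψ []) ≈ qᴷ ^ i
      count i = trans (∑-cong (monics i) (λ _ → ψ-0)) (trans (∑-monics-const i 1#) (*-identityʳ _))

    -- The degree of y is compared with j = n - 1 - m. Below j the sums form a geometric series, at
    -- j the factor χ l appears, beyond j and over all residues they vanish. Finally (qu)^j =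
    -- (qu)^(n-1) v^m because q u v = 1.
    Ẑ-monic : ∀ {l} → ¬ l ≡ F.0# → ∀ {m} (f : Monic m) → m ℕ.< n →
              Ẑ (const l *ₚ toPoly f) ≈ c + E * (v ^ m * (χ l - c))
    Ẑ-monic {l} l≢0 {m} f m<n = begin
      Z (weight u c) φ
        ≈⟨ Z-split u c φ ⟩
      ∑ (List.upTo n) T + u ^ n * c * ∑V n φ
        ≈⟨ +-cong (reflexive (≡.cong (λ k → ∑ (List.upTo k) T) (≡.sym j+1+m≡n)))
                  (trans (*-congˡ (trans (∑-cong (monics n) (λ y → ψ-cong (P.*-congʳ {Vec.toList y}
                                           (P.sym (P.*-identityˡ (const l *ₚ toPoly f))))))
                    (ψ-vanish-monic l≢0 f m<n 1ₚ 1ₚ [] (P.*-identityˡ 1ₚ)))) (zeroʳ _)) ⟩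
      ∑ (List.upTo (j ℕ.+ suc m)) T + 0#
        ≈⟨ trans (+-identityʳ _) (∑-upTo-+ j (suc m) T) ⟩
      ∑ (List.upTo j) T + ∑ (List.upTo (suc m)) (λ i → T (j ℕ.+ i))
        ≈⟨ +-cong (∑-upTo-cong j below)
             (trans (reflexive (∑-upTo-suc m (λ i → T (j ℕ.+ i))))
               (+-cong (trans (reflexive (≡.cong T (ℕ.+-identityʳ j))) top) (∑-upTo-zero m above))) ⟩
      -- Adding and subtracting (qu)^j c completes the truncated geometric series to c and leaves χ
      -- l - c.
      ∑ (List.upTo j) ((qᴷ * u) ^_) + ((qᴷ * u) ^ j * χ l + 0#)
        ≈⟨ solve 4 (λ s y c x → s :+ (y :* x :+ :0) := (s :+ y :* c) :+ y :* (x :- c))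
             refl _ ((qᴷ * u) ^ j) c (χ l) ⟩
      ∑ (List.upTo j) ((qᴷ * u) ^_) + (qᴷ * u) ^ j * c + (qᴷ * u) ^ j * (χ l - c)
        ≈⟨ +-cong (geometric inv j) (*-congʳ power) ⟩
      c + E * v ^ m * (χ l - c)
        ≈⟨ +-congˡ (*-assoc _ _ _) ⟩
      c + E * (v ^ m * (χ l - c)) ∎
      where
      open IntegerSolver K
      φ : Poly → Carrier
      φ y = ψ (const l *ₚ toPoly f *ₚ y)
      T : ℕ → Carrier
      T i = u ^ i * ∑M i φ
      j = n ∸ suc m
      m+1+j≡n : suc (m ℕ.+ j) ≡ n
      m+1+j≡n = ℕ.m+[n∸m]≡n m<n
      j+1+m≡n : j ℕ.+ suc m ≡ n
      j+1+m≡n = ℕ.m∸n+n≡m m<n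
      collect : ∀ i → u ^ i * qᴷ ^ i ≈ (qᴷ * u) ^ i
      collect i = trans (*-comm _ _) (sym (^-distrib-* qᴷ u i))
      below : ∀ i → i ℕ.< j → T i ≈ (qᴷ * u) ^ i
      below i i<j = trans (*-congˡ (gauss-below l f i
        (≡.subst (suc (m ℕ.+ i) ℕ.<_) m+1+j≡n (s≤s (ℕ.+-monoʳ-< m i<j))))) (collect i)
      top : T j ≈ (qᴷ * u) ^ j * χ l
      top = trans (*-congˡ (gauss-top l f j m+1+j≡n)) (trans (sym (*-assoc _ _ _)) (*-congʳ (collect j)))
      above : ∀ i → i ℕ.< m → T (j ℕ.+ suc i) ≈ 0#
      above i _ = trans (*-congˡ (gauss-above l≢0 f j (j ℕ.+ suc i) m+1+j≡n
        (ℕ.m<m+n j (s≤s z≤n)))) (zeroʳ _)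
      power : (qᴷ * u) ^ j ≈ E * v ^ m
      power = begin
        (qᴷ * u) ^ j                             ≈⟨ sym (*-identityʳ _) ⟩
        (qᴷ * u) ^ j * 1#                        ≈⟨ *-congˡ (sym (trans (^-congˡ m quv≈1) (1^ m))) ⟩
        (qᴷ * u) ^ j * (qᴷ * u * v) ^ m          ≈⟨ *-congˡ (^-distrib-* (qᴷ * u) v m) ⟩
        (qᴷ * u) ^ j * ((qᴷ * u) ^ m * v ^ m)    ≈⟨ sym (*-assoc _ _ _) ⟩
        (qᴷ * u) ^ j * (qᴷ * u) ^ m * v ^ m      ≈⟨ *-congʳ (sym (^-homo-* (qᴷ * u) j m)) ⟩
        (qᴷ * u) ^ (j ℕ.+ m) * v ^ m             ≈⟨ *-congʳ (reflexive (≡.cong ((qᴷ * u) ^_)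
                                                      (≡.cong (_∸ 1) (≡.trans (≡.sym (ℕ.+-suc j m)) j+1+m≡n)))) ⟩
        E * v ^ m                                ∎

  polynomialPart : Poly → Carrier → Carrier
  polynomialPart a u = ∑ (List.upTo n) (λ i → ∑ (List.upTo n) (λ j →
    u ^ i * u ^ j * ∑M i (λ x → ∑M j (λ y → ψ (a *ₚ x *ₚ y)))))

  module _ (a ā k : Poly) (aā≋1 : a *ₚ ā ≋ 1ₚ +ₚ k *ₚ toPoly g) where

    orthogonal-0 : ∑V n (λ z → ψ (a *ₚ [] *ₚ z)) ≈ qᴷ ^ n
    orthogonal-0 = trans (∑-cong (monics n) (λ v → trans (ψ-cong (P.trans
      (P.*-congʳ {Vec.toList v} (P.zeroʳ a)) P.refl)) ψ-0)) (trans (∑-monics-const n 1#) (*-identityʳ _))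

    -- The inner sum vanishes unless w = 0, because a is invertible modulo g.
    ∑∑ψ : ∑V n (λ w → ∑V n (λ z → ψ (a *ₚ w *ₚ z))) ≈ qᴷ ^ n
    ∑∑ψ = trans (∑V-by-degree n (λ f≋h → ∑-cong (monics n) (λ v → ψ-cong
        (P.*-congʳ {Vec.toList v} (P.*-congˡ {a} f≋h)))))
      (trans (+-cong orthogonal-0 (∑-upTo-zero n (λ m m<n → trans
        (∑-units-cong +-commutativeMonoid (λ l l≢0 → ∑-zero (monics m) (λ f →
          ψ-vanish-monic l≢0 f m<n a ā k aā≋1)))
        (∑-zero units (λ _ → refl))))) (+-identityʳ _))

    ψ-vanish : ∀ {m} (f : Monic m) → m ℕ.< n → ∑V n (λ y → ψ (a *ₚ toPoly f *ₚ y)) ≈ 0#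
    ψ-vanish f m<n = trans (∑-cong (monics n) (λ y → ψ-cong (P.*-congʳ {Vec.toList y}
        (P.*-congˡ {a} (P.sym (P.*-identityˡ (toPoly f)))))))
      (ψ-vanish-monic (F.0≢1 ∘ ≡.sym) f m<n a ā k aā≋1)

    -- A block that pairs the monic residues of one degree with all residues vanishes by
    -- orthogonality. Only the block of all residues against all residues brings in c, and it does
    -- so squared.
    D≈polynomialPart : ∀ u c → D u c a ≈ polynomialPart a u + u ^ n * c * (u ^ n * c) * qᴷ ^ n
    D≈polynomialPart u c = begin
      D u c a
        ≈⟨ Z-split u c G ⟩
      ∑ (List.upTo n) (λ i → u ^ i * ∑M i G) + N * ∑V n G
        ≈⟨ +-cong (∑-upTo-cong n monic-part) (*-congˡ full-part) ⟩
      polynomialPart a u + N * (N * qᴷ ^ n)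
        ≈⟨ +-congˡ (sym (*-assoc _ _ _)) ⟩
      polynomialPart a u + N * N * qᴷ ^ n ∎
      where
      N = u ^ n * c
      G : Poly → Carrier
      G x = Z (weight u c) (λ y → ψ (a *ₚ x *ₚ y))
      monic-part : ∀ i → i ℕ.< n → u ^ i * ∑M i G ≈ ∑ (List.upTo n) (λ j →
        u ^ i * u ^ j * ∑M i (λ x → ∑M j (λ y → ψ (a *ₚ x *ₚ y))))
      monic-part i i<n = begin
        u ^ i * ∑M i G
          ≈⟨ *-congˡ (∑-cong (monics i) (λ f → trans (Z-split u c (λ y → ψ (a *ₚ toPoly f *ₚ y)))
               (trans (+-congˡ (trans (*-congˡ (ψ-vanish f i<n)) (zeroʳ N))) (+-identityʳ _)))) ⟩
        u ^ i * ∑M i (λ x → ∑ (List.upTo n) (λ j → u ^ j * ∑M j (λ y → ψ (a *ₚ x *ₚ y))))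
          ≈⟨ *-congˡ (trans (∑-swap (monics i) (List.upTo n) _)
               (∑-cong (List.upTo n) (λ j → ∑-*ˡ (monics i) (u ^ j) _))) ⟩
        u ^ i * ∑ (List.upTo n) (λ j → u ^ j * ∑M i (λ x → ∑M j (λ y → ψ (a *ₚ x *ₚ y))))
          ≈⟨ trans (sym (∑-*ˡ (List.upTo n) (u ^ i) _)) (∑-cong (List.upTo n) (λ j → sym (*-assoc _ _ _))) ⟩
        ∑ (List.upTo n) (λ j → u ^ i * u ^ j * ∑M i (λ x → ∑M j (λ y → ψ (a *ₚ x *ₚ y)))) ∎
      full-part : ∑V n G ≈ N * qᴷ ^ n
      full-part = begin
        ∑V n G
          ≈⟨ ∑-cong (monics n) (λ v → Z-split u c (λ y → ψ (a *ₚ Vec.toList v *ₚ y))) ⟩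
        ∑V n (λ x → ∑ (List.upTo n) (λ j → u ^ j * ∑M j (λ y → ψ (a *ₚ x *ₚ y))) + N * ∑V n (λ y → ψ (a *ₚ x *ₚ y)))
          ≈⟨ trans (∑-+ (monics n) _ _) (+-cong (∑-swap (monics n) (List.upTo n) _) (∑-*ˡ (monics n) N _)) ⟩
        ∑ (List.upTo n) (λ j → ∑V n (λ x → u ^ j * ∑M j (λ y → ψ (a *ₚ x *ₚ y)))) +
        N * ∑V n (λ x → ∑V n (λ y → ψ (a *ₚ x *ₚ y)))
          ≈⟨ +-cong (∑-upTo-zero n cross) (*-congˡ ∑∑ψ) ⟩
        0# + N * qᴷ ^ n
          ≈⟨ +-identityˡ _ ⟩
        N * qᴷ ^ n ∎
        where
        open IntegerSolver polyRing
        cross : ∀ j → j ℕ.< n → ∑V n (λ x → u ^ j * ∑M j (λ y → ψ (a *ₚ x *ₚ y))) ≈ 0#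
        cross j j<n = begin
          ∑V n (λ x → u ^ j * ∑M j (λ y → ψ (a *ₚ x *ₚ y)))
            ≈⟨ trans (∑-*ˡ (monics n) (u ^ j) _) (*-congˡ (∑-swap (monics n) (monics j) _)) ⟩
          u ^ j * ∑M j (λ y → ∑V n (λ x → ψ (a *ₚ x *ₚ y)))
            ≈⟨ *-congˡ (∑-zero (monics j) (λ f → trans (∑-cong (monics n) (λ v → ψ-cong
                 (solve 3 (λ a x y → a :* x :* y := a :* y :* x) P.refl a (Vec.toList v) (toPoly f))))
                 (ψ-vanish f j<n))) ⟩
          u ^ j * 0#
            ≈⟨ zeroʳ _ ⟩
          0# ∎

  -- Poisson summation: completing the product c x y by translations modulo g
  -- separates the variables x and y.
  separation : ∀ c c̄ k → c *ₚ c̄ ≋ 1ₚ +ₚ k *ₚ toPoly g → ∀ x y →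
    ∑V n (λ w → ∑V n (λ z → ψ (-ₚ w *ₚ y) * ψ (z *ₚ x) * ψ (c̄ *ₚ w *ₚ z))) ≈ qᴷ ^ n * ψ (c *ₚ x *ₚ y)
  separation c c̄ k cc̄≋1 x y = begin
    ∑V n (λ w → ∑V n (λ z → ψ (-ₚ w *ₚ y) * ψ (z *ₚ x) * ψ (c̄ *ₚ w *ₚ z)))
      ≈⟨ ∑-cong (monics n) (λ w → ∑-cong (monics n) (λ z → sym (merge (Vec.toList w) (Vec.toList z)))) ⟩
    ∑V n (λ w → ∑V n (λ z → ψ (Q w z)))
      ≈⟨ sym (∑V-shift g (λ f≋h → ∑-cong (monics n) (λ z → ψ-cong (Q-cong (Vec.toList z) f≋h)))
           (λ h k′ → ∑-cong (monics n) (λ z → ψ-mod {h = Q h (Vec.toList z)} (-ₚ k′ *ₚ y +ₚ c̄ *ₚ k′ *ₚ Vec.toList z) (solve 7 (λ h k g y z x c̄ →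
             :- (h :+ k :* g) :* y :+ z :* x :+ c̄ :* (h :+ k :* g) :* z :=
             (:- h :* y :+ z :* x :+ c̄ :* h :* z) :+ (:- k :* y :+ c̄ :* k :* z) :* g)
             P.refl h k′ (toPoly g) y (Vec.toList z) x c̄))) (-ₚ (c *ₚ x))) ⟩
    -- The shift of w by -c x is chosen so that c̄ w z releases -z x modulo g, which cancels the
    -- term z x, while -w y releases c x y. The later shift of z by c y removes -w y in the same
    -- way.
    ∑V n (λ w → ∑V n (λ z → ψ (Q (w +ₚ -ₚ (c *ₚ x)) z)))
      ≈⟨ ∑-cong (monics n) (λ w → trans (∑-cong (monics n) (λ z → first-shift (Vec.toList w) (Vec.toList z)))
           (∑-*ˡ (monics n) (ψ (c *ₚ x *ₚ y)) _)) ⟩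
    ∑V n (λ w → ψ (c *ₚ x *ₚ y) * ∑V n (λ z → ψ (c̄ *ₚ w *ₚ z +ₚ -ₚ w *ₚ y)))
      ≈⟨ ∑-*ˡ (monics n) (ψ (c *ₚ x *ₚ y)) _ ⟩
    ψ (c *ₚ x *ₚ y) * ∑V n (λ w → ∑V n (λ z → ψ (c̄ *ₚ w *ₚ z +ₚ -ₚ w *ₚ y)))
      ≈⟨ *-congˡ (∑-cong (monics n) (λ w → second-shift (Vec.toList w))) ⟩
    ψ (c *ₚ x *ₚ y) * ∑V n (λ w → ∑V n (λ z → ψ (c̄ *ₚ w *ₚ z)))
      ≈⟨ trans (*-congˡ (∑∑ψ c̄ c k (P.trans (P.*-comm c̄ c) cc̄≋1))) (*-comm _ _) ⟩
    qᴷ ^ n * ψ (c *ₚ x *ₚ y) ∎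
    where
    open IntegerSolver polyRing
    Q : Poly → Poly → Poly
    Q w z = -ₚ w *ₚ y +ₚ z *ₚ x +ₚ c̄ *ₚ w *ₚ z
    Q-cong : ∀ z {w w′} → w ≋ w′ → Q w z ≋ Q w′ z
    Q-cong z w≋ = P.+-cong (P.+-congʳ {z *ₚ x} (P.*-congʳ {y} (P.-‿cong w≋))) (P.*-congʳ {z} (P.*-congˡ {c̄} w≋))
    merge : ∀ w z → ψ (Q w z) ≈ ψ (-ₚ w *ₚ y) * ψ (z *ₚ x) * ψ (c̄ *ₚ w *ₚ z)
    merge w z = trans (ψ-+ (-ₚ w *ₚ y +ₚ z *ₚ x) (c̄ *ₚ w *ₚ z)) (*-congʳ (ψ-+ (-ₚ w *ₚ y) (z *ₚ x)))
    first-shift : ∀ w z → ψ (Q (w +ₚ -ₚ (c *ₚ x)) z) ≈ ψ (c *ₚ x *ₚ y) * ψ (c̄ *ₚ w *ₚ z +ₚ -ₚ w *ₚ y)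
    first-shift w z = trans (ψ-mod (-ₚ (k *ₚ z *ₚ x)) (P.trans
      (solve 6 (λ w c x z y c̄ → :- (w :+ :- (c :* x)) :* y :+ z :* x :+ c̄ :* (w :+ :- (c :* x)) :* z :=
          (c :* x :* y :+ (c̄ :* w :* z :+ :- w :* y)) :+ (:1 :- c :* c̄) :* (z :* x)) P.refl w c x z y c̄)
      (P.+-congˡ {c *ₚ x *ₚ y +ₚ (c̄ *ₚ w *ₚ z +ₚ -ₚ w *ₚ y)} (P.trans
        (P.*-congʳ {z *ₚ x} (P.+-congˡ {1ₚ} (P.-‿cong cc̄≋1)))
        (solve 4 (λ k g z x → (:1 :- (:1 :+ k :* g)) :* (z :* x) := :- (k :* z :* x) :* g) P.refl k (toPoly g) z x)))))
      (ψ-+ (c *ₚ x *ₚ y) (c̄ *ₚ w *ₚ z +ₚ -ₚ w *ₚ y))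
    second-shift : ∀ w → ∑V n (λ z → ψ (c̄ *ₚ w *ₚ z +ₚ -ₚ w *ₚ y)) ≈ ∑V n (λ z → ψ (c̄ *ₚ w *ₚ z))
    second-shift w = begin
      ∑V n (λ z → ψ (c̄ *ₚ w *ₚ z +ₚ -ₚ w *ₚ y))
        ≈⟨ sym (∑V-shift g (λ f≋h → ψ-cong (P.+-congʳ { -ₚ w *ₚ y} (P.*-congˡ {c̄ *ₚ w} f≋h)))
             (λ h k′ → ψ-mod (c̄ *ₚ w *ₚ k′) (solve 6 (λ c̄ w h k g y →
               c̄ :* w :* (h :+ k :* g) :+ :- w :* y := (c̄ :* w :* h :+ :- w :* y) :+ (c̄ :* w :* k) :* g)
               P.refl c̄ w h k′ (toPoly g) y)) (c *ₚ y)) ⟩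
      ∑V n (λ z → ψ (c̄ *ₚ w *ₚ (z +ₚ c *ₚ y) +ₚ -ₚ w *ₚ y))
        ≈⟨ ∑-cong (monics n) (λ z → ψ-mod (k *ₚ w *ₚ y) (P.trans
             (solve 5 (λ c̄ w z c y → c̄ :* w :* (z :+ c :* y) :+ :- w :* y :=
               c̄ :* w :* z :+ (c :* c̄ :- :1) :* (w :* y)) P.refl c̄ w (Vec.toList z) c y)
             (P.+-congˡ {c̄ *ₚ w *ₚ Vec.toList z} (P.trans
               (P.*-congʳ {w *ₚ y} (P.+-congʳ { -ₚ 1ₚ} cc̄≋1))
               (solve 4 (λ k g w y → (:1 :+ k :* g :- :1) :* (w :* y) := (k :* w :* y) :* g)
                 P.refl k (toPoly g) w y))))) ⟩
      ∑V n (λ z → ψ (c̄ *ₚ w *ₚ z)) ∎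

  D-cong : ∀ u c {a b} → a ≋ b → D u c a ≈ D u c b
  D-cong u c a≋b = Z-cong (weight u c) (λ x → Z-cong (weight u c) (λ y →
    ψ-cong (P.*-congʳ {y} (P.*-congʳ {x} a≋b))))

  module _ {u c v c′ qi} (inv : (1# - qᴷ * u) * c ≈ 1#) (inv′ : (1# - qᴷ * v) * c′ ≈ 1#)
           (quv≈1 : qᴷ * u * v ≈ 1#) (q-inverse : qᴷ * qi ≈ 1#)
           (b b̄ k : Poly) (bb̄≋1 : b *ₚ b̄ ≋ 1ₚ +ₚ k *ₚ toPoly g) where

    private
      E N′ : Carrier
      E = (qᴷ * u) ^ (n ∸ 1)
      N′ = v ^ n * c′
      Ẑᵤ : Poly → Carrier
      Ẑᵤ = Ẑ inv quv≈1
      A B A′ B′ : Poly → Carrier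
      A w = Ẑᵤ (-ₚ w)
      B z = Ẑᵤ z
      A′ w = A w - c
      B′ z = B z - c
      b̄b≋1 : b̄ *ₚ b ≋ 1ₚ +ₚ k *ₚ toPoly g
      b̄b≋1 = P.trans (P.*-comm b̄ b) bb̄≋1

      Ẑ-cong : Congruent Ẑᵤ
      Ẑ-cong f≋h = Z-cong (weight u c) (λ y → ψ-cong (P.*-congʳ {y} f≋h))
      A-cong : Congruent A
      A-cong f≋h = Ẑ-cong (P.-‿cong f≋h)

      A′-0 : A′ [] ≈ 0#
      A′-0 = trans (+-congʳ (Ẑ-0 inv quv≈1)) (-‿inverseʳ c)
      B′-0 : B′ [] ≈ 0#
      B′-0 = A′-0

      minus-c : ∀ {x y} → x ≈ c + y → x - c ≈ y
      minus-c {x} {y} x≈ = trans (+-congʳ x≈) (solve 2 (λ c y → (c :+ y) :- c := y) refl c y)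
        where open IntegerSolver K

      A′-monic : ∀ {l} → ¬ l ≡ F.0# → ∀ {m} (f : Monic m) → m ℕ.< n →
                 A′ (const l *ₚ toPoly f) ≈ E * (v ^ m * (χ (F.- l) - c))
      A′-monic {l} l≢0 f m<n = minus-c (trans (Ẑ-cong (P.sym neg)) (Ẑ-monic inv quv≈1 (-‿≢0 l≢0) f m<n))
        where
        open IntegerSolver polyRing
        neg : const (F.- l) *ₚ toPoly f ≋ -ₚ (const l *ₚ toPoly f)
        neg = solve 2 (λ l f → :- l :* f := :- (l :* f)) P.refl (const l) (toPoly f)

      B′-monic : ∀ {l} → ¬ l ≡ F.0# → ∀ {m} (f : Monic m) → m ℕ.< n →
                 B′ (const l *ₚ toPoly f) ≈ E * (v ^ m * (χ l - c))
      B′-monic l≢0 f m<n = minus-c (Ẑ-monic inv quv≈1 l≢0 f m<n)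

    -- Once the sums over x and y are moved inside, the sum over y becomes Ẑ(-w) and the sum over x
    -- becomes Ẑ(z). The power of q stays on the left; it is cancelled only at the end.
    separated : qᴷ ^ n * D u c b ≈ ∑V n (λ w → ∑V n (λ z → A w * B z * ψ (b̄ *ₚ w *ₚ z)))
    separated = begin
      qᴷ ^ n * D u c b
        ≈⟨ sym (trans (Z-cong W (λ x → Z-*ˡ W (qᴷ ^ n) (λ y → ψ (b *ₚ x *ₚ y))))
             (Z-*ˡ W (qᴷ ^ n) (λ x → Z W (λ y → ψ (b *ₚ x *ₚ y))))) ⟩
      Z W (λ x → Z W (λ y → qᴷ ^ n * ψ (b *ₚ x *ₚ y)))
        ≈⟨ Z-cong W (λ x → trans (Z-cong W (λ y → sym (separation b b̄ k bb̄≋1 x y)))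
             (trans (Z-∑V∑V W (λ w z y → ψ (-ₚ w *ₚ y) * ψ (z *ₚ x) * ψ (b̄ *ₚ w *ₚ z)))
               (∑-cong (monics n) (λ w → ∑-cong (monics n) (λ z → pull-y (Vec.toList w) (Vec.toList z) x))))) ⟩
      Z W (λ x → ∑V n (λ w → ∑V n (λ z → A w * ψ (z *ₚ x) * ψ (b̄ *ₚ w *ₚ z))))
        ≈⟨ trans (Z-∑V∑V W (λ w z x → A w * ψ (z *ₚ x) * ψ (b̄ *ₚ w *ₚ z)))
             (∑-cong (monics n) (λ w → ∑-cong (monics n) (λ z → pull-x (Vec.toList w) (Vec.toList z)))) ⟩
      ∑V n (λ w → ∑V n (λ z → A w * B z * ψ (b̄ *ₚ w *ₚ z))) ∎
      where
      W = weight u c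
      pull-y : ∀ w z x → Z W (λ y → ψ (-ₚ w *ₚ y) * ψ (z *ₚ x) * ψ (b̄ *ₚ w *ₚ z)) ≈
               A w * ψ (z *ₚ x) * ψ (b̄ *ₚ w *ₚ z)
      pull-y w z x = trans (Z-*ʳ W (ψ (b̄ *ₚ w *ₚ z)) (λ y → ψ (-ₚ w *ₚ y) * ψ (z *ₚ x)))
        (*-congʳ (Z-*ʳ W (ψ (z *ₚ x)) (λ y → ψ (-ₚ w *ₚ y))))
      pull-x : ∀ w z → Z W (λ x → A w * ψ (z *ₚ x) * ψ (b̄ *ₚ w *ₚ z)) ≈ A w * B z * ψ (b̄ *ₚ w *ₚ z)
      pull-x w z = trans (Z-*ʳ W (ψ (b̄ *ₚ w *ₚ z)) (λ x → A w * ψ (z *ₚ x)))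
        (*-congʳ (Z-*ˡ W (A w) (λ x → ψ (z *ₚ x))))

    private
      ψ³ : Poly → Poly → Carrier
      ψ³ w z = ψ (b̄ *ₚ w *ₚ z)
      ψ³-cong : ∀ z → Congruent (λ w → ψ³ w z)
      ψ³-cong z f≋h = ψ-cong (P.*-congʳ {z} (P.*-congˡ {b̄} f≋h))
      ψ³-congʳ : ∀ w → Congruent (ψ³ w)
      ψ³-congʳ w f≋h = ψ-cong (P.*-congˡ {b̄ *ₚ w} f≋h)
      δ : Poly → Carrier
      δ w = ∑V n (ψ³ w)
      δ-cong : Congruent δ
      δ-cong f≋h = ∑-cong (monics n) (λ z → ψ³-cong (Vec.toList z) f≋h)
      δ-monic : ∀ {l} → ¬ l ≡ F.0# → ∀ {m} (f : Monic m) → m ℕ.< n → δ (const l *ₚ toPoly f) ≈ 0#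
      δ-monic l≢0 f m<n = ψ-vanish-monic l≢0 f m<n b̄ b k b̄b≋1

      by-degree-point : ∀ {φ} → Congruent φ →
        (∀ {l} → ¬ l ≡ F.0# → ∀ {m} (f : Monic m) → m ℕ.< n → φ (const l *ₚ toPoly f) ≈ 0#) →
        ∑V n φ ≈ φ []
      by-degree-point φ-cong vanish = trans (∑V-by-degree n φ-cong) (trans (+-congˡ (∑-upTo-zero n (λ m m<n → trans
        (∑-units-cong +-commutativeMonoid (λ l l≢0 → ∑-zero (monics m) (λ f → vanish l≢0 f m<n)))
        (∑-zero units (λ _ → refl))))) (+-identityʳ _))

      -- The sum over z isolates w = 0, where `A` equals c. This is the polar term that survives.
      S₁ : ∑V n (λ w → ∑V n (λ z → A w * c * ψ³ w z)) ≈ c * c * qᴷ ^ n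
      S₁ = begin
        ∑V n (λ w → ∑V n (λ z → A w * c * ψ³ w z))
          ≈⟨ ∑-cong (monics n) (λ w → ∑-*ˡ (monics n) _ _) ⟩
        ∑V n (λ w → A w * c * δ w)
          ≈⟨ by-degree-point (λ f≋h → *-cong (*-congʳ (A-cong f≋h)) (δ-cong f≋h))
               (λ l≢0 f m<n → trans (*-congˡ (δ-monic l≢0 f m<n)) (zeroʳ _)) ⟩
        A [] * c * δ []
          ≈⟨ *-cong (*-congʳ (Ẑ-0 inv quv≈1)) (orthogonal-0 b̄ b k b̄b≋1) ⟩
        c * c * qᴷ ^ n ∎

      S₂ : ∑V n (λ w → ∑V n (λ z → c * B′ z * ψ³ w z)) ≈ 0#
      S₂ = begin
        ∑V n (λ w → ∑V n (λ z → c * B′ z * ψ³ w z))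
          ≈⟨ ∑-swap (monics n) (monics n) _ ⟩
        ∑V n (λ z → ∑V n (λ w → c * B′ z * ψ³ w z))
          ≈⟨ ∑-cong (monics n) (λ z → trans (∑-*ˡ (monics n) _ _)
               (*-congˡ (∑-cong (monics n) (λ w → ψ-cong (solve 3 (λ b w z → b :* w :* z := b :* z :* w)
                 P.refl b̄ (Vec.toList w) (Vec.toList z)))))) ⟩
        ∑V n (λ z → c * B′ z * δ z)
          ≈⟨ by-degree-point (λ f≋h → *-cong (*-congˡ (+-congʳ (Ẑ-cong f≋h))) (δ-cong f≋h))
               (λ l≢0 f m<n → trans (*-congˡ (δ-monic l≢0 f m<n)) (zeroʳ _)) ⟩
        c * B′ [] * δ []
          ≈⟨ trans (*-congʳ (trans (*-congˡ B′-0) (zeroʳ c))) (zeroˡ _) ⟩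
        0# ∎
        where open IntegerSolver polyRing

      α β : 𝔽 → Carrier
      α l = χ (F.- l) - c
      β l = χ l - c

      PP : 𝔽 → Carrier
      PP ν = polynomialPart (const ν *ₚ b̄) v

      ψᶠ : 𝔽 → Poly → Poly → Carrier
      ψᶠ ν x y = ψ (const ν *ₚ b̄ *ₚ x *ₚ y)

      term : 𝔽 → 𝔽 → ℕ → ℕ → Poly → Poly → Carrier
      term l μ i j x y = α l * β μ * (E * E) * (v ^ i * v ^ j * ψᶠ (l F.* μ) x y)

      const-*ₚ : ∀ l μ → const l *ₚ const μ ≋ const (l F.* μ)
      const-*ₚ l μ = const-* l (const μ)

      inner : ∀ {l} → ¬ l ≡ F.0# → ∀ {i} (f : Monic i) → i ℕ.< n →
        ∑V n (λ z → A′ (const l *ₚ toPoly f) * B′ z * ψ³ (const l *ₚ toPoly f) z) ≈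
        ∑ (List.upTo n) (λ j → ∑ units (λ μ → ∑M j (λ y → term l μ i j (toPoly f) y)))
      inner {l} l≢0 {i} f i<n = begin
        ∑V n (λ z → A′ x * B′ z * ψ³ x z)
          ≈⟨ ∑V-by-degree n (λ f≋h → *-cong (*-congˡ (+-congʳ (Ẑ-cong f≋h))) (ψ³-congʳ x f≋h)) ⟩
        A′ x * B′ [] * ψ³ x [] + _
          ≈⟨ +-cong (trans (*-congʳ (trans (*-congˡ B′-0) (zeroʳ _))) (zeroˡ _))
               (∑-upTo-cong n (λ j j<n → ∑-units-cong +-commutativeMonoid (λ μ μ≢0 →
                 ∑-cong (monics j) (λ h → pointwise j<n μ≢0 h)))) ⟩
        0# + _
          ≈⟨ +-identityˡ _ ⟩
        ∑ (List.upTo n) (λ j → ∑ units (λ μ → ∑M j (λ y → term l μ i j (toPoly f) y))) ∎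
        where
        open IntegerSolver K
        module PS = IntegerSolver polyRing
        x = const l *ₚ toPoly f
        pointwise : ∀ {j} → j ℕ.< n → ∀ {μ} → ¬ μ ≡ F.0# → ∀ (h : Monic j) →
          A′ x * B′ (const μ *ₚ toPoly h) * ψ³ x (const μ *ₚ toPoly h) ≈ term l μ i j (toPoly f) (toPoly h)
        pointwise {j} j<n {μ} μ≢0 h = trans (*-cong (*-cong (A′-monic l≢0 f i<n) (B′-monic μ≢0 h j<n))
          (ψ-cong (P.trans (PS.solve 5 (λ b l f m h → b PS.:* (l PS.:* f) PS.:* (m PS.:* h) PS.:=
                       l PS.:* m PS.:* b PS.:* f PS.:* h) P.refl b̄ (const l) (toPoly f) (const μ) (toPoly h))
            (P.*-congʳ {toPoly h} (P.*-congʳ {toPoly f} (P.*-congʳ {b̄} (const-*ₚ l μ)))))))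
          (solve 6 (λ E vi α vj β s → E :* (vi :* α) :* (E :* (vj :* β)) :* s := α :* β :* (E :* E) :* (vi :* vj :* s))
            refl E (v ^ i) (α l) (v ^ j) (β μ) _)

      rearrange : ∀ l μ → ∑ (List.upTo n) (λ i → ∑ (List.upTo n) (λ j →
        ∑M i (λ x → ∑M j (λ y → term l μ i j x y)))) ≈ α l * β μ * (E * E) * PP (l F.* μ)
      rearrange l μ = trans (∑-cong (List.upTo n) (λ i → trans (∑-cong (List.upTo n) (λ j →
          trans (∑-cong (monics i) (λ f → trans (∑-*ˡ (monics j) _ _) (*-congˡ (∑-*ˡ (monics j) _ _))))
          (trans (∑-*ˡ (monics i) _ _) (*-congˡ (∑-*ˡ (monics i) _ _))))) (∑-*ˡ (List.upTo n) _ _)))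
        (∑-*ˡ (List.upTo n) _ _)

      S₃ : ∑V n (λ w → ∑V n (λ z → A′ w * B′ z * ψ³ w z)) ≈
           ∑ units (λ ν → amplitude c ν * (E * E * PP ν))
      S₃ = begin
        ∑V n (λ w → ∑V n (λ z → A′ w * B′ z * ψ³ w z))
          ≈⟨ ∑V-by-degree n (λ f≋h → ∑-cong (monics n) (λ z →
               *-cong (*-congʳ (+-congʳ (A-cong f≋h))) (ψ³-cong (Vec.toList z) f≋h))) ⟩
        ∑V n (λ z → A′ [] * B′ z * ψ³ [] z) + _
          ≈⟨ +-cong (∑-zero (monics n) (λ z → trans (*-congʳ (trans (*-congʳ A′-0) (zeroˡ _))) (zeroˡ _)))
               (∑-upTo-cong n (λ i i<n → ∑-units-cong +-commutativeMonoid (λ l l≢0 →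
                 ∑-cong (monics i) (λ f → inner l≢0 f i<n)))) ⟩
        0# + ∑ (List.upTo n) (λ i → ∑ units (λ l → ∑M i (λ x →
          ∑ (List.upTo n) (λ j → ∑ units (λ μ → ∑M j (λ y → term l μ i j x y))))))
          ≈⟨ trans (+-identityˡ _) (∑-swap (List.upTo n) units _) ⟩
        ∑ units (λ l → ∑ (List.upTo n) (λ i → ∑M i (λ x →
          ∑ (List.upTo n) (λ j → ∑ units (λ μ → ∑M j (λ y → term l μ i j x y))))))
          ≈⟨ ∑-cong units (λ l → trans (∑-cong (List.upTo n) (λ i → trans
               (∑-cong (monics i) (λ f → ∑-swap (List.upTo n) units _))
               (trans (∑-swap (monics i) units _) (∑-cong units (λ μ → ∑-swap (monics i) (List.upTo n) _)))))
               (trans (∑-swap (List.upTo n) units _) (∑-cong units (rearrange l)))) ⟩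
        ∑ units (λ l → ∑ units (λ μ → α l * β μ * (E * E) * PP (l F.* μ)))
          -- For fixed l the substitution μ = ν / l makes the polynomial part depend on ν alone, so
          -- that the sum over l collects into the amplitude.
          ≈⟨ ∑-units-cong +-commutativeMonoid (λ l l≢0 → sym (trans
               (∑-cong units (λ ν → *-congˡ (reflexive (≡.cong PP (≡.sym (unscale l l≢0 ν))))))
               (∑-units-reindex +-commutativeMonoid (λ ν → ν F.* l F.⁻¹) (λ μ → μ F.* l)
                 (λ _ ν≢0 → *-≢0 ν≢0 (⁻¹-≢0 l≢0)) (λ _ μ≢0 → *-≢0 μ≢0 l≢0)
                 (λ ν _ → cancelʳ l l≢0 ν) (λ ν _ → cancelʳ′ l l≢0 ν)
                 (λ μ → α l * β μ * (E * E) * PP (l F.* μ))))) ⟩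
        ∑ units (λ l → ∑ units (λ ν → α l * β (ν F.* l F.⁻¹) * (E * E) * PP ν))
          ≈⟨ trans (∑-swap units units _) (∑-cong units (λ ν → trans
               (∑-cong units (λ l → *-assoc _ _ _)) (∑-*ʳ units (E * E * PP ν) _))) ⟩
        ∑ units (λ ν → amplitude c ν * (E * E * PP ν)) ∎
        where
        cancelʳ : ∀ l → ¬ l ≡ F.0# → ∀ ν → ν F.* l F.* l F.⁻¹ ≡ ν
        cancelʳ l l≢0 ν = ≡.trans (F+.*-assoc ν l _) (≡.trans (≡.cong (ν F.*_) (F.*-inverse l l≢0)) (F+.*-identityʳ ν))
        cancelʳ′ : ∀ l → ¬ l ≡ F.0# → ∀ ν → ν F.* l F.⁻¹ F.* l ≡ ν
        cancelʳ′ l l≢0 ν = ≡.trans (F+.*-assoc ν _ l) (≡.trans (≡.cong (ν F.*_) (⁻¹-inverseˡ l l≢0)) (F+.*-identityʳ ν))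
        unscale : ∀ l → ¬ l ≡ F.0# → ∀ ν → l F.* (ν F.* l F.⁻¹) ≡ ν
        unscale l l≢0 ν = ≡.trans (F+.*-comm l _) (cancelʳ′ l l≢0 ν)

    expanded : qᴷ ^ n * D u c b ≈ c * c * qᴷ ^ n + ∑ units (λ ν → amplitude c ν * (E * E * PP ν))
    expanded = begin
      qᴷ ^ n * D u c b
        ≈⟨ separated ⟩
      ∑V n (λ w → ∑V n (λ z → A w * B z * ψ³ w z))
        -- The splitting A B = A c + c B′ + A′ B′ is asymmetric on purpose: A c keeps the whole zero
        -- frequency, while c B′ vanishes since B′ is zero at 0.
        ≈⟨ ∑-cong (monics n) (λ w → trans (∑-cong (monics n) (λ z →
             solve 4 (λ a b c s → a :* b :* s := a :* c :* s :+ (c :* (b :- c) :* s :+ (a :- c) :* (b :- c) :* s))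
               refl (A (Vec.toList w)) (B (Vec.toList z)) c _))
             (trans (∑-+ (monics n) _ _) (+-congˡ (∑-+ (monics n) _ _)))) ⟩
      ∑V n (λ w → ∑V n (λ z → A w * c * ψ³ w z) +
        (∑V n (λ z → c * B′ z * ψ³ w z) + ∑V n (λ z → A′ w * B′ z * ψ³ w z)))
        ≈⟨ trans (∑-+ (monics n) _ _) (+-congˡ (∑-+ (monics n) _ _)) ⟩
      _
        ≈⟨ +-cong S₁ (trans (+-cong S₂ S₃) (+-identityˡ _)) ⟩
      c * c * qᴷ ^ n + ∑ units (λ ν → amplitude c ν * (E * E * PP ν)) ∎
      where open IntegerSolver K

    private
      -- Completes the polynomial part at v to the full function by subtracting its polar term; ν b̄
      -- is again a unit modulo g, with inverse b / ν.
      PP≈ : ∀ ν → ¬ ν ≡ F.0# → PP ν ≈ D v c′ (ν ∙ₚ b̄) - N′ * N′ * qᴷ ^ n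
      PP≈ ν ν≢0 = begin
        PP ν
          ≈⟨ solve 2 (λ p r → p := (p :+ r) :- r) refl (PP ν) _ ⟩
        PP ν + N′ * N′ * qᴷ ^ n - N′ * N′ * qᴷ ^ n
          ≈⟨ +-congʳ (sym (D≈polynomialPart (const ν *ₚ b̄) (const (ν F.⁻¹) *ₚ b) k unit v c′)) ⟩
        D v c′ (const ν *ₚ b̄) - N′ * N′ * qᴷ ^ n
          ≈⟨ +-congʳ (D-cong v c′ (const-* ν b̄)) ⟩
        D v c′ (ν ∙ₚ b̄) - N′ * N′ * qᴷ ^ n ∎
        where
        open IntegerSolver K
        module PS = IntegerSolver polyRing
        unit : const ν *ₚ b̄ *ₚ (const (ν F.⁻¹) *ₚ b) ≋ 1ₚ +ₚ k *ₚ toPoly g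
        unit = P.trans (PS.solve 4 (λ n b̄ i b → n PS.:* b̄ PS.:* (i PS.:* b) PS.:= n PS.:* i PS.:* (b̄ PS.:* b))
                 P.refl (const ν) b̄ (const (ν F.⁻¹)) b)
          (P.trans (P.*-congʳ {b̄ *ₚ b} (P.trans (const-*ₚ ν (ν F.⁻¹)) (∷-cong (F.*-inverse ν ν≢0) P.refl)))
            (P.trans (P.*-identityˡ (b̄ *ₚ b)) b̄b≋1))

      n≡ : suc (n ∸ 1) ≡ n
      n≡ = ℕ.suc-pred n {{ℕ.>-nonZero 1≤n}}

      EN′≈vc′ : E * N′ ≈ v * c′
      EN′≈vc′ = begin
        E * (v ^ n * c′)                                 ≈⟨ *-congˡ (*-congʳ (reflexive (≡.cong (v ^_) (≡.sym n≡)))) ⟩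
        E * (v * v ^ (n ∸ 1) * c′)
          ≈⟨ solve 4 (λ e v w c → e :* (v :* w :* c) := (e :* w) :* (v :* c)) refl E v _ c′ ⟩
        E * v ^ (n ∸ 1) * (v * c′)                       ≈⟨ *-congʳ (trans (sym (^-distrib-* (qᴷ * u) v (n ∸ 1)))
                                                              (trans (^-congˡ (n ∸ 1) quv≈1) (1^ (n ∸ 1)))) ⟩
        1# * (v * c′)                                    ≈⟨ *-identityˡ _ ⟩
        v * c′                                           ∎
        where open IntegerSolver K

      -- Writing 1 as (1 - q u) c turns the bracket into c q (1 - u), and v q (1 - u) = q v - 1
      -- because q u v = 1; the factor c′ inverts this up to sign.
      vc′-identity : v * c′ * (1# + (qᴷ - 1#) * c) ≈ - c
      vc′-identity = begin
        v * c′ * (1# + (qᴷ - 1#) * c)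
          ≈⟨ *-congˡ (+-congʳ (sym inv)) ⟩
        v * c′ * ((1# - qᴷ * u) * c + (qᴷ - 1#) * c)
          ≈⟨ solve 5 (λ v c′ q u c → v :* c′ :* ((:1 :- q :* u) :* c :+ (q :- :1) :* c) :=
               c :* ((:1 :- q :* u :* v) :* c′ :- (:1 :- q :* v) :* c′)) refl v c′ qᴷ u c ⟩
        c * ((1# - qᴷ * u * v) * c′ - (1# - qᴷ * v) * c′)
          ≈⟨ *-congˡ (+-cong (*-congʳ (trans (+-congˡ (-‿cong quv≈1)) (-‿inverseʳ 1#))) (-‿cong inv′)) ⟩
        c * (0# * c′ - 1#)
          ≈⟨ solve 2 (λ c c′ → c :* (:0 :* c′ :- :1) := :- c) refl c c′ ⟩
        - c ∎
        where open IntegerSolver K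

      -- All the subtracted polar terms together amount to the term left by `S₁`: the square root of
      -- each side is, up to sign, E N′ (1 + (q - 1) c) = -c.
      polar-part : E * E * (N′ * N′ * qᴷ ^ n) * ∑ units (amplitude c) ≈ c * c * qᴷ ^ n
      polar-part = begin
        E * E * (N′ * N′ * qᴷ ^ n) * ∑ units (amplitude c)
          ≈⟨ *-congˡ (∑amplitude c) ⟩
        E * E * (N′ * N′ * qᴷ ^ n) * (r * r)
          ≈⟨ solve 4 (λ e m q r → e :* e :* (m :* m :* q) :* (r :* r) := (e :* m) :* r :* ((e :* m) :* r) :* q)
               refl E N′ (qᴷ ^ n) r ⟩
        E * N′ * r * (E * N′ * r) * qᴷ ^ n
          ≈⟨ *-congʳ (*-cong eq eq) ⟩
        - c * - c * qᴷ ^ n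
          ≈⟨ solve 2 (λ c q → :- c :* :- c :* q := c :* c :* q) refl c (qᴷ ^ n) ⟩
        c * c * qᴷ ^ n ∎
        where
        open IntegerSolver K
        r = 1# + (qᴷ - 1#) * c
        eq : E * N′ * r ≈ - c
        eq = trans (*-congʳ EN′≈vc′) vc′-identity

      -- Origin of the prefactor: (qu)² = q · q u², so n - 1 powers of q come out. They are q^n / q,
      -- where q^n cancels against the left side and 1/q is the denominator inside 𝒜.
      E²≈ : E * E ≈ qᴷ ^ n * ((qᴷ * u ^ 2) ^ (n ∸ 1) * qi)
      E²≈ = begin
        E * E                                          ≈⟨ sym (^-distrib-* (qᴷ * u) (qᴷ * u) (n ∸ 1)) ⟩
        (qᴷ * u * (qᴷ * u)) ^ (n ∸ 1)                  ≈⟨ ^-congˡ (n ∸ 1) (solve 2 (λ q u →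
                                                            q :* u :* (q :* u) := q :* (q :* (u :* (u :* :1)))) refl qᴷ u) ⟩
        (qᴷ * (qᴷ * u ^ 2)) ^ (n ∸ 1)                  ≈⟨ ^-distrib-* qᴷ (qᴷ * u ^ 2) (n ∸ 1) ⟩
        qᴷ ^ (n ∸ 1) * (qᴷ * u ^ 2) ^ (n ∸ 1)          ≈⟨ sym (trans (*-congʳ q-inverse) (*-identityˡ _)) ⟩
        qᴷ * qi * (qᴷ ^ (n ∸ 1) * (qᴷ * u ^ 2) ^ (n ∸ 1))
          ≈⟨ solve 4 (λ q i a b → q :* i :* (a :* b) := q :* a :* (b :* i)) refl qᴷ qi _ _ ⟩
        qᴷ ^ suc (n ∸ 1) * ((qᴷ * u ^ 2) ^ (n ∸ 1) * qi) ≈⟨ *-congʳ (reflexive (≡.cong (qᴷ ^_) n≡)) ⟩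
        qᴷ ^ n * ((qᴷ * u ^ 2) ^ (n ∸ 1) * qi)         ∎
        where open IntegerSolver K

      q^-cancel : ∀ {x y} → qᴷ ^ n * x ≈ qᴷ ^ n * y → x ≈ y
      q^-cancel {x} {y} eq = trans (sym (cancel x)) (trans (*-congˡ eq) (cancel y))
        where
        cancel : ∀ x → qi ^ n * (qᴷ ^ n * x) ≈ x
        cancel x = trans (sym (*-assoc _ _ _)) (trans (*-congʳ (trans (sym (^-distrib-* qi qᴷ n))
          (trans (^-congˡ n (trans (*-comm qi qᴷ) q-inverse)) (1^ n)))) (*-identityˡ x))

    functional-equation : D u c b ≈ (qᴷ * u ^ 2) ^ (n ∸ 1) *
      ∑ units (λ ν → qi * amplitude c ν * D v c′ (ν ∙ₚ b̄))
    functional-equation = q^-cancel (begin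
      qᴷ ^ n * D u c b
        ≈⟨ expanded ⟩
      c * c * qᴷ ^ n + ∑ units (λ ν → amplitude c ν * (E * E * PP ν))
        ≈⟨ +-congˡ (trans (∑-units-cong +-commutativeMonoid (λ ν ν≢0 → trans
             (*-congˡ (*-congˡ (PP≈ ν ν≢0)))
             (solve 4 (λ a e d r → a :* (e :* (d :- r)) := e :* (a :* d) :+ :- (e :* r) :* a)
               refl (amplitude c ν) (E * E) (D v c′ (ν ∙ₚ b̄)) (N′ * N′ * qᴷ ^ n))))
             (trans (∑-+ units _ _) (+-cong (∑-*ˡ units (E * E) _) (∑-*ˡ units _ (amplitude c))))) ⟩
      c * c * qᴷ ^ n + (E * E * M + - (E * E * (N′ * N′ * qᴷ ^ n)) * ∑ units (amplitude c))
        ≈⟨ solve 4 (λ p q r s → p :+ (q :+ :- r :* s) := q :+ (p :- r :* s)) refl _ _ (E * E * (N′ * N′ * qᴷ ^ n)) _ ⟩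
      E * E * M + (c * c * qᴷ ^ n - E * E * (N′ * N′ * qᴷ ^ n) * ∑ units (amplitude c))
        ≈⟨ +-congˡ (trans (+-congˡ (-‿cong polar-part)) (-‿inverseʳ _)) ⟩
      E * E * M + 0#
        ≈⟨ trans (+-identityʳ _) (*-congʳ E²≈) ⟩
      qᴷ ^ n * ((qᴷ * u ^ 2) ^ (n ∸ 1) * qi) * M
        ≈⟨ solve 4 (λ q r i m → q :* (r :* i) :* m := q :* (r :* (i :* m))) refl (qᴷ ^ n) _ qi M ⟩
      qᴷ ^ n * ((qᴷ * u ^ 2) ^ (n ∸ 1) * (qi * M))
        ≈⟨ *-congˡ (*-congˡ (trans (sym (∑-*ˡ units qi _)) (∑-cong units (λ ν → sym (*-assoc _ _ _))))) ⟩
      qᴷ ^ n * ((qᴷ * u ^ 2) ^ (n ∸ 1) * ∑ units (λ ν → qi * amplitude c ν * D v c′ (ν ∙ₚ b̄))) ∎)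
      where
      open IntegerSolver K
      M = ∑ units (λ ν → amplitude c ν * D v c′ (ν ∙ₚ b̄))

-- The divisor function as a convolution over factorisations.

module DivisorSums {q : ℕ} (F : FiniteField q) (K : CommutativeRing 0ℓ 0ℓ) where

  open Polynomials F
  open PolynomialRing F
  open PolynomialSums F K
  open FieldSum F
  open CommutativeRing K
  open RingSum K
  open SemiringMult semiring using (×-homo-+)
  open SetoidReasoning setoid

  sum·1 : ∀ {A : Set} (xs : List A) (h : A → ℕ) → sumℕ (List.map h xs) · 1# ≈ ∑ xs (λ x → h x · 1#)
  sum·1 []       h = refl
  sum·1 (x ∷ xs) h = trans (×-homo-+ 1# (h x) _) (+-congˡ (sum·1 xs h))

  length-filter·1 : ∀ {A : Set} {P : Pred A 0ℓ} (P? : Decidable P) xs →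
                    List.length (List.filter P? xs) · 1# ≈ ∑ xs (λ x → [ P? x ] 1#)
  length-filter·1 P? xs = trans (sym (*-identityʳ _))
    (trans (sym (∑-const (List.filter P? xs) 1#)) (∑-filter P? xs (λ _ → 1#)))

  ∑-zero-All : ∀ {A : Set} {xs : List A} {f : A → Carrier} → All (λ x → f x ≈ 0#) xs → ∑ xs f ≈ 0#
  ∑-zero-All []         = refl
  ∑-zero-All (fx≈0 ∷ z) = trans (+-cong fx≈0 (∑-zero-All z)) (+-identityˡ 0#)

  toPoly-subst : ∀ {m n} (eq : m ≡ n) (f : Monic m) → toPoly (≡.subst Monic eq f) ≡ toPoly f
  toPoly-subst ≡.refl f = ≡.refl

  -- A monic h can be cancelled, so there is at most one cofactor and its existence equals the
  -- number of cofactors.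
  divisor-count : ∀ {n} (f : Monic n) m (h : Monic m) →
    [ any? (λ k → toPoly k *ₚ toPoly h ≟ₚ toPoly f) (monics (n ∸ m)) ] 1# ≈
    ∑ (monics (n ∸ m)) (λ k → [ toPoly k *ₚ toPoly h ≟ₚ toPoly f ] 1#)
  divisor-count {n} f m h with any? (λ k → toPoly k *ₚ toPoly h ≟ₚ toPoly f) (monics (n ∸ m))
  ... | no none = sym (∑-zero-All (All.map (λ {k} ¬kh≈f → []-no (toPoly k *ₚ toPoly h ≟ₚ toPoly f) ¬kh≈f)
                                           (All.¬Any⇒All¬ (monics (n ∸ m)) none)))
  ... | yes some = sym (trans
    (monics-enumerates +-commutativeMonoid (n ∸ m) k₀ _ (λ k k≢k₀ → []-no (toPoly k *ₚ toPoly h ≟ₚ toPoly f)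
      (λ kh≈f → k≢k₀ (toPoly-injective k k₀ (*-monic-cancel (toPoly k) (toPoly k₀) h
        (coeffs≡ (λ i → ≡.trans (kh≈f i) (≡.sym (k₀h≈f i)))))))))
    ([]-yes (toPoly k₀ *ₚ toPoly h ≟ₚ toPoly f) k₀h≈f))
    where
    k₀ = proj₁ (Any.satisfied some)
    k₀h≈f = proj₂ (Any.satisfied some)

  d·1 : ∀ {n} (f : Monic n) → d f · 1# ≈ ∑ (List.upTo (suc n)) (λ m → ∑ (monics m) (λ h →
        ∑ (monics (n ∸ m)) (λ k → [ toPoly k *ₚ toPoly h ≟ₚ toPoly f ] 1#)))
  d·1 {n} f = trans (sum·1 (List.upTo (suc n)) (λ m → List.length (divisorsOfDegree f m))) (∑-cong (List.upTo (suc n)) (λ m →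
    trans (length-filter·1 (λ h → any? (λ k → toPoly k *ₚ toPoly h ≟ₚ toPoly f) (monics (n ∸ m))) (monics m))
          (∑-cong (monics m) (divisor-count f m))))

  ∑-product : ∀ {n m} → m ℕ.≤ n → ∀ {φ} → Congruent φ → (h : Monic m) (k : Monic (n ∸ m)) →
    ∑ (monics n) (λ f → [ toPoly k *ₚ toPoly h ≟ₚ toPoly f ] 1# * φ (toPoly f)) ≈ φ (toPoly h *ₚ toPoly k)
  ∑-product {n} {m} m≤n {φ} φ-cong h k = begin
    ∑ (monics n) (λ f → [ toPoly k *ₚ toPoly h ≟ₚ toPoly f ] 1# * φ (toPoly f))
      ≈⟨ monics-enumerates +-commutativeMonoid n f₀ _ (λ f f≢f₀ → trans (*-congʳ
           ([]-no (toPoly k *ₚ toPoly h ≟ₚ toPoly f) (λ kh≈f → f≢f₀ (toPoly-injective f f₀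
             (P.trans (P.sym (coeffs≡ kh≈f)) (P.sym f₀≋)))))) (zeroˡ _)) ⟩
    [ toPoly k *ₚ toPoly h ≟ₚ toPoly f₀ ] 1# * φ (toPoly f₀)
      ≈⟨ trans (*-congʳ ([]-yes (toPoly k *ₚ toPoly h ≟ₚ toPoly f₀) (P.sym f₀≋ .at))) (*-identityˡ _) ⟩
    φ (toPoly f₀)
      ≈⟨ φ-cong (P.trans f₀≋ (P.*-comm (toPoly k) (toPoly h))) ⟩
    φ (toPoly h *ₚ toPoly k) ∎
    where
    f₀ : Monic n
    f₀ = ≡.subst Monic (ℕ.m∸n+n≡m m≤n) (k ⊛ h)
    f₀≋ : toPoly f₀ ≋ toPoly k *ₚ toPoly h
    f₀≋ = P.trans (P.reflexive (toPoly-subst (ℕ.m∸n+n≡m m≤n) (k ⊛ h))) (toPoly-⊛ k h)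

  -- d is the Dirichlet convolution of 1 with itself: a weighted sum over f becomes an unweighted
  -- sum over ordered factorisations f = x y.
  ∑-divisors : ∀ n {φ} → Congruent φ → ∑ (monics n) (λ f → d f · 1# * φ (toPoly f)) ≈
    ∑ (List.upTo (suc n)) (λ m → ∑M m (λ x → ∑M (n ∸ m) (λ y → φ (x *ₚ y))))
  ∑-divisors n {φ} φ-cong = begin
    ∑ (monics n) (λ f → d f · 1# * φ (toPoly f))
      ≈⟨ ∑-cong (monics n) (λ f → trans (*-congʳ (d·1 f)) (sym (trans
           (∑-cong (List.upTo (suc n)) (λ m → trans (∑-cong (monics m) (λ h →
             ∑-*ʳ (monics (n ∸ m)) (φ (toPoly f)) _)) (∑-*ʳ (monics m) (φ (toPoly f)) _)))
           (∑-*ʳ (List.upTo (suc n)) (φ (toPoly f)) _)))) ⟩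
    ∑ (monics n) (λ f → ∑ (List.upTo (suc n)) (λ m → ∑ (monics m) (λ h → ∑ (monics (n ∸ m)) (λ k → T m f h k))))
      ≈⟨ trans (∑-swap (monics n) (List.upTo (suc n)) _) (∑-cong (List.upTo (suc n)) (λ m →
           trans (∑-swap (monics n) (monics m) _) (∑-cong (monics m) (λ h →
             ∑-swap (monics n) (monics (n ∸ m)) _)))) ⟩
    ∑ (List.upTo (suc n)) (λ m → ∑ (monics m) (λ h → ∑ (monics (n ∸ m)) (λ k → ∑ (monics n) (λ f → T m f h k))))
      ≈⟨ ∑-upTo-cong (suc n) (λ m m<1+n → ∑-cong (monics m) (λ h → ∑-cong (monics (n ∸ m)) (λ k →
           ∑-product (ℕ.≤-pred m<1+n) φ-cong h k))) ⟩
    ∑ (List.upTo (suc n)) (λ m → ∑M m (λ x → ∑M (n ∸ m) (λ y → φ (x *ₚ y)))) ∎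
    where
    T : ∀ m → Monic n → Monic m → Monic (n ∸ m) → Carrier
    T m f h k = [ toPoly k *ₚ toPoly h ≟ₚ toPoly f ] 1# * φ (toPoly f)

-- Coefficients of the Estermann series in terms of residue classes.

module EstermannCoefficients {q : ℕ} (F : FiniteField q) (K : CommutativeRing 0ℓ 0ℓ)
  (𝕏 : NontrivialCharacter F K) {n : ℕ} (1≤n : 1 ℕ.≤ n) (g : Polynomials.Monic F n) where

  open Polynomials F
  open PolynomialRing F
  open PolynomialSums F K
  open AdditiveCharacter F K 𝕏
  open Modulus 1≤n g
  open FunctionalEquation F K 𝕏 1≤n g
  open DivisorSums F K
  open CommutativeRing K
  open RingSum K
  open Convolution K
  open SetoidReasoning setoid

  -- Multiplication of a generating function by x^i.
  delay : ℕ → (ℕ → Carrier) → ℕ → Carrier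
  delay zero    a m       = a m
  delay (suc i) a zero    = 0#
  delay (suc i) a (suc m) = delay i a m

  δ₀ : ℕ → Carrier
  δ₀ zero    = 1#
  δ₀ (suc _) = 0#

  -- The weight of the index i among the monic polynomials of degree m: for
  -- m ≥ n every residue is represented q^(m - n) times.
  count : ℕ → ℕ → Carrier
  count i with i ℕ.<? n
  ... | yes _ = delay i δ₀
  ... | no  _ = delay i (qᴷ ^_)

  delay-< : ∀ i a m → m ℕ.< i → delay i a m ≈ 0#
  delay-< (suc i) a zero    _         = refl
  delay-< (suc i) a (suc m) (s≤s m<i) = delay-< i a m m<i

  delay-+ : ∀ i a m → delay i a (i ℕ.+ m) ≡ a m
  delay-+ zero    a m = ≡.refl
  delay-+ (suc i) a m = delay-+ i a m

  delay-δ₀ : ∀ i m → ¬ m ≡ i → delay i δ₀ m ≈ 0#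
  delay-δ₀ zero    zero    m≢i = contradiction ≡.refl m≢i
  delay-δ₀ zero    (suc m) m≢i = refl
  delay-δ₀ (suc i) zero    m≢i = refl
  delay-δ₀ (suc i) (suc m) m≢i = delay-δ₀ i m (m≢i ∘ ≡.cong suc)

  count-< : ∀ i m → i ℕ.< n → ¬ m ≡ i → count i m ≈ 0#
  count-< i m i<n m≢i with i ℕ.<? n
  ... | yes _  = delay-δ₀ i m m≢i
  ... | no i≮n = contradiction i<n i≮n

  count-diagonal : ∀ i → i ℕ.< n → count i i ≈ 1#
  count-diagonal i i<n with i ℕ.<? n
  ... | yes _  = trans (reflexive (≡.cong (delay i δ₀) (≡.sym (ℕ.+-identityʳ i)))) (reflexive (delay-+ i δ₀ 0))
  ... | no i≮n = contradiction i<n i≮n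

  count-n-< : ∀ m → m ℕ.< n → count n m ≈ 0#
  count-n-< m m<n with n ℕ.<? n
  ... | yes n<n = contradiction n<n (ℕ.n≮n n)
  ... | no _    = delay-< n _ m m<n

  count-n-+ : ∀ m → count n (n ℕ.+ m) ≈ qᴷ ^ m
  count-n-+ m with n ℕ.<? n
  ... | yes n<n = contradiction n<n (ℕ.n≮n n)
  ... | no _    = reflexive (delay-+ n (qᴷ ^_) m)

  -- Exactly one index contributes: i = m while m < n, and afterwards i = n, by equidistribution
  -- modulo g.
  ∑M-classes : ∀ m {φ} → Congruent φ → Periodic g φ →
               ∑M m φ ≈ ∑ (List.upTo (suc n)) (λ i → count i m * ∑E i φ)
  ∑M-classes m {φ} φ-cong φ-periodic with ℕ.<-≤-connex m n
  ... | inj₁ m<n = sym (trans (∑-upTo-point (suc n) m (ℕ.<-trans m<n (ℕ.n<1+n n)) _ other)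
      (trans (*-cong (count-diagonal m m<n) (∑E-< m<n φ)) (*-identityˡ _)))
    where
    other : ∀ i → i ℕ.< suc n → ¬ i ≡ m → count i m * ∑E i φ ≈ 0#
    other i i<1+n i≢m with ℕ.m≤n⇒m<n∨m≡n (ℕ.≤-pred i<1+n)
    ... | inj₁ i<n    = trans (*-congʳ (count-< i m i<n (i≢m ∘ ≡.sym))) (zeroˡ _)
    ... | inj₂ ≡.refl = trans (*-congʳ (count-n-< m m<n)) (zeroˡ _)
  ... | inj₂ n≤m = sym (begin
    ∑ (List.upTo (suc n)) (λ i → count i m * ∑E i φ)
      ≈⟨ ∑-upTo-point (suc n) n (ℕ.n<1+n n) _ other ⟩
    count n m * ∑E n φ
      ≈⟨ *-cong (trans (reflexive (≡.cong (count n) (≡.sym n+k≡m))) (count-n-+ (m ∸ n))) (∑E-n φ) ⟩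
    qᴷ ^ (m ∸ n) * ∑V n φ
      ≈⟨ sym (∑M-equidistributed g φ-cong φ-periodic (m ∸ n)) ⟩
    ∑M (n ℕ.+ (m ∸ n)) φ
      ≈⟨ reflexive (≡.cong (λ k → ∑M k φ) n+k≡m) ⟩
    ∑M m φ ∎)
    where
    n+k≡m : n ℕ.+ (m ∸ n) ≡ m
    n+k≡m = ℕ.m+[n∸m]≡n n≤m
    other : ∀ i → i ℕ.< suc n → ¬ i ≡ n → count i m * ∑E i φ ≈ 0#
    other i i<1+n i≢n with ℕ.m≤n⇒m<n∨m≡n (ℕ.≤-pred i<1+n)
    ... | inj₁ i<n = trans (*-congʳ (count-< i m i<n (λ m≡i → ℕ.<⇒≱ i<n (≡.subst (n ℕ.≤_) m≡i n≤m)))) (zeroˡ _)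
    ... | inj₂ i≡n = contradiction i≡n i≢n

  pair : Poly → ℕ → ℕ → Carrier
  pair a i j = ∑E i (λ x → ∑E j (λ y → ψ (a *ₚ x *ₚ y)))

  D≈∑pair : ∀ u c a → D u c a ≈ ∑ (List.upTo (suc n)) (λ i → ∑ (List.upTo (suc n)) (λ j →
            weight u c i * weight u c j * pair a i j))
  D≈∑pair u c a = ∑-cong (List.upTo (suc n)) (λ i → begin
    weight u c i * ∑E i (λ x → ∑ (List.upTo (suc n)) (λ j → weight u c j * ∑E j (λ y → ψ (a *ₚ x *ₚ y))))
      ≈⟨ *-congˡ (trans (∑-swap (monics i) (List.upTo (suc n)) _) (∑-cong (List.upTo (suc n)) (λ j →
           ∑-*ˡ (monics i) (weight u c j) _))) ⟩
    weight u c i * ∑ (List.upTo (suc n)) (λ j → weight u c j * pair a i j)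
      ≈⟨ trans (sym (∑-*ˡ (List.upTo (suc n)) (weight u c i) _)) (∑-cong (List.upTo (suc n)) (λ j → sym (*-assoc _ _ _))) ⟩
    ∑ (List.upTo (suc n)) (λ j → weight u c i * weight u c j * pair a i j) ∎)

  coefficient : ∀ a N → ∑ (monics N) (λ f → d f · 1# * ψ (a *ₚ toPoly f)) ≈
    ∑ (List.upTo (suc n)) (λ i → ∑ (List.upTo (suc n)) (λ j → conv (count i) (count j) N * pair a i j))
  coefficient a N = begin
    ∑ (monics N) (λ f → d f · 1# * ψ (a *ₚ toPoly f))
      ≈⟨ ∑-divisors N (λ f≋h → ψ-cong (P.*-congˡ {a} f≋h)) ⟩
    ∑ (List.upTo (suc N)) (λ m → ∑M m (λ x → ∑M (N ∸ m) (λ y → ψ (a *ₚ (x *ₚ y)))))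
      ≈⟨ ∑-cong (List.upTo (suc N)) (λ m → trans
           (∑-cong (monics m) (λ f → trans
             (∑-cong (monics (N ∸ m)) (λ h → ψ-cong (P.sym (P.*-assoc a (toPoly f) (toPoly h)))))
             (∑M-classes (N ∸ m) (λ f≋h → ψ-cong (P.*-congˡ {a *ₚ toPoly f} f≋h)) (y-periodic (toPoly f)))))
           (∑M-classes m {λ x → ∑ (List.upTo (suc n)) (λ j → count j (N ∸ m) * ∑E j (λ y → ψ (a *ₚ x *ₚ y)))}
             (λ f≋h → ∑-cong (List.upTo (suc n)) (λ j → *-congˡ (∑-cong (monics j) (λ v →
               ψ-cong (P.*-congʳ {embed j v} (P.*-congˡ {a} f≋h))))))
             (λ h k → ∑-cong (List.upTo (suc n)) (λ j → *-congˡ (∑-cong (monics j) (λ v → x-periodic (embed j v) h k)))))) ⟩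
    ∑ (List.upTo (suc N)) (λ m → ∑ (List.upTo (suc n)) (λ i → count i m *
      ∑E i (λ x → ∑ (List.upTo (suc n)) (λ j → count j (N ∸ m) * ∑E j (λ y → ψ (a *ₚ x *ₚ y))))))
      ≈⟨ ∑-cong (List.upTo (suc N)) (λ m → ∑-cong (List.upTo (suc n)) (λ i → distribute m i)) ⟩
    ∑ (List.upTo (suc N)) (λ m → ∑ (List.upTo (suc n)) (λ i → ∑ (List.upTo (suc n)) (λ j →
      count i m * count j (N ∸ m) * pair a i j)))
      ≈⟨ trans (∑-swap (List.upTo (suc N)) (List.upTo (suc n)) _) (∑-cong (List.upTo (suc n)) (λ i →
           ∑-swap (List.upTo (suc N)) (List.upTo (suc n)) _)) ⟩
    ∑ (List.upTo (suc n)) (λ i → ∑ (List.upTo (suc n)) (λ j → ∑ (List.upTo (suc N)) (λ m →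
      count i m * count j (N ∸ m) * pair a i j)))
      ≈⟨ ∑-cong (List.upTo (suc n)) (λ i → ∑-cong (List.upTo (suc n)) (λ j → trans
           (∑-*ʳ (List.upTo (suc N)) (pair a i j) (λ m → count i m * count j (N ∸ m)))
           (*-congʳ (sym (conv≈∑ (count i) (count j) N))))) ⟩
    ∑ (List.upTo (suc n)) (λ i → ∑ (List.upTo (suc n)) (λ j → conv (count i) (count j) N * pair a i j)) ∎
    where
    open IntegerSolver polyRing
    y-periodic : ∀ x → Periodic g (λ y → ψ (a *ₚ x *ₚ y))
    y-periodic x h k = ψ-mod {h = a *ₚ x *ₚ h} (a *ₚ x *ₚ k) (solve 4 (λ z h k g →
      z :* (h :+ k :* g) := z :* h :+ (z :* k) :* g) P.refl (a *ₚ x) h k (toPoly g))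
    x-periodic : ∀ y h k → ψ (a *ₚ (h +ₚ k *ₚ toPoly g) *ₚ y) ≈ ψ (a *ₚ h *ₚ y)
    x-periodic y h k = ψ-mod {h = a *ₚ h *ₚ y} (a *ₚ k *ₚ y) (solve 5 (λ a h k g y →
      a :* (h :+ k :* g) :* y := a :* h :* y :+ (a :* k :* y) :* g) P.refl a h k (toPoly g) y)
    distribute : ∀ m i → count i m *
      ∑E i (λ x → ∑ (List.upTo (suc n)) (λ j → count j (N ∸ m) * ∑E j (λ y → ψ (a *ₚ x *ₚ y)))) ≈
      ∑ (List.upTo (suc n)) (λ j → count i m * count j (N ∸ m) * pair a i j)
    distribute m i = trans (*-congˡ (trans (∑-swap (monics i) (List.upTo (suc n)) _) (∑-cong (List.upTo (suc n)) (λ j →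
        ∑-*ˡ (monics i) (count j (N ∸ m)) _))))
      (trans (sym (∑-*ˡ (List.upTo (suc n)) (count i m) _)) (∑-cong (List.upTo (suc n)) (λ j → sym (*-assoc _ _ _))))

  -- Reduces the series to finitely many Cauchy products of explicit series, one for each pair of
  -- residue classes; `D≈∑pair` gives the same combination of their sums.
  term≈conv : ∀ a u N → ∑ (monics N) (λ f → d f · 1# * ψ (a *ₚ toPoly f) * u ^ N) ≈
    ∑ (List.upTo (suc n)) (λ i → ∑ (List.upTo (suc n)) (λ j →
      conv (λ k → count i k * u ^ k) (λ k → count j k * u ^ k) N * pair a i j))
  term≈conv a u N = begin
    ∑ (monics N) (λ f → d f · 1# * ψ (a *ₚ toPoly f) * u ^ N)
      ≈⟨ trans (∑-*ʳ (monics N) (u ^ N) _) (*-congʳ (coefficient a N)) ⟩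
    ∑ (List.upTo (suc n)) (λ i → ∑ (List.upTo (suc n)) (λ j → conv (count i) (count j) N * pair a i j)) * u ^ N
      ≈⟨ sym (trans (∑-cong (List.upTo (suc n)) (λ i → ∑-*ʳ (List.upTo (suc n)) (u ^ N) _)) (∑-*ʳ (List.upTo (suc n)) (u ^ N) _)) ⟩
    ∑ (List.upTo (suc n)) (λ i → ∑ (List.upTo (suc n)) (λ j → conv (count i) (count j) N * pair a i j * u ^ N))
      ≈⟨ ∑-cong (List.upTo (suc n)) (λ i → ∑-cong (List.upTo (suc n)) (λ j → trans
           (solve 3 (λ c p u → c :* p :* u := c :* u :* p) refl _ (pair a i j) (u ^ N))
           (*-congʳ (sym (conv-powers u (count i) (count j) N))))) ⟩
    ∑ (List.upTo (suc n)) (λ i → ∑ (List.upTo (suc n)) (λ j →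
      conv (λ k → count i k * u ^ k) (λ k → count j k * u ^ k) N * pair a i j)) ∎
    where open IntegerSolver K

-- Inequalities in an Archimedean ordered field.

module OrderedField (R : RealField) where

  open RealField R
  private module < = IsStrictTotalOrder isStrictTotalOrder
  open IntegerSolver commutativeRing
  open SemiringExp semiring using (_^_; ^-congˡ)
  open RingSum commutativeRing using (1^)

  strictPartialOrder : StrictPartialOrder 0ℓ 0ℓ 0ℓ
  strictPartialOrder = record { isStrictPartialOrder = <.isStrictPartialOrder }

  module ≤R = OrderReasoning strictPartialOrder
  open ≤R

  infix 4 _≤_
  _≤_ : ℝ → ℝ → Set
  x ≤ y = x < y ⊎ x ≈ y

  <-trans : ∀ {x y z} → x < y → y < z → x < z
  <-trans = <.trans

  <-irrefl : ∀ {x} → ¬ x < x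
  <-irrefl = <.irrefl refl

  <-cong : ∀ {x x′ y y′} → x ≈ x′ → y ≈ y′ → x < y → x′ < y′
  <-cong x≈ y≈ x<y = <.<-respˡ-≈ x≈ (<.<-respʳ-≈ y≈ x<y)

  ≤-cong : ∀ {x x′ y y′} → x ≈ x′ → y ≈ y′ → x ≤ y → x′ ≤ y′
  ≤-cong x≈ y≈ (inj₁ x<y) = inj₁ (<-cong x≈ y≈ x<y)
  ≤-cong x≈ y≈ (inj₂ x≈y) = inj₂ (trans (sym x≈) (trans x≈y y≈))

  ≤-refl : ∀ {x} → x ≤ x
  ≤-refl = inj₂ refl

  ≤-<-trans : ∀ {x y z} → x ≤ y → y < z → x < z
  ≤-<-trans (inj₁ x<y) y<z = <-trans x<y y<z
  ≤-<-trans (inj₂ x≈y) y<z = <-cong (sym x≈y) refl y<z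

  <-≤-trans : ∀ {x y z} → x < y → y ≤ z → x < z
  <-≤-trans x<y (inj₁ y<z) = <-trans x<y y<z
  <-≤-trans x<y (inj₂ y≈z) = <-cong refl y≈z x<y

  ≤-trans : ∀ {x y z} → x ≤ y → y ≤ z → x ≤ z
  ≤-trans (inj₁ x<y) y≤z = inj₁ (<-≤-trans x<y y≤z)
  ≤-trans (inj₂ x≈y) y≤z = ≤-cong (sym x≈y) refl y≤z

  ≤⇒≯ : ∀ {x y} → x ≤ y → ¬ y < x
  ≤⇒≯ x≤y y<x = <-irrefl (≤-<-trans x≤y y<x)

  ≮⇒≥ : ∀ {x y} → ¬ x < y → y ≤ x
  ≮⇒≥ {x} {y} x≮y with compare x y
  ... | tri< x<y _ _ = contradiction x<y x≮y
  ... | tri≈ _ x≈y _ = inj₂ (sym x≈y)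
  ... | tri> _ _ y<x = inj₁ y<x

  ≰⇒> : ∀ {x y} → ¬ y ≤ x → x < y
  ≰⇒> {x} {y} y≰x with compare x y
  ... | tri< x<y _ _ = x<y
  ... | tri≈ _ x≈y _ = contradiction (inj₂ (sym x≈y)) y≰x
  ... | tri> _ _ y<x = contradiction (inj₁ y<x) y≰x

  <⇒≉ : ∀ {x y} → x < y → ¬ x ≈ y
  <⇒≉ x<y x≈y = <.irrefl x≈y x<y

  x<y⇒0<y-x : ∀ {x y} → x < y → 0# < y - x
  x<y⇒0<y-x {x} x<y = <-cong (-‿inverseʳ x) refl (+-monoˡ-< (- x) x<y)

  0<y-x⇒x<y : ∀ {x y} → 0# < y - x → x < y
  0<y-x⇒x<y {x} {y} 0<y-x = <-cong (+-identityˡ x)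
    (solve 2 (λ x y → (y :- x) :+ x := y) refl x y) (+-monoˡ-< x 0<y-x)

  0≤y-x⇒x≤y : ∀ {x y} → 0# ≤ y - x → x ≤ y
  0≤y-x⇒x≤y (inj₁ 0<) = inj₁ (0<y-x⇒x<y 0<)
  0≤y-x⇒x≤y {x} {y} (inj₂ 0≈) = inj₂ (begin-equality
    x            ≈⟨ sym (+-identityˡ x) ⟩
    0# + x       ≈⟨ +-congʳ 0≈ ⟩
    y - x + x    ≈⟨ solve 2 (λ x y → (y :- x) :+ x := y) refl x y ⟩
    y            ∎)

  x≤y⇒0≤y-x : ∀ {x y} → x ≤ y → 0# ≤ y - x
  x≤y⇒0≤y-x (inj₁ x<y) = inj₁ (x<y⇒0<y-x x<y)
  x≤y⇒0≤y-x {x} (inj₂ x≈y) = inj₂ (trans (sym (-‿inverseʳ x)) (+-congʳ x≈y))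

  ≤-by : ∀ {x y e} → 0# ≤ e → y - x ≈ e → x ≤ y
  ≤-by 0≤e eq = 0≤y-x⇒x≤y (≤-cong refl (sym eq) 0≤e)

  <-by : ∀ {x y e} → 0# < e → y - x ≈ e → x < y
  <-by 0<e eq = 0<y-x⇒x<y (<-cong refl (sym eq) 0<e)

  +-pos : ∀ {x y} → 0# < x → 0# ≤ y → 0# < x + y
  +-pos {x} {y} 0<x 0≤y = <-≤-trans 0<x (≤-by 0≤y (solve 2 (λ x y → (x :+ y) :- x := y) refl x y))

  +-nonneg : ∀ {x y} → 0# ≤ x → 0# ≤ y → 0# ≤ x + y
  +-nonneg (inj₁ 0<x) 0≤y = inj₁ (+-pos 0<x 0≤y)
  +-nonneg {x} {y} (inj₂ 0≈x) 0≤y = ≤-cong refl (trans (sym (+-identityˡ y)) (+-congʳ 0≈x)) 0≤y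

  *-nonneg : ∀ {x y} → 0# ≤ x → 0# ≤ y → 0# ≤ x * y
  *-nonneg (inj₁ 0<x) (inj₁ 0<y) = inj₁ (*-pos 0<x 0<y)
  *-nonneg {x} {y} (inj₂ 0≈x) _ = inj₂ (trans (sym (zeroˡ y)) (*-congʳ 0≈x))
  *-nonneg {x} {y} _ (inj₂ 0≈y) = inj₂ (trans (sym (zeroʳ x)) (*-congˡ 0≈y))

  +-mono-≤ : ∀ {x x′ y y′} → x ≤ x′ → y ≤ y′ → x + y ≤ x′ + y′
  +-mono-≤ {x} {x′} {y} {y′} x≤ y≤ = ≤-by (+-nonneg (x≤y⇒0≤y-x x≤) (x≤y⇒0≤y-x y≤))
    (solve 4 (λ x x′ y y′ → (x′ :+ y′) :- (x :+ y) := (x′ :- x) :+ (y′ :- y)) refl x x′ y y′)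

  *-monoˡ-≤ : ∀ {x y} z → 0# ≤ z → x ≤ y → z * x ≤ z * y
  *-monoˡ-≤ {x} {y} z 0≤z x≤y = ≤-by (*-nonneg 0≤z (x≤y⇒0≤y-x x≤y))
    (solve 3 (λ x y z → z :* y :- z :* x := z :* (y :- x)) refl x y z)

  *-monoʳ-≤ : ∀ {x y} z → 0# ≤ z → x ≤ y → x * z ≤ y * z
  *-monoʳ-≤ z 0≤z x≤y = ≤-cong (*-comm _ _) (*-comm _ _) (*-monoˡ-≤ z 0≤z x≤y)

  *-monoˡ-< : ∀ {x y} z → 0# < z → x < y → z * x < z * y
  *-monoˡ-< {x} {y} z 0<z x<y = <-by (*-pos 0<z (x<y⇒0<y-x x<y))
    (solve 3 (λ x y z → z :* y :- z :* x := z :* (y :- x)) refl x y z)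

  *-mono-≤ : ∀ {x x′ y y′} → 0# ≤ x → 0# ≤ y′ → x ≤ x′ → y ≤ y′ → x * y ≤ x′ * y′
  *-mono-≤ {x} {x′} {y} {y′} 0≤x 0≤y′ x≤ y≤ = ≤-trans (*-monoˡ-≤ x 0≤x y≤) (*-monoʳ-≤ y′ 0≤y′ x≤)

  neg-pos : ∀ {x} → x < 0# → 0# < - x
  neg-pos {x} x<0 = <-cong refl (+-identityˡ (- x)) (x<y⇒0<y-x x<0)

  square-nonneg : ∀ x → 0# ≤ x * x
  square-nonneg x with compare 0# x
  ... | tri< 0<x _ _ = inj₁ (*-pos 0<x 0<x)
  ... | tri≈ _ 0≈x _ = inj₂ (trans (sym (zeroˡ x)) (*-congʳ 0≈x))
  ... | tri> _ _ x<0 = inj₁ (<-cong refl (solve 1 (λ x → :- x :* :- x := x :* x) refl x)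
                              (*-pos (neg-pos x<0) (neg-pos x<0)))

  square-pos : ∀ {x} → ¬ x ≈ 0# → 0# < x * x
  square-pos {x} x≉0 with compare 0# x
  ... | tri< 0<x _ _ = *-pos 0<x 0<x
  ... | tri≈ _ 0≈x _ = contradiction (sym 0≈x) x≉0
  ... | tri> _ _ x<0 = <-cong refl (solve 1 (λ x → :- x :* :- x := x :* x) refl x)
                              (*-pos (neg-pos x<0) (neg-pos x<0))

  0<1 : 0# < 1#
  0<1 = <-cong refl (*-identityˡ 1#) (square-pos (λ 1≈0 → 0#≉1# (sym 1≈0)))

  0≤1 : 0# ≤ 1#
  0≤1 = inj₁ 0<1

  square-cancel-≤ : ∀ {x y} → 0# ≤ y → x * x ≤ y * y → x ≤ y
  square-cancel-≤ {x} {y} 0≤y x²≤y² = ≮⇒≥ λ y<x → ≤⇒≯ x²≤y²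
    (<-by (*-pos (x<y⇒0<y-x y<x) (+-pos (≤-<-trans 0≤y y<x) 0≤y))
      (solve 2 (λ x y → x :* x :- y :* y := (x :- y) :* (x :+ y)) refl x y))

  reciprocal-pos : ∀ {x} → 0# < x → ∃[ y ] x * y ≈ 1# × 0# < y
  reciprocal-pos {x} 0<x = y , xy≈1 , positive
    where
    y = proj₁ (inverse x (λ x≈0 → <-irrefl (<-cong refl x≈0 0<x)))
    xy≈1 = proj₂ (inverse x (λ x≈0 → <-irrefl (<-cong refl x≈0 0<x)))
    positive : 0# < y
    positive = ≰⇒> λ y≤0 → ≤⇒≯ (≤-cong xy≈1 (zeroʳ x) (*-monoˡ-≤ x (inj₁ 0<x) y≤0)) 0<1

  half : ℝ
  half = proj₁ (reciprocal-pos (+-pos 0<1 0≤1))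

  0<half : 0# < half
  0<half = proj₂ (proj₂ (reciprocal-pos (+-pos 0<1 0≤1)))

  half+half : ∀ x → x * half + x * half ≈ x
  half+half x = begin-equality
    x * half + x * half   ≈⟨ solve 2 (λ x h → x :* h :+ x :* h := x :* ((:1 :+ :1) :* h)) refl x half ⟩
    x * ((1# + 1#) * half) ≈⟨ *-congˡ (proj₁ (proj₂ (reciprocal-pos (+-pos 0<1 0≤1)))) ⟩
    x * 1#                ≈⟨ *-identityʳ x ⟩
    x                     ∎

  ·1-nonneg : ∀ n → 0# ≤ n · 1#
  ·1-nonneg zero    = ≤-refl
  ·1-nonneg (suc n) = +-nonneg 0≤1 (·1-nonneg n)

  suc·1-pos : ∀ n → 0# < suc n · 1#
  suc·1-pos n = +-pos 0<1 (·1-nonneg n)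

  ·1-mono-≤ : ∀ {m n} → m ℕ.≤ n → m · 1# ≤ n · 1#
  ·1-mono-≤ {n = n} z≤n = ·1-nonneg n
  ·1-mono-≤ (s≤s m≤n)   = +-mono-≤ ≤-refl (·1-mono-≤ m≤n)

  ^-pos : ∀ {r} → 0# < r → ∀ n → 0# < r ^ n
  ^-pos 0<r zero    = 0<1
  ^-pos 0<r (suc n) = *-pos 0<r (^-pos 0<r n)

  ^-nonneg : ∀ {r} → 0# ≤ r → ∀ n → 0# ≤ r ^ n
  ^-nonneg 0≤r zero    = 0≤1
  ^-nonneg 0≤r (suc n) = *-nonneg 0≤r (^-nonneg 0≤r n)

  ^-mono-≤ : ∀ {r s} → 0# ≤ r → r ≤ s → ∀ n → r ^ n ≤ s ^ n
  ^-mono-≤ 0≤r r≤s zero    = ≤-refl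
  ^-mono-≤ 0≤r r≤s (suc n) = *-mono-≤ 0≤r (^-nonneg (≤-trans 0≤r r≤s) n) r≤s (^-mono-≤ 0≤r r≤s n)

  -- The first two terms of the binomial expansion of (r + h)^(n+1).
  bernoulli : ∀ {r h} → 0# ≤ r → 0# ≤ h → ∀ n →
              r ^ suc n + (suc n · 1#) * h * r ^ n ≤ (r + h) ^ suc n
  bernoulli {r} {h} 0≤r 0≤h zero =
    inj₂ (solve 2 (λ r h → r :* :1 :+ (:1 :+ :0) :* h :* :1 := (r :+ h) :* :1) refl r h)
  bernoulli {r} {h} 0≤r 0≤h (suc n) = ≤-trans
    (≤-by (*-nonneg (*-nonneg (*-nonneg (·1-nonneg (suc n)) 0≤h) 0≤h) (^-nonneg 0≤r n))
      (solve 4 (λ r h m p → (r :+ h) :* (r :* p :+ m :* h :* p) :-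
          (r :* (r :* p) :+ (:1 :+ m) :* h :* (r :* p)) := m :* h :* h :* p) refl r h (suc n · 1#) (r ^ n)))
    (*-monoˡ-≤ (r + h) (+-nonneg 0≤r 0≤h) (bernoulli 0≤r 0≤h n))

  -- Lets a linear factor be absorbed by a slight increase of the ratio; this drives both
  -- `geometric-null` and the bound for Cauchy products.
  linear*geometric : ∀ {r h} → 0# ≤ r → 0# ≤ h → ∀ n → (suc n · 1#) * h * r ^ n ≤ (r + h) ^ suc n
  linear*geometric {r} {h} 0≤r 0≤h n = ≤-trans
    (≤-by (^-nonneg 0≤r (suc n)) (solve 2 (λ p x → (p :+ x) :- x := p) refl (r ^ suc n) _))
    (bernoulli 0≤r 0≤h n)

  -- With h = 1 - r the previous bound reads (n + 1) h r^n ≤ 1, and the Archimedean property makes n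
  -- + 1 exceed M / (h ε).
  geometric-null : ∀ {r} → 0# ≤ r → r < 1# → ∀ M → 0# ≤ M → ∀ ε → 0# < ε →
                   ∃[ N ] ∀ n → N ℕ.≤ n → M * r ^ n < ε
  geometric-null {r} 0≤r r<1 M 0≤M ε 0<ε = N , bound
    where
    h = 1# - r
    0<h : 0# < h
    0<h = x<y⇒0<y-x r<1
    y = proj₁ (reciprocal-pos (*-pos 0<h 0<ε))
    hεy≈1 : h * ε * y ≈ 1#
    hεy≈1 = proj₁ (proj₂ (reciprocal-pos (*-pos 0<h 0<ε)))
    N = proj₁ (archimedean (M * y))
    bound : ∀ n → N ℕ.≤ n → M * r ^ n < ε
    bound n N≤n = ≰⇒> λ ε≤ → ≤⇒≯ (small ε≤) large
      where
      large : M < (suc n · 1#) * (h * ε)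
      large = <-cong (trans (solve 3 (λ x m y → x :* (m :* y) := m :* (x :* y)) refl (h * ε) M y)
          (trans (*-congˡ hεy≈1) (*-identityʳ M))) (*-comm _ _)
        (*-monoˡ-< (h * ε) (*-pos 0<h 0<ε) (<-≤-trans (proj₂ (archimedean (M * y)))
          (·1-mono-≤ (ℕ.m≤n⇒m≤1+n N≤n))))
      small : ε ≤ M * r ^ n → (suc n · 1#) * (h * ε) ≤ M
      small ε≤ = ≤-trans (*-monoˡ-≤ _ (·1-nonneg (suc n)) (*-monoˡ-≤ h (inj₁ 0<h) ε≤))
        (≤-cong (solve 4 (λ m k h p → m :* (k :* h :* p) := k :* (h :* (m :* p))) refl M (suc n · 1#) h (r ^ n))
                (*-identityʳ M)
          (*-monoˡ-≤ M 0≤M (≤-trans (linear*geometric 0≤r (inj₁ 0<h) n)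
            (inj₂ (trans (^-congˡ (suc n) (solve 1 (λ r → r :+ (:1 :- r) := :1) refl r)) (1^ (suc n)))))))

-- The field of complex numbers and its norm.

module ComplexField (R : RealField) where

  open Complex R public using (ℂ; _+i_; re; im; ∣_∣<_; normSq; 0ℂ; 1ℂ; ofReal)
  private
    module ℝ = RealField R
    module C = Complex R
  open ℝ using (ℝ) renaming (_<_ to _<ᴿ_; _*_ to _*ᴿ_; _≈_ to _≈ᴿ_)
  open OrderedField R
  open IntegerSolver ℝ.commutativeRing

  complexRing : CommutativeRing 0ℓ 0ℓ
  complexRing = record
    { Carrier = ℂ ; _≈_ = C._≈_ ; _+_ = C._+_ ; _*_ = C._*_ ; -_ = C.-_ ; 0# = 0ℂ ; 1# = 1ℂ
    ; isCommutativeRing = record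
      { isRing = record
        { +-isAbelianGroup = record
          { isGroup = record
            { isMonoid = record
              { isSemigroup = record
                { isMagma = record
                  { isEquivalence = record
                    { refl  = ℝ.refl , ℝ.refl
                    ; sym   = λ (p , q) → ℝ.sym p , ℝ.sym q
                    ; trans = λ (p , q) (p′ , q′) → ℝ.trans p p′ , ℝ.trans q q′ }
                  ; ∙-cong = λ (p , q) (p′ , q′) → ℝ.+-cong p p′ , ℝ.+-cong q q′ }
                ; assoc = λ x y z → ℝ.+-assoc _ _ _ , ℝ.+-assoc _ _ _ }
              ; identity = (λ x → ℝ.+-identityˡ _ , ℝ.+-identityˡ _) , (λ x → ℝ.+-identityʳ _ , ℝ.+-identityʳ _) }
            ; inverse = (λ x → ℝ.-‿inverseˡ _ , ℝ.-‿inverseˡ _) , (λ x → ℝ.-‿inverseʳ _ , ℝ.-‿inverseʳ _)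
            ; ⁻¹-cong = λ (p , q) → ℝ.-‿cong p , ℝ.-‿cong q }
          ; comm = λ x y → ℝ.+-comm _ _ , ℝ.+-comm _ _ }
        ; *-cong = λ (p , q) (p′ , q′) →
            ℝ.+-cong (ℝ.*-cong p p′) (ℝ.-‿cong (ℝ.*-cong q q′)) , ℝ.+-cong (ℝ.*-cong p q′) (ℝ.*-cong q p′)
        ; *-assoc = λ (a +i b) (c +i d) (e +i f) →
            solve 6 (λ a b c d e f → (a :* c :- b :* d) :* e :- (a :* d :+ b :* c) :* f :=
              a :* (c :* e :- d :* f) :- b :* (c :* f :+ d :* e)) ℝ.refl a b c d e f ,
            solve 6 (λ a b c d e f → (a :* c :- b :* d) :* f :+ (a :* d :+ b :* c) :* e :=
              a :* (c :* f :+ d :* e) :+ b :* (c :* e :- d :* f)) ℝ.refl a b c d e f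
        ; *-identity =
            (λ (a +i b) → solve 2 (λ a b → :1 :* a :- :0 :* b := a) ℝ.refl a b ,
                          solve 2 (λ a b → :1 :* b :+ :0 :* a := b) ℝ.refl a b) ,
            (λ (a +i b) → solve 2 (λ a b → a :* :1 :- b :* :0 := a) ℝ.refl a b ,
                          solve 2 (λ a b → a :* :0 :+ b :* :1 := b) ℝ.refl a b)
        ; distrib =
            (λ (a +i b) (c +i d) (e +i f) →
              solve 6 (λ a b c d e f → a :* (c :+ e) :- b :* (d :+ f) := (a :* c :- b :* d) :+ (a :* e :- b :* f))
                ℝ.refl a b c d e f ,
              solve 6 (λ a b c d e f → a :* (d :+ f) :+ b :* (c :+ e) := (a :* d :+ b :* c) :+ (a :* f :+ b :* e))
                ℝ.refl a b c d e f) ,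
            (λ (a +i b) (c +i d) (e +i f) →
              solve 6 (λ a b c d e f → (c :+ e) :* a :- (d :+ f) :* b := (c :* a :- d :* b) :+ (e :* a :- f :* b))
                ℝ.refl a b c d e f ,
              solve 6 (λ a b c d e f → (c :+ e) :* b :+ (d :+ f) :* a := (c :* b :+ d :* a) :+ (e :* b :+ f :* a))
                ℝ.refl a b c d e f) }
      ; *-comm = λ (a +i b) (c +i d) →
          solve 4 (λ a b c d → a :* c :- b :* d := c :* a :- d :* b) ℝ.refl a b c d ,
          solve 4 (λ a b c d → a :* d :+ b :* c := c :* b :+ d :* a) ℝ.refl a b c d } }

  open CommutativeRing complexRing

  normSq-cong : ∀ {z w} → z ≈ w → normSq z ≈ᴿ normSq w
  normSq-cong (p , q) = ℝ.+-cong (ℝ.*-cong p p) (ℝ.*-cong q q)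

  normSq-nonneg : ∀ z → ℝ.0# ≤ normSq z
  normSq-nonneg z = +-nonneg (square-nonneg (re z)) (square-nonneg (im z))

  normSq-* : ∀ z w → normSq (z * w) ≈ᴿ normSq z *ᴿ normSq w
  normSq-* (a +i b) (c +i d) = solve 4 (λ a b c d →
    (a :* c :- b :* d) :* (a :* c :- b :* d) :+ (a :* d :+ b :* c) :* (a :* d :+ b :* c) :=
    (a :* a :+ b :* b) :* (c :* c :+ d :* d)) ℝ.refl a b c d

  normSq-neg : ∀ z → normSq (- z) ≈ᴿ normSq z
  normSq-neg (a +i b) = solve 2 (λ a b → :- a :* :- a :+ :- b :* :- b := a :* a :+ b :* b) ℝ.refl a b

  normSq-0 : normSq 0ℂ ≈ᴿ ℝ.0#
  normSq-0 = solve 0 (:0 :* :0 :+ :0 :* :0 := :0) ℝ.refl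

  normSq-1 : normSq 1ℂ ≈ᴿ ℝ.1#
  normSq-1 = solve 0 (:1 :* :1 :+ :0 :* :0 := :1) ℝ.refl

  normSq-pos : ∀ {z} → ¬ z ≈ 0ℂ → ℝ.0# <ᴿ normSq z
  normSq-pos {a +i b} z≉0 with a ℝ.≟ ℝ.0# | b ℝ.≟ ℝ.0#
  ... | yes a≈0 | yes b≈0 = contradiction (a≈0 , b≈0) z≉0
  ... | no a≉0  | _       = +-pos (square-pos a≉0) (square-nonneg b)
  ... | yes _   | no b≉0  = <-cong ℝ.refl (ℝ.+-comm _ _) (+-pos (square-pos b≉0) (square-nonneg a))

  _≟_ : ∀ z w → Dec (z ≈ w)
  (a +i b) ≟ (c +i d) with a ℝ.≟ c | b ℝ.≟ d
  ... | yes p | yes q = yes (p , q)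
  ... | no ¬p | _     = no (¬p ∘ proj₁)
  ... | yes _ | no ¬q = no (¬q ∘ proj₂)

  infix 9 _⁻¹
  _⁻¹ : ℂ → ℂ
  _⁻¹ = C._⁻¹

  *-inverse : ∀ z → ¬ z ≈ 0ℂ → z * z ⁻¹ ≈ 1ℂ
  *-inverse z@(a +i b) z≉0 with normSq z ℝ.≟ ℝ.0#
  ... | yes ≈0 = contradiction (ℝ.sym ≈0) (<⇒≉ (normSq-pos z≉0))
  ... | no ≉0  =
    ℝ.trans (solve 3 (λ a b r → a :* (a :* r) :- b :* :- (b :* r) := (a :* a :+ b :* b) :* r) ℝ.refl a b r) nr≈1 ,
    solve 3 (λ a b r → a :* :- (b :* r) :+ b :* (a :* r) := :0) ℝ.refl a b r
    where
    r = proj₁ (ℝ.inverse (normSq z) ≉0)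
    nr≈1 : normSq z *ᴿ r ≈ᴿ ℝ.1#
    nr≈1 = proj₂ (ℝ.inverse (normSq z) ≉0)

  0⁻¹ : ∀ {z} → z ≈ 0ℂ → z ⁻¹ ≈ 0ℂ
  0⁻¹ {z} z≈0 with normSq z ℝ.≟ ℝ.0#
  ... | yes _ = refl
  ... | no ≉0 = contradiction (ℝ.trans (normSq-cong z≈0) normSq-0) ≉0

  1≉0 : ¬ 1ℂ ≈ 0ℂ
  1≉0 (1≈0 , _) = ℝ.0#≉1# (ℝ.sym 1≈0)

module FieldLemmas (K : CommutativeRing 0ℓ 0ℓ) where

  open CommutativeRing K
  open IntegerSolver K
  open SetoidReasoning setoid

  inverse-unique : ∀ {x y z} → x * y ≈ 1# → x * z ≈ 1# → y ≈ z
  inverse-unique {x} {y} {z} xy≈1 xz≈1 = begin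
    y            ≈⟨ sym (*-identityʳ y) ⟩
    y * 1#       ≈⟨ *-congˡ (sym xz≈1) ⟩
    y * (x * z)  ≈⟨ solve 3 (λ x y z → y :* (x :* z) := x :* y :* z) refl x y z ⟩
    x * y * z    ≈⟨ *-congʳ xy≈1 ⟩
    1# * z       ≈⟨ *-identityˡ z ⟩
    z            ∎

  cancel-inverse : ∀ {x y} z → x * y ≈ 1# → y * (x * z) ≈ z
  cancel-inverse {x} {y} z xy≈1 = begin
    y * (x * z)  ≈⟨ solve 3 (λ x y z → y :* (x :* z) := x :* y :* z) refl x y z ⟩
    x * y * z    ≈⟨ *-congʳ xy≈1 ⟩
    1# * z       ≈⟨ *-identityˡ z ⟩
    z            ∎

  *-cancelˡ-invertible : ∀ {x x⁻¹ y z} → x * x⁻¹ ≈ 1# → x * y ≈ x * z → y ≈ z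
  *-cancelˡ-invertible {y = y} {z} inv eq =
    trans (sym (cancel-inverse y inv)) (trans (*-congˡ eq) (cancel-inverse z inv))

  x-y≈0⇒x≈y : ∀ {x y} → x - y ≈ 0# → x ≈ y
  x-y≈0⇒x≈y {x} {y} eq = begin
    x           ≈⟨ solve 2 (λ x y → x := (x :- y) :+ y) refl x y ⟩
    x - y + y   ≈⟨ +-congʳ eq ⟩
    0# + y      ≈⟨ +-identityˡ y ⟩
    y           ∎

  x≈y⇒x-y≈0 : ∀ {x y} → x ≈ y → x - y ≈ 0#
  x≈y⇒x-y≈0 {x} {y} x≈y = trans (+-congʳ x≈y) (-‿inverseʳ y)

  1-x≈0⇒x≈1 : ∀ {x} → 1# - x ≈ 0# → x ≈ 1#
  1-x≈0⇒x≈1 eq = sym (x-y≈0⇒x≈y eq)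

  telescope : ∀ x y z → (x - y) + (y - z) ≈ x - z
  telescope = solve 3 (λ x y z → (x :- y) :+ (y :- z) := x :- z) refl

  last-difference : ∀ x a s → (x + a - s) + - (x - s) ≈ a
  last-difference = solve 3 (λ x a s → (x :+ a :- s) :+ :- (x :- s) := a) refl

  sub-+ : ∀ x y s t → (x - s) + (y - t) ≈ (x + y) - (s + t)
  sub-+ = solve 4 (λ x y s t → (x :- s) :+ (y :- t) := (x :+ y) :- (s :+ t)) refl

  sub-*ʳ : ∀ x s c → (x - s) * c ≈ x * c - s * c
  sub-*ʳ = solve 3 (λ x s c → (x :- s) :* c := x :* c :- s :* c) refl

  sub-cancelˡ : ∀ x y s → y - s ≈ (x + y) - (x + s)
  sub-cancelˡ = solve 3 (λ x y s → y :- s := (x :+ y) :- (x :+ s)) refl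

  sub-cancelʳ : ∀ x y s → - y + ((x + y) - s) ≈ x - s
  sub-cancelʳ = solve 3 (λ x y s → :- y :+ ((x :+ y) :- s) := x :- s) refl

  neg-sub : ∀ x y → - (x - y) ≈ y - x
  neg-sub = solve 2 (λ x y → :- (x :- y) := y :- x) refl

module ComplexNorm (R : RealField) where

  open ComplexField R
  private
    module ℝ = RealField R
    module C = Complex R
  open ℝ using (ℝ) renaming (_<_ to _<ᴿ_; _+_ to _+ᴿ_; _*_ to _*ᴿ_; -_ to -ᴿ_; _-_ to _-ᴿ_; _≈_ to _≈ᴿ_)
  open OrderedField R
  open SemiringExp ℝ.semiring using () renaming (_^_ to _^ᴿ_)
  open CommutativeRing complexRing
  open FieldLemmas complexRing
  open RingSum complexRing using (_^_)

  ⁻¹-unique : ∀ {z w} → z * w ≈ 1ℂ → z ⁻¹ ≈ w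
  ⁻¹-unique {z} {w} zw≈1 = inverse-unique (*-inverse z z≉0) zw≈1
    where
    z≉0 : ¬ z ≈ 0ℂ
    z≉0 z≈0 = 1≉0 (trans (sym zw≈1) (trans (*-congʳ z≈0) (zeroˡ w)))

  ⁻¹-cong : ∀ {z w} → z ≈ w → z ⁻¹ ≈ w ⁻¹
  ⁻¹-cong {z} {w} z≈w with w ≟ 0ℂ
  ... | yes w≈0 = trans (0⁻¹ (trans z≈w w≈0)) (sym (0⁻¹ w≈0))
  ... | no w≉0  = ⁻¹-unique (trans (*-congʳ z≈w) (*-inverse w w≉0))

  *-≉0 : ∀ {z w} → ¬ z ≈ 0ℂ → ¬ w ≈ 0ℂ → ¬ z * w ≈ 0ℂ
  *-≉0 {z} {w} z≉0 w≉0 zw≈0 = w≉0 (*-cancelˡ-invertible (*-inverse z z≉0) (trans zw≈0 (sym (zeroʳ z))))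

  infix 4 ∥_∥≤_
  -- Means |z| ≤ r, tested on squares since no square root is at hand; the sign of r is stored
  -- because r² does not determine it.
  record ∥_∥≤_ (z : ℂ) (r : ℝ) : Set where
    constructor bound
    field
      nonneg  : ℝ.0# ≤ r
      normSq≤ : normSq z ≤ r *ᴿ r
  open ∥_∥≤_ public

  ∥∥-cong : ∀ {z w r s} → z ≈ w → r ≈ᴿ s → ∥ z ∥≤ r → ∥ w ∥≤ s
  ∥∥-cong z≈w r≈s (bound 0≤r z≤r) =
    bound (≤-cong ℝ.refl r≈s 0≤r) (≤-cong (normSq-cong z≈w) (ℝ.*-cong r≈s r≈s) z≤r)

  ∥∥-weaken : ∀ {z r s} → r ≤ s → ∥ z ∥≤ r → ∥ z ∥≤ s
  ∥∥-weaken r≤s (bound 0≤r z≤r) =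
    bound (≤-trans 0≤r r≤s) (≤-trans z≤r (*-mono-≤ 0≤r (≤-trans 0≤r r≤s) r≤s r≤s))

  ∥∥-0 : ∀ {r} → ℝ.0# ≤ r → ∥ 0ℂ ∥≤ r
  ∥∥-0 0≤r = bound 0≤r (≤-cong (ℝ.sym normSq-0) ℝ.refl (*-nonneg 0≤r 0≤r))

  ∥∥-1 : ∥ 1ℂ ∥≤ ℝ.1#
  ∥∥-1 = bound 0≤1 (inj₂ (ℝ.trans normSq-1 (ℝ.sym (ℝ.*-identityˡ _))))

  ∥∥-neg : ∀ {z r} → ∥ z ∥≤ r → ∥ - z ∥≤ r
  ∥∥-neg {z} (bound 0≤r z≤r) = bound 0≤r (≤-cong (ℝ.sym (normSq-neg z)) ℝ.refl z≤r)

  ∥∥-* : ∀ {z w r s} → ∥ z ∥≤ r → ∥ w ∥≤ s → ∥ z * w ∥≤ r *ᴿ s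
  ∥∥-* {z} {w} {r} {s} (bound 0≤r z≤r) (bound 0≤s w≤s) = bound (*-nonneg 0≤r 0≤s)
    (≤-cong (ℝ.sym (normSq-* z w)) (solve 2 (λ r s → r :* r :* (s :* s) := r :* s :* (r :* s)) ℝ.refl r s)
      (*-mono-≤ (normSq-nonneg z) (*-nonneg 0≤s 0≤s) z≤r w≤s))
    where open IntegerSolver ℝ.commutativeRing

  -- By the Cauchy-Schwarz inequality inner≤.
  ∥∥-+ : ∀ {z w r s} → ∥ z ∥≤ r → ∥ w ∥≤ s → ∥ z + w ∥≤ r +ᴿ s
  ∥∥-+ {z@(a +i b)} {w@(c +i d)} {r} {s} (bound 0≤r z≤r) (bound 0≤s w≤s) = bound (+-nonneg 0≤r 0≤s)
    (≤-cong (solve 4 (λ a b c d → (a :* a :+ b :* b) :+ ((:1 :+ :1) :* (a :* c :+ b :* d) :+ (c :* c :+ d :* d)) :=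
               (a :+ c) :* (a :+ c) :+ (b :+ d) :* (b :+ d)) ℝ.refl a b c d)
            (solve 2 (λ r s → r :* r :+ ((:1 :+ :1) :* (r :* s) :+ s :* s) := (r :+ s) :* (r :+ s)) ℝ.refl r s)
      (+-mono-≤ z≤r (+-mono-≤ (*-monoˡ-≤ _ (+-nonneg 0≤1 0≤1) inner≤) w≤s)))
    where
    open IntegerSolver ℝ.commutativeRing
    inner≤ : a *ᴿ c +ᴿ b *ᴿ d ≤ r *ᴿ s
    inner≤ = square-cancel-≤ (*-nonneg 0≤r 0≤s) (≤-trans
      (≤-by (square-nonneg (a *ᴿ d -ᴿ b *ᴿ c)) (solve 4 (λ a b c d →
        (a :* a :+ b :* b) :* (c :* c :+ d :* d) :- (a :* c :+ b :* d) :* (a :* c :+ b :* d) :=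
        (a :* d :- b :* c) :* (a :* d :- b :* c)) ℝ.refl a b c d))
      (≤-cong ℝ.refl (solve 2 (λ r s → r :* r :* (s :* s) := r :* s :* (r :* s)) ℝ.refl r s)
        (*-mono-≤ (normSq-nonneg z) (*-nonneg 0≤s 0≤s) z≤r w≤s)))

  ∥∥-^ : ∀ {z r} → ∥ z ∥≤ r → ∀ n → ∥ z ^ n ∥≤ r ^ᴿ n
  ∥∥-^ z≤r zero    = ∥∥-1
  ∥∥-^ z≤r (suc n) = ∥∥-* z≤r (∥∥-^ z≤r n)

  ∥∥-ofReal : ∀ {x} → ℝ.0# ≤ x → ∥ ofReal x ∥≤ x
  ∥∥-ofReal {x} 0≤x = bound 0≤x (inj₂ (solve 1 (λ x → x :* x :+ :0 :* :0 := x :* x) ℝ.refl x))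
    where open IntegerSolver ℝ.commutativeRing

  -- With s = |z|² the bound 1 + s works, since s ≤ (1 + s)²; no square root is needed.
  ∥∥-exists : ∀ z → ∃[ r ] ∥ z ∥≤ r
  ∥∥-exists z = ℝ.1# +ᴿ s , bound (+-nonneg 0≤1 0≤s)
    (≤-by (+-nonneg 0≤1 (+-nonneg 0≤s (*-nonneg 0≤s 0≤s)))
      (solve 1 (λ s → (:1 :+ s) :* (:1 :+ s) :- s := :1 :+ (s :+ s :* s)) ℝ.refl s))
    where
    open IntegerSolver ℝ.commutativeRing
    s = normSq z
    0≤s = normSq-nonneg z

  ∥∥⇒∣∣< : ∀ {z r ε} → ∥ z ∥≤ r → r <ᴿ ε → ∣ z ∣< ε
  ∥∥⇒∣∣< {z} {r} {ε} (bound 0≤r z≤r) r<ε = 0<ε , ≤-<-trans z≤r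
    (<-by (*-pos′ (x<y⇒0<y-x r<ε) (+-pos 0<ε 0≤r)) (solve 2 (λ r e → e :* e :- r :* r := (e :- r) :* (e :+ r)) ℝ.refl r ε))
    where
    open IntegerSolver ℝ.commutativeRing
    open ℝ using () renaming (*-pos to *-pos′)
    0<ε : ℝ.0# <ᴿ ε
    0<ε = ≤-<-trans 0≤r r<ε

  ∣∣<⇒∥∥ : ∀ {z ε} → ∣ z ∣< ε → ∥ z ∥≤ ε
  ∣∣<⇒∥∥ (0<ε , z<ε) = bound (inj₁ 0<ε) (inj₁ z<ε)

  -- If d = |z|² were positive, ε = d / (1 + d) would refute the bound: both ε and 1 / (1 + d) are
  -- less than 1, hence ε² < ε < d.
  ∥∥-arbitrary⇒≈0 : ∀ {z} → (∀ ε → ℝ.0# <ᴿ ε → ∥ z ∥≤ ε) → z ≈ 0ℂ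
  ∥∥-arbitrary⇒≈0 {z} small with z ≟ 0ℂ
  ... | yes z≈0 = z≈0
  ... | no z≉0  = contradiction ε²<d (≤⇒≯ (normSq≤ (small ε 0<ε)))
    where
    open IntegerSolver ℝ.commutativeRing
    d = normSq z
    0<d = normSq-pos z≉0
    recip = reciprocal-pos (+-pos 0<1 (inj₁ 0<d))
    y = proj₁ recip
    0<y = proj₂ (proj₂ recip)
    ε = d *ᴿ y
    0<ε : ℝ.0# <ᴿ ε
    0<ε = ℝ.*-pos 0<d 0<y
    dy+y≈1 : d *ᴿ y +ᴿ y ≈ᴿ ℝ.1#
    dy+y≈1 = ℝ.trans (solve 2 (λ d y → d :* y :+ y := (:1 :+ d) :* y) ℝ.refl d y) (proj₁ (proj₂ recip))
    ε<1 : ε <ᴿ ℝ.1#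
    ε<1 = <-by 0<y (ℝ.trans (ℝ.+-congʳ (ℝ.sym dy+y≈1)) (solve 2 (λ e y → e :+ y :- e := y) ℝ.refl ε y))
    y<1 : y <ᴿ ℝ.1#
    y<1 = <-by 0<ε (ℝ.trans (ℝ.+-congʳ (ℝ.sym dy+y≈1)) (solve 2 (λ e y → e :+ y :- y := e) ℝ.refl ε y))
    ε²<d : ε *ᴿ ε <ᴿ d
    ε²<d = <-trans (<-cong ℝ.refl (ℝ.*-identityʳ ε) (*-monoˡ-< ε 0<ε ε<1))
      (<-cong ℝ.refl (ℝ.*-identityʳ d) (*-monoˡ-< d 0<d y<1))

  ofℕ : ℕ → ℂ
  ofℕ = C.ofℕ

  ofℕ≈ofReal : ∀ n → ofℕ n ≈ ofReal (n ℝ.· ℝ.1#)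
  ofℕ≈ofReal zero    = refl
  ofℕ≈ofReal (suc n) = trans (+-congˡ (ofℕ≈ofReal n)) (ℝ.refl , ℝ.+-identityˡ _)

  ofℕ-suc≉0 : ∀ n → ¬ ofℕ (suc n) ≈ 0ℂ
  ofℕ-suc≉0 n eq = <⇒≉ (suc·1-pos n) (ℝ.sym (proj₁ (trans (sym (ofℕ≈ofReal (suc n))) eq)))

  ofReal-* : ∀ x y → ofReal x * ofReal y ≈ ofReal (x *ᴿ y)
  ofReal-* x y = solve 2 (λ x y → x :* y :- :0 :* :0 := x :* y) ℝ.refl x y ,
                 solve 2 (λ x y → x :* :0 :+ :0 :* y := :0) ℝ.refl x y
    where open IntegerSolver ℝ.commutativeRing

-- Partial sums and geometrically convergent series.

module PartialSums (K : CommutativeRing 0ℓ 0ℓ) where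

  open CommutativeRing K
  open IntegerSolver K
  open RingSum K
  open Convolution K
  open SetoidReasoning setoid

  sumTo : (ℕ → Carrier) → ℕ → Carrier
  sumTo a zero    = 0#
  sumTo a (suc n) = sumTo a n + a n

  sumTo-cong : ∀ {a b} → (∀ n → a n ≈ b n) → ∀ n → sumTo a n ≈ sumTo b n
  sumTo-cong a≈b zero    = refl
  sumTo-cong a≈b (suc n) = +-cong (sumTo-cong a≈b n) (a≈b n)

  sumTo-+ : ∀ a b n → sumTo (λ k → a k + b k) n ≈ sumTo a n + sumTo b n
  sumTo-+ a b zero    = sym (+-identityˡ 0#)
  sumTo-+ a b (suc n) = trans (+-congʳ (sumTo-+ a b n)) (interchange _ _ _ _)

  sumTo-*ʳ : ∀ a c n → sumTo (λ k → a k * c) n ≈ sumTo a n * c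
  sumTo-*ʳ a c zero    = sym (zeroˡ c)
  sumTo-*ʳ a c (suc n) = trans (+-congʳ (sumTo-*ʳ a c n)) (sym (distribʳ c _ _))

  sumTo-suc : ∀ a n → sumTo a (suc n) ≈ a 0 + sumTo (a ∘ suc) n
  sumTo-suc a zero    = +-comm _ _
  sumTo-suc a (suc n) = trans (+-congʳ (sumTo-suc a n)) (+-assoc _ _ _)

  sumTo-0 : ∀ n → sumTo (λ _ → 0#) n ≈ 0#
  sumTo-0 zero    = refl
  sumTo-0 (suc n) = trans (+-identityʳ _) (sumTo-0 n)

  sumTo-+-tail : ∀ a n k → sumTo a (n ℕ.+ k) ≈ sumTo a n + sumTo (λ j → a (n ℕ.+ j)) k
  sumTo-+-tail a n zero    = trans (reflexive (≡.cong (sumTo a) (ℕ.+-identityʳ n))) (sym (+-identityʳ _))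
  sumTo-+-tail a n (suc k) = trans (reflexive (≡.cong (sumTo a) (ℕ.+-suc n k)))
    (trans (+-congʳ (sumTo-+-tail a n k)) (+-assoc _ _ _))

  sumTo-conv : ∀ a b n → sumTo (conv a b) n ≈ conv a (sumTo b) n
  sumTo-conv a b zero    = sym (zeroʳ _)
  sumTo-conv a b (suc n) = begin
    sumTo (conv a b) n + conv a b n            ≈⟨ +-congʳ (sumTo-conv a b n) ⟩
    conv a (sumTo b) n + conv a b n            ≈⟨ sym (conv-+ʳ a (sumTo b) b n) ⟩
    conv a (sumTo b ∘ suc) n                   ≈⟨ sym (trans (+-congˡ (zeroʳ _)) (+-identityʳ _)) ⟩
    conv a (sumTo b ∘ suc) n + a (suc n) * 0#  ≈⟨ sym (conv-snoc a (sumTo b) n) ⟩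
    conv a (sumTo b) (suc n)                   ∎

  conv-const : ∀ a c n → conv a (λ _ → c) n ≈ sumTo a (suc n) * c
  conv-const a c zero    = *-congʳ (sym (+-identityˡ _))
  conv-const a c (suc n) = trans (+-congˡ (conv-const (a ∘ suc) c n))
    (trans (sym (distribʳ c _ _)) (*-congʳ (sym (sumTo-suc a (suc n)))))

  -- As in Mertens' theorem, each partial sum of b inside the convolution is replaced by its limit B
  -- plus an error. The terms with B form a partial sum of a, and both remaining pieces are small.
  product-error : ∀ a b A B n → sumTo (conv a b) n - A * B ≈
    conv a (λ k → sumTo b k - B) n + (sumTo a (suc n) - A) * B
  product-error a b A B n = begin
    sumTo (conv a b) n - A * B
      ≈⟨ +-congʳ (trans (sumTo-conv a b n) (conv-cong {a = a} (λ _ → refl)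
           (λ k → solve 2 (λ s B → s := (s :- B) :+ B) refl (sumTo b k) B) n)) ⟩
    conv a (λ k → sumTo b k - B + B) n - A * B
      ≈⟨ +-congʳ (trans (conv-+ʳ a (λ k → sumTo b k - B) (λ _ → B) n) (+-congˡ (conv-const a B n))) ⟩
    conv a (λ k → sumTo b k - B) n + sumTo a (suc n) * B - A * B
      ≈⟨ solve 4 (λ c s A B → c :+ s :* B :- A :* B := c :+ (s :- A) :* B) refl _ (sumTo a (suc n)) A B ⟩
    conv a (λ k → sumTo b k - B) n + (sumTo a (suc n) - A) * B ∎

  geometric-error : ∀ {x c} → (1# - x) * c ≈ 1# → ∀ n → sumTo (x ^_) n - c ≈ x ^ n * - c
  geometric-error {x} {c} inv zero    = solve 1 (λ c → :0 :- c := :1 :* :- c) refl c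
  geometric-error {x} {c} inv (suc n) = begin
    sumTo (x ^_) n + x ^ n - c
      ≈⟨ solve 3 (λ s y c → s :+ y :- c := (s :- c) :+ y :* :1) refl (sumTo (x ^_) n) (x ^ n) c ⟩
    sumTo (x ^_) n - c + x ^ n * 1#
      ≈⟨ +-cong (geometric-error inv n) (*-congˡ (sym inv)) ⟩
    x ^ n * - c + x ^ n * ((1# - x) * c)
      ≈⟨ solve 3 (λ x y c → y :* :- c :+ y :* ((:1 :- x) :* c) := x :* y :* :- c) refl x (x ^ n) c ⟩
    x * x ^ n * - c ∎

-- The part of the structure of ℂ used in the theory of limits; working with
-- it abstractly keeps the type checker from expanding complex numbers into
-- pairs of reals.
record NormedField (R : RealField) : Set₁ where
  open RealField R using (ℝ) renaming (_<_ to _<ᴿ_; _+_ to _+ᴿ_; _*_ to _*ᴿ_; _≈_ to _≈ᴿ_; _·_ to _·ᴿ_; 0# to 0ᴿ; 1# to 1ᴿ)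
  open OrderedField R using (_≤_)
  infix 4 ∥_∥≤_
  infix 9 _⁻¹
  field
    ring : CommutativeRing 0ℓ 0ℓ
  open CommutativeRing ring renaming (Carrier to ℂ)
  open SemiringMult semiring using () renaming (_×_ to _·_)
  field
    ∥_∥≤_     : ℂ → ℝ → Set
    nonneg    : ∀ {z r} → ∥ z ∥≤ r → 0ᴿ ≤ r
    ∥∥-cong   : ∀ {z w r s} → z ≈ w → r ≈ᴿ s → ∥ z ∥≤ r → ∥ w ∥≤ s
    ∥∥-weaken : ∀ {z r s} → r ≤ s → ∥ z ∥≤ r → ∥ z ∥≤ s
    ∥∥-0      : ∀ {r} → 0ᴿ ≤ r → ∥ 0# ∥≤ r
    ∥∥-1      : ∥ 1# ∥≤ 1ᴿ
    ∥∥-neg    : ∀ {z r} → ∥ z ∥≤ r → ∥ - z ∥≤ r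
    ∥∥-*      : ∀ {z w r s} → ∥ z ∥≤ r → ∥ w ∥≤ s → ∥ z * w ∥≤ r *ᴿ s
    ∥∥-+      : ∀ {z w r s} → ∥ z ∥≤ r → ∥ w ∥≤ s → ∥ z + w ∥≤ r +ᴿ s
    ∥∥-exists : ∀ z → ∃[ r ] ∥ z ∥≤ r
    ∥∥-arbitrary⇒≈0 : ∀ {z} → (∀ ε → 0ᴿ <ᴿ ε → ∥ z ∥≤ ε) → z ≈ 0#
    _⁻¹       : ℂ → ℂ
    *-inverse : ∀ z → ¬ z ≈ 0# → z * z ⁻¹ ≈ 1#
    ⁻¹-cong   : ∀ {z w} → z ≈ w → z ⁻¹ ≈ w ⁻¹
    1≉0       : ¬ 1# ≈ 0#
    ofℕ-suc≉0 : ∀ n → ¬ suc n · 1# ≈ 0#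
    ∥∥-ofℕ⁻¹  : ∀ n {y} → 0ᴿ ≤ y → (suc n ·ᴿ 1ᴿ) *ᴿ y ≈ᴿ 1ᴿ → ∥ (suc n · 1#) ⁻¹ ∥≤ y
    ⁻¹-bounded : ∀ z₀ → ¬ z₀ ≈ 0# → ∃[ b ] ∃[ δ ] 0ᴿ <ᴿ δ × (∀ z → ∥ z - z₀ ∥≤ δ → ¬ z ≈ 0# × ∥ z ⁻¹ ∥≤ b)

module Series (R : RealField) (𝒩 : NormedField R) where

  open NormedField 𝒩 renaming (ring to complexRing)
  private
    module ℝ = RealField R
  open ℝ using (ℝ) renaming (_<_ to _<ᴿ_; _+_ to _+ᴿ_; _*_ to _*ᴿ_; -_ to -ᴿ_; _-_ to _-ᴿ_; _≈_ to _≈ᴿ_)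
  open OrderedField R
  open SemiringExp ℝ.semiring using () renaming (_^_ to _^ᴿ_)
  open CommutativeRing complexRing renaming (Carrier to ℂ; 0# to 0ℂ; 1# to 1ℂ)
  open FieldLemmas complexRing
  open RingSum complexRing using (∑; _^_; _·_)
  open Convolution complexRing
  open PartialSums complexRing
  open SetoidReasoning setoid

  ∥∥-^ : ∀ {z r} → ∥ z ∥≤ r → ∀ n → ∥ z ^ n ∥≤ r ^ᴿ n
  ∥∥-^ z≤r zero    = ∥∥-1
  ∥∥-^ z≤r (suc n) = ∥∥-* z≤r (∥∥-^ z≤r n)

  Sums : (ℕ → ℂ) → ℂ → Set
  Sums a s = ∀ ε → ℝ.0# <ᴿ ε → ∃[ N ] ∀ n → N ℕ.≤ n → ∥ sumTo a n - s ∥≤ ε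

  -- Geometric decay is the notion of convergence used throughout: it survives addition, shifts and
  -- Cauchy products with explicit constants.
  record GeometricBound (a : ℕ → ℂ) : Set where
    field
      M r : ℝ
      0≤M : ℝ.0# ≤ M
      0<r : ℝ.0# <ᴿ r
      r<1 : r <ᴿ ℝ.1#
      bounded : ∀ n → ∥ a n ∥≤ M *ᴿ r ^ᴿ n
  open GeometricBound

  geo-cong : ∀ {a b} → (∀ n → a n ≈ b n) → GeometricBound a → GeometricBound b
  geo-cong a≈b A = record { GeometricBound A ; bounded = λ n → ∥∥-cong (a≈b n) ℝ.refl (bounded A n) }

  geo-*ʳ : ∀ {a} c → GeometricBound a → GeometricBound (λ n → a n * c)
  geo-*ʳ {a} c A = record
    { M = M A *ᴿ b ; r = r A ; 0≤M = *-nonneg (0≤M A) (nonneg c≤b) ; 0<r = 0<r A ; r<1 = r<1 A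
    ; bounded = λ n → ∥∥-cong refl (solve 3 (λ m x b → m :* x :* b := m :* b :* x) ℝ.refl (M A) (r A ^ᴿ n) b)
        (∥∥-* (bounded A n) c≤b) }
    where
    open IntegerSolver ℝ.commutativeRing
    b = proj₁ (∥∥-exists c)
    c≤b = proj₂ (∥∥-exists c)

  geo-ratio : ∀ {a} (A : GeometricBound a) {s} → r A ≤ s → ∀ n → ∥ a n ∥≤ M A *ᴿ s ^ᴿ n
  geo-ratio A r≤s n = ∥∥-weaken (*-monoˡ-≤ _ (0≤M A) (^-mono-≤ (inj₁ (0<r A)) r≤s n)) (bounded A n)

  common-ratio : ∀ {a b} (A : GeometricBound a) (B : GeometricBound b) →
    ∃[ s ] ℝ.0# <ᴿ s × s <ᴿ ℝ.1# × r A ≤ s × r B ≤ s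
  common-ratio A B with ℝ.compare (r A) (r B)
  ... | tri< rA<rB _ _ = r B , 0<r B , r<1 B , inj₁ rA<rB , ≤-refl
  ... | tri≈ _ rA≈rB _ = r B , 0<r B , r<1 B , inj₂ rA≈rB , ≤-refl
  ... | tri> _ _ rB<rA = r A , 0<r A , r<1 A , ≤-refl , inj₁ rB<rA

  geo-+ : ∀ {a b} → GeometricBound a → GeometricBound b → GeometricBound (λ n → a n + b n)
  geo-+ A B with common-ratio A B
  ... | s , 0<s , s<1 , A≤s , B≤s = record
    { M = M A +ᴿ M B ; r = s ; 0≤M = +-nonneg (0≤M A) (0≤M B) ; 0<r = 0<s ; r<1 = s<1
    ; bounded = λ n → ∥∥-cong refl (ℝ.sym (ℝ.distribʳ _ _ _)) (∥∥-+ (geo-ratio A A≤s n) (geo-ratio B B≤s n)) }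

  geo-neg : ∀ {a} → GeometricBound a → GeometricBound (λ n → - a n)
  geo-neg A = record { GeometricBound A ; bounded = λ n → ∥∥-neg (bounded A n) }

  geo-suc : ∀ {a} → GeometricBound a → GeometricBound (a ∘ suc)
  geo-suc A = record
    { M = M A ; r = r A ; 0≤M = 0≤M A ; 0<r = 0<r A ; r<1 = r<1 A
    ; bounded = λ n → ∥∥-weaken (*-monoˡ-≤ _ (0≤M A) (≤-cong ℝ.refl (ℝ.*-identityˡ _)
        (*-monoʳ-≤ _ (^-nonneg (inj₁ (0<r A)) n) (inj₁ (r<1 A))))) (bounded A (suc n)) }

  -- Shifting the exponent costs a factor 1/r in the constant, and the norm of the restored first
  -- term is added to it.
  geo-unsuc : ∀ {a} → GeometricBound (a ∘ suc) → GeometricBound a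
  geo-unsuc {a} A = record
    { M = M A *ᴿ y +ᴿ b ; r = r A ; 0≤M = +-nonneg (*-nonneg (0≤M A) (inj₁ 0<y)) (nonneg a₀≤b)
    ; 0<r = 0<r A ; r<1 = r<1 A ; bounded = bounded′ }
    where
    open IntegerSolver ℝ.commutativeRing
    b = proj₁ (∥∥-exists (a 0))
    a₀≤b = proj₂ (∥∥-exists (a 0))
    y = proj₁ (reciprocal-pos (0<r A))
    0<y = proj₂ (proj₂ (reciprocal-pos (0<r A)))
    bounded′ : ∀ n → ∥ a n ∥≤ (M A *ᴿ y +ᴿ b) *ᴿ r A ^ᴿ n
    bounded′ zero = ∥∥-weaken (≤-by (*-nonneg (0≤M A) (inj₁ 0<y))
      (solve 2 (λ m b → (m :+ b) :* :1 :- b := m) ℝ.refl (M A *ᴿ y) b)) a₀≤b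
    bounded′ (suc n) = ∥∥-weaken (≤-by (*-nonneg (nonneg a₀≤b) (^-nonneg (inj₁ (0<r A)) (suc n)))
      (ℝ.trans (solve 5 (λ m y b r x → (m :* y :+ b) :* (r :* x) :- m :* x := (m :* x) :* (r :* y :- :1) :+ b :* (r :* x))
        ℝ.refl (M A) y b (r A) (r A ^ᴿ n))
        (ℝ.trans (ℝ.+-congʳ (ℝ.trans (ℝ.*-congˡ (ℝ.trans (ℝ.+-congʳ (proj₁ (proj₂ (reciprocal-pos (0<r A)))))
          (ℝ.-‿inverseʳ _))) (ℝ.zeroʳ _))) (ℝ.+-identityˡ _)))) (bounded A n)

  geo-drop : ∀ N {a} → GeometricBound (λ n → a (N ℕ.+ n)) → GeometricBound a
  geo-drop zero    A = A
  geo-drop (suc N) A = geo-unsuc (geo-drop N A)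

  conv-bounded : ∀ {M M′ s} → ℝ.0# ≤ M → ℝ.0# ≤ s → ∀ n {a b} → (∀ k → ∥ a k ∥≤ M *ᴿ s ^ᴿ k) →
    (∀ k → ∥ b k ∥≤ M′ *ᴿ s ^ᴿ k) → ∥ conv a b n ∥≤ (suc n ℝ.· ℝ.1#) *ᴿ (M *ᴿ M′ *ᴿ s ^ᴿ n)
  conv-bounded {M} {M′} 0≤M 0≤s zero a≤ b≤ = ∥∥-cong refl
    (solve 2 (λ m m′ → m :* :1 :* (m′ :* :1) := (:1 :+ :0) :* (m :* m′ :* :1)) ℝ.refl M M′) (∥∥-* (a≤ 0) (b≤ 0))
    where open IntegerSolver ℝ.commutativeRing
  conv-bounded {M} {M′} {s} 0≤M 0≤s (suc n) a≤ b≤ = ∥∥-cong refl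
    (solve 5 (λ m m′ s x k → m :* :1 :* (m′ :* (s :* x)) :+ k :* (m :* s :* m′ :* x) := (:1 :+ k) :* (m :* m′ :* (s :* x)))
      ℝ.refl M M′ s (s ^ᴿ n) (suc n ℝ.· ℝ.1#))
    (∥∥-+ (∥∥-* (a≤ 0) (b≤ (suc n))) (conv-bounded (*-nonneg 0≤M 0≤s) 0≤s n
      (λ k → ∥∥-cong refl (ℝ.sym (ℝ.*-assoc M s _)) (a≤ (suc k))) b≤))
    where open IntegerSolver ℝ.commutativeRing

  -- The n + 1 products are each at most M M′ s^n. The factor n + 1 is absorbed by raising the ratio
  -- from s to the midpoint t of s and 1.
  geo-conv : ∀ {a b} → GeometricBound a → GeometricBound b → GeometricBound (conv a b)
  geo-conv A B with common-ratio A B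
  ... | s , 0<s , s<1 , A≤s , B≤s = record
    { M = M A *ᴿ M B *ᴿ y *ᴿ t ; r = t ; 0≤M = *-nonneg (*-nonneg (*-nonneg (0≤M A) (0≤M B)) (inj₁ 0<y)) (inj₁ 0<t)
    ; 0<r = 0<t ; r<1 = t<1
    ; bounded = λ n → ∥∥-weaken (poly n) (conv-bounded (0≤M A) (inj₁ 0<s) n (geo-ratio A A≤s) (geo-ratio B B≤s)) }
    where
    open IntegerSolver ℝ.commutativeRing
    h = (ℝ.1# -ᴿ s) *ᴿ half
    0<h : ℝ.0# <ᴿ h
    0<h = ℝ.*-pos (x<y⇒0<y-x s<1) 0<half
    t = s +ᴿ h
    0<t : ℝ.0# <ᴿ t
    0<t = +-pos 0<s (inj₁ 0<h)
    t<1 : t <ᴿ ℝ.1#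
    t<1 = <-by 0<h (ℝ.trans (solve 2 (λ s h → :1 :- (s :+ h) := (:1 :- s) :- h) ℝ.refl s h)
      (ℝ.trans (ℝ.+-congʳ (ℝ.sym (half+half (ℝ.1# -ᴿ s)))) (solve 1 (λ h → h :+ h :- h := h) ℝ.refl h)))
    y = proj₁ (reciprocal-pos 0<h)
    hy≈1 = proj₁ (proj₂ (reciprocal-pos 0<h))
    0<y = proj₂ (proj₂ (reciprocal-pos 0<h))
    poly : ∀ n → (suc n ℝ.· ℝ.1#) *ᴿ (M A *ᴿ M B *ᴿ s ^ᴿ n) ≤ M A *ᴿ M B *ᴿ y *ᴿ t *ᴿ t ^ᴿ n
    poly n = ≤-cong
      (ℝ.trans (solve 5 (λ m y k h x → m :* y :* (k :* h :* x) := (h :* y) :* (k :* (m :* x)))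
        ℝ.refl (M A *ᴿ M B) y (suc n ℝ.· ℝ.1#) h (s ^ᴿ n)) (ℝ.trans (ℝ.*-congʳ hy≈1) (ℝ.*-identityˡ _)))
      (ℝ.sym (ℝ.*-assoc _ _ _))
      (*-monoˡ-≤ (M A *ᴿ M B *ᴿ y) (*-nonneg (*-nonneg (0≤M A) (0≤M B)) (inj₁ 0<y))
        (linear*geometric (inj₁ 0<s) (inj₁ 0<h) n))

  GeometricSum : (ℕ → ℂ) → ℂ → Set
  GeometricSum a s = GeometricBound (λ n → sumTo a n - s)

  geometricSum⇒sums : ∀ {a s} → GeometricSum a s → Sums a s
  geometricSum⇒sums A ε 0<ε = proj₁ null , λ n N≤n → ∥∥-weaken (inj₁ (proj₂ null n N≤n)) (bounded A n)
    where null = geometric-null (inj₁ (0<r A)) (r<1 A) (M A) (0≤M A) ε 0<ε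

  sum-cong : ∀ {a b s t} → (∀ n → a n ≈ b n) → s ≈ t → GeometricSum a s → GeometricSum b t
  sum-cong a≈b s≈t = geo-cong (λ n → +-cong (sumTo-cong a≈b n) (-‿cong s≈t))

  -- A term is the difference of two consecutive errors.
  sum⇒terms : ∀ {a s} → GeometricSum a s → GeometricBound a
  sum⇒terms {a} {s} A = geo-cong
    (λ n → last-difference (sumTo a n) (a n) s)
    (geo-+ (geo-suc A) (geo-neg A))

  sum-+ : ∀ {a b s t} → GeometricSum a s → GeometricSum b t → GeometricSum (λ n → a n + b n) (s + t)
  sum-+ {a} {b} {s} {t} A B = geo-cong (λ n → trans
    (sub-+ (sumTo a n) (sumTo b n) s t) (+-congʳ (sym (sumTo-+ a b n)))) (geo-+ A B)

  sum-*ʳ : ∀ {a s} c → GeometricSum a s → GeometricSum (λ n → a n * c) (s * c)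
  sum-*ʳ {a} {s} c A = geo-cong (λ n → trans
    (sub-*ʳ (sumTo a n) s c) (+-congʳ (sym (sumTo-*ʳ a c n)))) (geo-*ʳ c A)

  sum-conv : ∀ {a b s t} → GeometricSum a s → GeometricSum b t → GeometricSum (conv a b) (s * t)
  sum-conv {a} {b} {s} {t} A B = geo-cong (λ n → sym (product-error a b s t n))
    (geo-+ (geo-conv (sum⇒terms A) B) (geo-*ʳ t (geo-suc A)))

  sum-unsuc : ∀ {a s} → GeometricSum (a ∘ suc) s → GeometricSum a (a 0 + s)
  sum-unsuc {a} {s} A = geo-unsuc (geo-cong (λ n → trans
    (sub-cancelˡ (a 0) (sumTo (a ∘ suc) n) s) (+-congʳ (sym (sumTo-suc a n)))) A)

  geo-0 : GeometricBound (λ _ → 0ℂ)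
  geo-0 = record
    { M = ℝ.0# ; r = half ; 0≤M = ≤-refl ; 0<r = 0<half ; r<1 = half<1
    ; bounded = λ n → ∥∥-0 (*-nonneg ≤-refl (^-nonneg (inj₁ 0<half) n)) }
    where
    half<1 : half <ᴿ ℝ.1#
    half<1 = <-by 0<half (ℝ.trans (ℝ.+-congʳ (ℝ.sym (half+half ℝ.1#)))
      (solve 1 (λ h → :1 :* h :+ :1 :* h :- h := h) ℝ.refl half))
      where open IntegerSolver ℝ.commutativeRing

  sum-0 : GeometricSum (λ _ → 0ℂ) 0ℂ
  sum-0 = geo-cong (λ n → sym (trans (+-congʳ (sumTo-0 n)) (-‿inverseʳ 0ℂ))) geo-0

  sum-∑ : ∀ {A : Set} (xs : List A) {a : A → ℕ → ℂ} {s : A → ℂ} → (∀ x → GeometricSum (a x) (s x)) →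
          GeometricSum (λ n → ∑ xs (λ x → a x n)) (∑ xs s)
  sum-∑ []       A = sum-0
  sum-∑ (x ∷ xs) A = sum-+ (A x) (sum-∑ xs A)

  sum-geometric : ∀ {x r c} → ∥ x ∥≤ r → ℝ.0# <ᴿ r → r <ᴿ ℝ.1# → (1ℂ - x) * c ≈ 1ℂ → GeometricSum (x ^_) c
  sum-geometric {x} {r} {c} x≤r 0<r r<1 inv = geo-cong (λ n → sym (geometric-error inv n))
    (geo-*ʳ (- c) (record { M = ℝ.1# ; r = r ; 0≤M = 0≤1 ; 0<r = 0<r ; r<1 = r<1
      ; bounded = λ n → ∥∥-cong refl (ℝ.sym (ℝ.*-identityˡ _)) (∥∥-^ x≤r n) }))

  sums-unique : ∀ {a s t} → Sums a s → Sums a t → s ≈ t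
  sums-unique {a} {s} {t} S T = x-y≈0⇒x≈y (∥∥-arbitrary⇒≈0 λ ε 0<ε →
    ∥∥-cong (close ε 0<ε) (half+half ε) (∥∥-+ (∥∥-neg (near S ε 0<ε (ℕ.m≤m⊔n _ _))) (near T ε 0<ε (ℕ.m≤n⊔m _ _))))
    where
    N : ∀ ε → ℝ.0# <ᴿ ε → ℕ
    N ε 0<ε = proj₁ (S (ε *ᴿ half) (ℝ.*-pos 0<ε 0<half)) ℕ.⊔ proj₁ (T (ε *ᴿ half) (ℝ.*-pos 0<ε 0<half))
    near : ∀ {u} (U : Sums a u) ε (0<ε : ℝ.0# <ᴿ ε) →
           proj₁ (U (ε *ᴿ half) (ℝ.*-pos 0<ε 0<half)) ℕ.≤ N ε 0<ε → ∥ sumTo a (N ε 0<ε) - u ∥≤ ε *ᴿ half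
    near U ε 0<ε ≤N = proj₂ (U (ε *ᴿ half) (ℝ.*-pos 0<ε 0<half)) (N ε 0<ε) ≤N
    close : ∀ ε 0<ε → - (sumTo a (N ε 0<ε) - s) + (sumTo a (N ε 0<ε) - t) ≈ s - t
    close ε 0<ε = trans (+-congʳ (neg-sub _ s)) (telescope s _ t)

  -- Some later partial sum is rⁿ-close to s, and the terms in between sum to
  -- at most M rⁿ / (1 - r).
  sums⇒geometricSum : ∀ {a s} → GeometricBound a → Sums a s → GeometricSum a s
  sums⇒geometricSum {a} {s} A S = record
    { M = M A *ᴿ t +ᴿ ℝ.1# ; r = r A ; 0≤M = +-nonneg (*-nonneg (0≤M A) (inj₁ 0<t)) 0≤1
    ; 0<r = 0<r A ; r<1 = r<1 A ; bounded = bounded′ }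
    where
    open IntegerSolver ℝ.commutativeRing
    recip = reciprocal-pos (x<y⇒0<y-x (r<1 A))
    t = proj₁ recip
    0<t = proj₂ (proj₂ recip)
    rt+1≈t : r A *ᴿ t +ᴿ ℝ.1# ≈ᴿ t
    rt+1≈t = ℝ.trans (ℝ.+-congˡ (ℝ.sym (proj₁ (proj₂ recip))))
      (solve 2 (λ r t → r :* t :+ (:1 :- r) :* t := t) ℝ.refl (r A) t)
    tail : ∀ k n → ∥ sumTo (λ j → a (n ℕ.+ j)) k ∥≤ M A *ᴿ r A ^ᴿ n *ᴿ t
    tail zero    n = ∥∥-0 (*-nonneg (*-nonneg (0≤M A) (^-nonneg (inj₁ (0<r A)) n)) (inj₁ 0<t))
    tail (suc k) n = ∥∥-cong
      (sym (trans (sumTo-suc (λ j → a (n ℕ.+ j)) k) (+-cong (reflexive (≡.cong a (ℕ.+-identityʳ n)))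
        (sumTo-cong (λ j → reflexive (≡.cong a (ℕ.+-suc n j))) k))))
      (ℝ.trans (solve 4 (λ m x r t → m :* x :+ m :* (r :* x) :* t := m :* x :* (r :* t :+ :1)) ℝ.refl
        (M A) (r A ^ᴿ n) (r A) t) (ℝ.*-congˡ rt+1≈t))
      (∥∥-+ (bounded A n) (tail k (suc n)))
    bounded′ : ∀ n → ∥ sumTo a n - s ∥≤ (M A *ᴿ t +ᴿ ℝ.1#) *ᴿ r A ^ᴿ n
    bounded′ n with S (r A ^ᴿ n) (^-pos (0<r A) n)
    ... | N , close = ∥∥-cong
      (sub-cancelʳ (sumTo a n) T s)
      (solve 3 (λ m x t → m :* x :* t :+ x := (m :* t :+ :1) :* x) ℝ.refl (M A) (r A ^ᴿ n) t)
      (∥∥-+ (∥∥-neg (tail N n)) (∥∥-cong (+-congʳ (sumTo-+-tail a n N)) ℝ.refl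
        (close (n ℕ.+ N) (ℕ.m≤n+m N n))))
      where T = sumTo (λ j → a (n ℕ.+ j)) N

  ratio-bound : ∀ {a : ℕ → ℂ} {r} → ℝ.0# <ᴿ r → r <ᴿ ℝ.1# → (t : ℕ → ℂ) → (∀ n → a (suc n) ≈ a n * t n) →
                (∀ n → ∥ t n ∥≤ r) → GeometricBound a
  ratio-bound {a} {r} 0<r r<1 t a≈ t≤r = record
    { M = b ; r = r ; 0≤M = nonneg a₀≤b ; 0<r = 0<r ; r<1 = r<1 ; bounded = bounded′ }
    where
    open IntegerSolver ℝ.commutativeRing
    b = proj₁ (∥∥-exists (a 0))
    a₀≤b = proj₂ (∥∥-exists (a 0))
    bounded′ : ∀ n → ∥ a n ∥≤ b *ᴿ r ^ᴿ n
    bounded′ zero    = ∥∥-cong refl (ℝ.sym (ℝ.*-identityʳ b)) a₀≤b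
    bounded′ (suc n) = ∥∥-cong (sym (a≈ n))
      (solve 3 (λ b x r → b :* x :* r := b :* (r :* x)) ℝ.refl b (r ^ᴿ n) r) (∥∥-* (bounded′ n) (t≤r n))

-- The complex numbers as a normed field.

module ComplexNormedField (R : RealField) where

  open ComplexField R
  open ComplexNorm R
  private
    module ℝ = RealField R
    module C = Complex R
  open ℝ using (ℝ) renaming (_<_ to _<ᴿ_; _+_ to _+ᴿ_; _*_ to _*ᴿ_; -_ to -ᴿ_; _-_ to _-ᴿ_; _≈_ to _≈ᴿ_)
  open OrderedField R
  open CommutativeRing complexRing using (_≈_; -_; _-_; refl; sym; trans; *-congʳ; *-congˡ)

  -- The difference of the two sides is |2 z - z₀|².
  normSq-sub : ∀ z z₀ → normSq z₀ ≤ (ℝ.1# +ᴿ ℝ.1#) *ᴿ (normSq z +ᴿ normSq (z - z₀))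
  normSq-sub (a +i b) (c +i d) = ≤-by
    (+-nonneg (square-nonneg (a +ᴿ (a -ᴿ c))) (square-nonneg (b +ᴿ (b -ᴿ d))))
    (solve 4 (λ a b c d → (:1 :+ :1) :* ((a :* a :+ b :* b) :+ ((a :- c) :* (a :- c) :+ (b :- d) :* (b :- d))) :-
        (c :* c :+ d :* d) := (a :+ (a :- c)) :* (a :+ (a :- c)) :+ (b :+ (b :- d)) :* (b :+ (b :- d)))
      ℝ.refl a b c d)
    where open IntegerSolver ℝ.commutativeRing

  -- With δ² ≤ |z₀|² / 4, `normSq-sub` gives |z|² ≥ |z₀|² / 4. So z is nonzero and |1/z|² ≤ s = 4 /
  -- |z₀|², which makes 1 + s a bound for |1/z|.
  ⁻¹-bounded : ∀ z₀ → ¬ z₀ ≈ 0ℂ →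
    ∃[ b ] ∃[ δ ] ℝ.0# <ᴿ δ × (∀ z → ∥ z - z₀ ∥≤ δ → ¬ z ≈ 0ℂ × ∥ z ⁻¹ ∥≤ b)
  ⁻¹-bounded z₀ z₀≉0 = ℝ.1# +ᴿ s , δ , 0<δ , λ z z≤δ → apart z z≤δ , bounded z z≤δ
    where
    open IntegerSolver ℝ.commutativeRing
    d = normSq z₀
    0<d = normSq-pos z₀≉0
    recip = reciprocal-pos (+-pos 0<1 (inj₁ 0<d))
    y = proj₁ recip
    0<y = proj₂ (proj₂ recip)
    dy+y≈1 : d *ᴿ y +ᴿ y ≈ᴿ ℝ.1#
    dy+y≈1 = ℝ.trans (solve 2 (λ d y → d :* y :+ y := (:1 :+ d) :* y) ℝ.refl d y) (proj₁ (proj₂ recip))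
    δ = d *ᴿ y *ᴿ half
    0<dy = ℝ.*-pos 0<d 0<y
    0<δ : ℝ.0# <ᴿ δ
    0<δ = ℝ.*-pos 0<dy 0<half
    -- δ² ≤ d / 4, because d y ≤ 1 and y ≤ 1.
    δ²≤ : δ *ᴿ δ ≤ d *ᴿ half *ᴿ half
    δ²≤ = ≤-by (*-nonneg (*-nonneg (inj₁ 0<d) (*-nonneg (inj₁ 0<half) (inj₁ 0<half)))
        (+-nonneg (*-nonneg (inj₁ 0<y) (inj₁ 0<y)) (+-nonneg (inj₁ 0<dy) ≤-refl)))
      (ℝ.trans (solve 3 (λ d y h → d :* h :* h :- d :* y :* h :* (d :* y :* h) := d :* (h :* h) :* (:1 :- (d :* y) :* y))
        ℝ.refl d y half) (ℝ.*-congˡ (ℝ.trans (ℝ.+-congʳ (ℝ.sym dy+y≈1′)) (ℝ.trans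
          (solve 2 (λ e y → (e :+ y) :* (e :+ y) :- e :* y := y :* y :+ (e :+ :0) :* (e :+ y)) ℝ.refl (d *ᴿ y) y)
          (ℝ.+-congˡ (ℝ.trans (ℝ.*-congˡ dy+y≈1) (ℝ.*-identityʳ _)))))))
      where
      dy+y≈1′ : (d *ᴿ y +ᴿ y) *ᴿ (d *ᴿ y +ᴿ y) ≈ᴿ ℝ.1#
      dy+y≈1′ = ℝ.trans (ℝ.*-cong dy+y≈1 dy+y≈1) (ℝ.*-identityˡ _)
    quarter : d *ᴿ half *ᴿ half +ᴿ d *ᴿ half *ᴿ half ≈ᴿ d *ᴿ half
    quarter = half+half (d *ᴿ half)
    lower : ∀ z → ∥ z - z₀ ∥≤ δ → d *ᴿ half *ᴿ half ≤ normSq z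
    lower z z≤δ = ≤-by (+-nonneg (*-nonneg (x≤y⇒0≤y-x (normSq-sub z z₀)) (inj₁ 0<half))
        (x≤y⇒0≤y-x (≤-trans (normSq≤ z≤δ) δ²≤)))
      (ℝ.sym (ℝ.trans (solve 5 (λ n e d h k → ((:1 :+ :1) :* (n :+ e) :- d) :* h :+ (k :- e) :=
          (n :+ e) :* ((:1 :+ :1) :* h) :- d :* h :+ (k :- e)) ℝ.refl (normSq z) (normSq (z - z₀)) d half K′)
        (ℝ.trans (ℝ.+-congʳ (ℝ.+-cong (ℝ.trans (ℝ.*-congˡ two-half) (ℝ.*-identityʳ _)) (ℝ.-‿cong (ℝ.sym quarter))))
          (solve 3 (λ n e k → n :+ e :- (k :+ k) :+ (k :- e) := n :- k) ℝ.refl (normSq z) (normSq (z - z₀)) K′))))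
      where
      K′ = d *ᴿ half *ᴿ half
      two-half : (ℝ.1# +ᴿ ℝ.1#) *ᴿ half ≈ᴿ ℝ.1#
      two-half = ℝ.trans (solve 1 (λ h → (:1 :+ :1) :* h := :1 :* h :+ :1 :* h) ℝ.refl half) (half+half ℝ.1#)
    0<K′ : ℝ.0# <ᴿ d *ᴿ half *ᴿ half
    0<K′ = ℝ.*-pos (ℝ.*-pos 0<d 0<half) 0<half
    s = proj₁ (reciprocal-pos 0<K′)
    0<s = proj₂ (proj₂ (reciprocal-pos 0<K′))
    apart : ∀ z → ∥ z - z₀ ∥≤ δ → ¬ z ≈ 0ℂ
    apart z z≤δ z≈0 = <⇒≉ (<-≤-trans 0<K′ (lower z z≤δ)) (ℝ.sym (ℝ.trans (normSq-cong z≈0) normSq-0))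
    bounded : ∀ z → ∥ z - z₀ ∥≤ δ → ∥ z ⁻¹ ∥≤ ℝ.1# +ᴿ s
    bounded z z≤δ = bound (+-nonneg 0≤1 (inj₁ 0<s)) (≤-trans inverse≤s
      (≤-by (+-nonneg 0≤1 (+-nonneg (inj₁ 0<s) (*-nonneg (inj₁ 0<s) (inj₁ 0<s))))
        (solve 1 (λ s → (:1 :+ s) :* (:1 :+ s) :- s := :1 :+ (s :+ s :* s)) ℝ.refl s)))
      where
      m = normSq (z ⁻¹)
      inverse≤s : m ≤ s
      inverse≤s = ≤-cong
        (ℝ.trans (solve 3 (λ m s k → s :* m :* k := m :* (k :* s)) ℝ.refl m s (d *ᴿ half *ᴿ half))
          (ℝ.trans (ℝ.*-congˡ (proj₁ (proj₂ (reciprocal-pos 0<K′)))) (ℝ.*-identityʳ m)))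
        (ℝ.trans (solve 3 (λ m s n → s :* m :* n := s :* (n :* m)) ℝ.refl m s (normSq z))
          (ℝ.trans (ℝ.*-congˡ (ℝ.trans (ℝ.sym (normSq-* z (z ⁻¹)))
            (ℝ.trans (normSq-cong (*-inverse z (apart z z≤δ))) normSq-1))) (ℝ.*-identityʳ s)))
        (*-monoˡ-≤ (s *ᴿ m) (*-nonneg (inj₁ 0<s) (normSq-nonneg (z ⁻¹))) (lower z z≤δ))

  ofℕ⁻¹≈ : ∀ n {y} → (suc n ℝ.· ℝ.1#) *ᴿ y ≈ᴿ ℝ.1# → (ofℕ (suc n)) ⁻¹ ≈ ofReal y
  ofℕ⁻¹≈ n {y} inv = ⁻¹-unique (trans (*-congʳ (ofℕ≈ofReal (suc n)))
    (trans (ofReal-* _ y) (inv , ℝ.refl)))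

  complexNormedField : NormedField R
  complexNormedField = record
    { ring = complexRing ; ∥_∥≤_ = ∥_∥≤_ ; nonneg = nonneg ; ∥∥-cong = ∥∥-cong ; ∥∥-weaken = ∥∥-weaken
    ; ∥∥-0 = ∥∥-0 ; ∥∥-1 = ∥∥-1 ; ∥∥-neg = ∥∥-neg ; ∥∥-* = ∥∥-* ; ∥∥-+ = ∥∥-+ ; ∥∥-exists = ∥∥-exists
    ; ∥∥-arbitrary⇒≈0 = ∥∥-arbitrary⇒≈0 ; _⁻¹ = _⁻¹ ; *-inverse = *-inverse ; ⁻¹-cong = ⁻¹-cong ; 1≉0 = 1≉0
    ; ofℕ-suc≉0 = ofℕ-suc≉0
    ; ∥∥-ofℕ⁻¹ = λ n 0≤y inv → ∥∥-cong (sym (ofℕ⁻¹≈ n inv)) ℝ.refl (∥∥-ofReal 0≤y)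
    ; ⁻¹-bounded = ⁻¹-bounded }

-- The exponential series.

module Exponential (R : RealField) (𝒩 : NormedField R) where

  open NormedField 𝒩 renaming (ring to complexRing)
  private
    module ℝ = RealField R
  open ℝ using (ℝ) renaming (_<_ to _<ᴿ_; _+_ to _+ᴿ_)
  open OrderedField R
  open CommutativeRing complexRing renaming (Carrier to ℂ; 0# to 0ℂ; 1# to 1ℂ)
  open FieldLemmas complexRing
  open RingSum complexRing using (_^_; _·_)
  open SemiringMult semiring using (×1-homo-*)
  open SemiringExp semiring using (^-congˡ)
  open Convolution complexRing
  open PartialSums complexRing
  open Series R 𝒩
  open IntegerSolver complexRing
  open SetoidReasoning setoid

  ofℕ : ℕ → ℂ
  ofℕ n = n · 1ℂ

  term : ℂ → ℕ → ℂ
  term z n = z ^ n * ofℕ (n !) ⁻¹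

  ofℕ-!≉0 : ∀ n → ¬ ofℕ (n !) ≈ 0ℂ
  ofℕ-!≉0 n = ≡.subst (λ m → ¬ ofℕ m ≈ 0ℂ) (ℕ.suc-pred (n !) {{ℕ._!≢0 n}}) (ofℕ-suc≉0 (ℕ.pred (n !)))

  suc*!⁻¹ : ∀ n → ofℕ (suc n) * ofℕ (suc n !) ⁻¹ ≈ ofℕ (n !) ⁻¹
  suc*!⁻¹ n = inverse-unique {ofℕ (n !)} (begin
    ofℕ (n !) * (ofℕ (suc n) * ofℕ (suc n !) ⁻¹)
      ≈⟨ solve 3 (λ a b c → a :* (b :* c) := b :* a :* c) refl (ofℕ (n !)) (ofℕ (suc n)) _ ⟩
    ofℕ (suc n) * ofℕ (n !) * ofℕ (suc n !) ⁻¹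
      ≈⟨ *-congʳ (sym (×1-homo-* (suc n) (n !))) ⟩
    ofℕ (suc n !) * ofℕ (suc n !) ⁻¹
      ≈⟨ *-inverse _ (ofℕ-!≉0 (suc n)) ⟩
    1ℂ ∎) (*-inverse _ (ofℕ-!≉0 n))

  -- The differential equation E′ = z E, read off from coefficients.
  term-suc : ∀ z n → ofℕ (suc n) * term z (suc n) ≈ z * term z n
  term-suc z n = trans (solve 4 (λ m z x i → m :* (z :* x :* i) := z :* (x :* (m :* i))) refl (ofℕ (suc n)) z (z ^ n) _)
    (*-congˡ (*-congˡ (suc*!⁻¹ n)))

  1⁻¹ : ofℕ 1 ⁻¹ ≈ 1ℂ
  1⁻¹ = inverse-unique (*-inverse (ofℕ 1) (ofℕ-suc≉0 0)) (trans (*-identityʳ _) (+-identityʳ 1ℂ))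

  term-0 : ∀ z → term z 0 ≈ 1ℂ
  term-0 z = trans (*-identityˡ _) 1⁻¹

  -- By the Leibniz rule the product of the two series obeys the recursion E′ = (z + w) E with the
  -- same initial value, so no binomial coefficients are needed.
  conv-term : ∀ z w n → conv (term z) (term w) n ≈ term (z + w) n
  conv-term z w zero    = trans (*-cong (term-0 z) (term-0 w)) (trans (*-identityˡ 1ℂ) (sym (term-0 (z + w))))
  conv-term z w (suc n) = *-cancelˡ-invertible (*-inverse _ (ofℕ-suc≉0 n)) (begin
    ofℕ (suc n) * conv (term z) (term w) (suc n)
      ≈⟨ conv-leibniz (term z) (term w) n ⟩
    conv (λ k → ofℕ (suc k) * term z (suc k)) (term w) n + conv (term z) (λ k → ofℕ (suc k) * term w (suc k)) n
      ≈⟨ +-cong (trans (conv-cong (term-suc z) (λ _ → refl) n) (conv-*ˡ z (term z) (term w) n))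
                (trans (conv-cong {a = term z} (λ _ → refl) (term-suc w) n) (conv-*ʳ w (term z) (term w) n)) ⟩
    z * conv (term z) (term w) n + w * conv (term z) (term w) n
      ≈⟨ sym (distribʳ _ z w) ⟩
    (z + w) * conv (term z) (term w) n
      ≈⟨ *-congˡ (conv-term z w n) ⟩
    (z + w) * term (z + w) n
      ≈⟨ sym (term-suc (z + w) n) ⟩
    ofℕ (suc n) * term (z + w) (suc n) ∎)

  half<1 : half <ᴿ ℝ.1#
  half<1 = <-by 0<half (ℝ.trans (ℝ.+-congʳ (ℝ.sym (half+half ℝ.1#)))
    (RS.solve 1 (λ h → RS.:1 RS.:* h RS.:+ RS.:1 RS.:* h RS.:- h RS.:= h) ℝ.refl half))
    where module RS = IntegerSolver ℝ.commutativeRing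

  -- The ratio of consecutive terms is at most 1/2 from n ≥ 2 ∥z∥ on.
  term-geometric : ∀ z → GeometricBound (term z)
  term-geometric z = geo-drop N (ratio-bound 0<half half<1 (λ k → z * ofℕ (suc (N ℕ.+ k)) ⁻¹) step small)
    where
    module RS = IntegerSolver ℝ.commutativeRing
    b = proj₁ (∥∥-exists z)
    z≤b = proj₂ (∥∥-exists z)
    N = proj₁ (ℝ.archimedean (b +ᴿ b))
    step : ∀ k → term z (N ℕ.+ suc k) ≈ term z (N ℕ.+ k) * (z * ofℕ (suc (N ℕ.+ k)) ⁻¹)
    step k = begin
      term z (N ℕ.+ suc k)                                   ≈⟨ reflexive (≡.cong (term z) (ℕ.+-suc N k)) ⟩
      term z (suc (N ℕ.+ k))                                 ≈⟨ sym (cancel-inverse _ (*-inverse m (ofℕ-suc≉0 (N ℕ.+ k)))) ⟩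
      m ⁻¹ * (m * term z (suc (N ℕ.+ k)))                    ≈⟨ *-congˡ (term-suc z (N ℕ.+ k)) ⟩
      m ⁻¹ * (z * term z (N ℕ.+ k))                          ≈⟨ solve 3 (λ i z t → i :* (z :* t) := t :* (z :* i)) refl _ z _ ⟩
      term z (N ℕ.+ k) * (z * m ⁻¹)                          ∎
      where m = ofℕ (suc (N ℕ.+ k))
    small : ∀ k → ∥ z * ofℕ (suc (N ℕ.+ k)) ⁻¹ ∥≤ half
    small k = ∥∥-weaken (≤-cong
        (ℝ.trans (RS.solve 3 (λ b h y → y RS.:* (b RS.:+ b) RS.:* h RS.:= (b RS.:* h RS.:+ b RS.:* h) RS.:* y) ℝ.refl b half y)
          (ℝ.*-congʳ (half+half b)))
        (ℝ.trans (RS.solve 3 (λ y m h → y RS.:* m RS.:* h RS.:= m RS.:* y RS.:* h) ℝ.refl y m half)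
          (ℝ.trans (ℝ.*-congʳ my≈1) (ℝ.*-identityˡ half)))
        (*-monoʳ-≤ half (inj₁ 0<half) (*-monoˡ-≤ y (inj₁ 0<y)
          (inj₁ (<-≤-trans (proj₂ (ℝ.archimedean (b +ᴿ b))) (·1-mono-≤ (ℕ.m≤n⇒m≤1+n (ℕ.m≤m+n N k))))))))
      (∥∥-* z≤b (∥∥-ofℕ⁻¹ (N ℕ.+ k) (inj₁ 0<y) my≈1))
      where
      m = suc (N ℕ.+ k) ℝ.· ℝ.1#
      y = proj₁ (reciprocal-pos (suc·1-pos (N ℕ.+ k)))
      my≈1 = proj₁ (proj₂ (reciprocal-pos (suc·1-pos (N ℕ.+ k))))
      0<y = proj₂ (proj₂ (reciprocal-pos (suc·1-pos (N ℕ.+ k))))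

  module _ (exp : ℂ → ℂ) (isExp : ∀ z → Sums (term z) (exp z)) where

    exp-sum : ∀ z → GeometricSum (term z) (exp z)
    exp-sum z = sums⇒geometricSum (term-geometric z) (isExp z)

    exp-+ : ∀ z w → exp (z + w) ≈ exp z * exp w
    exp-+ z w = sums-unique (isExp (z + w))
      (geometricSum⇒sums (sum-cong (conv-term z w) refl (sum-conv (exp-sum z) (exp-sum w))))

    exp-cong : ∀ {z w} → z ≈ w → exp z ≈ exp w
    exp-cong {z} {w} z≈w = sums-unique
      (geometricSum⇒sums (sum-cong (λ n → *-congʳ (^-congˡ n z≈w)) refl (exp-sum z))) (isExp w)

    exp-0 : exp 0ℂ ≈ 1ℂ
    exp-0 = sums-unique (isExp 0ℂ) (geometricSum⇒sums (sum-cong (λ _ → refl) (trans (+-identityʳ _) (term-0 0ℂ))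
      (sum-unsuc (sum-cong (λ n → sym (trans (*-congʳ (zeroˡ _)) (zeroˡ _))) refl sum-0))))

    exp-ofℕ* : ∀ k z → exp (ofℕ k * z) ≈ exp z ^ k
    exp-ofℕ* zero    z = trans (exp-cong (zeroˡ z)) exp-0
    exp-ofℕ* (suc k) z = trans (exp-cong (trans (distribʳ z 1ℂ (ofℕ k)) (+-congʳ (*-identityˡ z))))
      (trans (exp-+ z (ofℕ k * z)) (*-congˡ (exp-ofℕ* k z)))

-- Limits and complex derivatives.

module DifferenceQuotients (K : CommutativeRing 0ℓ 0ℓ) where

  open CommutativeRing K
  open IntegerSolver K
  open SetoidReasoning setoid

  quotient-* : ∀ f g f₀ g₀ i → (f * g - f₀ * g₀) * i ≈ (f - f₀) * i * g + f₀ * ((g - g₀) * i)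
  quotient-* = solve 5 (λ f g f₀ g₀ i →
    (f :* g :- f₀ :* g₀) :* i := (f :- f₀) :* i :* g :+ f₀ :* ((g :- g₀) :* i)) refl

  quotient-+ : ∀ f g f₀ g₀ i → (f - f₀) * i + (g - g₀) * i ≈ (f + g - (f₀ + g₀)) * i
  quotient-+ = solve 5 (λ f g f₀ g₀ i →
    (f :- f₀) :* i :+ (g :- g₀) :* i := (f :+ g :- (f₀ :+ g₀)) :* i) refl

  product-sub : ∀ f g l m → (f - l) * g + (g - m) * l ≈ f * g - l * m
  product-sub = solve 4 (λ f g l m → (f :- l) :* g :+ (g :- m) :* l := f :* g :- l :* m) refl

  inverse-sub : ∀ {f f⁻¹ l l⁻¹} → f * f⁻¹ ≈ 1# → l * l⁻¹ ≈ 1# → - (f - l) * (f⁻¹ * l⁻¹) ≈ f⁻¹ - l⁻¹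
  inverse-sub {f} {f⁻¹} {l} {l⁻¹} f-inv l-inv = begin
    - (f - l) * (f⁻¹ * l⁻¹)
      ≈⟨ solve 4 (λ f i l j → :- (f :- l) :* (i :* j) := (l :* j) :* i :- (f :* i) :* j) refl f f⁻¹ l l⁻¹ ⟩
    l * l⁻¹ * f⁻¹ - f * f⁻¹ * l⁻¹
      ≈⟨ +-cong (*-congʳ l-inv) (-‿cong (*-congʳ f-inv)) ⟩
    1# * f⁻¹ - 1# * l⁻¹
      ≈⟨ solve 2 (λ i j → :1 :* i :- :1 :* j := i :- j) refl f⁻¹ l⁻¹ ⟩
    f⁻¹ - l⁻¹ ∎

  regroup : ∀ x a b i → - x * (a * b) * i ≈ x * i * (a * - b)
  regroup = solve 4 (λ x a b i → :- x :* (a :* b) :* i := x :* i :* (a :* :- b)) refl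

  quotient-cancel : ∀ {x i} y → x * i ≈ 1# → y * i * x ≈ y
  quotient-cancel {x} {i} y inv = trans (solve 3 (λ x i y → y :* i :* x := y :* (x :* i)) refl x i y)
    (trans (*-congˡ inv) (*-identityʳ y))

module Limits (R : RealField) (𝒩 : NormedField R) where

  open NormedField 𝒩 renaming (ring to complexRing)
  private
    module ℝ = RealField R
  open ℝ using (ℝ) renaming (_<_ to _<ᴿ_; _+_ to _+ᴿ_; _*_ to _*ᴿ_; _≈_ to _≈ᴿ_)
  open OrderedField R
  open CommutativeRing complexRing renaming (Carrier to ℂ; 0# to 0ℂ; 1# to 1ℂ)
  open FieldLemmas complexRing
  open DifferenceQuotients complexRing
  open RingSum complexRing using (∑; _^_)

  -- Punctured neighbourhoods, with closed balls because the bounds on norms are weak inequalities.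
  Near : ℂ → (ℂ → Set) → Set
  Near z P = ∃[ δ ] ℝ.0# <ᴿ δ × (∀ w → ¬ w ≈ z → ∥ w - z ∥≤ δ → P w)

  min : ∀ x y → ℝ.0# <ᴿ x → ℝ.0# <ᴿ y → ∃[ m ] ℝ.0# <ᴿ m × m ≤ x × m ≤ y
  min x y 0<x 0<y with ℝ.compare x y
  ... | tri< x<y _ _ = x , 0<x , ≤-refl , inj₁ x<y
  ... | tri≈ _ x≈y _ = x , 0<x , ≤-refl , inj₂ x≈y
  ... | tri> _ _ y<x = y , 0<y , inj₁ y<x , ≤-refl

  near-× : ∀ {z P Q} → Near z P → Near z Q → Near z (λ w → P w × Q w)
  near-× (δ , 0<δ , p) (δ′ , 0<δ′ , q) with min δ δ′ 0<δ 0<δ′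
  ... | m , 0<m , m≤δ , m≤δ′ = m , 0<m , λ w w≉z w≤m →
    p w w≉z (∥∥-weaken m≤δ w≤m) , q w w≉z (∥∥-weaken m≤δ′ w≤m)

  near-map : ∀ {z P Q} → (∀ w → ¬ w ≈ z → P w → Q w) → Near z P → Near z Q
  near-map f (δ , 0<δ , p) = δ , 0<δ , λ w w≉z w≤δ → f w w≉z (p w w≉z w≤δ)

  always : ∀ {z P} → (∀ w → ¬ w ≈ z → P w) → Near z P
  always p = ℝ.1# , 0<1 , λ w w≉z _ → p w w≉z

  Null Bounded : (ℂ → ℂ) → ℂ → Set
  Null f z = ∀ ε → ℝ.0# <ᴿ ε → Near z (λ w → ∥ f w ∥≤ ε)
  Bounded f z = ∃[ b ] Near z (λ w → ∥ f w ∥≤ b)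

  Limit : (ℂ → ℂ) → ℂ → ℂ → Set
  Limit f z l = Null (λ w → f w - l) z

  null-cong : ∀ {f g z} → Near z (λ w → f w ≈ g w) → Null f z → Null g z
  null-cong f≈g f-null ε 0<ε =
    near-map (λ w _ (eq , small) → ∥∥-cong eq ℝ.refl small) (near-× f≈g (f-null ε 0<ε))

  null-+ : ∀ {f g z} → Null f z → Null g z → Null (λ w → f w + g w) z
  null-+ f-null g-null ε 0<ε = near-map (λ w _ (p , q) → ∥∥-cong refl (half+half ε) (∥∥-+ p q))
    (near-× (f-null (ε *ᴿ half) (ℝ.*-pos 0<ε 0<half)) (g-null (ε *ᴿ half) (ℝ.*-pos 0<ε 0<half)))

  null-neg : ∀ {f z} → Null f z → Null (λ w → - f w) z
  null-neg f-null ε 0<ε = near-map (λ w _ → ∥∥-neg) (f-null ε 0<ε)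

  null-0 : ∀ {z} → Null (λ _ → 0ℂ) z
  null-0 ε 0<ε = always (λ w _ → ∥∥-0 (inj₁ 0<ε))

  bounded-pos : ∀ {f z} → Bounded f z → ∃[ b ] ℝ.0# <ᴿ b × Near z (λ w → ∥ f w ∥≤ b)
  bounded-pos (b , near) with ℝ.compare ℝ.0# b
  ... | tri< 0<b _ _ = b , 0<b , near
  ... | tri≈ _ 0≈b _ = ℝ.1# , 0<1 , near-map (λ w _ → ∥∥-weaken (inj₁ (<-cong 0≈b ℝ.refl 0<1))) near
  ... | tri> _ _ b<0 = ℝ.1# , 0<1 , near-map (λ w _ → ∥∥-weaken (inj₁ (<-trans b<0 0<1))) near

  null-* : ∀ {f g z} → Null f z → Bounded g z → Null (λ w → f w * g w) z
  null-* {f} {g} {z} f-null g-bounded ε 0<ε =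
    near-map (λ w _ (p , q) → ∥∥-cong refl εyb≈ε (∥∥-* p q)) (near-× (f-null (ε *ᴿ y) (ℝ.*-pos 0<ε 0<y)) (proj₂ (proj₂ pos)))
    where
    open IntegerSolver ℝ.commutativeRing
    pos = bounded-pos g-bounded
    b = proj₁ pos
    y = proj₁ (reciprocal-pos (proj₁ (proj₂ pos)))
    0<y = proj₂ (proj₂ (reciprocal-pos (proj₁ (proj₂ pos))))
    εyb≈ε : ε *ᴿ y *ᴿ b ≈ᴿ ε
    εyb≈ε = ℝ.trans (solve 3 (λ e y b → e :* y :* b := e :* (b :* y)) ℝ.refl ε y b)
      (ℝ.trans (ℝ.*-congˡ (proj₁ (proj₂ (reciprocal-pos (proj₁ (proj₂ pos)))))) (ℝ.*-identityʳ ε))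

  bounded-const : ∀ c z → Bounded (λ _ → c) z
  bounded-const c z = proj₁ (∥∥-exists c) , always (λ _ _ → proj₂ (∥∥-exists c))

  bounded-* : ∀ {f g z} → Bounded f z → Bounded g z → Bounded (λ w → f w * g w) z
  bounded-* (b , p) (b′ , q) = b *ᴿ b′ , near-map (λ w _ (x , y) → ∥∥-* x y) (near-× p q)

  limit⇒bounded : ∀ {f z l} → Limit f z l → Bounded f z
  limit⇒bounded {f} {z} {l} lim = ℝ.1# +ᴿ proj₁ (∥∥-exists l) ,
    near-map (λ w _ p → ∥∥-cong (trans (+-assoc _ _ _) (trans (+-congˡ (-‿inverseˡ l)) (+-identityʳ _))) ℝ.refl
      (∥∥-+ p (proj₂ (∥∥-exists l)))) (lim ℝ.1# 0<1)

  limit-cong : ∀ {f g z l m} → Near z (λ w → f w ≈ g w) → l ≈ m → Limit f z l → Limit g z m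
  limit-cong f≈g l≈m = null-cong (near-map (λ w _ eq → +-cong eq (-‿cong l≈m)) f≈g)

  limit-const : ∀ c z → Limit (λ _ → c) z c
  limit-const c z = null-cong (always (λ w _ → sym (-‿inverseʳ c))) null-0

  limit-+ : ∀ {f g z l m} → Limit f z l → Limit g z m → Limit (λ w → f w + g w) z (l + m)
  limit-+ {f} {g} {z} {l} {m} F G = null-cong (always (λ w _ → sub-+ (f w) (g w) l m)) (null-+ F G)

  limit-* : ∀ {f g z l m} → Limit f z l → Limit g z m → Limit (λ w → f w * g w) z (l * m)
  limit-* {f} {g} {z} {l} {m} F G = null-cong (always (λ w _ → product-sub (f w) (g w) l m))
    (null-+ (null-* F (limit⇒bounded {l = m} G)) (null-* G (bounded-const l z)))

  limit-⁻¹ : ∀ {f z l} → ¬ l ≈ 0ℂ → Limit f z l →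
             Near z (λ w → ¬ f w ≈ 0ℂ) × Limit (λ w → f w ⁻¹) z (l ⁻¹)
  limit-⁻¹ {f} {z} {l} l≉0 lim = near-map (λ w _ → proj₁) near ,
    null-cong (near-map (λ w _ (fw≉0 , _) → inverse-sub (*-inverse (f w) fw≉0) (*-inverse l l≉0)) near)
      (null-* (null-neg lim) (bounded-* (proj₁ (⁻¹-bounded l l≉0) , near-map (λ w _ → proj₂) near)
                                        (bounded-const (l ⁻¹) z)))
    where
    δ = proj₁ (proj₂ (⁻¹-bounded l l≉0))
    near : Near z (λ w → ¬ f w ≈ 0ℂ × ∥ f w ⁻¹ ∥≤ proj₁ (⁻¹-bounded l l≉0))
    near = near-map (λ w _ → proj₂ (proj₂ (proj₂ (⁻¹-bounded l l≉0))) (f w))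
      (lim δ (proj₁ (proj₂ (proj₂ (⁻¹-bounded l l≉0)))))

  Differentiable : (ℂ → ℂ) → ℂ → Set
  Differentiable f z = ∃[ l ] Limit (λ w → (f w - f z) * (w - z) ⁻¹) z l

  sub-inverse : ∀ {w z} → ¬ w ≈ z → (w - z) * (w - z) ⁻¹ ≈ 1ℂ
  sub-inverse w≉z = *-inverse _ (w≉z ∘ x-y≈0⇒x≈y)

  differentiable⇒continuous : ∀ {f z} → Differentiable f z → Limit f z (f z)
  differentiable⇒continuous {f} {z} (l , lim) = null-cong
    (always (λ w w≉z → trans (*-comm _ _) (quotient-cancel (f w - f z) (sub-inverse w≉z))))
    (null-* id-null (limit⇒bounded lim))
    where
    id-null : Null (λ w → w - z) z
    id-null ε 0<ε = ε , 0<ε , λ w _ p → p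

  diff-cong : ∀ {f g z} → (∀ w → f w ≈ g w) → Differentiable f z → Differentiable g z
  diff-cong {z = z} f≈g (l , lim) =
    l , limit-cong (always (λ w _ → *-congʳ (+-cong (f≈g w) (-‿cong (f≈g z))))) refl lim

  diff-const : ∀ c {z} → Differentiable (λ _ → c) z
  diff-const c {z} = 0ℂ , limit-cong
    (always (λ w _ → sym (trans (*-congʳ (-‿inverseʳ c)) (zeroˡ _)))) refl (limit-const 0ℂ z)

  diff-id : ∀ {z} → Differentiable id z
  diff-id {z} = 1ℂ , limit-cong (always (λ w w≉z → sym (sub-inverse w≉z))) refl (limit-const 1ℂ z)

  diff-+ : ∀ {f g z} → Differentiable f z → Differentiable g z → Differentiable (λ w → f w + g w) z
  diff-+ {f} {g} {z} (l , F) (m , G) = l + m ,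
    limit-cong (always (λ w _ → quotient-+ (f w) (g w) (f z) (g z) ((w - z) ⁻¹))) refl (limit-+ F G)

  diff-* : ∀ {f g z} → Differentiable f z → Differentiable g z → Differentiable (λ w → f w * g w) z
  diff-* {f} {g} {z} (l , F) (m , G) = l * g z + f z * m ,
    limit-cong (always (λ w _ → sym (quotient-* (f w) (g w) (f z) (g z) ((w - z) ⁻¹)))) refl
      (limit-+ (limit-* F (differentiable⇒continuous (m , G))) (limit-* (limit-const (f z) z) G))

  diff-⁻¹ : ∀ {f z} → ¬ f z ≈ 0ℂ → Differentiable f z → Differentiable (λ w → f w ⁻¹) z
  diff-⁻¹ {f} {z} fz≉0 (l , F) = l * (f z ⁻¹ * - (f z ⁻¹)) ,
    limit-cong (near-map (λ w _ fw≉0 → trans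
        (sym (regroup (f w - f z) (f w ⁻¹) (f z ⁻¹) ((w - z) ⁻¹)))
        (*-congʳ (inverse-sub (*-inverse (f w) fw≉0) (*-inverse (f z) fz≉0)))) (proj₁ inverse)) refl
      (limit-* F (limit-* (proj₂ inverse) (limit-const (- (f z ⁻¹)) z)))
    where inverse = limit-⁻¹ fz≉0 (differentiable⇒continuous (l , F))

  diff-^ : ∀ n {z} → Differentiable (_^ n) z
  diff-^ zero    = diff-const 1ℂ
  diff-^ (suc n) = diff-* diff-id (diff-^ n)

  diff-∑ : ∀ {A : Set} (xs : List A) {f : A → ℂ → ℂ} {z} → (∀ x → Differentiable (f x) z) →
           Differentiable (λ w → ∑ xs (λ x → f x w)) z
  diff-∑ []       F = diff-const 0ℂ
  diff-∑ (x ∷ xs) F = diff-+ (F x) (diff-∑ xs F)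

  -- A ball on which inverses near z - a stay bounded contains no zero; translated to z it misses a.
  -- If z = a, the puncture itself suffices.
  avoid : ∀ {z a} → Dec (z ≈ a) → Near z (λ w → ¬ w ≈ a)
  avoid (yes z≈a) = always (λ w w≉z w≈a → w≉z (trans w≈a (sym z≈a)))
  avoid {z} {a} (no z≉a) = δ , 0<δ , λ w _ p → separated p
    where
    apart-bound = ⁻¹-bounded (z - a) (z≉a ∘ x-y≈0⇒x≈y)
    δ = proj₁ (proj₂ apart-bound)
    0<δ = proj₁ (proj₂ (proj₂ apart-bound))
    separated : ∀ {w} → ∥ w - z ∥≤ δ → ¬ w ≈ a
    separated {w} p w≈a = proj₁ (proj₂ (proj₂ (proj₂ apart-bound)) (w - a)
      (∥∥-cong (trans (sub-cancelˡ (- a) w z) (+-cong (+-comm _ _) (-‿cong (+-comm _ _)))) ℝ.refl p))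
      (x≈y⇒x-y≈0 w≈a)

-- The Estermann function as a rational function of u.

module EstermannFunction (R : RealField) (𝒩 : NormedField R) {q : ℕ} (F : FiniteField q)
  (𝕏 : NontrivialCharacter F (NormedField.ring 𝒩)) {n : ℕ} (1≤n : 1 ℕ.≤ n) (g : Polynomials.Monic F n) where

  open NormedField 𝒩 renaming (ring to complexRing)
  private
    module ℝ = RealField R
    module F = FiniteField F
    module F+ = CommutativeRing F.commutativeRing
  open ℝ using () renaming (_<_ to _<ᴿ_)
  open CommutativeRing complexRing renaming (Carrier to ℂ; 0# to 0ℂ; 1# to 1ℂ)
  open F using (units) renaming (Carrier to 𝔽)
  open Polynomials F
  open PolynomialRing F
  open PolynomialSums F complexRing
  open FieldSum F using (∑-units-cong)
  open NontrivialCharacter 𝕏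
  open AdditiveCharacter F complexRing 𝕏
  open Modulus 1≤n g using (ψ)
  open FunctionalEquation F complexRing 𝕏 1≤n g using (D; weight; functional-equation)
  open EstermannCoefficients F complexRing 𝕏 1≤n g
  open RingSum complexRing
  open FieldLemmas complexRing
  open Series R 𝒩
  open Limits R 𝒩
  open SemiringExp semiring using (^-congˡ)
  open CommSemiringExp commutativeSemiring using (^-distrib-*)
  open IntegerSolver complexRing
  open SetoidReasoning setoid

  pole : ℂ → ℂ
  pole u = (1ℂ - qᴷ * u) ⁻¹

  1-qu≉0 : ∀ {u} → ¬ qᴷ * u ≈ 1ℂ → ¬ 1ℂ - qᴷ * u ≈ 0ℂ
  1-qu≉0 qu≉1 = qu≉1 ∘ 1-x≈0⇒x≈1

  pole-inverse : ∀ {u} → ¬ qᴷ * u ≈ 1ℂ → (1ℂ - qᴷ * u) * pole u ≈ 1ℂ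
  pole-inverse qu≉1 = *-inverse _ (1-qu≉0 qu≉1)

  pole-cong : ∀ {u w} → u ≈ w → pole u ≈ pole w
  pole-cong u≈w = ⁻¹-cong (+-congˡ (-‿cong (*-congˡ u≈w)))

  𝓓 : Poly → ℂ → ℂ
  𝓓 a u = D u (pole u) a

  sum-delay : ∀ {u} i {b s} → GeometricSum (λ k → b k * u ^ k) s → GeometricSum (λ k → delay i b k * u ^ k) (u ^ i * s)
  sum-delay zero    B = sum-cong (λ _ → refl) (sym (*-identityˡ _)) B
  sum-delay {u} (suc i) {b} {s} B = sum-cong (λ _ → refl)
    (solve 3 (λ u x s → :0 :* :1 :+ x :* s :* u := u :* x :* s) refl u (u ^ i) s)
    (sum-unsuc {λ k → delay (suc i) b k * u ^ k} (sum-cong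
      (λ k → solve 3 (λ d x u → d :* x :* u := d :* (u :* x)) refl (delay i b k) (u ^ k) u) refl
      (sum-*ʳ u (sum-delay i B))))

  sum-δ₀ : ∀ {u} → GeometricSum (λ k → δ₀ k * u ^ k) 1ℂ
  sum-δ₀ {u} = sum-cong (λ _ → refl) (trans (+-identityʳ _) (*-identityˡ 1ℂ))
    (sum-unsuc {λ k → δ₀ k * u ^ k} (sum-cong (λ k → sym (zeroˡ _)) refl sum-0))

  -- The weights are the generating functions of the counts; convergence matters only for the class
  -- of all residues, whose series is geometric with ratio q u.
  sum-weight : ∀ {u r} → ∥ qᴷ * u ∥≤ r → ℝ.0# <ᴿ r → r <ᴿ ℝ.1# → ¬ qᴷ * u ≈ 1ℂ →
               ∀ i → GeometricSum (λ k → count i k * u ^ k) (weight u (pole u) i)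
  sum-weight {u} qu≤r 0<r r<1 qu≉1 i with i ℕ.<? n
  ... | yes _ = sum-cong (λ _ → refl) (*-identityʳ _) (sum-delay i sum-δ₀)
  ... | no  _ = sum-delay i (sum-cong (λ k → ^-distrib-* qᴷ u k) refl
                  (sum-geometric qu≤r 0<r r<1 (pole-inverse qu≉1)))

  𝓓-sum : ∀ a {u r} → ∥ qᴷ * u ∥≤ r → ℝ.0# <ᴿ r → r <ᴿ ℝ.1# → ¬ qᴷ * u ≈ 1ℂ →
          GeometricSum (λ N → ∑ (monics N) (λ f → d f · 1ℂ * ψ (a *ₚ toPoly f) * u ^ N)) (𝓓 a u)
  𝓓-sum a {u} qu≤r 0<r r<1 qu≉1 = sum-cong (λ N → sym (term≈conv a u N)) (sym (D≈∑pair u (pole u) a))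
    (sum-∑ (List.upTo (suc n)) (λ i → sum-∑ (List.upTo (suc n)) (λ j →
      sum-*ʳ (pair a i j) (sum-conv (sum-weight qu≤r 0<r r<1 qu≉1 i) (sum-weight qu≤r 0<r r<1 qu≉1 j)))))

  weight-cong : ∀ i {u w c c′} → u ≈ w → c ≈ c′ → weight u c i ≈ weight w c′ i
  weight-cong i u≈w c≈c′ with i ℕ.<? n
  ... | yes _ = ^-congˡ i u≈w
  ... | no  _ = *-cong (^-congˡ i u≈w) c≈c′

  𝓓-cong : ∀ a {u w} → u ≈ w → 𝓓 a u ≈ 𝓓 a w
  𝓓-cong a {u} {w} u≈w = trans (D≈∑pair u (pole u) a) (trans
    (∑-cong (List.upTo (suc n)) (λ i → ∑-cong (List.upTo (suc n)) (λ j → *-congʳ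
      (*-cong (weight-cong i u≈w (pole-cong u≈w)) (weight-cong j u≈w (pole-cong u≈w))))))
    (sym (D≈∑pair w (pole w) a)))

  weight-differentiable : ∀ {z} → ¬ qᴷ * z ≈ 1ℂ → ∀ i → Differentiable (λ u → weight u (pole u) i) z
  weight-differentiable {z} qz≉1 i with i ℕ.<? n
  ... | yes _ = diff-^ i
  ... | no  _ = diff-* (diff-^ i) (diff-⁻¹ (1-qu≉0 qz≉1)
      (diff-cong (λ u → solve 2 (λ q u → :1 :+ :- q :* u := :1 :- q :* u) refl qᴷ u)
        (diff-+ (diff-const 1ℂ) (diff-* (diff-const (- qᴷ)) diff-id))))

  𝓓-differentiable : ∀ a {z} → ¬ qᴷ * z ≈ 1ℂ → Differentiable (𝓓 a) z
  𝓓-differentiable a qz≉1 = diff-cong (λ u → sym (D≈∑pair u (pole u) a))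
    (diff-∑ (List.upTo (suc n)) (λ i → diff-∑ (List.upTo (suc n)) (λ j →
      diff-* (diff-* (weight-differentiable qz≉1 i) (weight-differentiable qz≉1 j)) (diff-const (pair a i j)))))

  -- (u - z) times the i-th weight, for the pole z = 1 / q.
  regular : ℂ → ℕ → ℂ → ℂ
  regular z i u with i ℕ.<? n
  ... | yes _ = u ^ i * (u - z)
  ... | no  _ = u ^ i * - z

  regular-differentiable : ∀ z i w → Differentiable (regular z i) w
  regular-differentiable z i w with i ℕ.<? n
  ... | yes _ = diff-* (diff-^ i) (diff-+ diff-id (diff-const (- z)))
  ... | no  _ = diff-* (diff-^ i) (diff-const (- z))

  -- Since q z = 1, the factor w - z equals -z (1 - q w) and removes the simple pole of a weight.
  weight-regular : ∀ {z} → qᴷ * z ≈ 1ℂ → ∀ i w → ¬ w ≈ z → (w - z) * weight w (pole w) i ≈ regular z i w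
  weight-regular {z} qz≈1 i w w≉z with i ℕ.<? n
  ... | yes _ = *-comm _ _
  ... | no  _ = begin
    (w - z) * (w ^ i * pole w)
      ≈⟨ *-congʳ (trans (solve 2 (λ w z → w :- z := w :* :1 :- z) refl w z) (trans (+-congʳ (*-congˡ (sym qz≈1)))
           (solve 3 (λ w z q → w :* (q :* z) :- z := :- z :* (:1 :- q :* w)) refl w z qᴷ))) ⟩
    - z * (1ℂ - qᴷ * w) * (w ^ i * pole w)
      ≈⟨ solve 4 (λ z x w c → z :* x :* (w :* c) := w :* z :* (x :* c)) refl (- z) (1ℂ - qᴷ * w) (w ^ i) (pole w) ⟩
    w ^ i * - z * ((1ℂ - qᴷ * w) * pole w)
      ≈⟨ trans (*-congˡ (pole-inverse (λ qw≈1 → w≉z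
           (*-cancelˡ-invertible {qᴷ} {z} qz≈1 (trans qw≈1 (sym qz≈1)))))) (*-identityʳ _) ⟩
    w ^ i * - z ∎

  𝓓-regular : Poly → ℂ → ℂ → ℂ
  𝓓-regular a z w = ∑ (List.upTo (suc n)) (λ i → ∑ (List.upTo (suc n)) (λ j →
    regular z i w * regular z j w * pair a i j))

  𝓓-regular-differentiable : ∀ a z w → Differentiable (𝓓-regular a z) w
  𝓓-regular-differentiable a z w = diff-∑ (List.upTo (suc n)) (λ i → diff-∑ (List.upTo (suc n)) (λ j →
    diff-* (diff-* (regular-differentiable z i w) (regular-differentiable z j w)) (diff-const (pair a i j))))

  -- Each summand has two weights, each with at most a simple pole, so one factor w - z goes to each
  -- of them.
  𝓓≈regular : ∀ a {z} → qᴷ * z ≈ 1ℂ → ∀ w → ¬ w ≈ z → (w - z) ^ 2 * 𝓓 a w ≈ 𝓓-regular a z w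
  𝓓≈regular a {z} qz≈1 w w≉z = begin
    (w - z) ^ 2 * 𝓓 a w
      ≈⟨ *-congˡ (D≈∑pair w (pole w) a) ⟩
    (w - z) ^ 2 * ∑ (List.upTo (suc n)) (λ i → ∑ (List.upTo (suc n)) (λ j →
      weight w (pole w) i * weight w (pole w) j * pair a i j))
      ≈⟨ sym (trans (∑-cong (List.upTo (suc n)) (λ i → ∑-*ˡ (List.upTo (suc n)) ((w - z) ^ 2) _))
                    (∑-*ˡ (List.upTo (suc n)) ((w - z) ^ 2) _)) ⟩
    ∑ (List.upTo (suc n)) (λ i → ∑ (List.upTo (suc n)) (λ j →
      (w - z) ^ 2 * (weight w (pole w) i * weight w (pole w) j * pair a i j)))
      ≈⟨ ∑-cong (List.upTo (suc n)) (λ i → ∑-cong (List.upTo (suc n)) (λ j → trans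
           (solve 4 (λ x a b p → x :* (x :* :1) :* (a :* b :* p) := x :* a :* (x :* b) :* p) refl
             (w - z) (weight w (pole w) i) (weight w (pole w) j) (pair a i j))
           (*-congʳ (*-cong (weight-regular qz≈1 i w w≉z) (weight-regular qz≈1 j w w≉z))))) ⟩
    𝓓-regular a z w ∎

  𝒜 : 𝔽 → ℂ → ℂ
  𝒜 l u = ∑ (0 ∷ 1 ∷ []) λ η₁ → ∑ (0 ∷ 1 ∷ []) λ η₂ →
    (- 1ℂ) ^ (η₁ ℕ.+ η₂)
    * Kl (η₁ F.· F.1# F.+ F.- F.1#) ((F.1# F.+ F.- (η₂ F.· F.1#)) F.* l)
    * (qᴷ * (1ℂ - qᴷ * u) ^ (η₁ ℕ.+ η₂)) ⁻¹

  Kl-00 : Kl F.0# F.0# ≈ qᴷ - 1ℂ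
  Kl-00 = trans (∑-cong units (λ γ → trans (reflexive (≡.cong χ (≡.trans
    (≡.cong₂ F._+_ (F+.zeroˡ γ) (F+.zeroˡ (γ F.⁻¹))) (F+.+-identityˡ F.0#)))) χ-0)) ∑1-units

  Kl-0l : ∀ {l} → ¬ l ≡ F.0# → Kl F.0# l ≈ - 1ℂ
  Kl-0l {l} l≢0 = trans (∑-cong units (λ γ → reflexive (≡.cong χ (≡.trans
    (≡.cong (F._+ l F.* γ F.⁻¹) (F+.zeroˡ γ)) (F+.+-identityˡ _))))) (∑χ-⁻¹ l≢0)

  Kl-10 : Kl (F.- F.1#) F.0# ≈ - 1ℂ
  Kl-10 = trans (∑-cong units (λ γ → reflexive (≡.cong χ (𝔽-solve 2 (λ γ i →
    :-′ :1′ :*′ γ :+′ :0′ :*′ i :=′ :-′ γ) ≡.refl γ (γ F.⁻¹))))) ∑χ-neg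
    where open IntegerSolver F.commutativeRing using () renaming
            (solve to 𝔽-solve; _:*_ to _:*′_; _:+_ to _:+′_; :-_ to :-′_; _:=_ to _:=′_; :1 to :1′; :0 to :0′)

  -- Of the four Kloosterman sums only the one with η₁ = η₂ = 0 is genuine: the mixed ones
  -- degenerate to -1, and the one with both arguments zero to q - 1.
  qᴷ≉0⇒𝒜≈ : ¬ qᴷ ≈ 0ℂ → ∀ {l} → ¬ l ≡ F.0# → ∀ {u} → ¬ qᴷ * u ≈ 1ℂ →
    𝒜 l u ≈ qᴷ ⁻¹ * (Kl (F.- F.1#) l + ((1ℂ + 1ℂ) * pole u + (qᴷ - 1ℂ) * (pole u * pole u)))
  qᴷ≉0⇒𝒜≈ q≉0 {l} l≢0 {u} qu≉1 = begin
    𝒜 l u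
      ≈⟨ +-cong (+-cong (*-cong (*-congˡ (Kl≡ -1+0 1l)) (inverse-power 0))
                        (+-congʳ (*-cong (*-congˡ (trans (Kl≡ -1+0 0l) Kl-10)) (inverse-power 1))))
                (+-congʳ (+-cong (*-cong (*-congˡ (trans (Kl≡ -1+1 1l) (Kl-0l l≢0))) (inverse-power 1))
                                 (+-congʳ (*-cong (*-congˡ (trans (Kl≡ -1+1 0l) Kl-00)) (inverse-power 2))))) ⟩
    1ℂ * Kl (F.- F.1#) l * (qᴷ ⁻¹ * 1ℂ) + ((- 1ℂ * 1ℂ) * - 1ℂ * (qᴷ ⁻¹ * (c * 1ℂ)) + 0ℂ) +
    ((- 1ℂ * 1ℂ) * - 1ℂ * (qᴷ ⁻¹ * (c * 1ℂ)) + ((- 1ℂ * (- 1ℂ * 1ℂ)) * (qᴷ - 1ℂ) * (qᴷ ⁻¹ * (c * (c * 1ℂ))) + 0ℂ) + 0ℂ)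
      ≈⟨ solve 4 (λ k i c q →
           :1 :* k :* (i :* :1) :+ ((:- :1 :* :1) :* :- :1 :* (i :* (c :* :1)) :+ :0) :+
           ((:- :1 :* :1) :* :- :1 :* (i :* (c :* :1)) :+ ((:- :1 :* (:- :1 :* :1)) :* (q :- :1) :* (i :* (c :* (c :* :1))) :+ :0) :+ :0)
           := i :* (k :+ ((:1 :+ :1) :* c :+ (q :- :1) :* (c :* c)))) refl (Kl (F.- F.1#) l) (qᴷ ⁻¹) c qᴷ ⟩
    qᴷ ⁻¹ * (Kl (F.- F.1#) l + ((1ℂ + 1ℂ) * c + (qᴷ - 1ℂ) * (c * c))) ∎
    where
    c = pole u
    Kl≡ : ∀ {α α′ β β′} → α ≡ α′ → β ≡ β′ → Kl α β ≈ Kl α′ β′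
    Kl≡ ≡.refl ≡.refl = refl
    open IntegerSolver F.commutativeRing using () renaming
      (solve to 𝔽-solve; _:*_ to _:*′_; _:+_ to _:+′_; :-_ to :-′_; _:=_ to _:=′_; :1 to :1′; :0 to :0′)
    -1+0 : F.0# F.+ F.- F.1# ≡ F.- F.1#
    -1+0 = F+.+-identityˡ _
    -1+1 : (F.1# F.+ F.0#) F.+ F.- F.1# ≡ F.0#
    -1+1 = 𝔽-solve 0 ((:1′ :+′ :0′) :+′ :-′ :1′ :=′ :0′) ≡.refl
    1l : (F.1# F.+ F.- F.0#) F.* l ≡ l
    1l = 𝔽-solve 1 (λ l → (:1′ :+′ :-′ :0′) :*′ l :=′ l) ≡.refl l
    0l : (F.1# F.+ F.- (F.1# F.+ F.0#)) F.* l ≡ F.0#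
    0l = 𝔽-solve 1 (λ l → (:1′ :+′ :-′ (:1′ :+′ :0′)) :*′ l :=′ :0′) ≡.refl l
    inverse-power : ∀ k → (qᴷ * (1ℂ - qᴷ * u) ^ k) ⁻¹ ≈ qᴷ ⁻¹ * c ^ k
    inverse-power k = sym (inverse-unique inv (*-inverse _ nonzero))
      where
      inv : qᴷ * (1ℂ - qᴷ * u) ^ k * (qᴷ ⁻¹ * c ^ k) ≈ 1ℂ
      inv = begin
        qᴷ * (1ℂ - qᴷ * u) ^ k * (qᴷ ⁻¹ * c ^ k)     ≈⟨ solve 4 (λ q x i y → q :* x :* (i :* y) := q :* i :* (x :* y)) refl qᴷ _ _ _ ⟩
        qᴷ * qᴷ ⁻¹ * ((1ℂ - qᴷ * u) ^ k * c ^ k)     ≈⟨ *-cong (*-inverse qᴷ q≉0) (sym (^-distrib-* (1ℂ - qᴷ * u) c k)) ⟩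
        1ℂ * ((1ℂ - qᴷ * u) * c) ^ k                 ≈⟨ *-identityˡ _ ⟩
        ((1ℂ - qᴷ * u) * c) ^ k                      ≈⟨ ^-congˡ k (pole-inverse qu≉1) ⟩
        1ℂ ^ k                                       ≈⟨ 1^ k ⟩
        1ℂ                                           ∎
      nonzero : ¬ qᴷ * (1ℂ - qᴷ * u) ^ k ≈ 0ℂ
      nonzero eq = 1≉0 (trans (sym inv) (trans (*-congʳ eq) (zeroˡ _)))

  module _ (q≉0 : ¬ qᴷ ≈ 0ℂ) where

    𝒜≈amplitude : ∀ {l} → ¬ l ≡ F.0# → ∀ {u} → ¬ qᴷ * u ≈ 1ℂ → 𝒜 l u ≈ qᴷ ⁻¹ * amplitude (pole u) l
    𝒜≈amplitude l≢0 {u} qu≉1 = trans (qᴷ≉0⇒𝒜≈ q≉0 l≢0 qu≉1) (*-congˡ (sym (amplitude-Kl (pole u) l≢0)))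

    𝒜-closed : ∀ {l} → ¬ l ≡ F.0# → ∀ {u} → ¬ qᴷ * u ≈ 1ℂ → 𝒜 l u ≈
      Kl (F.- F.1#) l * qᴷ ⁻¹ + (1ℂ + qᴷ - 2 · 1ℂ * qᴷ * u) * (qᴷ * (1ℂ - qᴷ * u) ^ 2) ⁻¹
    𝒜-closed {l} l≢0 {u} qu≉1 = begin
      𝒜 l u
        ≈⟨ qᴷ≉0⇒𝒜≈ q≉0 l≢0 qu≉1 ⟩
      qᴷ ⁻¹ * (k + ((1ℂ + 1ℂ) * c + (qᴷ - 1ℂ) * (c * c)))
        -- Inserting (1 - q u) c = 1 into 2 c creates the common denominator: 2 (1 - q u) + q - 1 =
        -- 1 + q - 2 q u.
        ≈⟨ *-congˡ (+-congˡ (+-congʳ (sym (trans (*-congˡ (pole-inverse qu≉1)) (*-identityʳ _))))) ⟩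
      qᴷ ⁻¹ * (k + ((1ℂ + 1ℂ) * c * ((1ℂ - qᴷ * u) * c) + (qᴷ - 1ℂ) * (c * c)))
        ≈⟨ solve 5 (λ i k c q u → i :* (k :+ ((:1 :+ :1) :* c :* ((:1 :- q :* u) :* c) :+ (q :- :1) :* (c :* c))) :=
             k :* i :+ (:1 :+ q :- (:1 :+ (:1 :+ :0)) :* q :* u) :* (i :* (c :* c))) refl (qᴷ ⁻¹) k c qᴷ u ⟩
      k * qᴷ ⁻¹ + (1ℂ + qᴷ - 2 · 1ℂ * qᴷ * u) * (qᴷ ⁻¹ * (c * c))
        ≈⟨ +-congˡ (*-congˡ (inverse-unique inv (*-inverse _ nonzero))) ⟩
      k * qᴷ ⁻¹ + (1ℂ + qᴷ - 2 · 1ℂ * qᴷ * u) * (qᴷ * (1ℂ - qᴷ * u) ^ 2) ⁻¹ ∎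
      where
      c = pole u
      k = Kl (F.- F.1#) l
      inv : qᴷ * (1ℂ - qᴷ * u) ^ 2 * (qᴷ ⁻¹ * (c * c)) ≈ 1ℂ
      inv = begin
        qᴷ * (1ℂ - qᴷ * u) ^ 2 * (qᴷ ⁻¹ * (c * c))
          ≈⟨ solve 4 (λ q x i c → q :* (x :* (x :* :1)) :* (i :* (c :* c)) := q :* i :* (x :* c :* (x :* c))) refl qᴷ _ (qᴷ ⁻¹) c ⟩
        qᴷ * qᴷ ⁻¹ * ((1ℂ - qᴷ * u) * c * ((1ℂ - qᴷ * u) * c))
          ≈⟨ *-cong (*-inverse qᴷ q≉0) (*-cong (pole-inverse qu≉1) (pole-inverse qu≉1)) ⟩
        1ℂ * (1ℂ * 1ℂ)
          ≈⟨ trans (*-identityˡ _) (*-identityˡ _) ⟩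
        1ℂ ∎
      nonzero : ¬ qᴷ * (1ℂ - qᴷ * u) ^ 2 ≈ 0ℂ
      nonzero eq = 1≉0 (trans (sym inv) (trans (*-congʳ eq) (zeroˡ _)))

    -- The prefactor and the amplitudes enter as variables with equations, so that a caller may
    -- supply its own forms of them.
    𝓓-functional-equation : ∀ b b̄ k → b *ₚ b̄ ≋ 1ₚ +ₚ k *ₚ toPoly g →
      ∀ w v → qᴷ * w * v ≈ 1ℂ → ¬ qᴷ * w ≈ 1ℂ → ¬ w ≈ 1ℂ →
      (C : ℂ) → C ≈ (qᴷ * w ^ 2) ^ (n ∸ 1) → (A : 𝔽 → ℂ) → (∀ l → ¬ l ≡ F.0# → A l ≈ 𝒜 l w) →
      𝓓 b w ≈ C * ∑ units (λ l → A l * 𝓓 (l ∙ₚ b̄) v)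
    𝓓-functional-equation b b̄ k bb̄≋1 w v qwv≈1 qw≉1 w≉1 C C≈ A A≈𝒜 = trans
      (functional-equation (pole-inverse qw≉1) (pole-inverse qv≉1) qwv≈1 (*-inverse qᴷ q≉0) b b̄ k bb̄≋1)
      (*-cong (sym C≈) (∑-units-cong +-commutativeMonoid (λ l l≢0 →
        *-congʳ (sym (trans (A≈𝒜 l l≢0) (𝒜≈amplitude l≢0 qw≉1))))))
      where
      -- As q v = 1 / w, the pole of the right-hand function at v = 1/q corresponds to w = 1.
      qv≉1 : ¬ qᴷ * v ≈ 1ℂ
      qv≉1 qv≈1 = w≉1 (begin
        w               ≈⟨ sym (*-identityʳ w) ⟩
        w * 1ℂ          ≈⟨ *-congˡ (sym qv≈1) ⟩
        w * (qᴷ * v)    ≈⟨ solve 3 (λ w q v → w :* (q :* v) := q :* w :* v) refl w qᴷ v ⟩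
        qᴷ * w * v      ≈⟨ qwv≈1 ⟩
        1ℂ              ∎)

  -- What the final theorem needs to know about 𝓓; over the complex numbers
  -- 𝓓 has to stay a variable, since the type checker would otherwise unfold it.
  record Continuation : Set where
    field
      D̂       : Poly → ℂ → ℂ
      D̂-cong  : ∀ a {u w} → u ≈ w → D̂ a u ≈ D̂ a w
      D̂-sum   : ∀ a {u r} → ∥ qᴷ * u ∥≤ r → ℝ.0# <ᴿ r → r <ᴿ ℝ.1# → ¬ qᴷ * u ≈ 1ℂ →
        GeometricSum (λ N → ∑ (monics N) (λ f → d f · 1ℂ * ψ (a *ₚ toPoly f) * u ^ N)) (D̂ a u)
      D̂-differentiable : ∀ a {z} → ¬ qᴷ * z ≈ 1ℂ → Differentiable (D̂ a) z
      H       : Poly → ℂ → ℂ → ℂ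
      H-differentiable : ∀ a z w → Differentiable (H a z) w
      D̂≈H     : ∀ a {z} → qᴷ * z ≈ 1ℂ → ∀ w → ¬ w ≈ z → (w - z) ^ 2 * D̂ a w ≈ H a z w
      D̂-functional-equation : ¬ qᴷ ≈ 0ℂ → ∀ b b̄ k → b *ₚ b̄ ≋ 1ₚ +ₚ k *ₚ toPoly g →
        ∀ w v → qᴷ * w * v ≈ 1ℂ → ¬ qᴷ * w ≈ 1ℂ → ¬ w ≈ 1ℂ →
        (C : ℂ) → C ≈ (qᴷ * w ^ 2) ^ (n ∸ 1) → (A : 𝔽 → ℂ) → (∀ l → ¬ l ≡ F.0# → A l ≈ 𝒜 l w) →
        D̂ b w ≈ C * ∑ units (λ l → A l * D̂ (l ∙ₚ b̄) v)

  continuation : Continuation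
  continuation = record
    { D̂ = 𝓓 ; D̂-cong = 𝓓-cong ; D̂-sum = 𝓓-sum ; D̂-differentiable = 𝓓-differentiable
    ; H = 𝓓-regular ; H-differentiable = 𝓓-regular-differentiable ; D̂≈H = 𝓓≈regular
    ; D̂-functional-equation = 𝓓-functional-equation }

module RingIdentities (K : CommutativeRing 0ℓ 0ℓ) where

  open CommutativeRing K
  open IntegerSolver K

  pull-fourth : ∀ a b c r i → a * b * c * r * i ≈ r * (a * b * c * i)
  pull-fourth = solve 5 (λ a b c r i → a :* b :* c :* r :* i := r :* (a :* b :* c :* i)) refl

  pull-second : ∀ a b c i → a * b * c * i ≈ a * (c * (b * i))
  pull-second = solve 4 (λ a b c i → a :* b :* c :* i := a :* (c :* (b :* i))) refl

  add-subtract : ∀ x y → x ≈ y + (x + - y)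
  add-subtract = solve 2 (λ x y → x := y :+ (x :- y)) refl

-- The additive character built from the exponential and π.

module ExponentialCharacter (R : RealField) (exp : Complex.ℂ R → Complex.ℂ R) (isExp : Complex.IsExp R exp)
  (π : RealField.ℝ R) (isPi : Complex.IsPi R exp π) (p η : ℕ) (p-prime : Prime p) (1≤η : 1 ℕ.≤ η)
  (F : FiniteField (p ℕ.^ η)) where

  open ComplexField R
  open ComplexNorm R
  open ComplexNormedField R
  private
    module ℝ = RealField R
    module C = Complex R
    module F = FiniteField F
  open ℝ using (ℝ) renaming (_<_ to _<ᴿ_; _*_ to _*ᴿ_; -_ to -ᴿ_; _-_ to _-ᴿ_; _≈_ to _≈ᴿ_)
  open OrderedField R
  open C using (HasSum; partialSum; 𝕚)
  open CommutativeRing complexRing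
  open RingSum complexRing using (_^_; _·_)
  open FieldLemmas complexRing
  open RingIdentities complexRing
  open PartialSums complexRing
  open Series R complexNormedField using (Sums; sums-unique)
  open Exponential R complexNormedField using (term; exp-+; exp-0; exp-cong; exp-ofℕ*; ofℕ-!≉0)
  open Estermann R exp π p η F using (e_q; Tr; residue)

  partialSum≡sumTo : ∀ a n → partialSum a n ≡ sumTo a n
  partialSum≡sumTo a zero    = ≡.refl
  partialSum≡sumTo a (suc n) = ≡.cong (λ s → s + a n) (partialSum≡sumTo a n)

  hasSum⇒sums : ∀ {a s} → HasSum a s → Sums a s
  hasSum⇒sums {a} {s} S ε 0<ε = proj₁ (S ε 0<ε) , λ n N≤n →
    ≡.subst (λ t → ∥ t - s ∥≤ ε) (partialSum≡sumTo a n) (∣∣<⇒∥∥ (proj₂ (S ε 0<ε) n N≤n))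

  half-< : ∀ {ε} → ℝ.0# <ᴿ ε → ε *ᴿ half <ᴿ ε
  half-< {ε} 0<ε = <-by (ℝ.*-pos 0<ε 0<half) (ℝ.trans (ℝ.+-congʳ (ℝ.sym (half+half ε)))
    (solve 1 (λ h → h :+ h :- h := h) ℝ.refl (ε *ᴿ half)))
    where open IntegerSolver ℝ.commutativeRing

  sums⇒hasSum : ∀ {a s} → Sums a s → HasSum a s
  sums⇒hasSum {a} {s} S ε 0<ε = proj₁ near , λ n N≤n → ∥∥⇒∣∣<
    (≡.subst (λ t → ∥ t - s ∥≤ ε *ᴿ half) (≡.sym (partialSum≡sumTo a n)) (proj₂ near n N≤n)) (half-< 0<ε)
    where near = S (ε *ᴿ half) (ℝ.*-pos 0<ε 0<half)

  exp-sums : ∀ z → Sums (term z) (exp z)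
  exp-sums z = hasSum⇒sums (isExp z)

  conj : ℂ → ℂ
  conj z = re z +i (-ᴿ im z)

  conj-cong : ∀ {z w} → z ≈ w → conj z ≈ conj w
  conj-cong (p , q) = p , ℝ.-‿cong q

  conj-+ : ∀ z w → conj (z + w) ≈ conj z + conj w
  conj-+ (a +i b) (c +i d) = ℝ.refl , solve 2 (λ b d → :- (b :+ d) := :- b :+ :- d) ℝ.refl b d
    where open IntegerSolver ℝ.commutativeRing

  conj-* : ∀ z w → conj (z * w) ≈ conj z * conj w
  conj-* (a +i b) (c +i d) =
    solve 4 (λ a b c d → a :* c :- b :* d := a :* c :- :- b :* :- d) ℝ.refl a b c d ,
    solve 4 (λ a b c d → :- (a :* d :+ b :* c) := a :* :- d :+ :- b :* c) ℝ.refl a b c d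
    where open IntegerSolver ℝ.commutativeRing

  conj-real : ∀ x → conj (ofReal x) ≈ ofReal x
  conj-real x = ℝ.refl , solve 0 (:- :0 := :0) ℝ.refl
    where open IntegerSolver ℝ.commutativeRing

  conj-^ : ∀ z n → conj (z ^ n) ≈ conj z ^ n
  conj-^ z zero    = conj-real ℝ.1#
  conj-^ z (suc n) = trans (conj-* z (z ^ n)) (*-congˡ (conj-^ z n))

  conj-ofℕ : ∀ n → conj (ofℕ n) ≈ ofℕ n
  conj-ofℕ n = trans (conj-cong (ofℕ≈ofReal n)) (trans (conj-real (n ℝ.· ℝ.1#)) (sym (ofℕ≈ofReal n)))

  conj-⁻¹ : ∀ z → ¬ z ≈ 0ℂ → conj (z ⁻¹) ≈ conj z ⁻¹
  conj-⁻¹ z z≉0 = sym (⁻¹-unique (trans (sym (conj-* z (z ⁻¹)))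
    (trans (conj-cong (*-inverse z z≉0)) (conj-real ℝ.1#))))

  conj-term : ∀ z n → conj (term z n) ≈ term (conj z) n
  conj-term z n = trans (conj-* (z ^ n) (ofℕ (n !) ⁻¹)) (*-cong (conj-^ z n)
    (trans (conj-⁻¹ (ofℕ (n !)) (ofℕ-!≉0 n)) (⁻¹-cong (conj-ofℕ (n !)))))

  conj-sumTo : ∀ a n → conj (sumTo a n) ≈ sumTo (λ k → conj (a k)) n
  conj-sumTo a zero    = conj-real ℝ.0#
  conj-sumTo a (suc n) = trans (conj-+ (sumTo a n) (a n)) (+-congʳ (conj-sumTo a n))

  ∥∥-conj : ∀ {z r} → ∥ z ∥≤ r → ∥ conj z ∥≤ r
  ∥∥-conj {a +i b} (bound 0≤r z≤r) = bound 0≤r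
    (≤-cong (solve 2 (λ a b → a :* a :+ b :* b := a :* a :+ :- b :* :- b) ℝ.refl a b) ℝ.refl z≤r)
    where open IntegerSolver ℝ.commutativeRing

  -- Conjugation preserves norms and fixes the coefficients 1 / n!, so it carries the convergent
  -- partial sums at z to those at the conjugate.
  exp-conj : ∀ z → exp (conj z) ≈ conj (exp z)
  exp-conj z = sums-unique {term (conj z)} (exp-sums (conj z)) λ ε 0<ε →
    proj₁ (exp-sums z ε 0<ε) , λ n N≤n →
      ∥∥-cong (conj-difference n) ℝ.refl (∥∥-conj (proj₂ (exp-sums z ε 0<ε) n N≤n))
    where
    conj-neg : ∀ w → conj (- w) ≈ - conj w
    conj-neg w = ℝ.refl , ℝ.refl
    conj-difference : ∀ n → conj (sumTo (term z) n - exp z) ≈ sumTo (term (conj z)) n - conj (exp z)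
    conj-difference n = trans (conj-+ (sumTo (term z) n) (- exp z))
      (+-cong (trans (conj-sumTo (term z) n) (sumTo-cong (conj-term z) n)) (conj-neg (exp z)))

  cis : ℝ → ℂ
  cis x = exp (𝕚 * ofReal x)

  -- The number 𝕚 x and its conjugate add up to 0, so cis x times its conjugate is exp 0.
  normSq-cis : ∀ x → normSq (cis x) ≈ᴿ ℝ.1#
  normSq-cis x = ℝ.trans (solve 2 (λ a b → a :* a :+ b :* b := a :* a :- b :* :- b) ℝ.refl (re (cis x)) (im (cis x)))
    (proj₁ product)
    where
    open IntegerSolver ℝ.commutativeRing
    z = 𝕚 * ofReal x
    z+z̄≈0 : z + conj z ≈ 0ℂ
    z+z̄≈0 = solve 1 (λ x → (:0 :* x :- :1 :* :0) :+ (:0 :* x :- :1 :* :0) := :0) ℝ.refl x ,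
            ℝ.-‿inverseʳ (im z)
    product : cis x * conj (cis x) ≈ 1ℂ
    product = trans (*-congˡ (sym (exp-conj z))) (trans (sym (exp-+ exp exp-sums z (conj z)))
      (trans (exp-cong exp exp-sums z+z̄≈0) (exp-0 exp exp-sums)))

  -- On the unit circle the real points are exactly the square roots of 1. Squares are used because
  -- the characterisation of π speaks only of the sine: it makes cis π real, and its sign is never
  -- determined.
  square-im≈0 : ∀ x → im (cis x) ≈ᴿ ℝ.0# → cis x ^ 2 ≈ 1ℂ
  square-im≈0 x b≈0 = trans (*-congˡ (*-identityʳ (cis x))) (
      ℝ.trans (solve 2 (λ a b → a :* a :- b :* b := (a :* a :+ b :* b) :- (:1 :+ :1) :* (b :* b)) ℝ.refl a b)
        (ℝ.trans (ℝ.+-cong (normSq-cis x) (ℝ.-‿cong (ℝ.*-congˡ (ℝ.trans (ℝ.*-congʳ b≈0) (ℝ.zeroˡ b)))))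
          (solve 0 (:1 :- (:1 :+ :1) :* :0 := :1) ℝ.refl)) ,
      ℝ.trans (ℝ.+-cong (ℝ.trans (ℝ.*-congˡ b≈0) (ℝ.zeroʳ a)) (ℝ.trans (ℝ.*-congʳ b≈0) (ℝ.zeroˡ a))) (ℝ.+-identityʳ _))
    where
    open IntegerSolver ℝ.commutativeRing
    a = re (cis x)
    b = im (cis x)

  square≈1⇒im≈0 : ∀ x → cis x ^ 2 ≈ 1ℂ → im (cis x) ≈ᴿ ℝ.0#
  square≈1⇒im≈0 x sq≈1 with im (cis x) ℝ.≟ ℝ.0#
  ... | yes b≈0 = b≈0
  ... | no b≉0  = contradiction
    (ℝ.trans (ℝ.sym (ℝ.-‿inverseʳ ℝ.1#)) (ℝ.trans (ℝ.+-cong (ℝ.sym (normSq-cis x)) (ℝ.-‿cong (ℝ.sym re≈1)))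
      (solve 2 (λ a b → (a :* a :+ b :* b) :- (a :* a :- b :* b) := b :* b :+ b :* b) ℝ.refl a b)))
    (<⇒≉ (+-pos (square-pos b≉0) (square-nonneg b)))
    where
    open IntegerSolver ℝ.commutativeRing
    a = re (cis x)
    b = im (cis x)
    re≈1 : a *ᴿ a -ᴿ b *ᴿ b ≈ᴿ ℝ.1#
    re≈1 = proj₁ (trans (*-congˡ (sym (*-identityʳ (cis x)))) sq≈1)

  θ ζ : ℂ
  θ = ofℕ 2 * ofReal π * 𝕚 * ofℕ p ⁻¹
  ζ = exp θ

  e_q≈ζ^ : ∀ y → e_q y ≈ ζ ^ residue (Tr y)
  e_q≈ζ^ y = trans (exp-cong exp exp-sums (pull-fourth (ofℕ 2) (ofReal π) 𝕚 (ofℕ (residue (Tr y))) (ofℕ p ⁻¹)))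
    (exp-ofℕ* exp exp-sums (residue (Tr y)) θ)

  private
    1<p : 1 ℕ.< p
    1<p = ℕ.nonTrivial⇒n>1 p {{prime⇒nonTrivial p-prime}}
    sucp : suc (ℕ.pred p) ≡ p
    sucp = ℕ.suc-pred p {{prime⇒nonZero p-prime}}
    p-recip : ∃[ y ] (p ℝ.· ℝ.1#) *ᴿ y ≈ᴿ ℝ.1# × ℝ.0# <ᴿ y
    p-recip = reciprocal-pos (≡.subst (λ n → ℝ.0# <ᴿ n ℝ.· ℝ.1#) sucp (suc·1-pos (ℕ.pred p)))
    y = proj₁ p-recip
    py≈1 = proj₁ (proj₂ p-recip)
    0<y = proj₂ (proj₂ p-recip)

  ofℕ-p≉0 : ¬ ofℕ p ≈ 0ℂ
  ofℕ-p≉0 = ≡.subst (λ n → ¬ ofℕ n ≈ 0ℂ) sucp (ofℕ-suc≉0 (ℕ.pred p))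

  ofℕ-p⁻¹ : ofℕ p ⁻¹ ≈ ofReal y
  ofℕ-p⁻¹ = ⁻¹-unique (trans (*-congʳ (ofℕ≈ofReal p)) (trans (ofReal-* (p ℝ.· ℝ.1#) y) (py≈1 , ℝ.refl)))

  exp-double : ∀ x → exp (ofℕ 2 * (𝕚 * ofReal x)) ≈ cis x ^ 2
  exp-double x = exp-ofℕ* exp exp-sums 2 (𝕚 * ofReal x)

  -- p θ is twice 𝕚 π, so the power is the square of cis π.
  ζ^p≈1 : ζ ^ p ≈ 1ℂ
  ζ^p≈1 = trans (sym (exp-ofℕ* exp exp-sums p θ)) (trans (exp-cong exp exp-sums pθ≈)
    (trans (exp-double π) (square-im≈0 π (proj₁ (proj₂ isPi)))))
    where
    pθ≈ : ofℕ p * θ ≈ ofℕ 2 * (𝕚 * ofReal π)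
    pθ≈ = trans (sym (pull-fourth (ofℕ 2) (ofReal π) 𝕚 (ofℕ p) (ofℕ p ⁻¹)))
      (trans (*-assoc (ofℕ 2 * ofReal π * 𝕚) (ofℕ p) (ofℕ p ⁻¹))
      (trans (pull-second (ofℕ 2) (ofReal π) 𝕚 (ofℕ p * ofℕ p ⁻¹))
        (*-congˡ {ofℕ 2} (*-congˡ {𝕚} (trans (*-congˡ {ofReal π} (*-inverse (ofℕ p) ofℕ-p≉0)) (*-identityʳ (ofReal π)))))))

  -- If ζ = cis(π/p)² were 1, then sin(π/p) = 0 with 0 < π/p < π.
  ζ≉1 : ¬ ζ ≈ 1ℂ
  ζ≉1 ζ≈1 = proj₂ (proj₂ isPi) x 0<x x<π (square≈1⇒im≈0 x (trans (sym ζ≈) ζ≈1))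
    where
    x = π *ᴿ y
    0<x : ℝ.0# <ᴿ x
    0<x = ℝ.*-pos (proj₁ isPi) 0<y
    1<p·1 : ℝ.1# <ᴿ p ℝ.· ℝ.1#
    1<p·1 = <-≤-trans (<-cong (ℝ.+-identityʳ ℝ.1#) ℝ.refl
        (<-by 0<1 (solve 0 ((:1 :+ (:1 :+ :0)) :- (:1 :+ :0) := :1) ℝ.refl))) (·1-mono-≤ 1<p)
      where open IntegerSolver ℝ.commutativeRing
    y<1 : y <ᴿ ℝ.1#
    y<1 = <-cong (ℝ.*-identityʳ y) (ℝ.trans (ℝ.*-comm y _) py≈1) (*-monoˡ-< y 0<y 1<p·1)
    x<π : x <ᴿ π
    x<π = <-cong ℝ.refl (ℝ.*-identityʳ π) (*-monoˡ-< π (proj₁ isPi) y<1)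
    ζ≈ : ζ ≈ cis x ^ 2
    ζ≈ = trans (exp-cong exp exp-sums (trans (pull-second (ofℕ 2) (ofReal π) 𝕚 (ofℕ p ⁻¹))
      (*-congˡ {ofℕ 2} (*-congˡ {𝕚} (trans (*-congˡ {ofReal π} ofℕ-p⁻¹) (ofReal-* π y)))))) (exp-double x)

  private
    module ρ = TraceTheory.RootOfUnity R exp π p η p-prime 1≤η F complexRing ζ

  character : NontrivialCharacter F complexRing
  character = record
    { χ   = e_q
    ; χ-0 = trans (e_q≈ζ^ F.0#) (ρ.χ-0 ζ^p≈1)
    ; χ-+ = λ x y → trans (e_q≈ζ^ (x F.+ y)) (trans (ρ.χ-+ ζ^p≈1 x y)
              (*-cong (sym (e_q≈ζ^ x)) (sym (e_q≈ζ^ y))))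
    ; τ   = proj₁ (ρ.χ-hits-ζ ζ^p≈1)
    ; κ   = (1ℂ - ζ) ⁻¹
    ; τ-nontrivial = trans (*-congʳ (+-congˡ (-‿cong (trans (e_q≈ζ^ (proj₁ (ρ.χ-hits-ζ ζ^p≈1))) (proj₂ (ρ.χ-hits-ζ ζ^p≈1))))))
        (*-inverse (1ℂ - ζ) (ζ≉1 ∘ 1-x≈0⇒x≈1))
    }

-- Meromorphy, agreement with the series, and the final equation.

module EstermannContinuation (R : RealField) (exp : Complex.ℂ R → Complex.ℂ R) (isExp : Complex.IsExp R exp)
  (π : RealField.ℝ R) (isPi : Complex.IsPi R exp π) (p η : ℕ) (p-prime : Prime p) (1≤η : 1 ℕ.≤ η)
  (F : FiniteField (p ℕ.^ η)) {n : ℕ} (1≤n : 1 ℕ.≤ n) (g : Polynomials.Monic F n)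
  (E : EstermannFunction.Continuation R (ComplexNormedField.complexNormedField R) F
         (ExponentialCharacter.character R exp isExp π isPi p η p-prime 1≤η F) 1≤n g) where

  open ComplexField R
  open ComplexNorm R
  open ComplexNormedField R
  private
    module ℝ = RealField R
    module C = Complex R
    module F = FiniteField F
  open ℝ using (ℝ) renaming (_<_ to _<ᴿ_; _+_ to _+ᴿ_; _*_ to _*ᴿ_; -_ to -ᴿ_; _-_ to _-ᴿ_)
  open OrderedField R
  open C using (HasSum; DifferentiableAt; MeromorphicAt; _≈ᵐ_; _≈_; _+_; _*_; _-_; _^_; _·_; ∑)
  open CommutativeRing complexRing
    using (refl; sym; trans; reflexive; *-congʳ; *-congˡ; *-identityˡ)
  open RingSum complexRing using (∑-cong)
  open FieldLemmas complexRing
  open PartialSums complexRing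
  open Polynomials F
  open PolynomialRing F
  open Limits R complexNormedField using (Differentiable; Near; near-×; avoid)
  open Series R complexNormedField using (geometricSum⇒sums; sum-cong)
  open ExponentialCharacter R exp isExp π isPi p η p-prime 1≤η F
  open Estermann R exp π p η F
  open EstermannFunction R complexNormedField F character 1≤n g using (𝒜-closed; module Continuation)
  open Continuation E

  q≉0 : ¬ qℂ ≈ 0ℂ
  q≉0 = ≡.subst (λ m → ¬ ofℕ m ≈ 0ℂ) (ℕ.suc-pred (p ℕ.^ η) {{ℕ.m^n≢0 p η {{prime⇒nonZero p-prime}}}})
    (ofℕ-suc≉0 (ℕ.pred (p ℕ.^ η)))

  near⇒ball : ∀ {z P} → Near z P → ∃[ r ] ℝ.0# <ᴿ r × (∀ w → ¬ w ≈ z → ∣ w - z ∣< r → P w)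
  near⇒ball (r , 0<r , near) = r , 0<r , λ w w≉z w<r → near w w≉z (∣∣<⇒∥∥ w<r)

  differentiable⇒differentiableAt : ∀ {f z} → Differentiable f z → DifferentiableAt f z
  differentiable⇒differentiableAt (l , lim) = l , λ ε 0<ε →
    let near = near⇒ball (lim (ε *ᴿ half) (ℝ.*-pos 0<ε 0<half)) in
    proj₁ near , proj₁ (proj₂ near) , λ w w≉z w<δ → ∥∥⇒∣∣< (proj₂ (proj₂ near) w w≉z w<δ) (half-< 0<ε)

  avoid-pole : ∀ {z} → ¬ qℂ * z ≈ 1ℂ → Near z (λ w → ¬ qℂ * w ≈ 1ℂ)
  avoid-pole {z} qz≉1 = proj₁ near , proj₁ (proj₂ near) , λ w w≉z w≤δ qw≈1 →
    proj₂ (proj₂ near) w w≉z w≤δ (*-cancelˡ-invertible (*-inverse qℂ q≉0) (trans qw≈1 (sym (*-inverse qℂ q≉0))))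
    where
    near : Near z (λ w → ¬ w ≈ qℂ ⁻¹)
    near = avoid (z ≟ (qℂ ⁻¹))

  meromorphicAt-pole : ∀ a z → qℂ * z ≈ 1ℂ → MeromorphicAt (D̂ a) z
  meromorphicAt-pole a z qz≈1 = 2 , ℝ.1# , H a z , 0<1 ,
    (λ w _ → differentiable⇒differentiableAt (H-differentiable a z w)) ,
    (λ w w≉z _ → D̂≈H a qz≈1 w w≉z)

  meromorphicAt-regular : ∀ a z → ¬ qℂ * z ≈ 1ℂ → MeromorphicAt (D̂ a) z
  meromorphicAt-regular a z qz≉1 = 0 , proj₁ ball , D̂ a , proj₁ (proj₂ ball) ,
    (λ w w<r → differentiable⇒differentiableAt (D̂-differentiable a (regular-point w w<r (w ≟ z)))) ,
    (λ w _ _ → *-identityˡ (D̂ a w))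
    where
    ball = near⇒ball (avoid-pole qz≉1)
    regular-point : ∀ w → ∣ w - z ∣< proj₁ ball → Dec (w ≈ z) → ¬ qℂ * w ≈ 1ℂ
    regular-point w _   (yes w≈z) qw≈1 = qz≉1 (trans (*-congˡ {qℂ} (sym w≈z)) qw≈1)
    regular-point w w<r (no w≉z)  = proj₂ (proj₂ ball) w w≉z w<r

  meromorphicAt : ∀ a z → Dec (qℂ * z ≈ 1ℂ) → MeromorphicAt (D̂ a) z
  meromorphicAt a z (yes qz≈1) = meromorphicAt-pole a z qz≈1
  meromorphicAt a z (no qz≉1)  = meromorphicAt-regular a z qz≉1

  term≈ : ∀ a u N → ∑ (monics N) (λ f → d f · 1ℂ * e_q (ResidueFunctional.ρ F 1≤n g (a *ₚ toPoly f)) * u ^ N) ≈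
          estermannTerm a g u N
  term≈ a u N = ∑-cong (monics N) (λ f → *-congʳ {u ^ N} (*-congˡ {ofℕ (d f)}
    (reflexive (≡.cong e_q (≡.sym (ResidueFunctional.coefAt-/ F 1≤n g (a *ₚ toPoly f)))))))

  D̂-hasSum : ∀ a u → ∣ qℂ * u ∣< ℝ.1# → HasSum (estermannTerm a g u) (D̂ a u)
  D̂-hasSum a u (_ , s<1·1) = sums⇒hasSum (geometricSum⇒sums (sum-cong (term≈ a u) refl
    (D̂-sum a qu≤r 0<r r<1 qu≉1)))
    where
    open IntegerSolver ℝ.commutativeRing
    s = normSq (qℂ * u)
    0≤s = normSq-nonneg (qℂ * u)
    s<1 : s <ᴿ ℝ.1#
    s<1 = <-cong ℝ.refl (ℝ.*-identityˡ ℝ.1#) s<1·1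
    qu≉1 : ¬ qℂ * u ≈ 1ℂ
    qu≉1 qu≈1 = <⇒≉ s<1 (ℝ.trans (normSq-cong qu≈1) normSq-1)
    -- The mean of 1 and s = |qu|² is below 1 and, by the inequality between geometric and
    -- arithmetic mean, at least |qu|.
    r = (ℝ.1# +ᴿ s) *ᴿ half
    0<r : ℝ.0# <ᴿ r
    0<r = ℝ.*-pos (+-pos 0<1 0≤s) 0<half
    r<1 : r <ᴿ ℝ.1#
    r<1 = <-by (ℝ.*-pos (x<y⇒0<y-x s<1) 0<half) (ℝ.trans
      (ℝ.+-congʳ (ℝ.sym (half+half ℝ.1#)))
      (solve 2 (λ s h → (:1 :* h :+ :1 :* h) :- (:1 :+ s) :* h := (:1 :- s) :* h) ℝ.refl s half))
    -- ((1 + s) / 2)² - s = ((1 - s) / 2)².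
    qu≤r : ∥ qℂ * u ∥≤ r
    qu≤r = bound (inj₁ 0<r) (≤-by (square-nonneg ((ℝ.1# -ᴿ s) *ᴿ half)) (ℝ.trans
      (ℝ.+-congˡ (ℝ.-‿cong (ℝ.trans (ℝ.sym (half+half s)) (ℝ.+-cong (ℝ.sym (half+half (s *ᴿ half)))
        (ℝ.sym (half+half (s *ᴿ half)))))))
      (solve 2 (λ s h → (:1 :+ s) :* h :* ((:1 :+ s) :* h) :-
          (s :* h :* h :+ s :* h :* h :+ (s :* h :* h :+ s :* h :* h)) :=
          (:1 :- s) :* h :* ((:1 :- s) :* h)) ℝ.refl s half)))

  isEstermann : ∀ a → IsEstermann a g (D̂ a)
  isEstermann a = (D̂-cong a , λ z → meromorphicAt a z ((qℂ * z) ≟ 1ℂ)) , D̂-hasSum a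

  congruence : ∀ c c̄ → toPoly g ∣ₚ (c *ₚ c̄ -ₚ 1ₚ) → ∃[ k ] c *ₚ c̄ ≋ 1ₚ +ₚ k *ₚ toPoly g
  congruence c c̄ (k RawMagma., kg≈) = k , P.trans (RingIdentities.add-subtract polyRing (c *ₚ c̄) 1ₚ)
    (P.+-congˡ {1ₚ} {c *ₚ c̄ -ₚ 1ₚ} {k *ₚ toPoly g} (P.sym (coeffs≡ {k *ₚ toPoly g} {c *ₚ c̄ -ₚ 1ₚ} kg≈)))

  -- Three points are kept out of the punctured neighbourhood: 0, where 1/(qu) has a pole; 1/q, the
  -- possible pole of the left side and of 𝒜; and 1, where the argument 1/(qu) reaches 1/q.
  D̂-equation : ∀ c c̄ → toPoly g ∣ₚ (c *ₚ c̄ -ₚ 1ₚ) →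
    D̂ c ≈ᵐ λ u → (qℂ * u ^ 2) ^ (n ∸ 1) * ∑ F.units (λ l → 𝒜 l u * D̂ (l ∙ₚ c̄) ((qℂ * u) ⁻¹))
  D̂-equation c c̄ g∣ z = near⇒ball (proj₁ near , proj₁ (proj₂ near) , λ w w≉z w≤δ →
    equation w (proj₂ (proj₂ near) w w≉z w≤δ))
    where
    near : Near z (λ w → ¬ w ≈ 0ℂ × ¬ w ≈ qℂ ⁻¹ × ¬ w ≈ 1ℂ)
    near = near-× (avoid (z ≟ 0ℂ)) (near-× (avoid (z ≟ (qℂ ⁻¹))) (avoid (z ≟ 1ℂ)))
    equation : ∀ w → ¬ w ≈ 0ℂ × ¬ w ≈ qℂ ⁻¹ × ¬ w ≈ 1ℂ →
      D̂ c w ≈ (qℂ * w ^ 2) ^ (n ∸ 1) * ∑ F.units (λ l → 𝒜 l w * D̂ (l ∙ₚ c̄) ((qℂ * w) ⁻¹))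
    equation w (w≉0 , w≉q⁻¹ , w≉1) = D̂-functional-equation q≉0 c c̄ (proj₁ (congruence c c̄ g∣))
      (proj₂ (congruence c c̄ g∣)) w ((qℂ * w) ⁻¹) (*-inverse (qℂ * w) (*-≉0 q≉0 w≉0))
      (λ qw≈1 → w≉q⁻¹ (*-cancelˡ-invertible (*-inverse qℂ q≉0) (trans qw≈1 (sym (*-inverse qℂ q≉0))))) w≉1
      ((qℂ * w ^ 2) ^ (n ∸ 1)) refl (λ l → 𝒜 l w) (λ _ _ → refl)

  𝒜-formula : ∀ l → ¬ l ≡ F.0# → ∀ u → ¬ qℂ * u ≈ 1ℂ →
    𝒜 l u ≈ Kl₂ (F.- F.1#) l * qℂ ⁻¹ + (1ℂ + qℂ - ofℕ 2 * qℂ * u) * (qℂ * (1ℂ - qℂ * u) ^ 2) ⁻¹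
  𝒜-formula l l≢0 u qu≉1 = 𝒜-closed q≉0 l≢0 qu≉1

  conclusion :
    (Σ (Poly → ℂ → ℂ) λ 𝓓₂ →
      (∀ a → IsEstermann a g (𝓓₂ a)) ×
      (∀ c c̄ → Coprime c (toPoly g) → toPoly g ∣ₚ (c *ₚ c̄ -ₚ 1ₚ) →
        𝓓₂ c ≈ᵐ λ u →
          (qℂ * u ^ 2) ^ (n ∸ 1)
          * ∑ F.units (λ l → 𝒜 l u * 𝓓₂ (l ∙ₚ c̄) ((qℂ * u) ⁻¹)))) ×
    (∀ l → ¬ l ≡ F.0# → ∀ u → ¬ qℂ * u ≈ 1ℂ →
      𝒜 l u ≈
        Kl₂ (F.- F.1#) l * qℂ ⁻¹
        + (1ℂ + qℂ - ofℕ 2 * qℂ * u) * (qℂ * (1ℂ - qℂ * u) ^ 2) ⁻¹)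
  conclusion = (D̂ , isEstermann , λ c c̄ _ g∣cc̄-1 → D̂-equation c c̄ g∣cc̄-1) , 𝒜-formula

proposition3p7 :
    (R : RealField) → let open Complex R in
    (exp : ℂ → ℂ) → IsExp exp →
    (π : ℝ) → IsPi exp π →
    (p η : ℕ) → Prime p → 1 ℕ.≤ η →
    (F : FiniteField (p ℕ.^ η)) →
    let module F = FiniteField F
        open Polynomials F
        open Estermann R exp π p η F
    in
    (n : ℕ) → 1 ℕ.≤ n → (g : Monic n) →
    (Σ (Poly → ℂ → ℂ) λ 𝓓₂ →
      (∀ a → IsEstermann a g (𝓓₂ a)) ×
      (∀ c c̄ → Coprime c (toPoly g) → toPoly g ∣ₚ (c *ₚ c̄ -ₚ 1ₚ) →
        𝓓₂ c ≈ᵐ λ u →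
          (qℂ * u ^ 2) ^ (n ∸ 1)
          * ∑ F.units (λ l → 𝒜 l u * 𝓓₂ (l ∙ₚ c̄) ((qℂ * u) ⁻¹)))) ×
    (∀ l → ¬ l ≡ F.0# → ∀ u → ¬ qℂ * u ≈ 1ℂ →
      𝒜 l u ≈
        Kl₂ (F.- F.1#) l * qℂ ⁻¹
        + (1ℂ + qℂ - ofℕ 2 * qℂ * u) * (qℂ * (1ℂ - qℂ * u) ^ 2) ⁻¹)
proposition3p7 R exp isExp π isPi p η p-prime 1≤η F n 1≤n g =
  EstermannContinuation.conclusion R exp isExp π isPi p η p-prime 1≤η F 1≤n g
    (EstermannFunction.continuation R (ComplexNormedField.complexNormedField R) F
      (ExponentialCharacter.character R exp isExp π isPi p η p-prime 1≤η F) 1≤n g)
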